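{- Let $p \geq 5$ be a prime number. For all integers $\alpha, \beta, \gamma$ with $\alpha \neq 0$, the sequence $q(n) = \alpha n^2 + \beta n + \gamma$ ($n \geq 0$) has some integer $n \geq 1$ with $D_q(n) \neq p^{\lceil \log_p n \rceil}$.
   Context: For an integer sequence $s = (s(i))_{i \geq 0}$ and an integer $n \geq 1$, the discriminator $D_s(n)$ is the least positive integer $m$ such that $s(0), \ldots, s(n-1)$ are pairwise incongruent modulo $m$. If two of $s(0), \ldots, s(n-1)$ are equal, no such $m$ exists, and then $D_s(n) \neq p^{\lceil \log_p n \rceil}$ is understood to hold. -}

module Defs where

open import Data.Nat as ℕ using (ℕ; zero; suc; _<_; _≤_; _^_)
open import Data.Integer as ℤ using (ℤ; +_)
open import Data.Integer.Divisibility using (_∣_)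
open import Data.Product using (_×_)
open import Relation.Nullary using (¬_)
open import Relation.Binary.PropositionalEquality using (_≡_)

PairwiseIncongruent : (ℕ → ℤ) → ℕ → ℕ → Set
PairwiseIncongruent s n m =
  ∀ i j → i < n → j < n → i < j → ¬ ((+ m) ∣ (s i ℤ.- s j))

-- D_s(n) = m : m is the least positive integer with s(0..n-1) pairwise
-- incongruent mod m. If no such m exists, D_s(n) = m holds for no m.
IsDiscriminator : (ℕ → ℤ) → ℕ → ℕ → Set
IsDiscriminator s n m =
  1 ≤ m × PairwiseIncongruent s n m ×
  (∀ m′ → 1 ≤ m′ → m′ < m → ¬ PairwiseIncongruent s n m′)

IsCeilLog : ℕ → ℕ → ℕ → Set
IsCeilLog p n k = n ≤ p ^ k × (∀ j → j < k → p ^ j < n)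

quadSeq : ℤ → ℤ → ℤ → ℕ → ℤ
quadSeq α β γ n = α ℤ.* (+ n) ℤ.* (+ n) ℤ.+ β ℤ.* (+ n) ℤ.+ γ

{-# OPTIONS --safe #-}
-- q(j) − q(i) = (j − i)(α(i + j) + β), so if p ∤ α or p ∣ β then q(0), …, q(p − 1) collide modulo p and n = p works.
-- Otherwise α s + β = ± g (A s ± c) with gcd(A, c) = 1 and p ∣ A. Suppose D(p^k + 1) = p^(k+1) for all k up to a large bound.
-- A large prime m in (p^k, p^(k+1)) must then divide A s ± c for some s < 2 p^k; with b ≡ ± c and d m ≡ b (mod A),
-- 0 < d < A, this says d m ≤ 2 A p^k + c. So the primes of the class b/d avoid (2 A p^k / d, p^(k+1)) at every scale k.
--
-- This contradicts Selberg's symmetry formula in residue classes modulo A,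
--   φ(A) (ψ_c(x) log x + Σ_j Λ(j) ψ_{c/j}(x/j)) = 2 x log x + O(x),
-- and its corollary φ(A) (ψ_c(x) − ψ_c(y)) ≤ 2 (x − y) + O(x / log x). If class c has no primes in (y, x], then almost every j
-- must be such that class c/j attains this upper bound on (y/j, x/j]; the j for which it does not carry little Λ(j)/j.
-- (i)   Taking c = b/(A − 1) and j ≡ 1, the primes ≡ 1 are rare in the intervals J k, for some k.
-- (ii)  Taking c = 1 on such a J k, the classes d/b with d > A/2 have small logarithmic mass.
-- (iii) By Mertens the φ(A)/2 remaining classes d/b, d < A/2, carry all of log x, so each attains its bound (2/φ(A)) log x.
--       But some d < A/2 has d d′ ≡ b² with p d′ > 2 A, and then the class d/b = b/d′ has gaps at every scale.
--
-- Logarithms are rational: for each N there is an exactly additive L on [1, N] close to log.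
module Submission where

open import Defs
open import Data.Bool as Bool using (Bool; true; false; _∧_; if_then_else_)
open import Data.Empty using (⊥; ⊥-elim)
open import Data.Integer as ℤ using (ℤ; +_; -[1+_]; ∣_∣)
import Data.Integer.Properties as ℤ
import Data.Integer.Tactic.RingSolver as ℤ-Ring
open import Data.List using (List; []; _∷_; length)
open import Data.List.Relation.Unary.All using (All; []; _∷_)
open import Data.Nat as ℕ using (ℕ; zero; suc; _+_; _*_; _∸_; _≤_; _<_; z≤n; s≤s; _/_; NonZero; _^_; _%_; ∣_-_∣)
open import Data.Nat.Coprimality as Coprimality using (Coprime; coprime-divisor; coprime?; coprime-Bézout)
open import Data.Nat.DivMod using (m≡m%n+[m/n]*n; m%n<n; m/n*n≤m; m<n⇒m%n≡m; n%n≡0; %-distribˡ-*; [m+kn]%n≡m%n; [m+n]%n≡m%n; m%n%n≡m%n; %-distribˡ-+; m*n%n≡0; m%n≤m)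
open import Data.Nat.Divisibility using (_∣_; _∣?_; divides; ∣⇒≤; ∣-trans; ∣-refl; n∣m*n; m∣m*n; *-cancelˡ-∣; *-monoʳ-∣; ∣1⇒≡1; ∣n∣m%n⇒∣m; %-presˡ-∣; ∣m+n∣m⇒∣n; m%n≡0⇒n∣m; 0∣⇒≡0; *-monoˡ-∣; ∣n⇒∣m*n)
open import Data.Nat.GCD using (module Bézout; gcd; gcd[m,n]∣m; gcd[m,n]∣n; gcd-greatest; gcd[m,n]≡0⇒m≡0)
open import Data.Nat.Induction using (<-rec)
open import Data.Nat.ListAction using (product)
open import Data.Nat.Primality using (Prime; prime?; euclidsLemma; prime⇒nonZero; prime⇒nonTrivial; prime⇒irreducible)
open import Data.Nat.Primality.Factorisation using (PrimeFactorisation; factorise)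
import Data.Nat.Properties as ℕ
open import Data.Nat.Tactic.RingSolver using (solve-∀)
open import Data.Product using (Σ; _×_; _,_; proj₁; proj₂)
open import Data.Rational as ℚ using (ℚ; fromℚᵘ; toℚᵘ)
import Data.Rational.Properties as ℚ
open import Data.Rational.Unnormalised as ℚᵘ using (mkℚᵘ; *≡*)
import Data.Rational.Unnormalised.Properties as ℚᵘ
open import Data.Sign as Sign using (Sign)
open import Data.Sum using (_⊎_; inj₁; inj₂)
open import Data.Unit using (⊤; tt)
open import Relation.Binary.Definitions using (tri<; tri≈; tri>)
open import Relation.Binary.PropositionalEquality
open import Relation.Nullary using (¬_; Dec; yes; no; contradiction)
open import Relation.Nullary.Decidable using (_×-dec_; map′; ¬?; decidable-stable)

-- The rational logarithm is good only up to some N, so the contradiction has to come from finitely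
-- many scales, with explicit constants. For a large parameter t let N = p^(2 t² + 1). Step (i) has
-- about t² intervals J k against a total mass O(t), so in one of them the primes ≡ 1 have density
-- O(1/t). Step (ii) then bounds the mass of each class above A/2 by O(t). In step (iii) the special
-- class loses a fixed amount at each of t² - O(t) scales, while the other estimates leave room for
-- a loss of O(t) only. The shape of J k serves two purposes. Its endpoints have ratio close to 4p/5
-- ≥ 4, which exceeds the ratio 4A/(A + 1) of the part of a scale where primes of a class with d >
-- A/2 may still lie, so J k divided by any such j meets a gap. And for j in J k the interval (5P/2,
-- 5P] divided by j, with P a large power of p, overlaps a gap of the class b/(A - 1). The number of
-- scales depends only on p and the coefficients, and collisions modulo m are decidable; the
-- required n is therefore found by a finite search although the estimates end in a contradiction.

infixl 6 _⊕_ _⊖_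
infixl 7 _⊗_
infix 4 _⊑_

-- Rational numbers with their embeddings and order

private
  ζℚ : ℤ → ℚ
  ζℚ z = fromℚᵘ (mkℚᵘ z 0)

  to-ζ : ∀ z → toℚᵘ (ζℚ z) ℚᵘ.≃ mkℚᵘ z 0
  to-ζ z = ℚ.toℚᵘ-fromℚᵘ (mkℚᵘ z 0)

  ζℚ-+ : ∀ a b → ζℚ (a ℤ.+ b) ≡ ζℚ a ℚ.+ ζℚ b
  ζℚ-+ a b = ℚ.toℚᵘ-injective (ℚᵘ.≃-trans (to-ζ (a ℤ.+ b)) (ℚᵘ.≃-trans (*≡* (lem a b)) (ℚᵘ.≃-trans
    (ℚᵘ.≃-sym (ℚᵘ.+-cong (to-ζ a) (to-ζ b))) (ℚᵘ.≃-sym (ℚ.toℚᵘ-homo-+ (ζℚ a) (ζℚ b))))))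
    where
    lem : ∀ a b → (a ℤ.+ b) ℤ.* (+ 1 ℤ.* + 1) ≡ (a ℤ.* + 1 ℤ.+ b ℤ.* + 1) ℤ.* + 1
    lem = ℤ-Ring.solve-∀

  ζℚ-* : ∀ a b → ζℚ (a ℤ.* b) ≡ ζℚ a ℚ.* ζℚ b
  ζℚ-* a b = ℚ.toℚᵘ-injective (ℚᵘ.≃-trans (to-ζ (a ℤ.* b)) (ℚᵘ.≃-trans (*≡* (lem a b)) (ℚᵘ.≃-trans
    (ℚᵘ.≃-sym (ℚᵘ.*-cong (to-ζ a) (to-ζ b))) (ℚᵘ.≃-sym (ℚ.toℚᵘ-homo-* (ζℚ a) (ζℚ b))))))
    where
    lem : ∀ a b → (a ℤ.* b) ℤ.* (+ 1 ℤ.* + 1) ≡ (a ℤ.* b) ℤ.* + 1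
    lem = ℤ-Ring.solve-∀

  ζℚ-neg : ∀ a → ζℚ (ℤ.- a) ≡ ℚ.- (ζℚ a)
  ζℚ-neg a = ℚ.toℚᵘ-injective (ℚᵘ.≃-trans (to-ζ (ℤ.- a)) (ℚᵘ.≃-trans
    (ℚᵘ.≃-sym (ℚᵘ.-‿cong (to-ζ a))) (ℚᵘ.≃-sym (ℚ.toℚᵘ-homo‿- (ζℚ a)))))

  ζℚ-mono : ∀ {m n} → m ℕ.≤ n → ζℚ (+ m) ℚ.≤ ζℚ (+ n)
  ζℚ-mono {m} {n} m≤n = ℚ.toℚᵘ-cancel-≤ (ℚᵘ.≤-respˡ-≃ (ℚᵘ.≃-sym (to-ζ (+ m)))
    (ℚᵘ.≤-respʳ-≃ (ℚᵘ.≃-sym (to-ζ (+ n))) (ℚᵘ.*≤* (ℤ.*-monoʳ-≤-nonNeg (+ 1) (ℤ.+≤+ m≤n)))))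

  ζℚ-cancel : ∀ {m n} → ζℚ (+ m) ℚ.≤ ζℚ (+ n) → m ℕ.≤ n
  ζℚ-cancel {m} {n} h with ℚᵘ.≤-respˡ-≃ (to-ζ (+ m)) (ℚᵘ.≤-respʳ-≃ (to-ζ (+ n)) (ℚ.toℚᵘ-mono-≤ h))
  ... | ℚᵘ.*≤* q = ℤ.drop‿+≤+ (ℤ.*-cancelʳ-≤-pos (+ m) (+ n) (+ 1) q)

  invℚ : ℕ → ℚ
  invℚ zero    = ζℚ (+ 0)
  invℚ (suc n) = fromℚᵘ (mkℚᵘ (+ 1) n)

  invℚ-inverse : ∀ n → 1 ℕ.≤ n → ζℚ (+ n) ℚ.* invℚ n ≡ ζℚ (+ 1)
  invℚ-inverse (suc n) _ = ℚ.toℚᵘ-injective (ℚᵘ.≃-trans (ℚ.toℚᵘ-homo-* (ζℚ (+ suc n)) (invℚ (suc n)))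
    (ℚᵘ.≃-trans (ℚᵘ.*-cong (to-ζ (+ suc n)) (ℚ.toℚᵘ-fromℚᵘ (mkℚᵘ (+ 1) n)))
    (ℚᵘ.≃-trans (*≡* (lem (+ suc n))) (ℚᵘ.≃-sym (to-ζ (+ 1))))))
    where
    lem : ∀ k → (k ℤ.* + 1) ℤ.* + 1 ≡ + 1 ℤ.* (+ 1 ℤ.* k)
    lem = ℤ-Ring.solve-∀

  invℚ-nonneg : ∀ n → ζℚ (+ 0) ℚ.≤ invℚ n
  invℚ-nonneg zero    = ℚ.≤-refl
  invℚ-nonneg (suc n) = ℚ.toℚᵘ-cancel-≤ (ℚᵘ.≤-respʳ-≃ (ℚᵘ.≃-sym (ℚ.toℚᵘ-fromℚᵘ (mkℚᵘ (+ 1) n)))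
    (ℚᵘ.≤-respˡ-≃ (ℚᵘ.≃-sym (to-ζ (+ 0))) (ℚᵘ.*≤* (ℤ.+≤+ ℕ.z≤n))))

  ℚ-archimedean : ∀ a → Σ ℕ λ n → a ℚ.≤ ζℚ (+ n)
  ℚ-archimedean (ℚ.mkℚ (+ n) d c) = n , ℚ.toℚᵘ-cancel-≤ (ℚᵘ.≤-respʳ-≃ (ℚᵘ.≃-sym (to-ζ (+ n)))
    (ℚᵘ.*≤* (ℤ.*-monoˡ-≤-nonNeg (+ n) (ℤ.+≤+ (ℕ.s≤s ℕ.z≤n)))))
  ℚ-archimedean (ℚ.mkℚ -[1+ n ] d c) = 0 , ℚ.toℚᵘ-cancel-≤ (ℚᵘ.≤-respʳ-≃ (ℚᵘ.≃-sym (to-ζ (+ 0))) (ℚᵘ.*≤* ℤ.-≤+))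

-- The rationals, sealed so that no arithmetic is ever unfolded.
abstract
  R : Set
  R = ℚ

  _⊕_ _⊗_ : R → R → R
  _⊕_ = ℚ._+_
  _⊗_ = ℚ._*_

  neg : R → R
  neg = ℚ.-_

  _⊑_ : R → R → Set
  _⊑_ = ℚ._≤_

  ζ : ℤ → R
  ζ = ζℚ

  ι : ℕ → R
  ι n = ζ (+ n)

  inv : ℕ → R
  inv = invℚ

  ⊕-comm : ∀ a b → a ⊕ b ≡ b ⊕ a
  ⊕-comm = ℚ.+-comm

  ⊕-assoc : ∀ a b c → a ⊕ b ⊕ c ≡ a ⊕ (b ⊕ c)
  ⊕-assoc = ℚ.+-assoc

  ⊕-identityˡ : ∀ a → ι 0 ⊕ a ≡ a
  ⊕-identityˡ = ℚ.+-identityˡ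

  ⊕-inverseʳ : ∀ a → a ⊕ neg a ≡ ι 0
  ⊕-inverseʳ = ℚ.+-inverseʳ

  ⊗-comm : ∀ a b → a ⊗ b ≡ b ⊗ a
  ⊗-comm = ℚ.*-comm

  ⊗-assoc : ∀ a b c → a ⊗ b ⊗ c ≡ a ⊗ (b ⊗ c)
  ⊗-assoc = ℚ.*-assoc

  ⊗-identityˡ : ∀ a → ι 1 ⊗ a ≡ a
  ⊗-identityˡ = ℚ.*-identityˡ

  ⊗-distribˡ : ∀ a b c → a ⊗ (b ⊕ c) ≡ a ⊗ b ⊕ a ⊗ c
  ⊗-distribˡ = ℚ.*-distribˡ-+

  neg-⊕ : ∀ a b → neg (a ⊕ b) ≡ neg a ⊕ neg b
  neg-⊕ = ℚ.neg-distrib-+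

  neg-⊗ : ∀ a b → neg (a ⊗ b) ≡ neg a ⊗ b
  neg-⊗ = ℚ.neg-distribˡ-*

  ⊑-refl : ∀ {a} → a ⊑ a
  ⊑-refl = ℚ.≤-refl

  ⊑-trans : ∀ {a b c} → a ⊑ b → b ⊑ c → a ⊑ c
  ⊑-trans = ℚ.≤-trans

  ⊑-antisym : ∀ {a b} → a ⊑ b → b ⊑ a → a ≡ b
  ⊑-antisym = ℚ.≤-antisym

  ⊑-total : ∀ a b → a ⊑ b ⊎ b ⊑ a
  ⊑-total = ℚ.≤-total

  ⊕-mono : ∀ {a b c d} → a ⊑ b → c ⊑ d → a ⊕ c ⊑ b ⊕ d
  ⊕-mono = ℚ.+-mono-≤

  ⊗-monoˡ : ∀ {c a b} → ι 0 ⊑ c → a ⊑ b → c ⊗ a ⊑ c ⊗ b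
  ⊗-monoˡ {c} 0≤c = ℚ.*-monoˡ-≤-nonNeg c {{ℚ.nonNegative 0≤c}}

  ζ-+ : ∀ a b → ζ (a ℤ.+ b) ≡ ζ a ⊕ ζ b
  ζ-+ = ζℚ-+

  ζ-* : ∀ a b → ζ (a ℤ.* b) ≡ ζ a ⊗ ζ b
  ζ-* = ζℚ-*

  ζ-neg : ∀ a → ζ (ℤ.- a) ≡ neg (ζ a)
  ζ-neg = ζℚ-neg

  ζ-ι : ∀ n → ζ (+ n) ≡ ι n
  ζ-ι n = refl

  ι-+ : ∀ m n → ι (m ℕ.+ n) ≡ ι m ⊕ ι n
  ι-+ m n = ζℚ-+ (+ m) (+ n)

  ι-* : ∀ m n → ι (m ℕ.* n) ≡ ι m ⊗ ι n
  ι-* m n = trans (cong ζℚ (ℤ.pos-* m n)) (ζℚ-* (+ m) (+ n))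

  ι-mono : ∀ {m n} → m ℕ.≤ n → ι m ⊑ ι n
  ι-mono = ζℚ-mono

  ι-cancel : ∀ {m n} → ι m ⊑ ι n → m ℕ.≤ n
  ι-cancel = ζℚ-cancel

  inv-inverse : ∀ n → 1 ℕ.≤ n → ι n ⊗ inv n ≡ ι 1
  inv-inverse = invℚ-inverse

  inv-nonneg : ∀ n → ι 0 ⊑ inv n
  inv-nonneg = invℚ-nonneg

  archimedean : ∀ a → Σ ℕ λ n → a ⊑ ι n
  archimedean = ℚ-archimedean

_⊖_ : R → R → R
a ⊖ b = a ⊕ neg b

open ≡-Reasoning

-- A reflective prover for polynomial identities and linear inequalities

infixl 6 _∔_ _:+_ _:-_
infixl 7 _∗_ _:*_
infix 8 :-_

⊕-identityʳ : ∀ a → a ⊕ ι 0 ≡ a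
⊕-identityʳ a = trans (⊕-comm a (ι 0)) (⊕-identityˡ a)

⊗-distribʳ : ∀ c a b → (a ⊕ b) ⊗ c ≡ a ⊗ c ⊕ b ⊗ c
⊗-distribʳ c a b = trans (⊗-comm _ c) (trans (⊗-distribˡ c a b) (cong₂ _⊕_ (⊗-comm c a) (⊗-comm c b)))

⊕-cancelʳ : ∀ {a b} c → a ⊕ c ≡ b ⊕ c → a ≡ b
⊕-cancelʳ {a} {b} c e = begin
  a              ≡⟨ sym (⊕-identityʳ a) ⟩
  a ⊕ ι 0        ≡⟨ cong (a ⊕_) (sym (⊕-inverseʳ c)) ⟩
  a ⊕ (c ⊕ neg c) ≡⟨ sym (⊕-assoc a c (neg c)) ⟩
  a ⊕ c ⊕ neg c  ≡⟨ cong (_⊕ neg c) e ⟩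
  b ⊕ c ⊕ neg c  ≡⟨ ⊕-assoc b c (neg c) ⟩
  b ⊕ (c ⊕ neg c) ≡⟨ cong (b ⊕_) (⊕-inverseʳ c) ⟩
  b ⊕ ι 0        ≡⟨ ⊕-identityʳ b ⟩
  b ∎

⊗-zeroˡ : ∀ a → ι 0 ⊗ a ≡ ι 0
⊗-zeroˡ a = ⊕-cancelʳ (ι 0 ⊗ a) (begin
  ι 0 ⊗ a ⊕ ι 0 ⊗ a ≡⟨ sym (⊗-distribʳ a (ι 0) (ι 0)) ⟩
  (ι 0 ⊕ ι 0) ⊗ a   ≡⟨ cong (_⊗ a) (⊕-identityˡ (ι 0)) ⟩
  ι 0 ⊗ a           ≡⟨ sym (⊕-identityˡ _) ⟩
  ι 0 ⊕ ι 0 ⊗ a     ∎)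

⊕-swap : ∀ a b c → a ⊕ (b ⊕ c) ≡ b ⊕ (a ⊕ c)
⊕-swap a b c = trans (sym (⊕-assoc a b c)) (trans (cong (_⊕ c) (⊕-comm a b)) (⊕-assoc b a c))

⊗-swap : ∀ a b c → a ⊗ (b ⊗ c) ≡ b ⊗ (a ⊗ c)
⊗-swap a b c = trans (sym (⊗-assoc a b c)) (trans (cong (_⊗ c) (⊗-comm a b)) (⊗-assoc b a c))

-- Nested pairs have eta, so unification with the goal fills in the implicit environments of `ring`
-- and `linear` entry by entry.
Env : Set → ℕ → Set
Env A zero    = ⊤
Env A (suc m) = A × Env A m

at : ∀ {A} → A → ∀ m → Env A m → ℕ → A
at d zero    _        i       = d
at d (suc m) (x , xs) zero    = x
at d (suc m) (x , xs) (suc i) = at d m xs i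

-- Natural expressions are kept apart because `ι` turns their sums and products into those of `R`;
-- variables of both kinds then become atoms of one polynomial.
data N : Set where
  n#      : ℕ → N
  lit     : ℕ → N
  _∔_ _∗_ : N → N → N

data E : Set where
  v#      : ℕ → E
  nat     : N → E
  _:+_ _:*_ _:-_ : E → E → E
  :-_     : E → E

data Var : Set where
  rV nV : ℕ → Var

Mono = List Var
Poly = List (Mono × ℤ)

eqV : Var → Var → Bool
eqV (rV i) (rV j) = i ℕ.≡ᵇ j
eqV (nV i) (nV j) = i ℕ.≡ᵇ j
eqV _      _      = false

ltV : Var → Var → Bool
ltV (rV i) (rV j) = i ℕ.<ᵇ j
ltV (nV i) (nV j) = i ℕ.<ᵇ j
ltV (rV _) (nV _) = true
ltV (nV _) (rV _) = false

eqM : Mono → Mono → Bool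
eqM []      []      = true
eqM (x ∷ m) (y ∷ k) = eqV x y ∧ eqM m k
eqM _       _       = false

ltM : Mono → Mono → Bool
ltM []      []      = false
ltM []      (_ ∷ _) = true
ltM (_ ∷ _) []      = false
ltM (x ∷ m) (y ∷ k) = if ltV x y then true else if eqV x y then ltM m k else false

insV : Var → Mono → Mono
insV x []      = x ∷ []
insV x (y ∷ m) = if ltV y x then y ∷ insV x m else x ∷ y ∷ m

mulM : Mono → Mono → Mono
mulM []      k = k
mulM (x ∷ m) k = insV x (mulM m k)

insT : Mono → ℤ → Poly → Poly
insT m c []             = (m , c) ∷ []
insT m c ((k , d) ∷ p) with eqM m k
... | true  = (m , c ℤ.+ d) ∷ p
... | false = if ltM m k then (m , c) ∷ (k , d) ∷ p else (k , d) ∷ insT m c p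

addP : Poly → Poly → Poly
addP []            q = q
addP ((m , c) ∷ p) q = insT m c (addP p q)

mulT : Mono → ℤ → Poly → Poly
mulT m c []            = []
mulT m c ((k , d) ∷ p) = insT (mulM m k) (c ℤ.* d) (mulT m c p)

mulP : Poly → Poly → Poly
mulP []            q = []
mulP ((m , c) ∷ p) q = addP (mulT m c q) (mulP p q)

negP : Poly → Poly
negP []            = []
negP ((m , c) ∷ p) = (m , ℤ.- c) ∷ negP p

normN : N → Poly
normN (n# i)  = (nV i ∷ [] , + 1) ∷ []
normN (lit k) = ([] , + k) ∷ []
normN (a ∔ b) = addP (normN a) (normN b)
normN (a ∗ b) = mulP (normN a) (normN b)

norm : E → Poly
norm (v# i)   = (rV i ∷ [] , + 1) ∷ []
norm (nat a)  = normN a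
norm (a :+ b) = addP (norm a) (norm b)
norm (a :* b) = mulP (norm a) (norm b)
norm (a :- b) = addP (norm a) (negP (norm b))
norm (:- a)   = negP (norm a)

-- Cancelled terms stay in the list with coefficient 0, so vanishing is a test on coefficients and
-- not on the length.
allZero : Poly → Bool
allZero []                  = true
allZero ((_ , + zero) ∷ p)  = allZero p
allZero (_ ∷ _)             = false

-- A nonconstant term must vanish, since the sign of a monomial is not tracked; sign information
-- enters through the hypotheses handed to `linear`.
nonNegative : Poly → Bool
nonNegative []                  = true
nonNegative ((_ , + zero) ∷ p)  = nonNegative p
nonNegative (([] , + suc _) ∷ p) = nonNegative p
nonNegative (_ ∷ _)             = false

module Semantics {m n : ℕ} (ρ : Env R m) (ν : Env ℕ n) where

  ⟦_⟧ᴺ : N → ℕ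
  ⟦ n# i ⟧ᴺ  = at 0 n ν i
  ⟦ lit k ⟧ᴺ = k
  ⟦ a ∔ b ⟧ᴺ = ⟦ a ⟧ᴺ ℕ.+ ⟦ b ⟧ᴺ
  ⟦ a ∗ b ⟧ᴺ = ⟦ a ⟧ᴺ ℕ.* ⟦ b ⟧ᴺ

  ⟦_⟧ : E → R
  ⟦ v# i ⟧   = at (ι 0) m ρ i
  ⟦ nat a ⟧  = ι ⟦ a ⟧ᴺ
  ⟦ a :+ b ⟧ = ⟦ a ⟧ ⊕ ⟦ b ⟧
  ⟦ a :* b ⟧ = ⟦ a ⟧ ⊗ ⟦ b ⟧
  ⟦ a :- b ⟧ = ⟦ a ⟧ ⊖ ⟦ b ⟧
  ⟦ :- a ⟧   = neg ⟦ a ⟧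

  evV : Var → R
  evV (rV i) = at (ι 0) m ρ i
  evV (nV i) = ι (at 0 n ν i)

  evM : Mono → R
  evM []      = ι 1
  evM (x ∷ k) = evV x ⊗ evM k

  evP : Poly → R
  evP []            = ι 0
  evP ((k , c) ∷ p) = ζ c ⊗ evM k ⊕ evP p

  eqV-sound : ∀ x y → eqV x y ≡ true → x ≡ y
  eqV-sound (rV i) (rV j) e = cong rV (ℕ.≡ᵇ⇒≡ i j (subst Bool.T (sym e) tt))
  eqV-sound (nV i) (nV j) e = cong nV (ℕ.≡ᵇ⇒≡ i j (subst Bool.T (sym e) tt))
  eqV-sound (rV i) (nV j) ()
  eqV-sound (nV i) (rV j) ()

  eqM-sound : ∀ a b → eqM a b ≡ true → a ≡ b
  eqM-sound []      []      e = refl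
  eqM-sound (x ∷ a) (y ∷ b) e with eqV x y in ex
  ... | true = cong₂ _∷_ (eqV-sound x y ex) (eqM-sound a b e)
  eqM-sound (x ∷ a) (y ∷ b) () | false

  insV-sound : ∀ x k → evM (insV x k) ≡ evV x ⊗ evM k
  insV-sound x []      = refl
  insV-sound x (y ∷ k) with ltV y x
  ... | true  = trans (cong (evV y ⊗_) (insV-sound x k)) (⊗-swap (evV y) (evV x) (evM k))
  ... | false = refl

  mulM-sound : ∀ a b → evM (mulM a b) ≡ evM a ⊗ evM b
  mulM-sound []      b = sym (⊗-identityˡ (evM b))
  mulM-sound (x ∷ a) b = trans (insV-sound x (mulM a b))
    (trans (cong (evV x ⊗_) (mulM-sound a b)) (sym (⊗-assoc (evV x) (evM a) (evM b))))

  insT-sound : ∀ k c p → evP (insT k c p) ≡ ζ c ⊗ evM k ⊕ evP p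
  insT-sound k c []            = refl
  insT-sound k c ((l , d) ∷ p) with eqM k l in e
  ... | true = begin
    ζ (c ℤ.+ d) ⊗ evM k ⊕ evP p            ≡⟨ cong (λ z → z ⊗ evM k ⊕ evP p) (ζ-+ c d) ⟩
    (ζ c ⊕ ζ d) ⊗ evM k ⊕ evP p            ≡⟨ cong (_⊕ evP p) (⊗-distribʳ (evM k) (ζ c) (ζ d)) ⟩
    ζ c ⊗ evM k ⊕ ζ d ⊗ evM k ⊕ evP p      ≡⟨ ⊕-assoc _ _ _ ⟩
    ζ c ⊗ evM k ⊕ (ζ d ⊗ evM k ⊕ evP p)    ≡⟨ cong (λ z → ζ c ⊗ evM k ⊕ (ζ d ⊗ evM z ⊕ evP p)) (eqM-sound k l e) ⟩
    ζ c ⊗ evM k ⊕ (ζ d ⊗ evM l ⊕ evP p)    ∎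
  ... | false with ltM k l
  ... | true  = refl
  ... | false = trans (cong (ζ d ⊗ evM l ⊕_) (insT-sound k c p)) (⊕-swap _ _ _)

  addP-sound : ∀ p q → evP (addP p q) ≡ evP p ⊕ evP q
  addP-sound []            q = sym (⊕-identityˡ (evP q))
  addP-sound ((k , c) ∷ p) q = trans (insT-sound k c (addP p q))
    (trans (cong (ζ c ⊗ evM k ⊕_) (addP-sound p q)) (sym (⊕-assoc _ _ _)))

  mulT-sound : ∀ k c p → evP (mulT k c p) ≡ ζ c ⊗ evM k ⊗ evP p
  mulT-sound k c []            = sym (trans (⊗-comm _ _) (⊗-zeroˡ _))
  mulT-sound k c ((l , d) ∷ p) = begin
    evP (insT (mulM k l) (c ℤ.* d) (mulT k c p))  ≡⟨ insT-sound (mulM k l) (c ℤ.* d) (mulT k c p) ⟩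
    ζ (c ℤ.* d) ⊗ evM (mulM k l) ⊕ evP (mulT k c p) ≡⟨ cong₂ _⊕_ (cong₂ _⊗_ (ζ-* c d) (mulM-sound k l)) (mulT-sound k c p) ⟩
    ζ c ⊗ ζ d ⊗ (evM k ⊗ evM l) ⊕ ζ c ⊗ evM k ⊗ evP p ≡⟨ cong (_⊕ ζ c ⊗ evM k ⊗ evP p) inner ⟩
    ζ c ⊗ evM k ⊗ (ζ d ⊗ evM l) ⊕ ζ c ⊗ evM k ⊗ evP p ≡⟨ sym (⊗-distribˡ _ _ _) ⟩
    ζ c ⊗ evM k ⊗ (ζ d ⊗ evM l ⊕ evP p) ∎
    where
    inner : ζ c ⊗ ζ d ⊗ (evM k ⊗ evM l) ≡ ζ c ⊗ evM k ⊗ (ζ d ⊗ evM l)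
    inner = trans (⊗-assoc _ _ _) (trans (cong (ζ c ⊗_) (⊗-swap (ζ d) (evM k) (evM l))) (sym (⊗-assoc _ _ _)))

  mulP-sound : ∀ p q → evP (mulP p q) ≡ evP p ⊗ evP q
  mulP-sound []            q = sym (⊗-zeroˡ (evP q))
  mulP-sound ((k , c) ∷ p) q = trans (addP-sound (mulT k c q) (mulP p q))
    (trans (cong₂ _⊕_ (mulT-sound k c q) (mulP-sound p q)) (sym (⊗-distribʳ (evP q) _ _)))

  negP-sound : ∀ p → evP (negP p) ≡ neg (evP p)
  negP-sound []            = ζ0
    where
    ζ0 : ι 0 ≡ neg (ι 0)
    ζ0 = trans (sym (ζ-ι 0)) (trans (ζ-neg (+ 0)) (cong neg (ζ-ι 0)))
  negP-sound ((k , c) ∷ p) = trans (cong₂ _⊕_ (trans (cong (_⊗ evM k) (ζ-neg c)) (sym (neg-⊗ (ζ c) (evM k)))) (negP-sound p))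
    (sym (neg-⊕ _ _))

  single : ∀ x → ζ (+ 1) ⊗ (x ⊗ ι 1) ⊕ ι 0 ≡ x
  single x = trans (⊕-identityʳ _) (trans (cong (_⊗ (x ⊗ ι 1)) (ζ-ι 1)) (trans (⊗-identityˡ _)
    (trans (⊗-comm x (ι 1)) (⊗-identityˡ x))))

  normN-sound : ∀ a → evP (normN a) ≡ ι ⟦ a ⟧ᴺ
  normN-sound (n# i)  = single _
  normN-sound (lit k) = trans (⊕-identityʳ _) (trans (⊗-comm _ _) (trans (⊗-identityˡ _) (ζ-ι k)))
  normN-sound (a ∔ b) = trans (addP-sound (normN a) (normN b)) (trans (cong₂ _⊕_ (normN-sound a) (normN-sound b)) (sym (ι-+ _ _)))
  normN-sound (a ∗ b) = trans (mulP-sound (normN a) (normN b)) (trans (cong₂ _⊗_ (normN-sound a) (normN-sound b)) (sym (ι-* _ _)))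

  norm-sound : ∀ a → evP (norm a) ≡ ⟦ a ⟧
  norm-sound (v# i)   = single _
  norm-sound (nat a)  = normN-sound a
  norm-sound (a :+ b) = trans (addP-sound (norm a) (norm b)) (cong₂ _⊕_ (norm-sound a) (norm-sound b))
  norm-sound (a :* b) = trans (mulP-sound (norm a) (norm b)) (cong₂ _⊗_ (norm-sound a) (norm-sound b))
  norm-sound (a :- b) = trans (addP-sound (norm a) (negP (norm b)))
    (cong₂ _⊕_ (norm-sound a) (trans (negP-sound (norm b)) (cong neg (norm-sound b))))
  norm-sound (:- a)   = trans (negP-sound (norm a)) (cong neg (norm-sound a))

  zero-term : ∀ k → ζ (+ 0) ⊗ evM k ≡ ι 0
  zero-term k = trans (cong (_⊗ evM k) (ζ-ι 0)) (⊗-zeroˡ (evM k))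

  allZero-sound : ∀ p → Bool.T (allZero p) → evP p ≡ ι 0
  allZero-sound []                  _ = refl
  allZero-sound ((k , + zero) ∷ p)  t = trans (cong₂ _⊕_ (zero-term k) (allZero-sound p t)) (⊕-identityˡ (ι 0))

  nonNegative-sound : ∀ p → Bool.T (nonNegative p) → ι 0 ⊑ evP p
  nonNegative-sound []                  _ = ⊑-refl
  nonNegative-sound ((k , + zero) ∷ p)  t = subst (ι 0 ⊑_)
    (sym (trans (cong (_⊕ evP p) (zero-term k)) (⊕-identityˡ _))) (nonNegative-sound p t)
  nonNegative-sound (([] , + suc c) ∷ p) t = subst (_⊑ evP (([] , + suc c) ∷ p)) (⊕-identityˡ (ι 0))
    (⊕-mono (subst (ι 0 ⊑_) (sym (trans (⊗-comm _ _) (trans (⊗-identityˡ _) (ζ-ι (suc c))))) (ι-mono ℕ.z≤n)) (nonNegative-sound p t))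

  ring-sound : ∀ a b → Bool.T (allZero (norm (a :- b))) → ⟦ a ⟧ ≡ ⟦ b ⟧
  ring-sound a b t = begin
    ⟦ a ⟧                      ≡⟨ sym (⊕-identityʳ _) ⟩
    ⟦ a ⟧ ⊕ ι 0                ≡⟨ cong (⟦ a ⟧ ⊕_) (sym (trans (⊕-comm _ _) (⊕-inverseʳ ⟦ b ⟧))) ⟩
    ⟦ a ⟧ ⊕ (neg ⟦ b ⟧ ⊕ ⟦ b ⟧) ≡⟨ sym (⊕-assoc _ _ _) ⟩
    ⟦ a :- b ⟧ ⊕ ⟦ b ⟧         ≡⟨ cong (_⊕ ⟦ b ⟧) (trans (sym (norm-sound (a :- b))) (allZero-sound (norm (a :- b)) t)) ⟩
    ι 0 ⊕ ⟦ b ⟧                ≡⟨ ⊕-identityˡ _ ⟩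
    ⟦ b ⟧                      ∎

  nonNegative⇒⊒ : ∀ e → Bool.T (nonNegative (norm e)) → ι 0 ⊑ ⟦ e ⟧
  nonNegative⇒⊒ e t = subst (ι 0 ⊑_) (norm-sound e) (nonNegative-sound (norm e) t)

⊑⇒⊖ : ∀ {a b} → a ⊑ b → ι 0 ⊑ b ⊖ a
⊑⇒⊖ {a} {b} h = subst (_⊑ b ⊖ a) (⊕-inverseʳ a) (⊕-mono h (⊑-refl {neg a}))

⊖⇒⊑ : ∀ {a b} → ι 0 ⊑ b ⊖ a → a ⊑ b
⊖⇒⊑ {a} {b} h = subst₂ _⊑_ (⊕-identityˡ a)
  (trans (⊕-assoc b (neg a) a) (trans (cong (b ⊕_) (trans (⊕-comm _ _) (⊕-inverseʳ a))) (⊕-identityʳ b)))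
  (⊕-mono h (⊑-refl {a}))

-- The goal a ⊑ b follows from c ⊑ d when (b - a) - (d - c) normalises to a nonnegative constant.
module _ (m n : ℕ) where
  open Semantics {m} {n}

  ring : ∀ {ρ ν} a b → {Bool.T (allZero (norm (a :- b)))} → ⟦_⟧ ρ ν a ≡ ⟦_⟧ ρ ν b
  ring {ρ} {ν} a b {t} = ring-sound ρ ν a b t

  linear : ∀ {ρ ν} a b c d → {Bool.T (nonNegative (norm ((b :- a) :- (d :- c))))} →
    ⟦_⟧ ρ ν c ⊑ ⟦_⟧ ρ ν d → ⟦_⟧ ρ ν a ⊑ ⟦_⟧ ρ ν b
  linear {ρ} {ν} a b c d {t} h = ⊖⇒⊑ (subst (ι 0 ⊑_) eq
    (subst (λ z → z ⊑ ⟦_⟧ ρ ν ((b :- a) :- (d :- c)) ⊕ ⟦_⟧ ρ ν (d :- c)) (⊕-identityˡ (ι 0)) (⊕-mono (nonNegative⇒⊒ ρ ν ((b :- a) :- (d :- c)) t) (⊑⇒⊖ h))))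
    where
    eq : ⟦_⟧ ρ ν ((b :- a) :- (d :- c)) ⊕ ⟦_⟧ ρ ν (d :- c) ≡ ⟦_⟧ ρ ν (b :- a)
    eq = trans (⊕-assoc _ _ _) (trans (cong (⟦_⟧ ρ ν (b :- a) ⊕_) (trans (⊕-comm _ _) (⊕-inverseʳ _))) (⊕-identityʳ _))

infixl 5 _⊞_
infixl 6 _⊙_

-- Sums of hypotheses, each multiplied by a nonnegative factor, are the certificates that `linear`
-- checks. Nonlinear steps enter as products of inequalities among the summands.
_⊞_ : ∀ {a b c d} → a ⊑ b → c ⊑ d → a ⊕ c ⊑ b ⊕ d
_⊞_ = ⊕-mono

_⊙_ : ∀ {a b} k → a ⊑ b → ι k ⊗ a ⊑ ι k ⊗ b
k ⊙ h = ⊗-monoˡ (ι-mono {0} {k} ℕ.z≤n) h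

≡⇒⊑ : ∀ {a b} → a ≡ b → a ⊑ b
≡⇒⊑ refl = ⊑-refl

≡⇒⊒ : ∀ {a b} → a ≡ b → b ⊑ a
≡⇒⊒ refl = ⊑-refl

infix 9 #_

#_ : ℕ → E
# k = nat (lit k)

v0 v1 v2 v3 v4 v5 v6 v7 v8 v9 v10 v11 v12 v13 n0 n1 n2 n3 n4 n5 n6 n7 n8 : E
v0 = v# 0
v1 = v# 1
v2 = v# 2
v3 = v# 3
v4 = v# 4
v5 = v# 5
v6 = v# 6
v7 = v# 7
v8 = v# 8
v9 = v# 9
v10 = v# 10
v11 = v# 11
v12 = v# 12
v13 = v# 13
n0 = nat (n# 0)
n1 = nat (n# 1)
n2 = nat (n# 2)
n3 = nat (n# 3)
n4 = nat (n# 4)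
n5 = nat (n# 5)
n6 = nat (n# 6)
n7 = nat (n# 7)
n8 = nat (n# 8)

-- Finite sums

0≤ι : ∀ n → ι 0 ⊑ ι n
0≤ι n = ι-mono z≤n

-- A trivial hypothesis that lets unification find the natural number n.
at# : ∀ n → ι 0 ⊗ ι 0 ⊑ ι 0 ⊗ ι n
at# n = 0 ⊙ 0≤ι n

⊗-nonneg : ∀ {a b} → ι 0 ⊑ a → ι 0 ⊑ b → ι 0 ⊑ a ⊗ b
⊗-nonneg {a} {b} 0≤a 0≤b = linear 2 0 (# 0) (v0 :* v1) (v0 :* # 0) (v0 :* v1) (⊗-monoˡ 0≤a 0≤b)

⊕-nonneg : ∀ {a b} → ι 0 ⊑ a → ι 0 ⊑ b → ι 0 ⊑ a ⊕ b
⊕-nonneg {a} {b} h k = linear 2 0 (# 0) (v0 :+ v1) (# 0 :+ # 0) (v0 :+ v1) (h ⊞ k)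

⊗-monoʳ : ∀ {c a b} → ι 0 ⊑ c → a ⊑ b → a ⊗ c ⊑ b ⊗ c
⊗-monoʳ {c} {a} {b} h k = linear 3 0 (v0 :* v1) (v2 :* v1) (v1 :* v0) (v1 :* v2) (⊗-monoˡ h k)

⊗-mono : ∀ {a b c d} → ι 0 ⊑ a → ι 0 ⊑ c → a ⊑ b → c ⊑ d → a ⊗ c ⊑ b ⊗ d
⊗-mono {a} {b} {c} {d} 0≤a 0≤c ab cd = ⊑-trans (⊗-monoʳ 0≤c ab) (⊗-monoˡ (⊑-trans 0≤a ab) cd)

sum : (ℕ → R) → ℕ → R
sum f zero    = ι 0
sum f (suc n) = sum f n ⊕ f (suc n)

sum-cong : ∀ {f g} n → (∀ i → 1 ≤ i → i ≤ n → f i ≡ g i) → sum f n ≡ sum g n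
sum-cong zero    h = refl
sum-cong (suc n) h = cong₂ _⊕_ (sum-cong n (λ i a b → h i a (ℕ.m≤n⇒m≤1+n b))) (h (suc n) (s≤s z≤n) ℕ.≤-refl)

sum-ext : ∀ {f g} n → (∀ i → f i ≡ g i) → sum f n ≡ sum g n
sum-ext n h = sum-cong n (λ i _ _ → h i)

sum-mono : ∀ {f g} n → (∀ i → 1 ≤ i → i ≤ n → f i ⊑ g i) → sum f n ⊑ sum g n
sum-mono zero    h = ⊑-refl
sum-mono (suc n) h = ⊕-mono (sum-mono n (λ i a b → h i a (ℕ.m≤n⇒m≤1+n b))) (h (suc n) (s≤s z≤n) ℕ.≤-refl)

sum-⊕ : ∀ f g n → sum (λ i → f i ⊕ g i) n ≡ sum f n ⊕ sum g n
sum-⊕ f g zero    = ring 0 0 (# 0) (# 0 :+ # 0)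
sum-⊕ f g (suc n) = trans (cong (_⊕ (f (suc n) ⊕ g (suc n))) (sum-⊕ f g n)) (ring 4 0 (v0 :+ v1 :+ (v2 :+ v3)) (v0 :+ v2 :+ (v1 :+ v3)))

sum-⊗ : ∀ c f n → sum (λ i → c ⊗ f i) n ≡ c ⊗ sum f n
sum-⊗ c f zero    = ring 1 0 (# 0) (v0 :* # 0)
sum-⊗ c f (suc n) = trans (cong (_⊕ c ⊗ f (suc n)) (sum-⊗ c f n)) (ring 3 0 (v0 :* v1 :+ v0 :* v2) (v0 :* (v1 :+ v2)))

sum-⊖ : ∀ f g n → sum (λ i → f i ⊖ g i) n ≡ sum f n ⊖ sum g n
sum-⊖ f g zero    = ring 0 0 (# 0) (# 0 :- # 0)
sum-⊖ f g (suc n) = trans (cong (_⊕ (f (suc n) ⊖ g (suc n))) (sum-⊖ f g n)) (ring 4 0 (v0 :- v1 :+ (v2 :- v3)) (v0 :+ v2 :- (v1 :+ v3)))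

sum-const : ∀ c n → sum (λ _ → c) n ≡ ι n ⊗ c
sum-const c zero    = ring 1 0 (# 0) (# 0 :* v0)
sum-const c (suc n) = trans (cong (_⊕ c) (sum-const c n)) (ring 1 1 (n0 :* v0 :+ v0) (nat (lit 1 ∔ n# 0) :* v0))

sum-zero : ∀ {f} n → (∀ i → 1 ≤ i → i ≤ n → f i ≡ ι 0) → sum f n ≡ ι 0
sum-zero {f} n h = trans (sum-cong n h) (trans (sum-const (ι 0) n) (ring 0 1 (n0 :* # 0) (# 0)))

sum-nonneg : ∀ {f} n → (∀ i → 1 ≤ i → i ≤ n → ι 0 ⊑ f i) → ι 0 ⊑ sum f n
sum-nonneg {f} n h = subst (_⊑ sum f n) (sum-zero {λ _ → ι 0} n (λ _ _ _ → refl)) (sum-mono n h)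

sum-swap : ∀ (f : ℕ → ℕ → R) m n → sum (λ i → sum (f i) n) m ≡ sum (λ j → sum (λ i → f i j) m) n
sum-swap f zero    n = sym (sum-zero n (λ _ _ _ → refl))
sum-swap f (suc m) n = trans (cong (_⊕ sum (f (suc m)) n) (sum-swap f m n)) (sym (sum-⊕ _ _ n))

sum-split : ∀ f m n → sum f (m + n) ≡ sum f m ⊕ sum (λ i → f (m + i)) n
sum-split f m zero    = trans (cong (sum f) (ℕ.+-identityʳ m)) (ring 1 0 v0 (v0 :+ # 0))
sum-split f m (suc n) = trans (cong (sum f) (ℕ.+-suc m n))
  (trans (cong₂ _⊕_ (sum-split f m n) (cong f (sym (ℕ.+-suc m n)))) (⊕-assoc _ _ _))

sum-trunc : ∀ f {m n} → m ≤ n → (∀ i → m < i → i ≤ n → f i ≡ ι 0) → sum f n ≡ sum f m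
sum-trunc f {m} {n} m≤n h = trans (cong (sum f) (sym (ℕ.m+[n∸m]≡n m≤n))) (trans (sum-split f m (n ∸ m))
  (trans (cong (sum f m ⊕_) (sum-zero (n ∸ m) (λ i 1≤i i≤ → h (m + i)
    (subst (_≤ m + i) (ℕ.+-comm m 1) (ℕ.+-monoʳ-≤ m 1≤i))
    (subst (m + i ≤_) (ℕ.m+[n∸m]≡n m≤n) (ℕ.+-monoʳ-≤ m i≤))))) (⊕-identityʳ _)))

sum-monoʳ : ∀ f {m n} → m ≤ n → (∀ i → m < i → i ≤ n → ι 0 ⊑ f i) → sum f m ⊑ sum f n
sum-monoʳ f {m} {n} m≤n h = subst (sum f m ⊑_) (trans (sym (sum-split f m (n ∸ m))) (cong (sum f) (ℕ.m+[n∸m]≡n m≤n)))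
  (linear 2 0 v0 (v0 :+ v1) (# 0) v1 (sum-nonneg {λ i → f (m + i)} (n ∸ m) (λ i 1≤i i≤ → h (m + i)
    (subst (_≤ m + i) (ℕ.+-comm m 1) (ℕ.+-monoʳ-≤ m 1≤i))
    (subst (m + i ≤_) (ℕ.m+[n∸m]≡n m≤n) (ℕ.+-monoʳ-≤ m i≤)))))

sum-single : ∀ f k n → 1 ≤ k → k ≤ n → (∀ i → 1 ≤ i → i ≤ n → i ≢ k → f i ≡ ι 0) → sum f n ≡ f k
sum-single f (suc k) n _ k≤n h = trans
  (sum-trunc f k≤n (λ i k<i i≤n → h i (ℕ.≤-trans (s≤s z≤n) k<i) i≤n (λ e → ℕ.<-irrefl (sym e) k<i)))
  (trans (cong (_⊕ f (suc k)) (sum-zero k (λ i 1≤i i≤k → h i 1≤i (ℕ.≤-trans (ℕ.m≤n⇒m≤1+n i≤k) k≤n) (λ e → ℕ.<-irrefl e (s≤s i≤k)))))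
    (⊕-identityˡ _))

χ : ∀ {P : Set} → Dec P → R
χ (yes _) = ι 1
χ (no _)  = ι 0

module _ {P : Set} where
  χ-yes : (d : Dec P) → P → χ d ≡ ι 1
  χ-yes (yes _) _ = refl
  χ-yes (no ¬p) p = contradiction p ¬p

  χ-no : (d : Dec P) → ¬ P → χ d ≡ ι 0
  χ-no (yes p) ¬p = contradiction p ¬p
  χ-no (no _)  _  = refl

  χ-nonneg : (d : Dec P) → ι 0 ⊑ χ d
  χ-nonneg (yes _) = 0≤ι 1
  χ-nonneg (no _)  = ⊑-refl

  χ≤1 : (d : Dec P) → χ d ⊑ ι 1
  χ≤1 (yes _) = ⊑-refl
  χ≤1 (no _)  = 0≤ι 1

  χ-cong : {Q : Set} (d : Dec P) (e : Dec Q) → (P → Q) → (Q → P) → χ d ≡ χ e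
  χ-cong (yes p) (yes q) f g = refl
  χ-cong (yes p) (no ¬q) f g = contradiction (f p) ¬q
  χ-cong (no ¬p) (yes q) f g = contradiction (g q) ¬p
  χ-cong (no ¬p) (no _)  f g = refl

infixl 7 _÷_

-- Total floor division; the value 0 at divisor 0 spares instance arguments inside sums.
_÷_ : ℕ → ℕ → ℕ
z ÷ zero  = 0
z ÷ suc k = z / suc k

÷-lower : ∀ z k → k * (z ÷ k) ≤ z
÷-lower z zero    = z≤n
÷-lower z (suc k) = subst (_≤ z) (ℕ.*-comm (z / suc k) (suc k)) (m/n*n≤m z (suc k))

÷-upper : ∀ z k → 1 ≤ k → z < k * suc (z ÷ k)
÷-upper z (suc k) _ = subst₂ _<_ (sym (m≡m%n+[m/n]*n z (suc k))) (ℕ.*-comm (suc (z / suc k)) (suc k))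
  (ℕ.+-monoˡ-< (z / suc k * suc k) (m%n<n z (suc k)))

÷-unique : ∀ z k q → k * q ≤ z → z < k * suc q → z ÷ k ≡ q
÷-unique z zero    q lo hi = contradiction hi (λ ())
÷-unique z k@(suc _) q lo hi = ℕ.≤-antisym
  (ℕ.≤-pred (ℕ.*-cancelˡ-< k _ _ (ℕ.≤-<-trans (÷-lower z k) hi)))
  (ℕ.≤-pred (ℕ.*-cancelˡ-< k _ _ (ℕ.≤-<-trans lo (÷-upper z k (s≤s z≤n)))))

÷-greatest : ∀ {z k q} → 1 ≤ k → k * q ≤ z → q ≤ z ÷ k
÷-greatest {z} {k@(suc _)} {q} 1≤k lo = ℕ.≤-pred (ℕ.*-cancelˡ-< k _ _ (ℕ.≤-<-trans lo (÷-upper z k 1≤k)))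

÷-monoˡ : ∀ {y z} k → y ≤ z → y ÷ k ≤ z ÷ k
÷-monoˡ zero        y≤z = z≤n
÷-monoˡ {y} {z} k@(suc _) y≤z = ÷-greatest {z} {k} (s≤s z≤n) (ℕ.≤-trans (÷-lower y k) y≤z)

÷≤ : ∀ z k → z ÷ k ≤ z
÷≤ z zero    = z≤n
÷≤ z (suc k) = ℕ.≤-trans (ℕ.m≤m+n _ _) (÷-lower z (suc k))

÷-÷ : ∀ z a b → 1 ≤ a → 1 ≤ b → z ÷ a ÷ b ≡ z ÷ (a * b)
÷-÷ z a@(suc _) b@(suc _) 1≤a 1≤b = sym (÷-unique z (a * b) (z ÷ a ÷ b)
  (ℕ.≤-trans (subst (_≤ a * (z ÷ a)) (sym (ℕ.*-assoc a b (z ÷ a ÷ b))) (ℕ.*-monoʳ-≤ a (÷-lower (z ÷ a) b))) (÷-lower z a))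
  (ℕ.<-≤-trans (÷-upper z a 1≤a) (subst (a * suc (z ÷ a) ≤_) (sym (ℕ.*-assoc a b _)) (ℕ.*-monoʳ-≤ a (÷-upper (z ÷ a) b 1≤b)))))

÷-1 : ∀ z → z ÷ 1 ≡ z
÷-1 z = ÷-unique z 1 z (ℕ.≤-reflexive (ℕ.*-identityˡ z)) (subst (z <_) (sym (ℕ.*-identityˡ (suc z))) ℕ.≤-refl)

sum-÷ : ∀ (f : ℕ → R) z k → 1 ≤ k → sum f (z ÷ k) ≡ sum (λ j → χ (k * j ℕ.≤? z) ⊗ f j) z
sum-÷ f z k 1≤k = trans (sum-cong (z ÷ k) (λ j _ j≤ → sym (trans (cong (_⊗ f j)
    (χ-yes (k * j ℕ.≤? z) (ℕ.≤-trans (ℕ.*-monoʳ-≤ k j≤) (÷-lower z k)))) (⊗-identityˡ _))))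
  (sym (sum-trunc _ (÷≤ z k) (λ j j> _ → trans (cong (_⊗ f j)
    (χ-no (k * j ℕ.≤? z) (λ le → ℕ.<⇒≱ j> (÷-greatest 1≤k le)))) (⊗-zeroˡ _))))

-- Both sides run over the pairs (i, j) with i j ≤ z.
sum-hyperbola : ∀ (f : ℕ → ℕ → R) z →
  sum (λ i → sum (f i) (z ÷ i)) z ≡ sum (λ j → sum (λ i → f i j) (z ÷ j)) z
sum-hyperbola f z = trans (sum-cong z (λ i 1≤i _ → sum-÷ (f i) z i 1≤i))
  (trans (sum-swap _ z z) (sum-cong z (λ j 1≤j _ → trans (sum-cong z (λ i _ _ →
    cong (λ k → χ (k ℕ.≤? z) ⊗ f i j) (ℕ.*-comm i j))) (sym (sum-÷ (λ i → f i j) z j 1≤j)))))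

-- Induction on z: the quotient `z ÷ k` grows exactly when the new integer is a multiple of k.
sum-multiples : ∀ (h : ℕ → R) z k → 1 ≤ k → sum (λ j → h (k * j)) (z ÷ k) ≡ sum (λ n → χ (k ∣? n) ⊗ h n) z
sum-multiples h zero    k@(suc _) 1≤k = refl
sum-multiples h (suc z) k@(suc k₀) 1≤k with k ∣? suc z
... | yes (divides (suc q) e) = trans (cong (sum (λ j → h (k * j))) q₁)
    (cong₂ _⊕_ (trans (cong (sum (λ j → h (k * j))) (sym q₀)) (sum-multiples h z k 1≤k))
      (trans (cong h (sym e′)) (sym (⊗-identityˡ _))))
  where
  e′ : suc z ≡ k * suc q
  e′ = trans e (ℕ.*-comm (suc q) k)
  q₁ : suc z ÷ k ≡ suc q
  q₁ = ÷-unique (suc z) k (suc q) (ℕ.≤-reflexive (sym e′))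
    (subst (_< k * suc (suc q)) (sym e′) (ℕ.*-monoʳ-< k (ℕ.n<1+n (suc q))))
  q₀ : z ÷ k ≡ q
  q₀ = ÷-unique z k q (ℕ.≤-pred (subst (k * q <_) (sym e′) (ℕ.*-monoʳ-< k (ℕ.n<1+n q)))) (ℕ.≤-reflexive e′)
... | no k∤ = trans (cong (sum (λ j → h (k * j))) q₁)
    (trans (sum-multiples h z k 1≤k) (sym (trans (cong (sum _ z ⊕_) (⊗-zeroˡ _)) (⊕-identityʳ _))))
  where
  q₁ : suc z ÷ k ≡ z ÷ k
  q₁ = ÷-unique (suc z) k (z ÷ k) (ℕ.m≤n⇒m≤1+n (÷-lower z k))
    (ℕ.≤∧≢⇒< (÷-upper z k 1≤k) (λ e → k∤ (divides (suc (z ÷ k)) (trans e (ℕ.*-comm k _)))))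

-- Dirichlet convolution with the constant 1.
divisorSum : (ℕ → R) → ℕ → R
divisorSum a n = sum (λ d → χ (d ∣? n) ⊗ a d) n

-- Groups the pairs (i, j) by the product n = i j. Through it the divisor identities of Λ and μ
-- enter the sums below.
sum-divisorSum : ∀ (a h : ℕ → R) z →
  sum (λ i → a i ⊗ sum (λ j → h (i * j)) (z ÷ i)) z ≡ sum (λ n → divisorSum a n ⊗ h n) z
sum-divisorSum a h z = trans (sum-cong z (λ i 1≤i _ → trans (cong (a i ⊗_) (sum-multiples h z i 1≤i)) (sym (sum-⊗ (a i) _ z))))
  (trans (sum-swap _ z z) (sum-cong z λ n 1≤n n≤z → trans
    (sum-trunc (λ i → a i ⊗ (χ (i ∣? n) ⊗ h n)) n≤z (λ i n<i _ → trans (cong (λ t → a i ⊗ (t ⊗ h n))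
      (χ-no (i ∣? n) (λ i∣n → ℕ.<⇒≱ n<i (∣⇒≤ {{ℕ.>-nonZero 1≤n}} i∣n)))) (ring 2 0 (v0 :* (# 0 :* v1)) (# 0))))
    (trans (sum-cong n (λ i _ _ → lem i n)) (trans (sum-⊗ (h n) _ n) (⊗-comm _ _)))))
  where
  lem : ∀ i n → a i ⊗ (χ (i ∣? n) ⊗ h n) ≡ h n ⊗ (χ (i ∣? n) ⊗ a i)
  lem i n = ring 3 0 (v0 :* (v1 :* v2)) (v2 :* (v1 :* v0))

-- Approximate logarithms

*-pos : ∀ {a b} → 1 ≤ a → 1 ≤ b → 1 ≤ a * b
*-pos = ℕ.*-mono-≤

⊗-cancelˡ : ∀ n {x y} → 1 ≤ n → ι n ⊗ x ⊑ ι n ⊗ y → x ⊑ y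
⊗-cancelˡ n {x} {y} 1≤n h = linear 3 1
    v0 v1 (v2 :* (n0 :* v0) :+ # 1 :* v0 :+ n0 :* v2 :* v1) (v2 :* (n0 :* v1) :+ n0 :* v2 :* v0 :+ # 1 :* v1)
    (⊗-monoˡ (inv-nonneg n) h
  ⊞ ≡⇒⊒ (cong (_⊗ x) (inv-inverse n 1≤n)) ⊞ ≡⇒⊑ (cong (_⊗ y) (inv-inverse n 1≤n)))

⊗-cancel≡ : ∀ n {x y} → 1 ≤ n → ι n ⊗ x ≡ ι n ⊗ y → x ≡ y
⊗-cancel≡ n 1≤n h = ⊑-antisym (⊗-cancelˡ n 1≤n (≡⇒⊑ h)) (⊗-cancelˡ n 1≤n (≡⇒⊒ h))

inv-anti : ∀ {m n} → 1 ≤ m → m ≤ n → inv n ⊑ inv m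
inv-anti {m} {n} 1≤m m≤n = ⊗-cancelˡ n 1≤n (⊗-cancelˡ m 1≤m
  (linear 2 2
      (n0 :* (n1 :* v0)) (n0 :* (n1 :* v1)) (n0 :+ n0 :* (n1 :* v0) :+ n1 :* # 1)
      (n1 :+ n0 :* # 1 :+ n1 :* (n0 :* v1))
      (ι-mono m≤n ⊞ ≡⇒⊑ (cong (ι m ⊗_) (inv-inverse n 1≤n)) ⊞ ≡⇒⊒ (cong (ι n ⊗_) (inv-inverse m 1≤m)))))
  where 1≤n = ℕ.≤-trans 1≤m m≤n

inv-* : ∀ m n → 1 ≤ m → 1 ≤ n → inv (m * n) ≡ inv m ⊗ inv n
inv-* m n 1≤m 1≤n = ⊗-cancel≡ (m * n) (*-pos 1≤m 1≤n) (trans (inv-inverse (m * n) (*-pos 1≤m 1≤n))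
  (sym (trans (cong (_⊗ (inv m ⊗ inv n)) (ι-* m n)) (trans e (cong₂ _⊗_ (inv-inverse m 1≤m) (inv-inverse n 1≤n)) ■))))
  where
  e : ι m ⊗ ι n ⊗ (inv m ⊗ inv n) ≡ (ι m ⊗ inv m) ⊗ (ι n ⊗ inv n)
  e = ring 2 2 (n0 :* n1 :* (v0 :* v1)) (n0 :* v0 :* (n1 :* v1))
  one : ι 1 ⊗ ι 1 ≡ ι 1
  one = ring 0 0 (# 1 :* # 1) (# 1)
  _■ : ∀ {x} → x ≡ ι 1 ⊗ ι 1 → x ≡ ι 1
  p ■ = trans p one

inv-1 : inv 1 ≡ ι 1
inv-1 = trans (sym (⊗-identityˡ _)) (inv-inverse 1 (s≤s z≤n))

inv≤1 : ∀ n → 1 ≤ n → inv n ⊑ ι 1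
inv≤1 n 1≤n = subst (inv n ⊑_) inv-1 (inv-anti (s≤s z≤n) 1≤n)

harmonic : ℕ → R
harmonic = sum inv

-- H(as) − H(s), an increasing approximation of log a.
D : ℕ → ℕ → R
D a s = harmonic (a * s) ⊖ harmonic s

block : ∀ b a → 1 ≤ b → ι a ⊗ inv (b + a) ⊑ sum (λ i → inv (b + i)) a × sum (λ i → inv (b + i)) a ⊑ ι a ⊗ inv b
block b a 1≤b =
    ⊑-trans (≡⇒⊒ (sum-const _ a)) (sum-mono a (λ i _ i≤a → inv-anti (ℕ.≤-trans 1≤b (ℕ.m≤m+n b i)) (ℕ.+-monoʳ-≤ b i≤a)))
  , ⊑-trans (sum-mono a (λ i _ _ → inv-anti 1≤b (ℕ.m≤m+n b i))) (≡⇒⊑ (sum-const _ a))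

inv-scale : ∀ a s → 1 ≤ a → 1 ≤ s → ι a ⊗ inv (a * s) ≡ inv s
inv-scale a s 1≤a 1≤s = trans (cong (ι a ⊗_) (inv-* a s 1≤a 1≤s)) (trans (sym (⊗-assoc _ _ _))
  (trans (cong (_⊗ inv s) (inv-inverse a 1≤a)) (⊗-identityˡ _)))

-- From s to s + 1 the first harmonic sum gains a terms between 1/(a s + a) and 1/(a s), in total
-- between 1/(s + 1) and 1/s; the second gains 1/(s + 1).
D-step : ∀ a s → 1 ≤ a → 1 ≤ s → D a s ⊑ D a (suc s) × D a (suc s) ⊑ D a s ⊕ (inv s ⊖ inv (suc s))
D-step a s 1≤a 1≤s = linear 6 1
    (v0 :- v1) (v2 :- (v1 :+ v3)) (v0 :+ v4 :+ n0 :* v5 :+ v3) (v2 :+ v4 :+ n0 :* v5)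
    (≡⇒⊒ e ⊞ proj₁ b ⊞ ≡⇒⊒ (trans (cong (λ t → ι a ⊗ inv t) t≡) (inv-scale a (suc s) 1≤a (s≤s z≤n))))
                   , linear 7 1
                       (v0 :- (v1 :+ v2)) (v3 :- v1 :+ (v4 :- v2)) (v0 :+ v5 :+ n0 :* v6) (v3 :+ v5 :+ n0 :* v6 :+ v4)
                       (≡⇒⊑ e ⊞ proj₂ b ⊞ ≡⇒⊑ (inv-scale a s 1≤a 1≤s))
  where
  t≡ : a * s + a ≡ a * suc s
  t≡ = trans (ℕ.+-comm (a * s) a) (sym (ℕ.*-suc a s))
  b = block (a * s) a (*-pos 1≤a 1≤s)
  e : harmonic (a * suc s) ≡ harmonic (a * s) ⊕ sum (λ i → inv (a * s + i)) a
  e = trans (cong harmonic (sym t≡)) (sum-split inv (a * s) a)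

D-mono : ∀ a s k → 1 ≤ a → 1 ≤ s → D a s ⊑ D a (k + s) × D a (k + s) ⊑ D a s ⊕ (inv s ⊖ inv (k + s))
D-mono a s zero    1≤a 1≤s = ⊑-refl , linear 3 0 (v0 :- v1) (v0 :- v1 :+ (v2 :- v2)) (# 0) (# 0) (⊑-refl {ι 0})
D-mono a s (suc k) 1≤a 1≤s = ⊑-trans (proj₁ ih) (proj₁ st) , linear 8 0
    (v0 :- (v1 :+ v2)) (v3 :- v4 :+ (v5 :- v2)) (v6 :- v1 :+ (v0 :- (v1 :+ v2)))
    (v3 :- v4 :+ (v5 :- v7) :+ (v6 :- v1 :+ (v7 :- v2)))
    (proj₂ ih ⊞ proj₂ st)
  where
  ih = D-mono a s k 1≤a 1≤s
  st = D-step a (k + s) 1≤a (ℕ.≤-trans 1≤s (ℕ.m≤n+m s k))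

module Approx (S : ℕ) (1≤S : 1 ≤ S) where

  ℓ : ℕ → R
  ℓ a = D a S

  -- `ℓ (a * b)` is exactly `ℓ b` plus `D a (b * S)`, and `D-mono` compares the latter with `ℓ a`,
  -- which is `D a S`.
  ℓ-* : ∀ a b → 1 ≤ a → 1 ≤ b → ℓ a ⊕ ℓ b ⊑ ℓ (a * b) × ℓ (a * b) ⊑ ℓ a ⊕ ℓ b ⊕ inv S
  ℓ-* a b 1≤a 1≤b = linear 5 0
      (v0 :- v1 :+ (v2 :- v1)) (v3 :- v1) (v0 :- v1 :+ v4) (v4 :- v2 :+ v3)
      (proj₁ m ⊞ ≡⇒⊒ e) , linear 7 0
      (v0 :- v1) (v2 :- v1 :+ (v3 :- v1) :+ v4) (v5 :- v3 :+ v0 :+ # 0) (v2 :- v1 :+ (v4 :- v6) :+ v5 :+ v6)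
      (proj₂ m ⊞ ≡⇒⊑ e ⊞ inv-nonneg (b * S))
    where
    k≡ : b * S ∸ S + S ≡ b * S
    k≡ = ℕ.m∸n+n≡m (subst (_≤ b * S) (ℕ.*-identityˡ S) (ℕ.*-monoˡ-≤ S 1≤b))
    m : D a S ⊑ D a (b * S) × D a (b * S) ⊑ D a S ⊕ (inv S ⊖ inv (b * S))
    m = subst (λ t → D a S ⊑ D a t × D a t ⊑ D a S ⊕ (inv S ⊖ inv t)) k≡ (D-mono a S (b * S ∸ S) 1≤a 1≤S)
    e : harmonic (a * b * S) ≡ harmonic (a * (b * S))
    e = cong harmonic (ℕ.*-assoc a b S)

  ℓ-step : ∀ n → 1 ≤ n → ℓ n ⊕ inv (suc n) ⊑ ℓ (suc n) × ℓ (suc n) ⊑ ℓ n ⊕ inv n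
  ℓ-step n 1≤n = linear 6 1
      (v0 :- v1 :+ v2) (v3 :- v1) (v0 :+ v4 :+ n0 :* v5 :+ v2) (v3 :+ v4 :+ n0 :* v5)
      (≡⇒⊒ e ⊞ proj₁ b ⊞ ≡⇒⊒ (trans (cong (λ t → ι S ⊗ inv t) t≡) (inv-scale S (suc n) 1≤S (s≤s z≤n))))
               , linear 6 1
                   (v0 :- v1) (v2 :- v1 :+ v3) (v0 :+ v4 :+ n0 :* v5) (v2 :+ v4 :+ n0 :* v5 :+ v3)
                   (≡⇒⊑ e ⊞ proj₂ b ⊞ ≡⇒⊑ (trans (cong (λ t → ι S ⊗ inv t) (ℕ.*-comm n S)) (inv-scale S n 1≤S 1≤n)))
    where
    b = block (n * S) S (*-pos 1≤n 1≤S)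
    t≡ : n * S + S ≡ S * suc n
    t≡ = trans (ℕ.+-comm (n * S) S) (ℕ.*-comm (suc n) S)
    e : harmonic (suc n * S) ≡ harmonic (n * S) ⊕ sum (λ i → inv (n * S + i)) S
    e = trans (cong harmonic (ℕ.+-comm S (n * S))) (sum-split inv (n * S) S)

  ℓ-1 : ℓ 1 ≡ ι 0
  ℓ-1 = trans (cong (λ t → harmonic t ⊖ harmonic S) (ℕ.*-identityˡ S)) (⊕-inverseʳ _)

  ℓ-nonneg : ∀ n → 1 ≤ n → ι 0 ⊑ ℓ n
  ℓ-nonneg (suc zero)    _ = ≡⇒⊒ ℓ-1
  ℓ-nonneg (suc (suc n)) _ = ⊑-trans (ℓ-nonneg (suc n) (s≤s z≤n))
    (linear 3 0 v0 v1 (v0 :+ v2 :+ # 0) (v1 :+ v2) (proj₁ (ℓ-step (suc n) (s≤s z≤n)) ⊞ inv-nonneg (suc (suc n))))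

-- The von Mangoldt function

prime≥2 : ∀ {q} → Prime q → 2 ≤ q
prime≥2 pq = ℕ.nonTrivial⇒n>1 _ {{prime⇒nonTrivial pq}}

prime≥1 : ∀ {q} → Prime q → 1 ≤ q
prime≥1 pq = ℕ.<⇒≤ (prime≥2 pq)

^-pos : ∀ {q} j → 1 ≤ q → 1 ≤ q ^ j
^-pos zero    _   = s≤s z≤n
^-pos (suc j) 1≤q = *-pos 1≤q (^-pos j 1≤q)

n<2^n : ∀ n → n < 2 ^ n
n<2^n zero    = s≤s z≤n
n<2^n (suc n) = ℕ.≤-trans (ℕ.+-mono-≤ (^-pos {2} n (s≤s z≤n)) (n<2^n n)) (ℕ.+-monoʳ-≤ (2 ^ n) (ℕ.m≤m+n (2 ^ n) 0))

PrimePower : ℕ → Set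
PrimePower n = Σ ℕ λ q → Σ ℕ λ j → Prime q × n ≡ q ^ suc j

primePower? : ∀ n → Dec (PrimePower n)
primePower? n = map′
  (λ { (q , _ , j , _ , pq , e) → q , j , pq , e })
  (λ { (q , j , pq , e) → q , s≤s (subst (q ≤_) (sym e) (ℕ.m≤m*n q (q ^ j) {{ℕ.>-nonZero (^-pos j (prime≥1 pq))}}))
     , j , subst (j <_) (sym e) (ℕ.<-≤-trans (n<2^n j) (ℕ.≤-trans (ℕ.^-monoˡ-≤ j (prime≥2 pq)) (ℕ.m≤n*m (q ^ j) q {{prime⇒nonZero pq}}))) , pq , e })
  (ℕ.anyUpTo? (λ q → ℕ.anyUpTo? (λ j → prime? q ×-dec (n ℕ.≟ q ^ suc j)) n) (suc n))

prime∣prime : ∀ {q r} → Prime q → Prime r → q ∣ r → q ≡ r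
prime∣prime pq pr q∣r with prime⇒irreducible pr q∣r
... | inj₁ q≡1 = contradiction (subst (2 ≤_) q≡1 (prime≥2 pq)) (λ { (s≤s ()) })
... | inj₂ q≡r = q≡r

prime∣^ : ∀ {q} r j → Prime q → q ∣ r ^ j → q ∣ r
prime∣^ r zero    pq d = contradiction (subst (2 ≤_) (∣1⇒≡1 d) (prime≥2 pq)) (λ { (s≤s ()) })
prime∣^ r (suc j) pq d with euclidsLemma r (r ^ j) pq d
... | inj₁ h = h
... | inj₂ h = prime∣^ r j pq h

primePower-base : ∀ {q r} i j → Prime q → Prime r → q ^ suc i ≡ r ^ suc j → q ≡ r
primePower-base {q} {r} i j pq pr e = prime∣prime pq pr (prime∣^ r (suc j) pq (subst (q ∣_) e (m∣m*n (q ^ i))))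

primePower-coprime : ∀ {q r} j → Prime q → Prime r → q ≢ r → Coprime (r ^ j) q
primePower-coprime {q} {r} j pq pr q≢r {d} (d∣r , d∣q) with prime⇒irreducible pq d∣q
... | inj₁ d≡1 = d≡1
... | inj₂ refl = contradiction (prime∣prime pq pr (prime∣^ r j pq d∣r)) q≢r

^-∣-bound : ∀ {q} a b k → Prime q → ¬ q ∣ k → q ^ a ∣ q ^ b * k → a ≤ b
^-∣-bound zero    b       k pq ∤ d = z≤n
^-∣-bound {q} (suc a) zero k pq ∤ d = contradiction (∣-trans (m∣m*n (q ^ a)) (subst (q ^ suc a ∣_) (ℕ.*-identityˡ k) d)) ∤
^-∣-bound {q} (suc a) (suc b) k pq ∤ d = s≤s (^-∣-bound a b k pq ∤
  (*-cancelˡ-∣ q {{prime⇒nonZero pq}} (subst (q ^ suc a ∣_) (ℕ.*-assoc q (q ^ b) k) d)))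

^-∣-mono : ∀ q {a b} k → a ≤ b → q ^ a ∣ q ^ b * k
^-∣-mono q {zero}  {b} k z≤n     = divides (q ^ b * k) (sym (ℕ.*-identityʳ _))
^-∣-mono q {suc a} {suc b} k (s≤s h) = subst (q ^ suc a ∣_) (sym (ℕ.*-assoc q (q ^ b) k)) (*-monoʳ-∣ q (^-∣-mono q k h))

valuation : ∀ q → Prime q → ∀ m → 1 ≤ m → Σ ℕ λ v → Σ ℕ λ k → m ≡ q ^ v * k × ¬ q ∣ k
valuation q pq = <-rec _ go
  where
  go : ∀ m → (∀ {i} → i < m → 1 ≤ i → Σ ℕ λ v → Σ ℕ λ k → i ≡ q ^ v * k × ¬ q ∣ k) →
       1 ≤ m → Σ ℕ λ v → Σ ℕ λ k → m ≡ q ^ v * k × ¬ q ∣ k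
  go m rec 1≤m with q ∣? m
  ... | no ∤ = 0 , m , sym (ℕ.*-identityˡ m) , ∤
  ... | yes (divides zero refl) = contradiction 1≤m (λ ())
  ... | yes (divides i@(suc _) e) with rec (subst (i <_) (sym e) (ℕ.m<m*n i q (prime≥2 pq))) (s≤s z≤n)
  ...   | v , k , e′ , ∤ = suc v , k , trans e (trans (ℕ.*-comm i q) (trans (cong (q *_) e′) (sym (ℕ.*-assoc q (q ^ v) k)))) , ∤

module _ (S : ℕ) (1≤S : 1 ≤ S) where
  open Approx S 1≤S

  mangoldt : ℕ → R
  mangoldt n with primePower? n
  ... | yes (q , _) = ℓ q
  ... | no _        = ι 0

  mangoldt-nonneg : ∀ n → ι 0 ⊑ mangoldt n
  mangoldt-nonneg n with primePower? n
  ... | yes (q , j , pq , _) = ℓ-nonneg q (prime≥1 pq)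
  ... | no _                 = ⊑-refl

  mangoldt-support : ∀ n → ¬ PrimePower n → mangoldt n ≡ ι 0
  mangoldt-support n ¬pp with primePower? n
  ... | yes pp = contradiction pp ¬pp
  ... | no _   = refl

  mangoldt-primePower : ∀ {q} j → Prime q → mangoldt (q ^ suc j) ≡ ℓ q
  mangoldt-primePower {q} j pq with primePower? (q ^ suc j)
  ... | yes (r , i , pr , e) = cong ℓ (sym (primePower-base j i pq pr e))
  ... | no ¬pp               = contradiction (q , j , pq , refl) ¬pp

  -- This is the sum of v_q(n) ℓ(q) over the primes q, hence exactly additive, whereas `ℓ` is
  -- additive only up to a small error.
  log : ℕ → R
  log = divisorSum mangoldt

  -- Passing from m to qm adds exactly one prime power divisor, q^(v+1) with v the q-adic valuation of m.
  log-prime-* : ∀ {q} m → Prime q → 1 ≤ m → log (q * m) ≡ log m ⊕ ℓ q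
  log-prime-* {q} m pq 1≤m with valuation q pq m 1≤m
  ... | v , k , e , ∤ = trans (sum-ext (q * m) term) (trans (sum-⊕ _ _ (q * m)) (cong₂ _⊕_
          (sum-trunc _ (ℕ.m≤n*m m q {{prime⇒nonZero pq}}) (λ d m<d _ → trans (cong (_⊗ mangoldt d)
            (χ-no (d ∣? m) (λ d∣m → ℕ.<⇒≱ m<d (∣⇒≤ {{ℕ.>-nonZero 1≤m}} d∣m)))) (⊗-zeroˡ _)))
          (trans (sum-single _ (q ^ suc v) (q * m) (^-pos (suc v) (prime≥1 pq)) top≤
              (λ d _ _ d≢ → trans (cong (_⊗ ℓ q) (χ-no (d ℕ.≟ q ^ suc v) d≢)) (⊗-zeroˡ _)))
            (trans (cong (_⊗ ℓ q) (χ-yes (q ^ suc v ℕ.≟ q ^ suc v) refl)) (⊗-identityˡ _)))))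
    where
    qm≡ : q * m ≡ q ^ suc v * k
    qm≡ = trans (cong (q *_) e) (sym (ℕ.*-assoc q (q ^ v) k))
    1≤k : 1 ≤ k
    1≤k = ℕ.n≢0⇒n>0 (λ { refl → ∤ (divides 0 refl) })
    top≤ : q ^ suc v ≤ q * m
    top≤ = subst (q ^ suc v ≤_) (sym qm≡) (ℕ.m≤m*n (q ^ suc v) k {{ℕ.>-nonZero 1≤k}})
    term : ∀ d → χ (d ∣? (q * m)) ⊗ mangoldt d ≡ χ (d ∣? m) ⊗ mangoldt d ⊕ χ (d ℕ.≟ q ^ suc v) ⊗ ℓ q
    term d with primePower? d
    ... | no ¬pp rewrite χ-no (d ℕ.≟ q ^ suc v) (λ { refl → ¬pp (q , v , pq , refl) }) = ring 4 0 (v0 :* # 0) (v1 :* # 0 :+ # 0 :* (v2 :- v3))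
    ... | yes (r , j , pr , refl) with q ℕ.≟ r
    ...   | no q≢r rewrite χ-no (r ^ suc j ℕ.≟ q ^ suc v) (λ e → q≢r (sym (primePower-base {r} {q} j v pr pq e)))
                | χ-cong (r ^ suc j ∣? (q * m)) (r ^ suc j ∣? m)
                    (coprime-divisor (primePower-coprime (suc j) pq pr q≢r)) (λ h → ∣-trans h (n∣m*n q {m})) = ring 4 0
                        (v0 :* (v1 :- v2)) (v0 :* (v1 :- v2) :+ # 0 :* (v3 :- v2))
    ...   | yes refl with ℕ.<-cmp j v
    ...     | tri< j<v j≢v _
              rewrite χ-yes (q ^ suc j ∣? (q * m)) (subst (q ^ suc j ∣_) (sym qm≡) (^-∣-mono q k (s≤s (ℕ.<⇒≤ j<v))))
                    | χ-yes (q ^ suc j ∣? m) (subst (q ^ suc j ∣_) (sym e) (^-∣-mono q k j<v))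
                    | χ-no (q ^ suc j ℕ.≟ q ^ suc v) (λ h → ℕ.<⇒≢ (ℕ.^-monoʳ-< q (prime≥2 pq) (s≤s j<v)) h) = ring 2 0
                        (# 1 :* (v0 :- v1)) (# 1 :* (v0 :- v1) :+ # 0 :* (v0 :- v1))
    ...     | tri≈ _ refl _
              rewrite χ-yes (q ^ suc v ∣? (q * m)) (subst (q ^ suc v ∣_) (sym qm≡) (^-∣-mono q {suc v} {suc v} k ℕ.≤-refl))
                    | χ-no (q ^ suc v ∣? m) (λ h → ℕ.<⇒≱ (ℕ.n<1+n v) (^-∣-bound (suc v) v k pq ∤ (subst (q ^ suc v ∣_) e h)))
                    | χ-yes (q ^ suc v ℕ.≟ q ^ suc v) refl = ring 2 0 (# 1 :* (v0 :- v1)) (# 0 :* (v0 :- v1) :+ # 1 :* (v0 :- v1))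
    ...     | tri> _ _ v<j
              rewrite χ-no (q ^ suc j ∣? (q * m)) (λ h → ℕ.<⇒≱ (s≤s v<j) (^-∣-bound (suc j) (suc v) k pq ∤ (subst (q ^ suc j ∣_) qm≡ h)))
                    | χ-no (q ^ suc j ∣? m) (λ h → ℕ.<⇒≱ v<j (ℕ.≤-trans (ℕ.n≤1+n j) (^-∣-bound (suc j) v k pq ∤ (subst (q ^ suc j ∣_) e h))))
                    | χ-no (q ^ suc j ℕ.≟ q ^ suc v) (λ h → ℕ.<⇒≢ (ℕ.^-monoʳ-< q (prime≥2 pq) (s≤s v<j)) (sym h)) = ring 2 0
                        (# 0 :* (v0 :- v1)) (# 0 :* (v0 :- v1) :+ # 0 :* (v0 :- v1))

  log-1 : log 1 ≡ ι 0
  log-1 = trans (cong (λ t → ι 0 ⊕ χ (1 ∣? 1) ⊗ t) (mangoldt-support 1 λ { (q , j , pq , e) →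
    ℕ.<⇒≢ (ℕ.<-≤-trans (prime≥2 pq) (ℕ.m≤m*n q (q ^ j) {{ℕ.>-nonZero (^-pos j (prime≥1 pq))}})) e })) (ring 1 0 (# 0 :+ v0 :* # 0) (# 0))

  -- Bounds the number of prime factors, and thereby the accumulated error in `log-approx`.
  productPos : ∀ qs → All Prime qs → suc (length qs) ≤ product qs
  productPos []       []       = s≤s z≤n
  productPos (q ∷ qs) (p ∷ ps) = ℕ.≤-trans (ℕ.+-mono-≤ (ℕ.≤-trans (s≤s z≤n) ih) ih)
    (subst (_≤ q * product qs) (cong (λ t → product qs + t) (ℕ.+-identityʳ _)) (ℕ.*-monoˡ-≤ (product qs) (prime≥2 p)))
    where ih = productPos qs ps

  sumℓ : List ℕ → R
  sumℓ []       = ι 0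
  sumℓ (q ∷ qs) = ℓ q ⊕ sumℓ qs

  log-product-* : ∀ qs b → All Prime qs → 1 ≤ b → log (product qs * b) ≡ sumℓ qs ⊕ log b
  log-product-* []       b []       1≤b = trans (cong log (ℕ.*-identityˡ b)) (sym (⊕-identityˡ _))
  log-product-* (q ∷ qs) b (p ∷ ps) 1≤b = trans (cong log (ℕ.*-assoc q (product qs) b))
    (trans (log-prime-* (product qs * b) p (*-pos (ℕ.≤-trans (s≤s z≤n) (productPos qs ps)) 1≤b))
      (trans (cong (_⊕ ℓ q) (log-product-* qs b ps 1≤b)) (ring 4 0 (v0 :+ v1 :+ (v2 :- v3)) (v2 :- v3 :+ v0 :+ v1))))

  log-product : ∀ qs → All Prime qs → log (product qs) ≡ sumℓ qs
  log-product qs ps = trans (cong log (sym (ℕ.*-identityʳ (product qs))))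
    (trans (log-product-* qs 1 ps (s≤s z≤n)) (trans (cong (sumℓ qs ⊕_) log-1) (⊕-identityʳ _)))

  log-* : ∀ a b → 1 ≤ a → 1 ≤ b → log (a * b) ≡ log a ⊕ log b
  log-* a b 1≤a 1≤b with factorise a {{ℕ.>-nonZero 1≤a}}
  ... | record { factors = qs ; isFactorisation = refl ; factorsPrime = ps } =
    trans (log-product-* qs b ps 1≤b) (cong (_⊕ log b) (sym (log-product qs ps)))

  -- Each prime factor costs at most one error `inv S` of `ℓ-*`.
  sumℓ-approx : ∀ qs → All Prime qs → sumℓ qs ⊑ ℓ (product qs) × ℓ (product qs) ⊑ sumℓ qs ⊕ ι (length qs) ⊗ inv S
  sumℓ-approx []       []       = ≡⇒⊒ ℓ-1 , linear 3 0 (v0 :- v1) (# 0 :+ # 0 :* v2) (v0 :- v1) (# 0) (≡⇒⊑ ℓ-1)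
  sumℓ-approx (q ∷ qs) (p ∷ ps) = linear 5 0
      (v0 :- v1 :+ v2) (v3 :- v1) (v2 :+ (v0 :- v1 :+ (v4 :- v1))) (v4 :- v1 :+ (v3 :- v1))
      (proj₁ ih ⊞ proj₁ st) , linear 6 1
      (v0 :- v1) (v2 :- v1 :+ v3 :+ nat (lit 1 ∔ n# 0) :* v4) (v5 :- v1 :+ (v0 :- v1))
      (v3 :+ n0 :* v4 :+ (v2 :- v1 :+ (v5 :- v1) :+ v4))
      (proj₂ ih ⊞ proj₂ st)
    where
    ih = sumℓ-approx qs ps
    st = ℓ-* q (product qs) (prime≥1 p) (ℕ.≤-trans (s≤s z≤n) (productPos qs ps))

  log-approx-product : ∀ qs → All Prime qs →
    log (product qs) ⊑ ℓ (product qs) × ℓ (product qs) ⊑ log (product qs) ⊕ ι (product qs) ⊗ inv S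
  log-approx-product qs ps = ⊑-trans (≡⇒⊑ (log-product qs ps)) (proj₁ (sumℓ-approx qs ps))
    , linear 5 2
        (v0 :- v1) (v2 :+ n0 :* v3) (v0 :- v1 :+ v4 :+ n1 :* v3) (v4 :+ n1 :* v3 :+ v2 :+ n0 :* v3)
        (proj₂ (sumℓ-approx qs ps) ⊞ ≡⇒⊒ (log-product qs ps) ⊞ ⊗-monoʳ (inv-nonneg S) (ι-mono len≤))
    where
    len≤ : length qs ≤ product qs
    len≤ = ℕ.≤-trans (ℕ.n≤1+n _) (productPos qs ps)

  log-approx : ∀ n → 1 ≤ n → log n ⊑ ℓ n × ℓ n ⊑ log n ⊕ ι n ⊗ inv S
  log-approx n 1≤n = subst (λ t → log t ⊑ ℓ t × ℓ t ⊑ log t ⊕ ι t ⊗ inv S) (sym (isFactorisation f))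
    (log-approx-product (factors f) (factorsPrime f))
    where
    open PrimeFactorisation
    f = factorise n {{ℕ.>-nonZero 1≤n}}

-- The interface to logarithms. Selberg's formula rests on exact additivity and on the exact divisor
-- identity between Λ and L. The growth of log is only approximate and only up to N, with a slack of
-- 1/n² per step, which is summable.
record LogSystem (N : ℕ) : Set where
  field
    Λ L       : ℕ → R
    Λ-nonneg  : ∀ n → ι 0 ⊑ Λ n
    Λ-support : ∀ n → ¬ PrimePower n → Λ n ≡ ι 0
    Λ-^       : ∀ {q} j → Prime q → Λ (q ^ suc j) ≡ Λ q
    L-divisors : ∀ n → divisorSum Λ n ≡ L n
    L-*       : ∀ a b → 1 ≤ a → 1 ≤ b → L (a * b) ≡ L a ⊕ L b
    L-step    : ∀ n → 1 ≤ n → suc n ≤ N →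
      L n ⊕ inv (suc n) ⊑ L (suc n) ⊕ inv (suc n) ⊗ inv (suc n) × L (suc n) ⊑ L n ⊕ inv n ⊕ inv n ⊗ inv n

logSystem : ∀ N → 1 ≤ N → LogSystem N
logSystem N 1≤N = record
  { Λ = mangoldt S 1≤S ; L = log S 1≤S ; Λ-nonneg = mangoldt-nonneg S 1≤S ; Λ-support = mangoldt-support S 1≤S
  ; Λ-^ = λ {q} j pq → trans (mangoldt-primePower S 1≤S j pq)
      (sym (trans (cong (mangoldt S 1≤S) (sym (ℕ.*-identityʳ q))) (mangoldt-primePower S 1≤S 0 pq)))
  ; L-divisors = λ _ → refl ; L-* = log-* S 1≤S
  ; L-step = step }
  where
  -- Makes the error n/S of `log-approx` at most 1/N², hence at most 1/k² for all n, k ≤ N.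
  S = N * (N * N)
  1≤NN = *-pos 1≤N 1≤N
  1≤S = *-pos 1≤N 1≤NN
  open Approx S 1≤S
  small : ∀ n k → n ≤ N → 1 ≤ k → k ≤ N → ι n ⊗ inv S ⊑ inv k ⊗ inv k
  small n k n≤N 1≤k k≤N = ⊑-trans (⊗-monoʳ (inv-nonneg S) (ι-mono n≤N)) (⊑-trans (≡⇒⊑ (inv-scale N (N * N) 1≤N 1≤NN))
    (⊑-trans (inv-anti (*-pos 1≤k 1≤k) (ℕ.*-mono-≤ k≤N k≤N)) (≡⇒⊑ (inv-* k k 1≤k 1≤k))))
  step : ∀ n → 1 ≤ n → suc n ≤ N →
    log S 1≤S n ⊕ inv (suc n) ⊑ log S 1≤S (suc n) ⊕ inv (suc n) ⊗ inv (suc n) × log S 1≤S (suc n) ⊑ log S 1≤S n ⊕ inv n ⊕ inv n ⊗ inv n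
  step n 1≤n n<N =
      linear 6 1
          (v0 :+ v1) (v2 :+ v1 :* v1) (v0 :+ v3 :+ (v4 :+ v1) :+ nat (lit 1 ∔ n# 0) :* v5)
          (v4 :+ (v2 :+ nat (lit 1 ∔ n# 0) :* v5) :+ v3 :+ v1 :* v1)
          (proj₁ (log-approx S 1≤S n 1≤n) ⊞ proj₂ (log-approx S 1≤S (suc n) (s≤s z≤n)) ⊞ proj₁ (ℓ-step n 1≤n)
        ⊞ small (suc n) (suc n) n<N (s≤s z≤n) n<N)
    , linear 6 1
        v0 (v1 :+ v2 :+ v2 :* v2) (v3 :+ v0 :+ v4 :+ n0 :* v5) (v1 :+ n0 :* v5 :+ v4 :+ (v3 :+ v2) :+ v2 :* v2)
        (proj₂ (log-approx S 1≤S n 1≤n) ⊞ proj₁ (log-approx S 1≤S (suc n) (s≤s z≤n)) ⊞ proj₂ (ℓ-step n 1≤n)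
        ⊞ small n n (ℕ.<⇒≤ n<N) 1≤n (ℕ.<⇒≤ n<N))

-- Chebyshev and Mertens estimates

-- Abel summation: decreasing nonnegative weights preserve the domination of partial sums.
sum-dominate : ∀ (a b w : ℕ → R) n → (∀ k → k ≤ n → sum a k ⊑ sum b k) →
  (∀ i → 1 ≤ i → i < n → w (suc i) ⊑ w i) → (∀ i → 1 ≤ i → i ≤ n → ι 0 ⊑ w i) →
  sum (λ i → a i ⊗ w i) n ⊑ sum (λ i → b i ⊗ w i) n
sum-dominate a b w zero    _ _ _ = ⊑-refl
sum-dominate a b w (suc n) h dec pos = linear 7 0
    (v0 :+ v1 :* v2) (v3 :+ v4 :* v2) (v2 :* (v5 :+ v4 :- (v6 :+ v1)) :+ # 0)
    (v3 :+ v4 :* v2 :- (v0 :+ v1 :* v2) :+ v2 :* (v5 :+ v4 :- (v6 :+ v1)))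
    (go (suc n) (s≤s z≤n) ℕ.≤-refl
    ⊞ ⊗-nonneg (pos (suc n) (s≤s z≤n) ℕ.≤-refl) (⊑⇒⊖ (h (suc n) ℕ.≤-refl)))
  where
  A B : ℕ → R
  A = sum (λ i → a i ⊗ w i)
  B = sum (λ i → b i ⊗ w i)
  -- The stronger claim that carries the induction: the weighted difference is at least the last
  -- weight times the unweighted difference.
  go : ∀ k → 1 ≤ k → k ≤ suc n → w k ⊗ (sum b k ⊖ sum a k) ⊑ B k ⊖ A k
  go (suc zero)    _ k≤ = ≡⇒⊑ (ring 3 0 (v0 :* (# 0 :+ v1 :- (# 0 :+ v2))) (# 0 :+ v1 :* v0 :- (# 0 :+ v2 :* v0)))
  go (suc (suc k)) _ k≤ = linear 10 0
      (v0 :* (v1 :+ v2 :+ v3 :- (v4 :+ v5 :+ v6))) (v7 :+ v2 :* v8 :+ v3 :* v0 :- (v9 :+ v5 :* v8 :+ v6 :* v0))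
      (v8 :* (v1 :+ v2 :- (v4 :+ v5)) :+ # 0)
      (v7 :+ v2 :* v8 :- (v9 :+ v5 :* v8) :+ (v8 :- v0) :* (v1 :+ v2 :- (v4 :+ v5)))
      (go (suc k) (s≤s z≤n) (ℕ.<⇒≤ k≤)
    ⊞ ⊗-nonneg (⊑⇒⊖ (dec (suc k) (s≤s z≤n) k≤)) (⊑⇒⊖ (h (suc k) (ℕ.<⇒≤ k≤))))

-- Telescoping, by 1/(n + 1)² ≤ 1/n - 1/(n + 1).
sum-inverse-squares : ∀ n → sum (λ i → inv i ⊗ inv i) n ⊑ ι 2
sum-inverse-squares zero = 0≤ι 2
sum-inverse-squares (suc n) = linear 2 0 v0 (# 2) (v0 :+ # 0) (# 2 :- v1 :+ v1) (go n ⊞ inv-nonneg (suc n))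
  where
  step : ∀ n → 1 ≤ n → inv (suc n) ⊗ inv (suc n) ⊑ inv n ⊖ inv (suc n)
  step n 1≤n = linear 2 0
      (v0 :* v0) (v1 :- v0) (v0 :* v0 :+ v1 :* v0) (v1 :* v0 :+ (v1 :- v0))
      (⊗-monoʳ (inv-nonneg (suc n)) (inv-anti 1≤n (ℕ.n≤1+n n)) ⊞ ≡⇒⊑ diff)
    where
    diff : inv n ⊗ inv (suc n) ≡ inv n ⊖ inv (suc n)
    diff = trans e (trans (cong₂ (λ x y → x ⊗ inv n ⊖ y ⊗ inv (suc n)) (inv-inverse (suc n) (s≤s z≤n)) (inv-inverse n 1≤n)) (ring 2 0
        (# 1 :* v0 :- # 1 :* v1) (v0 :- v1)))
      where
      e : inv n ⊗ inv (suc n) ≡ ι (suc n) ⊗ inv (suc n) ⊗ inv n ⊖ ι n ⊗ inv n ⊗ inv (suc n)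
      e = ring 2 1 (v0 :* v1) (nat (lit 1 ∔ n# 0) :* v1 :* v0 :- n0 :* v0 :* v1)
  go : ∀ n → sum (λ i → inv i ⊗ inv i) (suc n) ⊑ ι 2 ⊖ inv (suc n)
  go zero    = linear 1 0 (# 0 :+ v0 :* v0) (# 2 :- v0) (v0 :* v0 :+ v0) (# 1 :* # 1 :+ # 1) (≡⇒⊑ (cong (λ t → t ⊗ t) inv-1) ⊞ ≡⇒⊑ inv-1)
  go (suc n) = linear 3 0
      (v0 :+ v1 :* v1 :+ v2 :* v2) (# 2 :- v2) (v0 :+ v1 :* v1 :+ v2 :* v2) (# 2 :- v1 :+ (v1 :- v2))
      (go n ⊞ step (suc n) (s≤s z≤n))

inv-÷ : ∀ x d → 1 ≤ d → ι (x ÷ d) ⊑ ι x ⊗ inv d × ι x ⊗ inv d ⊑ ι (x ÷ d) ⊕ ι 1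
inv-÷ x d 1≤d = ⊗-cancelˡ d 1≤d (linear 1 3
    (n0 :* n1) (n0 :* (n2 :* v0)) (nat (n# 0 ∗ n# 1) :+ n2 :* # 1) (n2 :+ n2 :* (n0 :* v0))
    (ι-mono (÷-lower x d) ⊞ ≡⇒⊒ (cong (ι x ⊗_) (inv-inverse d 1≤d))))
              , ⊗-cancelˡ d 1≤d (linear 1 3
                  (n0 :* (n1 :* v0)) (n0 :* (n2 :+ # 1)) (n1 :+ n1 :* (n0 :* v0)) (nat (n# 0 ∗ (lit 1 ∔ n# 2)) :+ n1 :* # 1)
                  (ι-mono (ℕ.<⇒≤ (÷-upper x d 1≤d)) ⊞ ≡⇒⊑ (cong (ι x ⊗_) (inv-inverse d 1≤d))))

half : ∀ x → Σ ℕ λ z → x ≡ z + z ⊎ x ≡ suc (z + z)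
half zero = 0 , inj₁ refl
half (suc x) with half x
... | z , inj₁ e = z , inj₂ (cong suc e)
... | z , inj₂ e = suc z , inj₁ (trans (cong suc e) (cong suc (sym (ℕ.+-suc z z))))

module Bounds {N : ℕ} (ls : LogSystem N) where
  open LogSystem ls public

  L-1 : L 1 ≡ ι 0
  L-1 = sym (⊕-cancelʳ (L 1) (trans (⊕-identityˡ _) (L-* 1 1 (s≤s z≤n) (s≤s z≤n))))

  L-suc : ∀ n → 1 ≤ n → suc n ≤ N → L n ⊑ L (suc n)
  L-suc n 1≤n n<N = linear 3 0
      v0 v1 (v0 :+ v2 :+ # 0) (v1 :+ v2 :* v2 :+ v2 :* (# 1 :- v2))
      (proj₁ (L-step n 1≤n n<N) ⊞ ⊗-nonneg (inv-nonneg (suc n)) (⊑⇒⊖ (inv≤1 (suc n) (s≤s z≤n))))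

  L-mono : ∀ {m n} → 1 ≤ m → m ≤ n → n ≤ N → L m ⊑ L n
  L-mono {m} {n} 1≤m m≤n n≤N = go n m≤n n≤N
    where
    go : ∀ n → m ≤ n → n ≤ N → L m ⊑ L n
    go zero    m≤n _ = contradiction (ℕ.≤-trans 1≤m m≤n) (λ ())
    go (suc n) m≤n n<N with ℕ.m≤n⇒m<n∨m≡n m≤n
    ... | inj₂ refl = ⊑-refl
    ... | inj₁ (s≤s m≤n) = ⊑-trans (go n m≤n (ℕ.<⇒≤ n<N)) (L-suc n (ℕ.≤-trans 1≤m m≤n) n<N)

  L-nonneg : ∀ {n} → 1 ≤ n → n ≤ N → ι 0 ⊑ L n
  L-nonneg 1≤n n≤N = ⊑-trans (≡⇒⊒ L-1) (L-mono (s≤s z≤n) 1≤n n≤N)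

  L-growth : ∀ n → 1 ≤ n → suc n ≤ N → ι n ⊗ (L (suc n) ⊖ L n) ⊑ ι 2
  L-growth n 1≤n n<N = linear 3 1
      (n0 :* (v0 :- v1)) (# 2) (n0 :* v0 :+ n0 :* v2 :+ n0 :* v2 :* v2 :+ v2)
      (n0 :* (v1 :+ v2 :+ v2 :* v2) :+ # 1 :+ # 1 :* v2 :+ # 1)
      (⊗-monoˡ (0≤ι n) (proj₂ (L-step n 1≤n n<N)) ⊞ ≡⇒⊑ (inv-inverse n 1≤n)
    ⊞ ≡⇒⊑ (cong (_⊗ inv n) (inv-inverse n 1≤n)) ⊞ inv≤1 n 1≤n)

  L-suc≤2 : ∀ n → 1 ≤ n → suc n ≤ N → L (suc n) ⊑ L n ⊕ ι 2
  L-suc≤2 n 1≤n n<N = linear 3 0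
      v0 (v1 :+ # 2) (v0 :+ v2 :+ v2 :* v2) (v1 :+ v2 :+ v2 :* v2 :+ # 1 :+ # 1 :* # 1)
      (proj₂ (L-step n 1≤n n<N) ⊞ inv≤1 n 1≤n ⊞ ⊗-mono (inv-nonneg n) (inv-nonneg n) (inv≤1 n 1≤n) (inv≤1 n 1≤n))

  L-linear : ∀ n → 1 ≤ n → n ≤ N → L n ⊑ ι 2 ⊗ ι n
  L-linear (suc zero)    _ _   = ⊑-trans (≡⇒⊑ L-1) (linear 0 0 (# 0) (# 2 :* nat (lit 1 ∔ lit 0)) (# 0) (# 0) (⊑-refl {ι 0}))
  L-linear (suc (suc n)) _ n≤N = linear 2 1
      v0 (# 2 :* nat (lit 1 ∔ (lit 1 ∔ n# 0))) (v1 :+ v0) (# 2 :* nat (lit 1 ∔ n# 0) :+ (v1 :+ # 2))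
      (L-linear (suc n) (s≤s z≤n) (ℕ.<⇒≤ n≤N) ⊞ L-suc≤2 (suc n) (s≤s z≤n) n≤N)

  Λ≤L : ∀ n → 1 ≤ n → Λ n ⊑ L n
  Λ≤L (suc n) _ = linear 4 0
      v0 v1 (v2 :+ v3 :* v0 :+ # 1 :* v0 :+ # 0) (v1 :+ v3 :* v0 :+ v2)
      (≡⇒⊑ (L-divisors (suc n)) ⊞ ≡⇒⊒ (cong (_⊗ Λ (suc n)) (χ-yes (suc n ∣? suc n) ∣-refl))
    ⊞ sum-nonneg {λ d → χ (d ∣? suc n) ⊗ Λ d} n (λ d _ _ → ⊗-nonneg (χ-nonneg (d ∣? suc n)) (Λ-nonneg d)))

  -- Chebyshev's ψ(x), the logarithm of x!, and Mertens' sum.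
  ψ T s : ℕ → R
  ψ = sum Λ
  T = sum L
  s = sum (λ d → Λ d ⊗ inv d)

  s-mono : ∀ {m n} → m ≤ n → s m ⊑ s n
  s-mono m≤n = sum-monoʳ _ m≤n (λ i _ _ → ⊗-nonneg (Λ-nonneg i) (inv-nonneg i))

  -- Legendre's formula for log x!: there are ⌊x/d⌋ multiples of d up to x.
  T-count : ∀ x → sum (λ d → Λ d ⊗ ι (x ÷ d)) x ≡ T x
  T-count x = trans (sum-ext x (λ d → cong (Λ d ⊗_) (sym (trans (sum-const (ι 1) (x ÷ d)) (rng′ _)))))
    (trans (sum-divisorSum Λ (λ _ → ι 1) x) (sum-ext x (λ n → trans (rng″ _) (L-divisors n))))
    where
    rng′ : ∀ n → ι n ⊗ ι 1 ≡ ι n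
    rng′ n = ring 0 1 (n0 :* # 1) n0
    rng″ : ∀ a → a ⊗ ι 1 ≡ a
    rng″ a = ring 1 0 (v0 :* # 1) v0

  T-double : ∀ z → z + z ≤ N → T (z + z) ⊑ ι 2 ⊗ T z ⊕ ι 4 ⊗ ι z
  T-double zero    _ = linear 0 0 (# 0) (# 2 :* # 0 :+ # 4 :* # 0) (# 0) (# 0) (⊑-refl {ι 0})
  T-double (suc z) 2z≤N = linear 9 1
      (v0 :+ v1) (# 2 :* (v2 :+ v3) :+ # 4 :* nat (lit 1 ∔ n# 0))
      (v4 :+ (v0 :+ v1) :+ v5 :+ # 2 :* v6 :+ # 2 :* v7 :+ # 2 :* v8)
      (# 2 :* v2 :+ # 4 :* n0 :+ (v4 :+ v5 :+ v6) :+ v6 :+ # 2 :* (v7 :+ v3) :+ # 2 :* (v8 :+ # 2) :+ # 2 :* # 0)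
      (T-double z (ℕ.≤-trans (ℕ.≤-trans (ℕ.n≤1+n _) (ℕ.n≤1+n _)) le)
      ⊞ ≡⇒⊑ (cong T two) ⊞ L-suc (suc (z + z)) (s≤s z≤n) le ⊞ 2 ⊙ ≡⇒⊑ L2 ⊞ 2 ⊙ L-suc≤2 1 (s≤s z≤n) (ℕ.≤-trans (s≤s (s≤s z≤n)) le)
      ⊞ 2 ⊙ ≡⇒⊑ L-1)
    where
    two : suc z + suc z ≡ suc (suc (z + z))
    two = cong suc (ℕ.+-suc z z)
    le : suc (suc (z + z)) ≤ N
    le = subst (_≤ N) two 2z≤N
    L2 : L (suc (suc (z + z))) ≡ L 2 ⊕ L (suc z)
    L2 = trans (cong L (trans (sym two) (cong (λ t → suc z + t) (sym (ℕ.+-identityʳ (suc z)))))) (L-* 2 (suc z) (s≤s z≤n) (s≤s z≤n))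

  -- Chebyshev's argument with the central binomial coefficient: T(2z) - 2 T(z) gives Λ(d) the
  -- weight ⌊2z/d⌋ - 2⌊z/d⌋, which is nonnegative and equals 1 for z < d ≤ 2z.
  ψ-double : ∀ z → z + z ≤ N → ψ (z + z) ⊑ ψ z ⊕ ι 4 ⊗ ι z
  ψ-double z 2z≤N = linear 4 1 v0 (v1 :+ # 4 :* n0) (v0 :+ # 2 :* v2 :+ v3) (v3 :+ v1 :+ (# 2 :* v2 :+ # 4 :* n0)) (core ⊞ T-double z 2z≤N)
    where
    open ≡-Reasoning
    Tz : sum (λ d → Λ d ⊗ ι (z ÷ d)) (z + z) ≡ T z
    Tz = trans (sum-trunc _ (ℕ.m≤m+n z z) (λ d z<d _ → trans (cong (λ t → Λ d ⊗ ι t)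
      (÷-unique z d 0 (subst (_≤ z) (sym (ℕ.*-zeroʳ d)) z≤n) (subst (z <_) (sym (ℕ.*-identityʳ d)) z<d)))
      (trans (⊗-comm _ _) (⊗-zeroˡ _)))) (T-count z)
    ψz : sum (λ d → Λ d ⊗ χ (d ℕ.≤? z)) (z + z) ≡ ψ z
    ψz = trans (sum-trunc _ (ℕ.m≤m+n z z) (λ d z<d _ → trans (cong (Λ d ⊗_) (χ-no (d ℕ.≤? z) (ℕ.<⇒≱ z<d))) (trans (⊗-comm _ _) (⊗-zeroˡ _))))
      (sum-cong z (λ d _ d≤z → trans (cong (Λ d ⊗_) (χ-yes (d ℕ.≤? z) d≤z)) (trans (⊗-comm _ _) (⊗-identityˡ _))))
    term : ∀ d → 1 ≤ d → d ≤ z + z → ι 1 ⊕ ι 2 ⊗ ι (z ÷ d) ⊑ ι ((z + z) ÷ d) ⊕ χ (d ℕ.≤? z)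
    term d 1≤d d≤2z with d ℕ.≤? z
    ... | yes _ = linear 0 2 (# 1 :+ # 2 :* n0) (n1 :+ # 1) (nat (n# 0 ∔ n# 0)) n1 (ι-mono (÷-greatest {z + z} {d} {z ÷ d + z ÷ d} 1≤d
      (subst (_≤ z + z) (sym (ℕ.*-distribˡ-+ d (z ÷ d) (z ÷ d))) (ℕ.+-mono-≤ (÷-lower z d) (÷-lower z d)))))
    ... | no d≰z = linear 0 2
        (# 1 :+ # 2 :* n0) (n1 :+ # 0) (# 2 :* n0 :+ # 1) (# 2 :* # 0 :+ n1)
        (2 ⊙ ι-mono {z ÷ d} {0} (ℕ.≤-reflexive (÷-unique z d 0 (subst (_≤ z) (sym (ℕ.*-zeroʳ d)) z≤n)
        (subst (z <_) (sym (ℕ.*-identityʳ d)) (ℕ.≰⇒> d≰z))))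
      ⊞ ι-mono (÷-greatest {z + z} {d} {1} 1≤d (subst (_≤ z + z) (sym (ℕ.*-identityʳ d)) d≤2z)))
    core : ψ (z + z) ⊕ ι 2 ⊗ T z ⊑ T (z + z) ⊕ ψ z
    core = linear 6 0
        (v0 :+ # 2 :* v1) (v2 :+ v3) (v4 :+ (v0 :+ # 2 :* v1) :+ v5) (v5 :+ v4 :+ (v2 :+ v3))
        (sum-mono {λ d → Λ d ⊗ (ι 1 ⊕ ι 2 ⊗ ι (z ÷ d))} {λ d → Λ d ⊗ (ι ((z + z) ÷ d) ⊕ χ (d ℕ.≤? z))} (z + z)
          (λ d 1≤d d≤ → ⊗-monoˡ (Λ-nonneg d) (term d 1≤d d≤))
        ⊞ ≡⇒⊒ (trans (sum-ext (z + z) (λ d → lhs (Λ d) (ι (z ÷ d)))) (trans (sum-⊕ _ _ (z + z)) (cong (ψ (z + z) ⊕_) (trans (sum-⊗ (ι 2) _ (z + z)) (cong (ι 2 ⊗_) Tz)))))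
        ⊞ ≡⇒⊑ (trans (sum-ext (z + z) (λ d → ⊗-distribˡ (Λ d) _ _)) (trans (sum-⊕ _ _ (z + z)) (cong₂ _⊕_ (T-count (z + z)) ψz))))
      where
      lhs : ∀ a b → a ⊗ (ι 1 ⊕ ι 2 ⊗ b) ≡ a ⊕ ι 2 ⊗ (a ⊗ b)
      lhs a b = ring 2 0 (v0 :* (# 1 :+ # 2 :* v1)) (v0 :+ # 2 :* (v0 :* v1))

  -- Repeated halving with `ψ-double` sums a geometric series; an odd x costs in addition Λ(x) ≤
  -- L(x) ≤ 2x.
  chebyshev : ∀ x → x ≤ N → ψ x ⊑ ι 8 ⊗ ι x
  chebyshev = <-rec _ go
    where
    go : ∀ x → (∀ {y} → y < x → y ≤ N → ψ y ⊑ ι 8 ⊗ ι y) → x ≤ N → ψ x ⊑ ι 8 ⊗ ι x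
    go x rec x≤N with half x
    ... | zero , inj₁ refl = linear 0 0 (# 0) (# 8 :* # 0) (# 0) (# 0) (⊑-refl {ι 0})
    ... | suc z , inj₁ refl = linear 4 1
        (v0 :+ v1) (# 8 :* nat (lit 1 ∔ (n# 0 ∔ (lit 1 ∔ n# 0)))) (v2 :+ v3 :+ (v0 :+ v1) :+ # 4 :* # 0)
        (# 8 :* nat (lit 1 ∔ n# 0) :+ (v2 :+ v3 :+ # 4 :* nat (lit 1 ∔ n# 0)) :+ # 4 :* nat (lit 1 ∔ n# 0))
        (rec (ℕ.m<m+n (suc z) (s≤s z≤n)) (ℕ.≤-trans (ℕ.m≤m+n (suc z) (suc z)) x≤N)
        ⊞ ψ-double (suc z) x≤N ⊞ 4 ⊙ 0≤ι (suc z))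
    ... | z , inj₂ refl = linear 4 1
        (v0 :+ v1) (# 8 :* nat (lit 1 ∔ (n# 0 ∔ n# 0))) (v2 :+ v0 :+ v1 :+ v3)
        (# 8 :* n0 :+ (v2 :+ # 4 :* n0) :+ v3 :+ # 2 :* nat (lit 1 ∔ (n# 0 ∔ n# 0)))
        (rec (s≤s (ℕ.m≤m+n z z)) (ℕ.≤-trans (ℕ.m≤m+n z z) (ℕ.<⇒≤ x≤N)) ⊞ ψ-double z (ℕ.<⇒≤ x≤N)
        ⊞ Λ≤L (suc (z + z)) (s≤s z≤n) ⊞ L-linear (suc (z + z)) (s≤s z≤n) x≤N)

  T-lower : ∀ x → 1 ≤ x → x ≤ N → ι x ⊗ L x ⊑ T x ⊕ ι 2 ⊗ ι x
  T-lower (suc zero)    _ _   = linear 1 0 (# 1 :* v0) (# 0 :+ v0 :+ # 2 :* # 1) (# 0) (# 2) (0≤ι 2)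
  T-lower (suc (suc x)) _ x≤N = linear 3 1
      (nat (lit 1 ∔ (lit 1 ∔ n# 0)) :* v0) (v1 :+ v2 :+ v0 :+ # 2 :* nat (lit 1 ∔ (lit 1 ∔ n# 0)))
      (nat (lit 1 ∔ n# 0) :* v2 :+ nat (lit 1 ∔ n# 0) :* (v0 :- v2)) (v1 :+ v2 :+ # 2 :* nat (lit 1 ∔ n# 0) :+ # 2)
      (T-lower (suc x) (s≤s z≤n) (ℕ.<⇒≤ x≤N) ⊞ L-growth (suc x) (s≤s z≤n) x≤N)

  T-upper : ∀ x → 1 ≤ x → x ≤ N → T x ⊑ ι x ⊗ L x
  T-upper x 1≤x x≤N = ⊑-trans (sum-mono x (λ i 1≤i i≤x → L-mono 1≤i i≤x x≤N)) (≡⇒⊑ (sum-const (L x) x))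

  mertens-lower : ∀ x → 1 ≤ x → x ≤ N → L x ⊑ s x ⊕ ι 2
  mertens-lower x 1≤x x≤N = ⊗-cancelˡ x 1≤x (linear 5 1
      (n0 :* v0) (n0 :* (v1 :+ # 2)) (n0 :* v0 :+ v2 :+ v3 :+ v4) (v2 :+ # 2 :* n0 :+ v3 :+ v4 :+ n0 :* v1)
      (T-lower x 1≤x x≤N ⊞ ≡⇒⊒ (T-count x)
    ⊞ sum-mono {λ d → Λ d ⊗ ι (x ÷ d)} {λ d → ι x ⊗ (Λ d ⊗ inv d)} x (λ d 1≤d _ → linear 2 2
        (v0 :* n0) (n1 :* (v0 :* v1)) (v0 :* n0) (v0 :* (n1 :* v1))
        (⊗-monoˡ (Λ-nonneg d) (proj₁ (inv-÷ x d 1≤d))))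
    ⊞ ≡⇒⊑ (sum-⊗ (ι x) (λ d → Λ d ⊗ inv d) x)))

  -- In Legendre's formula the roundings of x/d add up to at most ψ(x), which is O(x) by Chebyshev's
  -- bound.
  mertens-upper : ∀ x → 1 ≤ x → x ≤ N → s x ⊑ L x ⊕ ι 8
  mertens-upper x 1≤x x≤N = ⊗-cancelˡ x 1≤x (linear 7 1
      (n0 :* v0) (n0 :* (v1 :+ # 8)) (v2 :+ v3 :+ v4 :+ v5 :+ n0 :* v0 :+ v6)
      (n0 :* v1 :+ v2 :+ # 8 :* n0 :+ v6 :+ v5 :+ (v3 :+ v4))
      (T-upper x 1≤x x≤N ⊞ ≡⇒⊑ (T-count x) ⊞ chebyshev x x≤N
    ⊞ sum-mono {λ d → ι x ⊗ (Λ d ⊗ inv d)} {λ d → Λ d ⊗ ι (x ÷ d) ⊕ Λ d} x (λ d 1≤d _ → linear 2 2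
        (n0 :* (v0 :* v1)) (v0 :* n1 :+ v0) (v0 :* (n0 :* v1)) (v0 :* (n1 :+ # 1))
        (⊗-monoˡ (Λ-nonneg d) (proj₂ (inv-÷ x d 1≤d))))
    ⊞ ≡⇒⊒ (sum-⊗ (ι x) (λ d → Λ d ⊗ inv d) x) ⊞ ≡⇒⊑ (sum-⊕ (λ d → Λ d ⊗ ι (x ÷ d)) Λ x)))

  -- Sums of log(x/d) and of its square. They are O(x) without a logarithm, which is why the error
  -- in Selberg's formula is O(x).
  u¹ u² : ℕ → R
  u¹ x = sum (λ d → L x ⊖ L d) x
  u² x = sum (λ d → (L x ⊖ L d) ⊗ (L x ⊖ L d)) x

  u¹-eq : ∀ x → u¹ x ≡ ι x ⊗ L x ⊖ T x
  u¹-eq x = trans (sum-⊖ (λ _ → L x) L x) (cong (_⊖ T x) (sum-const (L x) x))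

  u¹-bound : ∀ x → 1 ≤ x → x ≤ N → u¹ x ⊑ ι 2 ⊗ ι x
  u¹-bound x 1≤x x≤N = linear 3 1 v0 (# 2 :* n0) (v0 :+ n0 :* v1) (n0 :* v1 :- v2 :+ (v2 :+ # 2 :* n0)) (≡⇒⊑ (u¹-eq x) ⊞ T-lower x 1≤x x≤N)

  -- Induction on x: with δ = L(x + 1) - L(x) ≤ 2/x the increment 2 δ u¹(x) + x δ² is bounded.
  u²-bound : ∀ x → 1 ≤ x → x ≤ N → u² x ⊑ ι 16 ⊗ ι x
  u²-bound (suc zero)    _ _   = base
    where
    base : ι 0 ⊕ (L 1 ⊖ L 1) ⊗ (L 1 ⊖ L 1) ⊑ ι 16 ⊗ ι 1
    base = linear 1 0 (# 0 :+ (v0 :- v0) :* (v0 :- v0)) (# 16 :* # 1) (# 0) (# 16) (0≤ι 16)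
  u²-bound (suc (suc y)) _ x≤N = ⊑-trans (≡⇒⊑ expand)
    (linear 4 1
        (v0 :+ (v1 :- v1) :* (v1 :- v1) :+ (# 2 :* ((v2 :- v1) :* (v3 :+ (v1 :- v1))) :+ (v2 :- v1) :* (nat (lit 1 ∔ n# 0) :* (v2 :- v1))))
        (# 16 :* nat (lit 1 ∔ (lit 1 ∔ n# 0)))
        (v0 :+ (v1 :- v1) :* (v1 :- v1) :+ # 2 :* ((v2 :- v1) :* (v3 :+ (v1 :- v1))) :+ # 4 :* (nat (lit 1 ∔ n# 0) :* (v2 :- v1)) :+ (v2 :- v1) :* (nat (lit 1 ∔ n# 0) :* (v2 :- v1)) :+ # 2 :* v2)
        (# 16 :* nat (lit 1 ∔ n# 0) :+ # 2 :* ((v2 :- v1) :* (# 2 :* nat (lit 1 ∔ n# 0))) :+ # 4 :* # 2 :+ (v2 :- v1) :* # 2 :+ # 2 :* (v1 :+ # 2))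
        (u²-bound (suc y) (s≤s z≤n) (ℕ.<⇒≤ x≤N) ⊞ 2 ⊙ ⊗-monoˡ 0≤δ (u¹-bound x (s≤s z≤n) (ℕ.<⇒≤ x≤N))
      ⊞ 4 ⊙ L-growth x (s≤s z≤n) x≤N ⊞ ⊗-monoˡ 0≤δ (L-growth x (s≤s z≤n) x≤N) ⊞ 2 ⊙ L-suc≤2 x (s≤s z≤n) x≤N))
    where
    x = suc y
    δ = L (suc x) ⊖ L x
    0≤δ : ι 0 ⊑ δ
    0≤δ = ⊑⇒⊖ (L-suc x (s≤s z≤n) x≤N)
    expand : u² (suc x) ≡ u² x ⊕ (ι 2 ⊗ (δ ⊗ u¹ x) ⊕ δ ⊗ (ι x ⊗ δ))
    expand = trans (cong (_⊕ (L (suc x) ⊖ L (suc x)) ⊗ (L (suc x) ⊖ L (suc x)))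
       (trans (sum-ext x pt) (trans (sum-⊕ _ _ x) (cong (u² x ⊕_) (trans (sum-⊕ _ _ x)
         (cong₂ _⊕_ (sum-⊗ (ι 2 ⊗ δ) (λ d → L x ⊖ L d) x) (sum-const (δ ⊗ δ) x)))))))
      (fin (u² x) (L (suc x)) (u¹ x) δ (ι x))
      where
      pt : ∀ d → (L (suc x) ⊖ L d) ⊗ (L (suc x) ⊖ L d) ≡ (L x ⊖ L d) ⊗ (L x ⊖ L d) ⊕ (ι 2 ⊗ δ ⊗ (L x ⊖ L d) ⊕ δ ⊗ δ)
      pt d = pt′ (L (suc x)) (L x) (L d)
        where
        pt′ : ∀ a b c → (a ⊖ c) ⊗ (a ⊖ c) ≡ (b ⊖ c) ⊗ (b ⊖ c) ⊕ (ι 2 ⊗ (a ⊖ b) ⊗ (b ⊖ c) ⊕ (a ⊖ b) ⊗ (a ⊖ b))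
        pt′ a b c = ring 3 0
            ((v0 :- v1) :* (v0 :- v1))
            ((v2 :- v1) :* (v2 :- v1) :+ (# 2 :* (v0 :- v2) :* (v2 :- v1) :+ (v0 :- v2) :* (v0 :- v2)))
      fin : ∀ a l b δ x → a ⊕ (ι 2 ⊗ δ ⊗ b ⊕ x ⊗ (δ ⊗ δ)) ⊕ (l ⊖ l) ⊗ (l ⊖ l) ≡ a ⊕ (ι 2 ⊗ (δ ⊗ b) ⊕ δ ⊗ (x ⊗ δ))
      fin a l b δ x = ring 5 0
          (v0 :+ (# 2 :* v1 :* v2 :+ v3 :* (v1 :* v1)) :+ (v4 :- v4) :* (v4 :- v4))
          (v0 :+ (# 2 :* (v1 :* v2) :+ v1 :* (v3 :* v1)))

  sum-Λ-inverse-squares : ∀ x → x ≤ N → sum (λ m → Λ m ⊗ (inv m ⊗ inv m)) x ⊑ ι 16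
  sum-Λ-inverse-squares x x≤N = linear 3 0
      v0 (# 16) (v0 :+ v1 :+ # 8 :* v2) (v1 :+ # 8 :* v2 :+ # 8 :* # 2)
      (sum-dominate Λ (λ _ → ι 8) (λ m → inv m ⊗ inv m) x
      (λ k k≤x → linear 2 1 v0 v1 (v0 :+ n0 :* # 8) (# 8 :* n0 :+ v1) (chebyshev k (ℕ.≤-trans k≤x x≤N) ⊞ ≡⇒⊒ (sum-const (ι 8) k)))
      (λ i 1≤i _ → ⊗-mono (inv-nonneg _) (inv-nonneg _) (inv-anti 1≤i (ℕ.n≤1+n i)) (inv-anti 1≤i (ℕ.n≤1+n i)))
      (λ i _ _ → ⊗-nonneg (inv-nonneg i) (inv-nonneg i))
    ⊞ ≡⇒⊑ (sum-⊗ (ι 8) (λ m → inv m ⊗ inv m) x) ⊞ 8 ⊙ sum-inverse-squares x)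

  -- The part of Λ on proper prime powers. A gap excludes only primes, so this part is split off and
  -- shown to be negligible.
  Λᶜ : ℕ → R
  Λᶜ n = χ (¬? (prime? n)) ⊗ Λ n

  Λᶜ-nonneg : ∀ n → ι 0 ⊑ Λᶜ n
  Λᶜ-nonneg n = ⊗-nonneg (χ-nonneg (¬? (prime? n))) (Λ-nonneg n)

  base : ℕ → ℕ
  base n with primePower? n
  ... | yes (q , _) = q
  ... | no _        = 1

  base-^ : ∀ {q} j → Prime q → base (q ^ suc j) ≡ q
  base-^ {q} j pq with primePower? (q ^ suc j)
  ... | yes (r , i , pr , e) = sym (primePower-base j i pq pr e)
  ... | no ¬pp               = contradiction (q , j , pq , refl) ¬pp

  base≥1 : ∀ n → 1 ≤ base n
  base≥1 n with primePower? n
  ... | yes (q , _ , pq , _) = prime≥1 pq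
  ... | no _                 = s≤s z≤n

  -- The two ways in which n is charged to a smaller power m of the same prime, according to the
  -- parity of its exponent.
  hit : ℕ → ℕ → R
  hit n m = χ (n ℕ.≟ m * m) ⊕ χ (n ℕ.≟ m * m * base m)

  hit-nonneg : ∀ n m → ι 0 ⊑ hit n m
  hit-nonneg n m = ⊕-nonneg (χ-nonneg (n ℕ.≟ m * m)) (χ-nonneg (n ℕ.≟ m * m * base m))

  -- A proper prime power is m² or m²q for a smaller power m of the same prime q.
  Λᶜ-squares : ∀ n → 1 ≤ n → Λᶜ n ⊑ sum (λ m → Λ m ⊗ hit n m) n
  Λᶜ-squares n 1≤n with prime? n
  ... | yes _ = ⊑-trans (≡⇒⊑ (⊗-zeroˡ _)) nonneg
    where
    nonneg : ι 0 ⊑ sum (λ m → Λ m ⊗ hit n m) n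
    nonneg = sum-nonneg n (λ m _ _ → ⊗-nonneg (Λ-nonneg m) (hit-nonneg n m))
  ... | no ¬pn with primePower? n
  ...   | no ¬pp = ⊑-trans (≡⇒⊑ (trans (⊗-identityˡ _) (Λ-support n ¬pp))) nonneg
    where
    nonneg : ι 0 ⊑ sum (λ m → Λ m ⊗ hit n m) n
    nonneg = sum-nonneg n (λ m _ _ → ⊗-nonneg (Λ-nonneg m) (hit-nonneg n m))
  ...   | yes (q , zero , pq , e) = contradiction (subst Prime (sym (trans e (ℕ.*-identityʳ q))) pq) ¬pn
  ...   | yes (q , suc j , pq , e) = ⊑-trans (≡⇒⊑ (trans (⊗-identityˡ _) (trans (cong Λ e) (Λ-^ (suc j) pq)))) (found (half (suc (suc j))))
    where
    term : ∀ m → ι 0 ⊑ Λ m ⊗ hit n m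
    term m = ⊗-nonneg (Λ-nonneg m) (hit-nonneg n m)
    ⊕-monoˡ0 : ∀ {a b} → ι 0 ⊑ a → b ⊑ a ⊕ b
    ⊕-monoˡ0 {a} {b} h = linear 2 0 v0 (v1 :+ v0) (# 0) v1 h
    at-m : ∀ m → 1 ≤ m → m ≤ n → Λ m ⊗ hit n m ⊑ sum (λ m → Λ m ⊗ hit n m) n
    at-m (suc m) _ m≤n = ⊑-trans (⊕-monoˡ0 (sum-nonneg {λ m → Λ m ⊗ hit n m} m (λ i _ _ → term i))) (sum-monoʳ (λ m → Λ m ⊗ hit n m) m≤n (λ i _ _ → term i))
    use : ∀ i → q ^ suc i * q ^ suc i ≤ n → ι 1 ⊑ hit n (q ^ suc i) → Λ q ⊑ sum (λ m → Λ m ⊗ hit n m) n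
    use i le h = ⊑-trans {b = Λ (q ^ suc i) ⊗ hit n (q ^ suc i)} (linear 3 0
        v0 (v1 :* v2) (v1 :* # 1 :+ v0) (v1 :* v2 :+ v1)
        (⊗-monoˡ (Λ-nonneg (q ^ suc i)) h ⊞ ≡⇒⊒ (Λ-^ i pq)))
      (at-m (q ^ suc i) pos (ℕ.≤-trans (ℕ.m≤m*n _ _ {{ℕ.>-nonZero pos}}) le))
      where pos = ^-pos (suc i) (prime≥1 pq)
    one₁ : ∀ {a b} → a ≡ ι 1 → ι 0 ⊑ b → ι 1 ⊑ a ⊕ b
    one₁ {a} {b} e h = linear 2 0 (# 1) (v0 :+ v1) (# 1 :+ # 0) (v0 :+ v1) (≡⇒⊒ e ⊞ h)
    one₂ : ∀ {a b} → b ≡ ι 1 → ι 0 ⊑ a → ι 1 ⊑ a ⊕ b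
    one₂ {a} {b} e h = linear 2 0 (# 1) (v0 :+ v1) (# 1 :+ # 0) (v1 :+ v0) (≡⇒⊒ e ⊞ h)
    found : (Σ ℕ λ z → suc (suc j) ≡ z + z ⊎ suc (suc j) ≡ suc (z + z)) → Λ q ⊑ sum (λ m → Λ m ⊗ hit n m) n
    found (suc i , inj₁ h) = use i (ℕ.≤-reflexive (sym eq)) (one₁ (χ-yes (n ℕ.≟ q ^ suc i * q ^ suc i) eq) (χ-nonneg (n ℕ.≟ q ^ suc i * q ^ suc i * base (q ^ suc i))))
      where
      eq : n ≡ q ^ suc i * q ^ suc i
      eq = trans e (trans (cong (q ^_) h) (ℕ.^-distribˡ-+-* q (suc i) (suc i)))
    found (suc i , inj₂ h) = use i (subst (q ^ suc i * q ^ suc i ≤_) (sym eq′) (ℕ.m≤m*n _ q {{ℕ.>-nonZero (prime≥1 pq)}}))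
        (one₂ (χ-yes (n ℕ.≟ q ^ suc i * q ^ suc i * base (q ^ suc i)) eq) (χ-nonneg (n ℕ.≟ q ^ suc i * q ^ suc i)))
      where
      eq′ : n ≡ q ^ suc i * q ^ suc i * q
      eq′ = trans e (trans (cong (q ^_) h) (trans (cong (q *_) (ℕ.^-distribˡ-+-* q (suc i) (suc i))) (ℕ.*-comm q _)))
      eq : n ≡ q ^ suc i * q ^ suc i * base (q ^ suc i)
      eq = trans eq′ (cong (q ^ suc i * q ^ suc i *_) (sym (base-^ i pq)))

  sum-delta : ∀ (f : ℕ → R) k x → 1 ≤ k → ι 0 ⊑ f k → sum (λ n → χ (n ℕ.≟ k) ⊗ f n) x ⊑ f k
  sum-delta f k x 1≤k 0≤f with k ℕ.≤? x
  ... | yes k≤x = ≡⇒⊑ (trans (sum-single _ k x 1≤k k≤x (λ i _ _ i≢k → trans (cong (_⊗ f i) (χ-no (i ℕ.≟ k) i≢k)) (⊗-zeroˡ _)))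
        (trans (cong (_⊗ f k) (χ-yes (k ℕ.≟ k) refl)) (⊗-identityˡ _)))
  ... | no k≰x = ⊑-trans (≡⇒⊑ (sum-zero x (λ i _ i≤x → trans (cong (_⊗ f i) (χ-no (i ℕ.≟ k) (λ { refl → k≰x i≤x }))) (⊗-zeroˡ _)))) 0≤f

  -- By `Λᶜ-squares` only two values of n, both at least m², are charged to m, so the sum is at most
  -- twice that of Λ(m)/m².
  sum-Λᶜ : ∀ x → x ≤ N → sum (λ n → Λᶜ n ⊗ inv n) x ⊑ ι 32
  sum-Λᶜ x x≤N = ⊑-trans (sum-mono x pt) (⊑-trans (≡⇒⊑ (sum-swap (λ n m → Λ m ⊗ (hit n m ⊗ inv n)) x x))
    (⊑-trans (sum-mono x inner) (⊑-trans (≡⇒⊑ (sum-⊗ (ι 2) (λ m → Λ m ⊗ (inv m ⊗ inv m)) x)) (linear 1 0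
        (# 2 :* v0) (# 32) (# 2 :* v0) (# 2 :* # 16)
        (2 ⊙ sum-Λ-inverse-squares x x≤N)))))
    where
    pt : ∀ n → 1 ≤ n → n ≤ x → Λᶜ n ⊗ inv n ⊑ sum (λ m → Λ m ⊗ (hit n m ⊗ inv n)) x
    pt n 1≤n n≤x = ⊑-trans (⊗-monoʳ (inv-nonneg n) (Λᶜ-squares n 1≤n)) (⊑-trans (≡⇒⊑ (trans (⊗-comm _ _)
      (trans (sym (sum-⊗ (inv n) _ n)) (sum-ext n (λ m → rr (inv n) (Λ m) (hit n m))))))
      (sum-monoʳ _ n≤x (λ m _ _ → ⊗-nonneg (Λ-nonneg m) (⊗-nonneg (hit-nonneg n m) (inv-nonneg n)))))
      where
      rr : ∀ a b c → a ⊗ (b ⊗ c) ≡ b ⊗ (c ⊗ a)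
      rr a b c = ring 3 0 (v0 :* (v1 :* v2)) (v1 :* (v2 :* v0))
    inner : ∀ m → 1 ≤ m → m ≤ x → sum (λ n → Λ m ⊗ (hit n m ⊗ inv n)) x ⊑ ι 2 ⊗ (Λ m ⊗ (inv m ⊗ inv m))
    inner m 1≤m m≤x = ⊑-trans (≡⇒⊑ (trans (sum-⊗ (Λ m) _ x) (cong (Λ m ⊗_) (trans (sum-ext x (λ n → ⊗-distribʳ (inv n) _ _)) (sum-⊕ _ _ x)))))
      (⊑-trans (⊗-monoˡ (Λ-nonneg m) (sum-delta inv (m * m) x 1≤mm (inv-nonneg _) ⊞ ⊑-trans (sum-delta inv (m * m * base m) x (*-pos 1≤mm (base≥1 m)) (inv-nonneg _))
        (inv-anti 1≤mm (ℕ.m≤m*n (m * m) (base m) {{ℕ.>-nonZero (base≥1 m)}}))))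
      (⊑-trans (≡⇒⊑ (cong (λ t → Λ m ⊗ (t ⊕ t)) (inv-* m m 1≤m 1≤m))) (dbl (Λ m) (inv m ⊗ inv m))))
      where
      1≤mm = *-pos 1≤m 1≤m
      dbl : ∀ a b → a ⊗ (b ⊕ b) ⊑ ι 2 ⊗ (a ⊗ b)
      dbl a b = ≡⇒⊑ (ring 2 0 (v0 :* (v1 :+ v1)) (# 2 :* (v0 :* v1)))

-- Möbius inversion and Abel summation

-- The estimate |y| ≤ c, kept as two inequalities for use by `linear`.
Within : R → R → Set
Within c y = neg c ⊑ y × y ⊑ c

within-⊗ : ∀ {a b x y} → Within a x → Within b y → Within (a ⊗ b) (x ⊗ y)
within-⊗ {a} {b} {x} {y} (l , h) (l′ , h′) =
    -- Uses 2ab + 2xy = (a - x)(b - y) + (a + x)(b + y); the upper bound uses 2ab - 2xy = (a - x)(b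
    -- + y) + (a + x)(b - y).
    ⊗-cancelˡ 2 (s≤s z≤n) (linear 4 0
        (# 2 :* (:- (v0 :* v1))) (# 2 :* (v2 :* v3)) (# 0 :+ # 0)
        ((v0 :- v2) :* (v1 :- v3) :+ (v2 :- (:- v0)) :* (v3 :- (:- v1)))
        (⊗-nonneg (⊑⇒⊖ h) (⊑⇒⊖ h′) ⊞ ⊗-nonneg (⊑⇒⊖ l) (⊑⇒⊖ l′)))
  , ⊗-cancelˡ 2 (s≤s z≤n) (linear 4 0
      (# 2 :* (v0 :* v1)) (# 2 :* (v2 :* v3)) (# 0 :+ # 0)
      ((v2 :- v0) :* (v1 :- (:- v3)) :+ (v0 :- (:- v2)) :* (v3 :- v1))
      (⊗-nonneg (⊑⇒⊖ h) (⊑⇒⊖ l′) ⊞ ⊗-nonneg (⊑⇒⊖ l) (⊑⇒⊖ h′)))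

within-weaken : ∀ {a b x} → a ⊑ b → Within a x → Within b x
within-weaken {a} {b} {x} h (l , u) = linear 3 0
    (:- v0) v1 ((:- v2) :+ v2) (v1 :+ v0)
    (l ⊞ h) , linear 3 0
    v0 v1 (v0 :+ v2) (v2 :+ v1)
    (u ⊞ h)

within-⊕ : ∀ {a b x y} → Within a x → Within b y → Within (a ⊕ b) (x ⊕ y)
within-⊕ {a} {b} {x} {y} (l , u) (l′ , u′) = linear 4 0
    (:- (v0 :+ v1)) (v2 :+ v3) ((:- v0) :- v1) (v2 :+ v3)
    (l ⊞ l′) , linear 4 0
    (v0 :+ v1) (v2 :+ v3) (v0 :+ v1) (v2 :+ v3)
    (u ⊞ u′)

within-sum : ∀ {f g : ℕ → R} n → (∀ i → 1 ≤ i → i ≤ n → Within (g i) (f i)) → Within (sum g n) (sum f n)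
within-sum zero    h = linear 0 0 (:- # 0) (# 0) (# 0) (# 0) (⊑-refl {ι 0}) , ⊑-refl
within-sum (suc n) h = within-⊕ (within-sum n (λ i a b → h i a (ℕ.m≤n⇒m≤1+n b))) (h (suc n) (s≤s z≤n) ℕ.≤-refl)

prod : (ℕ → R) → ℕ → R
prod f zero    = ι 1
prod f (suc n) = prod f n ⊗ f (suc n)

prod-cong : ∀ {f g} n → (∀ i → 1 ≤ i → i ≤ n → f i ≡ g i) → prod f n ≡ prod g n
prod-cong zero    h = refl
prod-cong (suc n) h = cong₂ _⊗_ (prod-cong n (λ i a b → h i a (ℕ.m≤n⇒m≤1+n b))) (h (suc n) (s≤s z≤n) ℕ.≤-refl)

prod-extend : ∀ f {m} n → m ≤ n → (∀ i → m < i → f i ≡ ι 1) → prod f n ≡ prod f m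
prod-extend f {m} zero    z≤n h = refl
prod-extend f {m} (suc n) m≤n h with ℕ.m≤n⇒m<n∨m≡n m≤n
... | inj₂ refl = refl
... | inj₁ (s≤s m≤n) = trans (cong₂ _⊗_ (prod-extend f n m≤n h) (h (suc n) (s≤s m≤n))) (trans (⊗-comm _ _) (⊗-identityˡ _))

prod-change : ∀ f g k n → 1 ≤ k → k ≤ n → (∀ i → i ≢ k → f i ≡ g i) → g k ≡ ι 1 → prod f n ≡ f k ⊗ prod g n
prod-change f g k zero    1≤k k≤n h gk = contradiction (ℕ.≤-trans 1≤k k≤n) (λ ())
prod-change f g k (suc n) 1≤k k≤n h gk with ℕ.m≤n⇒m<n∨m≡n k≤n
... | inj₂ refl = trans (cong (_⊗ f (suc n)) (prod-cong n (λ i _ i≤n → h i (λ e → ℕ.<⇒≢ (s≤s i≤n) e))))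
      (trans (⊗-comm _ _) (cong (f (suc n) ⊗_) (sym (trans (cong (prod g n ⊗_) gk) (trans (⊗-comm _ _) (⊗-identityˡ _))))))
... | inj₁ (s≤s k≤n′) = trans (cong₂ _⊗_ (prod-change f g k n 1≤k k≤n′ h gk) (h (suc n) (λ e → ℕ.<⇒≢ (s≤s k≤n′) (sym e)))) (⊗-assoc _ _ _)

-- The local factor of the Möbius function at q. It is 1 unless q is a prime divisor of n, so the
-- product defining `μ` may run over all integers up to n.
factor : ℕ → ℕ → R
factor q n with prime? q | q ∣? n | q * q ∣? n
... | no _  | _     | _     = ι 1
... | yes _ | no _  | _     = ι 1
... | yes _ | yes _ | yes _ = ι 0
... | yes _ | yes _ | no _  = neg (ι 1)

factor-∤ : ∀ q n → ¬ q ∣ n → factor q n ≡ ι 1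
factor-∤ q n ∤ with prime? q | q ∣? n | q * q ∣? n
... | no _  | _     | _ = refl
... | yes _ | no _  | _ = refl
... | yes _ | yes d | _ = contradiction d ∤

factor-once : ∀ q n → Prime q → q ∣ n → ¬ q * q ∣ n → factor q n ≡ neg (ι 1)
factor-once q n pq d ∤ with prime? q | q ∣? n | q * q ∣? n
... | no ¬p | _     | _     = contradiction pq ¬p
... | yes _ | no ∤′ | _     = contradiction d ∤′
... | yes _ | yes _ | yes e = contradiction e ∤
... | yes _ | yes _ | no _  = refl

factor-twice : ∀ q n → Prime q → q * q ∣ n → factor q n ≡ ι 0
factor-twice q n pq d with prime? q | q ∣? n | q * q ∣? n
... | no ¬p | _     | _     = contradiction pq ¬p
... | yes _ | no ∤  | _     = contradiction (∣-trans (m∣m*n q) d) ∤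
... | yes _ | yes _ | yes _ = refl
... | yes _ | yes _ | no ∤  = contradiction d ∤

factor-other : ∀ q r e → Prime q → r ≢ q → factor r (q * e) ≡ factor r e
factor-other q r e pq r≢q with prime? r
... | no _ = refl
... | yes pr with r ∣? (q * e) | r ∣? e | r * r ∣? (q * e) | r * r ∣? e
...   | no _  | no _  | _ | _ = refl
...   | no ∤  | yes d | _ | _ = contradiction (∣-trans d (n∣m*n q)) ∤
...   | yes d | no ∤  | _ | _ = contradiction (coprime-divisor {r} (subst (λ t → Coprime t q) (ℕ.*-identityʳ r) (primePower-coprime 1 pq pr (λ h → r≢q (sym h)))) d) ∤
...   | yes _ | yes _ | yes _ | yes _ = refl
...   | yes _ | yes _ | no _  | no _  = refl
...   | yes _ | yes _ | no ∤  | yes d = contradiction (∣-trans d (n∣m*n q)) ∤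
...   | yes _ | yes _ | yes d | no ∤  = contradiction (coprime-divisor {r * r} (subst (λ t → Coprime (r * t) q) (ℕ.*-identityʳ r) (primePower-coprime 2 pq pr (λ h → r≢q (sym h)))) d) ∤

factor-within : ∀ q n → Within (ι 1) (factor q n)
factor-within q n with prime? q | q ∣? n | q * q ∣? n
... | no _  | _     | _     = linear 0 0 (:- # 1) (# 1) (# 0) (# 2) (0≤ι 2) , ⊑-refl
... | yes _ | no _  | _     = linear 0 0 (:- # 1) (# 1) (# 0) (# 2) (0≤ι 2) , ⊑-refl
... | yes _ | yes _ | yes _ = linear 0 0 (:- # 1) (# 0) (# 0) (# 1) (0≤ι 1) , 0≤ι 1
... | yes _ | yes _ | no _  = ⊑-refl , linear 0 0 (:- # 1) (# 1) (# 0) (# 2) (0≤ι 2)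

μ : ℕ → R
μ n = prod (λ q → factor q n) n

μ-within : ∀ n → Within (ι 1) (μ n)
μ-within n = go n
  where
  go : ∀ k → Within (ι 1) (prod (λ q → factor q n) k)
  go zero    = linear 0 0 (:- # 1) (# 1) (# 0) (# 2) (0≤ι 2) , ⊑-refl
  go (suc k) = within-weaken (≡⇒⊑ (⊗-identityˡ (ι 1))) (within-⊗ (go k) (factor-within (suc k) n))

μ-extend : ∀ e n → 1 ≤ e → e ≤ n → prod (λ r → factor r e) n ≡ μ e
μ-extend e n 1≤e e≤n = prod-extend _ n e≤n (λ r e<r → factor-∤ r e (λ d → ℕ.<⇒≱ e<r (∣⇒≤ {{ℕ.>-nonZero 1≤e}} d)))

μ-prime-coprime : ∀ q e → Prime q → 1 ≤ e → ¬ q ∣ e → μ (q * e) ≡ neg (ι 1) ⊗ μ e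
μ-prime-coprime q e pq 1≤e ∤ = trans (prod-change (λ r → factor r (q * e)) (λ r → factor r e) q (q * e) (prime≥1 pq)
    (ℕ.m≤m*n q e {{ℕ.>-nonZero 1≤e}}) (λ r r≢q → factor-other q r e pq r≢q) (factor-∤ q e ∤))
  (cong₂ _⊗_ (factor-once q (q * e) pq (m∣m*n e) (λ d → ∤ (*-cancelˡ-∣ q {{prime⇒nonZero pq}} d)))
    (μ-extend e (q * e) 1≤e (ℕ.m≤n*m e q {{prime⇒nonZero pq}})))

prod-zero : ∀ f k n → 1 ≤ k → k ≤ n → f k ≡ ι 0 → prod f n ≡ ι 0
prod-zero f k zero    1≤k k≤n e = contradiction (ℕ.≤-trans 1≤k k≤n) (λ ())
prod-zero f k (suc n) 1≤k k≤n e with ℕ.m≤n⇒m<n∨m≡n k≤n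
... | inj₂ refl = trans (cong (prod f n ⊗_) e) (trans (⊗-comm _ _) (⊗-zeroˡ _))
... | inj₁ (s≤s k≤n′) = trans (cong (_⊗ f (suc n)) (prod-zero f k n 1≤k k≤n′ e)) (⊗-zeroˡ _)

μ-prime-square : ∀ q e → Prime q → 1 ≤ e → q ∣ e → μ (q * e) ≡ ι 0
μ-prime-square q e pq 1≤e d = prod-zero _ q (q * e) (prime≥1 pq) (ℕ.m≤m*n q e {{ℕ.>-nonZero 1≤e}})
  (factor-twice q (q * e) pq (*-monoʳ-∣ q d))

primeDivisor : ∀ n → 2 ≤ n → Σ ℕ λ q → Σ ℕ λ m → Prime q × n ≡ q * m
primeDivisor n 2≤n = go (factors f) (isFactorisation f) (factorsPrime f)
  where
  open PrimeFactorisation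
  f = factorise n {{ℕ.>-nonZero (ℕ.<⇒≤ 2≤n)}}
  go : ∀ qs → n ≡ product qs → All Prime qs → Σ ℕ λ q → Σ ℕ λ m → Prime q × n ≡ q * m
  go []       e []       = contradiction (subst (2 ≤_) e 2≤n) (λ { (s≤s ()) })
  go (q ∷ qs) e (p ∷ ps) = q , product qs , p , e

χ-not : ∀ {P : Set} (d : Dec P) → χ d ⊕ χ (¬? d) ≡ ι 1
χ-not (yes _) = ⊕-identityʳ (ι 1)
χ-not (no _)  = ⊕-identityˡ (ι 1)

-- Fix a prime q with n = q m. A divisor q e contributes -μ(e), or nothing if q divides e; the
-- divisors not divisible by q are divisors of m. The two halves cancel.
μ-divisors : ∀ n → 1 ≤ n → divisorSum μ n ≡ χ (n ℕ.≟ 1)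
μ-divisors (suc zero) _ = trans (cong₂ (λ x y → ι 0 ⊕ x ⊗ y) (χ-yes (1 ∣? 1) (divides 1 refl)) μ1) (ring 0 0 (# 0 :+ # 1 :* # 1) (# 1))
  where
  μ1 : μ 1 ≡ ι 1
  μ1 = trans (⊗-identityˡ _) (not-prime refl)
    where
    not-prime : ∀ {x} → factor 1 1 ≡ x → x ≡ ι 1
    not-prime {x} e with prime? 1
    ... | no _ = sym e
    ... | yes p = contradiction (prime≥2 p) (λ { (s≤s ()) })
μ-divisors n@(suc (suc _)) _ with primeDivisor n (s≤s (s≤s z≤n))
... | q , m , pq , n≡ = trans (trans (sum-ext n splitTerm) (trans (sum-⊕ _ _ n) (trans (cong₂ _⊕_ multiples rest) cancel)))
        (sym (χ-no (n ℕ.≟ 1) (λ ())))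
  where
  1≤m : 1 ≤ m
  1≤m = ℕ.n≢0⇒n>0 (λ { refl → contradiction (trans n≡ (ℕ.*-zeroʳ q)) (λ ()) })
  g : ℕ → R
  g d = χ (d ∣? n) ⊗ μ d
  h : ℕ → R
  h e = χ (e ∣? m) ⊗ (χ (¬? (q ∣? e)) ⊗ μ e)
  splitTerm : ∀ d → g d ≡ χ (q ∣? d) ⊗ g d ⊕ χ (¬? (q ∣? d)) ⊗ g d
  splitTerm d = trans (sym (⊗-identityˡ _)) (trans (cong (_⊗ g d) (sym (χ-not (q ∣? d)))) (⊗-distribʳ (g d) _ _))
  n÷q : n ÷ q ≡ m
  n÷q = ÷-unique n q m (ℕ.≤-reflexive (sym n≡)) (subst (_< q * suc m) (sym n≡) (ℕ.*-monoʳ-< q {{prime⇒nonZero pq}} (ℕ.n<1+n m)))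
  inner : ∀ e → 1 ≤ e → g (q * e) ≡ neg (ι 1) ⊗ h e
  inner e 1≤e with q ∣? e
  ... | yes d = trans (cong (χ (q * e ∣? n) ⊗_) (μ-prime-square q e pq 1≤e d)) (z (χ (q * e ∣? n)) (χ (e ∣? m)) (μ e))
    where
    z : ∀ a b c → a ⊗ ι 0 ≡ neg (ι 1) ⊗ (b ⊗ (ι 0 ⊗ c))
    z a b c = ring 3 0 (v0 :* # 0) ((:- # 1) :* (v1 :* (# 0 :* v2)))
  ... | no ∤ = trans (cong₂ _⊗_ (χ-cong (q * e ∣? n) (e ∣? m) (λ d → *-cancelˡ-∣ q {{prime⇒nonZero pq}} (subst (q * e ∣_) n≡ d))
        (λ d → subst (q * e ∣_) (sym n≡) (*-monoʳ-∣ q d))) (μ-prime-coprime q e pq 1≤e ∤)) (z (χ (e ∣? m)) (μ e))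
    where
    z : ∀ a b → a ⊗ (neg (ι 1) ⊗ b) ≡ neg (ι 1) ⊗ (a ⊗ (ι 1 ⊗ b))
    z a b = ring 2 0 (v0 :* ((:- # 1) :* v1)) ((:- # 1) :* (v0 :* (# 1 :* v1)))
  multiples : sum (λ d → χ (q ∣? d) ⊗ g d) n ≡ neg (ι 1) ⊗ sum h m
  multiples = trans (sym (sum-multiples g n q (prime≥1 pq))) (trans (cong (sum (λ j → g (q * j))) n÷q)
    (trans (sum-cong m (λ e 1≤e _ → inner e 1≤e)) (sum-⊗ (neg (ι 1)) h m)))
  same : ∀ d → χ (¬? (q ∣? d)) ⊗ g d ≡ h d
  same d with q ∣? d
  ... | yes _ = z (g d) (χ (d ∣? m)) (μ d)
    where
    z : ∀ a b c → ι 0 ⊗ a ≡ b ⊗ (ι 0 ⊗ c)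
    z a b c = ring 3 0 (# 0 :* v0) (v1 :* (# 0 :* v2))
  ... | no ∤ = trans (⊗-identityˡ _) (cong₂ _⊗_ (χ-cong (d ∣? n) (d ∣? m)
      (λ e → coprime-divisor {d} {q} cop (subst (d ∣_) n≡ e)) (λ e → subst (d ∣_) (sym n≡) (∣-trans e (n∣m*n q)))) (sym (⊗-identityˡ _)))
    where
    cop : Coprime d q
    cop {i} (i∣d , i∣q) with prime⇒irreducible pq i∣q
    ... | inj₁ i≡1 = i≡1
    ... | inj₂ refl = contradiction i∣d ∤
  rest : sum (λ d → χ (¬? (q ∣? d)) ⊗ g d) n ≡ sum h m
  rest = trans (sum-ext n same) (sum-trunc h (subst (m ≤_) (sym n≡) (ℕ.m≤n*m m q {{prime⇒nonZero pq}})) (λ d m<d _ →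
    trans (cong (_⊗ (χ (¬? (q ∣? d)) ⊗ μ d)) (χ-no (d ∣? m) (λ e → ℕ.<⇒≱ m<d (∣⇒≤ {{ℕ.>-nonZero 1≤m}} e)))) (⊗-zeroˡ _)))
  cancel : ∀ {x} → neg (ι 1) ⊗ x ⊕ x ≡ ι 0
  cancel {x} = ring 1 0 ((:- # 1) :* v0 :+ v0) (# 0)

within-const : ∀ {b} {e : ℕ → R} n → (∀ i → Within b (e i)) → Within (ι n ⊗ b) (sum e n)
within-const {b} n h = within-weaken (≡⇒⊑ (sum-const b n)) (within-sum n (λ i _ _ → h i))

within-⊖ : ∀ {a b x y} → Within a x → Within b y → Within (a ⊕ b) (x ⊖ y)
within-⊖ {a} {b} {x} {y} (l , u) (l′ , u′) = linear 4 0
    (:- (v0 :+ v1)) (v2 :- v3) ((:- v0) :+ v3) (v2 :+ v1)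
    (l ⊞ u′) , linear 4 0
    (v0 :- v1) (v2 :+ v3) (v0 :- v3) (v2 :+ v1)
    (u ⊞ l′)

within-≡ : ∀ {a x y} → x ≡ y → Within a x → Within a y
within-≡ refl h = h

within-zero : ∀ a → Within (a ⊖ a) (a ⊖ a)
within-zero a = linear 1 0 (:- (v0 :- v0)) (v0 :- v0) (# 0) (# 0) (⊑-refl {ι 0}) , ⊑-refl

within-nonneg : ∀ {a x} → ι 0 ⊑ x → x ⊑ a → Within a x
within-nonneg {a} {x} h k = linear 2 0 (:- v0) v1 (# 0 :+ # 0 :+ v1) (v1 :+ v1 :+ v0) (h ⊞ h ⊞ k) , k

within-bound : ∀ {a x} → Within a x → ι 0 ⊑ a
within-bound {a} {x} (l , u) = ⊗-cancelˡ 2 (s≤s z≤n) (linear 2 0 (# 2 :* # 0) (# 2 :* v0) ((:- v0) :+ v1) (v1 :+ v0) (l ⊞ u))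

within-scale : ∀ n {c x} → 1 ≤ n → Within c (ι n ⊗ x) → Within c x
within-scale n {c} {x} 1≤n h = ⊗-cancelˡ n 1≤n (linear 2 1
    (n0 :* (:- v0)) (n0 :* v1) ((:- v0) :+ v0) (n0 :* v1 :+ n0 :* v0)
    (proj₁ h ⊞ big)) , ⊗-cancelˡ n 1≤n (linear 2 1
    (n0 :* v0) (n0 :* v1) (n0 :* v0 :+ v1) (v1 :+ n0 :* v1)
    (proj₂ h ⊞ big))
  where
  big : c ⊑ ι n ⊗ c
  big = linear 1 1 v0 (n0 :* v0) (# 1 :* v0) (n0 :* v0) (⊗-monoʳ (within-bound h) (ι-mono 1≤n))

-- Whole periods contribute nothing, so only the last incomplete one counts.
periodic-bounded : ∀ A (e : ℕ → R) b → 1 ≤ A → (∀ i → e (A + i) ≡ e i) → sum e A ≡ ι 0 → (∀ i → Within b (e i)) →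
  ∀ z → Within (ι A ⊗ b) (sum e z)
periodic-bounded A e b 1≤A per zero-sum bound = <-rec _ go
  where
  go : ∀ z → (∀ {y} → y < z → Within (ι A ⊗ b) (sum e y)) → Within (ι A ⊗ b) (sum e z)
  go z rec with A ℕ.≤? z
  ... | no A≰z = within-weaken (⊗-monoʳ (within-bound (bound 0)) (ι-mono (ℕ.<⇒≤ (ℕ.≰⇒> A≰z)))) (within-const z bound)
  ... | yes A≤z = within-≡ (sym eq) (rec (subst (z ∸ A <_) (ℕ.m+[n∸m]≡n A≤z) (ℕ.m<n+m (z ∸ A) 1≤A)))
    where
    eq : sum e z ≡ sum e (z ∸ A)
    eq = trans (cong (sum e) (sym (ℕ.m+[n∸m]≡n A≤z))) (trans (sum-split e A (z ∸ A))
      (trans (cong₂ _⊕_ zero-sum (sum-ext (z ∸ A) per)) (⊕-identityˡ _)))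

module Summation (e w : ℕ → R) (B : R) (E-bound : ∀ z → Within B (sum e z)) where

  -- The remainder in Abel summation. Its increment is -E(z) (w(z + 1) - w(z)) with E the partial
  -- sums of `e`, so for monotone w it is at most B times the variation of w.
  V : ℕ → R
  V z = sum (λ i → e i ⊗ w i) z ⊖ sum e z ⊗ w z

  V-step : ∀ z → V (suc z) ≡ V z ⊖ sum e z ⊗ (w (suc z) ⊖ w z)
  V-step z = st (sum (λ i → e i ⊗ w i) z) (sum e z) (e (suc z)) (w (suc z)) (w z)
    where
    st : ∀ s t e w′ w → s ⊕ e ⊗ w′ ⊖ (t ⊕ e) ⊗ w′ ≡ s ⊖ t ⊗ w ⊖ t ⊗ (w′ ⊖ w)
    st s t e w′ w = ring 5 0 (v0 :+ v1 :* v2 :- (v3 :+ v1) :* v2) (v0 :- v3 :* v4 :- v3 :* (v2 :- v4))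

  V-increasing : ∀ z → (∀ i → 1 ≤ i → i < z → w i ⊑ w (suc i)) → 1 ≤ z → Within (B ⊗ (w z ⊖ w 1)) (V z)
  V-increasing (suc zero) inc _ = within-≡ (base (e 1) (w 1)) (within-⊗ (E-bound 0) (within-zero (w 1)))
    where
    base : ∀ e w → ι 0 ⊗ (w ⊖ w) ≡ ι 0 ⊕ e ⊗ w ⊖ (ι 0 ⊕ e) ⊗ w
    base e w = ring 2 0 (# 0 :* (v0 :- v0)) (# 0 :+ v1 :* v0 :- (# 0 :+ v1) :* v0)
  V-increasing (suc (suc z)) inc _ = within-≡ (sym (V-step (suc z)))
    (within-weaken (≡⇒⊑ (b₂ B (w 1) (w (suc z)) (w (suc (suc z))))) (within-⊖ (V-increasing (suc z) (λ i a b → inc i a (ℕ.m≤n⇒m≤1+n b)) (s≤s z≤n))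
      (within-⊗ (E-bound (suc z)) (within-nonneg (⊑⇒⊖ (inc (suc z) (s≤s z≤n) ℕ.≤-refl)) ⊑-refl))))
    where
    b₂ : ∀ b w w′ w″ → b ⊗ (w′ ⊖ w) ⊕ b ⊗ (w″ ⊖ w′) ≡ b ⊗ (w″ ⊖ w)
    b₂ b w w′ w″ = ring 4 0 (v0 :* (v1 :- v2) :+ v0 :* (v3 :- v1)) (v0 :* (v3 :- v2))

  increasing : ∀ z → (∀ i → 1 ≤ i → i < z → w i ⊑ w (suc i)) → 1 ≤ z → ι 0 ⊑ w 1 → ι 0 ⊑ w z →
    Within (ι 2 ⊗ (B ⊗ w z)) (sum (λ i → e i ⊗ w i) z)
  increasing z inc 1≤z 0≤w₁ 0≤w = within-≡ (back (sum (λ i → e i ⊗ w i) z) (sum e z ⊗ w z))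
    (within-weaken less
      (within-⊕ (V-increasing z inc 1≤z) (within-⊗ (E-bound z) (within-nonneg 0≤w ⊑-refl))))
    where
    less : B ⊗ (w z ⊖ w 1) ⊕ B ⊗ w z ⊑ ι 2 ⊗ (B ⊗ w z)
    less = linear 3 0 (v0 :* (v1 :- v2) :+ v0 :* v1) (# 2 :* (v0 :* v1)) (# 0) (v0 :* v2) (⊗-nonneg (within-bound (E-bound 0)) 0≤w₁)
    back : ∀ a b → a ⊖ b ⊕ b ≡ a
    back a b = ring 2 0 (v0 :- v1 :+ v1) v0

  V-decreasing : ∀ z k → (∀ i → z ≤ i → i < k + z → w (suc i) ⊑ w i) → Within (B ⊗ (w z ⊖ w (k + z))) (V (k + z) ⊖ V z)
  V-decreasing z zero dec = within-≡ (b₁ (w z) (V z)) (within-⊗ (E-bound 0) (within-zero (w z)))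
    where
    b₁ : ∀ w v → ι 0 ⊗ (w ⊖ w) ≡ v ⊖ v
    b₁ w v = ring 2 0 (# 0 :* (v0 :- v0)) (v1 :- v1)
  V-decreasing z (suc k) dec = within-≡ (trans (b₁ (V (k + z)) (V z) _) (cong (_⊖ V z) (sym (V-step (k + z)))))
    (within-weaken (≡⇒⊑ (b₂ B (w z) (w (k + z)) (w (suc k + z)))) (within-⊖ (V-decreasing z k (λ i a b → dec i a (ℕ.m≤n⇒m≤1+n b)))
      (within-⊗ (E-bound (k + z)) (within-neg (dec (k + z) (ℕ.m≤n+m z k) ℕ.≤-refl)))))
    where
    b₁ : ∀ a b c → a ⊖ b ⊖ c ≡ a ⊖ c ⊖ b
    b₁ a b c = ring 3 0 (v0 :- v1 :- v2) (v0 :- v2 :- v1)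
    b₂ : ∀ b w w′ w″ → b ⊗ (w ⊖ w′) ⊕ b ⊗ (w′ ⊖ w″) ≡ b ⊗ (w ⊖ w″)
    b₂ b w w′ w″ = ring 4 0 (v0 :* (v1 :- v2) :+ v0 :* (v2 :- v3)) (v0 :* (v1 :- v3))
    within-neg : ∀ {a b} → a ⊑ b → Within (b ⊖ a) (a ⊖ b)
    within-neg {a} {b} h = linear 2 0
        (:- (v0 :- v1)) (v1 :- v0) (# 0) (# 0)
        (⊑-refl {ι 0}) , linear 2 0
        (v0 :- v1) (v1 :- v0) (# 2 :* v0) (# 2 :* v1)
        (2 ⊙ h)

  decreasing : ∀ z k → (∀ i → z ≤ i → i < k + z → w (suc i) ⊑ w i) → ι 0 ⊑ w (k + z) → ι 0 ⊑ w z →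
    Within (ι 2 ⊗ (B ⊗ w z)) (sum (λ i → e i ⊗ w i) (k + z) ⊖ sum (λ i → e i ⊗ w i) z)
  decreasing z k dec 0≤w′ 0≤w = within-≡ (back (sum (λ i → e i ⊗ w i) (k + z)) (sum e (k + z) ⊗ w (k + z)) (sum (λ i → e i ⊗ w i) z) (sum e z ⊗ w z))
    (within-weaken (≡⇒⊑ (b₂ B (w z) (w (k + z)))) (within-⊖ (within-⊕ (V-decreasing z k dec)
      (within-⊗ (E-bound (k + z)) (within-nonneg 0≤w′ ⊑-refl))) (within-neg (within-⊗ (E-bound z) (within-nonneg 0≤w ⊑-refl)))))
    where
    back : ∀ a b c d → (a ⊖ b) ⊖ (c ⊖ d) ⊕ b ⊖ neg (neg d) ≡ a ⊖ c
    back a b c d = ring 4 0 (v0 :- v1 :- (v2 :- v3) :+ v1 :- (:- (:- v3))) (v0 :- v2)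
    b₂ : ∀ b w w′ → b ⊗ (w ⊖ w′) ⊕ b ⊗ w′ ⊕ b ⊗ w ≡ ι 2 ⊗ (b ⊗ w)
    b₂ b w w′ = ring 3 0 (v0 :* (v1 :- v2) :+ v0 :* v2 :+ v0 :* v1) (# 2 :* (v0 :* v1))
    within-neg : ∀ {a x} → Within a x → Within a (neg (neg x))
    within-neg {a} {x} (l , u) = linear 2 0 (:- v0) (:- (:- v1)) (:- v0) v1 l , linear 2 0 (:- (:- v0)) v1 v0 v1 u

module Euler {N : ℕ} (ls : LogSystem N) where
  open Bounds ls

  inv-diff : ∀ n → 1 ≤ n → inv n ⊗ inv (suc n) ≡ inv n ⊖ inv (suc n)
  inv-diff n 1≤n = trans e (trans (cong₂ (λ x y → x ⊗ inv n ⊖ y ⊗ inv (suc n)) (inv-inverse (suc n) (s≤s z≤n)) (inv-inverse n 1≤n)) (e₂ (inv n) (inv (suc n))))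
    where
    e : inv n ⊗ inv (suc n) ≡ ι (suc n) ⊗ inv (suc n) ⊗ inv n ⊖ ι n ⊗ inv n ⊗ inv (suc n)
    e = ring 2 1 (v0 :* v1) (nat (lit 1 ∔ n# 0) :* v1 :* v0 :- n0 :* v0 :* v1)
    e₂ : ∀ a b → ι 1 ⊗ a ⊖ ι 1 ⊗ b ≡ a ⊖ b
    e₂ a b = ring 2 0 (# 1 :* v0 :- # 1 :* v1) (v0 :- v1)

  inv-half : ∀ n → 1 ≤ n → inv n ⊑ ι 2 ⊗ inv (suc n)
  inv-half n 1≤n = ⊗-cancelˡ n 1≤n (⊗-cancelˡ (suc n) (s≤s z≤n) (linear 2 1
      (nat (lit 1 ∔ n# 0) :* (n0 :* v0)) (nat (lit 1 ∔ n# 0) :* (n0 :* (# 2 :* v1)))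
      (# 1 :+ nat (lit 1 ∔ n# 0) :* (n0 :* v0) :+ # 2 :* (n0 :* # 1))
      (n0 :+ nat (lit 1 ∔ n# 0) :* # 1 :+ # 2 :* (n0 :* (nat (lit 1 ∔ n# 0) :* v1)))
      (ι-mono 1≤n ⊞ ≡⇒⊑ (cong (ι (suc n) ⊗_) (inv-inverse n 1≤n))
    ⊞ 2 ⊙ ≡⇒⊒ (cong (ι n ⊗_) (inv-inverse (suc n) (s≤s z≤n))))))

  -- For the true logarithm this tends to Euler's constant; here its variation beyond z, which is
  -- O(1/z), takes over that role.
  y : ℕ → R
  y z = harmonic z ⊖ L z

  y-step : ∀ n → 1 ≤ n → suc n ≤ N → Within (ι 3 ⊗ (inv n ⊖ inv (suc n))) (y (suc n) ⊖ y n)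
  y-step n 1≤n n<N =
      linear 5 0
          (:- (# 3 :* (v0 :- v1))) (v2 :+ v1 :- v3 :- (v2 :- v4)) (v3 :+ v0 :* v0 :+ # 2 :* (v0 :* v1))
          (v4 :+ v0 :+ v0 :* v0 :+ v0 :* (# 2 :* v1) :+ # 2 :* (v0 :- v1))
          (proj₂ (L-step n 1≤n n<N) ⊞ ⊗-monoˡ (inv-nonneg n) (inv-half n 1≤n) ⊞ 2 ⊙ ≡⇒⊑ (inv-diff n 1≤n))
    , linear 5 0
        (v0 :+ v1 :- v2 :- (v0 :- v3)) (# 3 :* (v4 :- v1)) (v3 :+ v1 :+ v1 :* v1 :+ v4 :* v1 :+ # 2 :* v1)
        (v2 :+ v1 :* v1 :+ v4 :* v1 :+ (v4 :- v1) :+ # 2 :* v4)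
        (proj₁ (L-step n 1≤n n<N) ⊞ ⊗-monoʳ (inv-nonneg (suc n)) (inv-anti 1≤n (ℕ.n≤1+n n)) ⊞ ≡⇒⊑ (inv-diff n 1≤n)
        ⊞ 2 ⊙ inv-anti 1≤n (ℕ.n≤1+n n))

  y-diff : ∀ z k → 1 ≤ z → k + z ≤ N → Within (ι 3 ⊗ (inv z ⊖ inv (k + z))) (y (k + z) ⊖ y z)
  y-diff z zero    1≤z le = linear 3 0
      (:- (# 3 :* (v0 :- v0))) (v1 :- v2 :- (v1 :- v2)) (# 0) (# 0)
      (⊑-refl {ι 0}) , linear 3 0
      (v0 :- v1 :- (v0 :- v1)) (# 3 :* (v2 :- v2)) (# 0) (# 0)
      (⊑-refl {ι 0})
  y-diff z (suc k) 1≤z le = within-≡ (e₁ (y (k + z)) (y z) (y (suc k + z))) (within-weaken (≡⇒⊑ (e₂ (inv z) (inv (k + z)) (inv (suc k + z))))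
    (within-⊕ (y-diff z k 1≤z (ℕ.<⇒≤ le)) (y-step (k + z) (ℕ.≤-trans 1≤z (ℕ.m≤n+m z k)) le)))
    where
    e₁ : ∀ a b c → a ⊖ b ⊕ (c ⊖ a) ≡ c ⊖ b
    e₁ a b c = ring 3 0 (v0 :- v1 :+ (v2 :- v0)) (v2 :- v1)
    e₂ : ∀ a b c → ι 3 ⊗ (a ⊖ b) ⊕ ι 3 ⊗ (b ⊖ c) ≡ ι 3 ⊗ (a ⊖ c)
    e₂ a b c = ring 3 0 (# 3 :* (v0 :- v1) :+ # 3 :* (v1 :- v2)) (# 3 :* (v0 :- v2))

  harmonic-bound : ∀ z → 1 ≤ z → z ≤ N → harmonic z ⊑ L z ⊕ ι 4
  harmonic-bound z 1≤z z≤N = linear 6 0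
      v0 (v1 :+ # 4) (v0 :- v1 :- (v2 :- v3) :+ v2 :+ # 0 :+ # 3 :* # 0 :+ # 3 :* v4)
      (# 3 :* (v4 :- v5) :+ # 1 :+ v3 :+ # 3 :* v5 :+ # 3 :* # 1)
      (proj₂ d ⊞ ≡⇒⊑ h1 ⊞ ≡⇒⊒ L-1 ⊞ 3 ⊙ inv-nonneg z ⊞ 3 ⊙ ≡⇒⊑ inv-1)
    where
    d : Within (ι 3 ⊗ (inv 1 ⊖ inv z)) (y z ⊖ y 1)
    d = subst (λ t → Within (ι 3 ⊗ (inv 1 ⊖ inv t)) (y t ⊖ y 1)) (ℕ.m∸n+n≡m 1≤z) (y-diff 1 (z ∸ 1) (s≤s z≤n) (subst (_≤ N) (sym (ℕ.m∸n+n≡m 1≤z)) z≤N))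
    h1 : harmonic 1 ≡ ι 1
    h1 = trans (⊕-identityˡ _) inv-1

-- Residue classes

coprime-* : ∀ {a b n} → Coprime a n → Coprime b n → Coprime (a * b) n
coprime-* {a} {b} {n} ca cb {d} (d∣ab , d∣n) = cb (coprime-divisor {d} {a} (λ { (i∣d , i∣a) → ca (i∣a , ∣-trans i∣d d∣n) }) d∣ab , d∣n)

coprime-*ˡ : ∀ {a b n} → Coprime (a * b) n → Coprime a n
coprime-*ˡ {a} {b} c (d∣a , d∣n) = c (∣-trans d∣a (m∣m*n b) , d∣n)

coprime-*ʳ : ∀ {a b n} → Coprime (a * b) n → Coprime b n
coprime-*ʳ {a} {b} c (d∣b , d∣n) = c (∣-trans d∣b (n∣m*n a) , d∣n)

module Residues (A : ℕ) {{nz : NonZero A}} where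

  infix 4 _≈_ _≈?_

  _≈_ : ℕ → ℕ → Set
  x ≈ y = x % A ≡ y % A

  _≈?_ : ∀ x y → Dec (x ≈ y)
  x ≈? y = x % A ℕ.≟ y % A

  1≤A : 1 ≤ A
  1≤A = ℕ.>-nonZero⁻¹ A

  ≈-*ˡ : ∀ k {x y} → x ≈ y → k * x ≈ k * y
  ≈-*ˡ k {x} {y} e = trans (%-distribˡ-* k x A) (trans (cong (λ t → (k % A * t) % A) e) (sym (%-distribˡ-* k y A)))

  ≈-*ʳ : ∀ k {x y} → x ≈ y → x * k ≈ y * k
  ≈-*ʳ k {x} {y} e = subst₂ _≈_ (ℕ.*-comm k x) (ℕ.*-comm k y) (≈-*ˡ k {x} {y} e)

  ≈-+A : ∀ k m → m + k * A ≈ m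
  ≈-+A k m = [m+kn]%n≡m%n m k A

  ≈-coprime : ∀ {x y} → x ≈ y → Coprime x A → Coprime y A
  ≈-coprime {x} {y} e c (d∣y , d∣A) = c (∣n∣m%n⇒∣m d∣A (subst (_ ∣_) (sym e) (%-presˡ-∣ d∣y d∣A)) , d∣A)

  inverse : ∀ k → Coprime k A → Σ ℕ λ k′ → k * k′ ≈ 1
  inverse k c with coprime-Bézout c
  ... | Bézout.+- x y e = x , subst (_≈ 1) (trans e (ℕ.*-comm x k)) (≈-+A y 1)
  -- Here k x ≡ -1, so (k x)² ≡ 1 and x (k x) inverts k.
  ... | Bézout.-+ x y e = x * (k * x) , (begin
      (k * (x * (k * x))) % A             ≡⟨ cong (_% A) (sym (ℕ.*-assoc k x (k * x))) ⟩
      (t * t) % A                         ≡⟨ sym (≈-+A y (t * t)) ⟩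
      (t * t + y * A) % A                 ≡⟨ cong (_% A) (ℕ.+-cancelʳ-≡ t (t * t + y * A) (1 + t * y * A) key) ⟩
      (1 + t * y * A) % A                 ≡⟨ ≈-+A (t * y) 1 ⟩
      1 % A                               ∎)
    where
    open ≡-Reasoning
    t = k * x
    e′ : 1 + t ≡ y * A
    e′ = trans (cong suc (ℕ.*-comm k x)) e
    lem : ∀ t z → t * t + z + t ≡ t * (1 + t) + z
    lem = solve-∀
    lem′ : ∀ t y A → t * (y * A) + (1 + t) ≡ 1 + t * y * A + t
    lem′ = solve-∀
    key : t * t + y * A + t ≡ 1 + t * y * A + t
    key = trans (lem t (y * A)) (trans (cong₂ (λ p q → t * p + q) e′ (sym e′)) (lem′ t y A))

  ≈-cancel : ∀ k {x y} → Coprime k A → k * x ≈ k * y → x ≈ y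
  ≈-cancel k {x} {y} c e with inverse k c
  ... | k′ , i = trans (sym (reduce x)) (trans (≈-*ˡ k′ {k * x} {k * y} e) (reduce y))
    where
    reduce : ∀ z → k′ * (k * z) ≈ z
    reduce z = trans (cong (_% A) (trans (sym (ℕ.*-assoc k′ k z)) (cong (_* z) (ℕ.*-comm k′ k))))
      (trans (≈-*ʳ z {k * k′} {1} i) (cong (_% A) (ℕ.*-identityˡ z)))

  -- Representatives run from 1 to A, to match the range of `sum`.
  rep : ℕ → ℕ
  rep x with x % A
  ... | zero  = A
  ... | suc r = suc r

  rep-spec : ∀ x → 1 ≤ rep x × rep x ≤ A × rep x ≈ x
  rep-spec x with x % A in e
  ... | zero  = 1≤A , ℕ.≤-refl , trans (n%n≡0 A) refl
  ... | suc r = s≤s z≤n , ℕ.<⇒≤ lt , m<n⇒m%n≡m lt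
    where
    lt : suc r < A
    lt = subst (_< A) e (m%n<n x A)

  ≈-unique : ∀ {i j} → 1 ≤ i → i ≤ A → 1 ≤ j → j ≤ A → i ≈ j → i ≡ j
  ≈-unique {i} {j} 1≤i i≤A 1≤j j≤A e with ℕ.m≤n⇒m<n∨m≡n i≤A | ℕ.m≤n⇒m<n∨m≡n j≤A
  ... | inj₁ i<A | inj₁ j<A = trans (sym (m<n⇒m%n≡m i<A)) (trans e (m<n⇒m%n≡m j<A))
  ... | inj₂ refl | inj₂ j≡A = sym j≡A
  ... | inj₁ i<A | inj₂ refl = contradiction (trans (sym (m<n⇒m%n≡m i<A)) (trans e (n%n≡0 A))) (λ { refl → contradiction 1≤i (λ ()) })
  ... | inj₂ refl | inj₁ j<A = contradiction (trans (sym (m<n⇒m%n≡m j<A)) (trans (sym e) (n%n≡0 A))) (λ { refl → contradiction 1≤j (λ ()) })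

  solve : ∀ k c → Coprime k A → Σ ℕ λ i → 1 ≤ i × i ≤ A × k * i ≈ c
  solve k c cop with inverse k cop
  ... | k′ , e with rep-spec (k′ * c)
  ...   | 1≤r , r≤A , r≈ = rep (k′ * c) , 1≤r , r≤A , trans (≈-*ˡ k {rep (k′ * c)} {k′ * c} r≈)
          (trans (cong (_% A) (sym (ℕ.*-assoc k k′ c))) (trans (≈-*ʳ c {k * k′} {1} e) (cong (_% A) (ℕ.*-identityˡ c))))

  -- Indicator of the class c/k. The form k m ≡ c needs no choice of an inverse and lets k contain a
  -- summation variable; the class is empty when c is a unit and k is not.
  class : ℕ → ℕ → ℕ → R
  class k c m = χ (k * m ≈? c)

  class-nonneg : ∀ k c m → ι 0 ⊑ class k c m
  class-nonneg k c m = χ-nonneg (k * m ≈? c)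

  class≤1 : ∀ k c m → class k c m ⊑ ι 1
  class≤1 k c m = χ≤1 (k * m ≈? c)

  class-coprime : ∀ {k c m} → Coprime c A → k * m ≈ c → Coprime k A × Coprime m A
  class-coprime {k} {c} {m} cc e = coprime-*ˡ {k} {m} h , coprime-*ʳ {k} {m} h
    where
    h : Coprime (k * m) A
    h = ≈-coprime {c} {k * m} (sym e) cc

  class-block : ∀ k c → Coprime k A → sum (class k c) A ≡ ι 1
  class-block k c cop with solve k c cop
  ... | i , 1≤i , i≤A , e = trans (sum-single (class k c) i A 1≤i i≤A (λ j 1≤j j≤A j≢i → χ-no (k * j ≈? c)
          (λ h → j≢i (≈-unique 1≤j j≤A 1≤i i≤A (≈-cancel k {j} {i} cop (trans h (sym e))))))) (χ-yes (k * i ≈? c) e)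

  shift : ∀ k i → k * (A + i) ≈ k * i
  shift k i = ≈-*ˡ k {A + i} {i} (trans (cong (_% A) (ℕ.+-comm A i)) ([m+n]%n≡m%n i A))

  class-periodic : ∀ k c i → class k c (A + i) ≡ class k c i
  class-periodic k c i = cong (λ t → χ (t ℕ.≟ c % A)) (shift k i)

  unit : ℕ → R
  unit i = χ (coprime? i A)

  unit-nonneg : ∀ i → ι 0 ⊑ unit i
  unit-nonneg i = χ-nonneg (coprime? i A)

  unit≤1 : ∀ i → unit i ⊑ ι 1
  unit≤1 i = χ≤1 (coprime? i A)

  unit-≈ : ∀ {i j} → i ≈ j → unit i ≡ unit j
  unit-≈ {i} {j} e = χ-cong (coprime? i A) (coprime? j A) (≈-coprime {i} {j} e) (≈-coprime {j} {i} (sym e))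

  unit-periodic : ∀ i → unit (A + i) ≡ unit i
  unit-periodic i = unit-≈ {A + i} {i} (trans (cong (_% A) (ℕ.+-comm A i)) ([m+n]%n≡m%n i A))

  count : ℕ → ℕ
  count zero = 0
  count (suc n) with coprime? (suc n) A
  ... | yes _ = suc (count n)
  ... | no _  = count n

  count-unit : ∀ n → sum unit n ≡ ι (count n)
  count-unit zero = refl
  count-unit (suc n) with coprime? (suc n) A
  ... | yes _ = trans (cong (_⊕ ι 1) (count-unit n)) (trans (⊕-comm _ _) (sym (ι-+ 1 (count n))))
  ... | no _  = trans (⊕-identityʳ _) (count-unit n)

  count≤ : ∀ n → count n ≤ n
  count≤ zero = z≤n
  count≤ (suc n) with coprime? (suc n) A
  ... | yes _ = s≤s (count≤ n)
  ... | no _  = ℕ.m≤n⇒m≤1+n (count≤ n)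

  φ : ℕ
  φ = count A

  φ≤A : φ ≤ A
  φ≤A = count≤ A

  unit-1 : unit 1 ≡ ι 1
  unit-1 = χ-yes (coprime? 1 A) (Coprimality.1-coprimeTo A)

  1≤φ : 1 ≤ φ
  1≤φ = ι-cancel (⊑-trans (≡⇒⊒ unit-1) (⊑-trans (⊑-trans (≡⇒⊒ (⊕-identityˡ (unit 1))) (sum-monoʳ unit 1≤A (λ i _ _ → unit-nonneg i))) (≡⇒⊑ (count-unit A))))

  -- Both deviations have mean zero over a period, so their partial sums stay bounded.
  classDev : ℕ → ℕ → ℕ → R
  classDev k c i = ι φ ⊗ class k c i ⊖ unit i

  unitDev : ℕ → R
  unitDev i = ι A ⊗ unit i ⊖ ι φ

  classDev-sum : ∀ k c → Coprime k A → ∀ z → Within (ι A ⊗ ι A) (sum (classDev k c) z)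
  classDev-sum k c cop = periodic-bounded A (classDev k c) (ι A) 1≤A
    (λ i → cong₂ (λ x y → ι φ ⊗ x ⊖ y) (class-periodic k c i) (unit-periodic i))
    (trans (sum-⊖ (λ i → ι φ ⊗ class k c i) unit A) (trans (cong₂ _⊖_ (trans (sum-⊗ (ι φ) (class k c) A)
      (trans (cong (ι φ ⊗_) (class-block k c cop)) (trans (⊗-comm _ _) (⊗-identityˡ _)))) (count-unit A)) (⊕-inverseʳ _)))
    (λ i → bound (class-nonneg k c i) (class≤1 k c i) (unit-nonneg i) (unit≤1 i))
    where
    bound : ∀ {x u} → ι 0 ⊑ x → x ⊑ ι 1 → ι 0 ⊑ u → u ⊑ ι 1 → Within (ι A) (ι φ ⊗ x ⊖ u)
    bound {x} {u} 0≤x x≤1 0≤u u≤1 = linear 2 2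
        (:- n0) (n1 :* v0 :- v1) (# 0 :+ v1 :+ # 1) (n1 :* v0 :+ # 1 :+ n0)
        (⊗-nonneg (0≤ι φ) 0≤x ⊞ u≤1 ⊞ ι-mono 1≤A) , linear 2 2
        (n0 :* v0 :- v1) n1 (n0 :* v0 :+ # 0 :+ n0) (n0 :* # 1 :+ v1 :+ n1)
        (⊗-monoˡ (0≤ι φ) x≤1 ⊞ 0≤u ⊞ ι-mono φ≤A)

  unitDev-sum : ∀ z → Within (ι A ⊗ ι A) (sum unitDev z)
  unitDev-sum = periodic-bounded A unitDev (ι A) 1≤A
    (λ i → cong (λ x → ι A ⊗ x ⊖ ι φ) (unit-periodic i))
    (trans (sum-⊖ (λ i → ι A ⊗ unit i) (λ _ → ι φ) A) (trans (cong₂ _⊖_ (trans (sum-⊗ (ι A) unit A) (cong (ι A ⊗_) (count-unit A)))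
      (sum-const (ι φ) A)) (⊕-inverseʳ _)))
    (λ i → bound (unit-nonneg i) (unit≤1 i))
    where
    bound : ∀ {u} → ι 0 ⊑ u → u ⊑ ι 1 → Within (ι A) (ι A ⊗ u ⊖ ι φ)
    bound {u} 0≤u u≤1 = linear 1 2
        (:- n0) (n0 :* v0 :- n1) (# 0 :+ n1) (n0 :* v0 :+ n0)
        (⊗-nonneg (0≤ι A) 0≤u ⊞ ι-mono φ≤A) , linear 1 2
        (n0 :* v0 :- n1) n0 (n0 :* v0 :+ # 0) (n0 :* # 1 :+ n1)
        (⊗-monoˡ (0≤ι A) u≤1 ⊞ 0≤ι φ)

-- Selberg's symmetry formula in residue classes

within-neg : ∀ {a x y} → Within a (x ⊖ y) → Within a (y ⊖ x)
within-neg {a} {x} {y} (l , u) = linear 3 0 (:- v0) (v1 :- v2) (v2 :- v1) v0 u , linear 3 0 (v0 :- v1) v2 (:- v2) (v1 :- v0) l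

module Densities {N : ℕ} (ls : LogSystem N) (A : ℕ) {{nz : NonZero A}} where
  open Bounds ls public
  open Euler ls public
  open Residues A public

  -- Bounds the partial sums of `unitDev` and `classDev`; the later error terms are stated in its
  -- powers.
  Δ : R
  Δ = ι A ⊗ ι A

  1≤Δ : ι 1 ⊑ Δ
  1≤Δ = ⊑-trans (ι-mono (*-pos 1≤A 1≤A)) (≡⇒⊑ (ι-* A A))

  A≤Δ : ι A ⊑ Δ
  A≤Δ = ⊑-trans (≡⇒⊒ (trans (⊗-comm _ _) (⊗-identityˡ _))) (⊗-monoˡ (0≤ι A) (ι-mono 1≤A))

  0≤Δ : ι 0 ⊑ Δ
  0≤Δ = ⊑-trans (0≤ι 1) 1≤Δ

  Δ≤DD : Δ ⊑ Δ ⊗ Δ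
  Δ≤DD = ⊑-trans (≡⇒⊒ (⊗-identityˡ Δ)) (⊗-monoʳ 0≤Δ 1≤Δ)

  φ≤Δ : ι φ ⊑ Δ
  φ≤Δ = ⊑-trans (ι-mono φ≤A) A≤Δ

  unitDev-Δ : ∀ z → Within Δ (sum unitDev z)
  unitDev-Δ = unitDev-sum

  classDev-Δ : ∀ k c → Coprime k A → ∀ z → Within Δ (sum (classDev k c) z)
  classDev-Δ = classDev-sum

  u : ℕ → R
  u = sum (λ i → unit i ⊗ inv i)

  u-nonneg : ∀ z → ι 0 ⊑ u z
  u-nonneg z = sum-nonneg z (λ i _ _ → ⊗-nonneg (unit-nonneg i) (inv-nonneg i))

  u≤harmonic : ∀ z → u z ⊑ harmonic z
  u≤harmonic z = sum-mono z (λ i _ _ → ⊑-trans (⊗-monoʳ (inv-nonneg i) (unit≤1 i)) (≡⇒⊑ (⊗-identityˡ _)))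

  -- Nearly constant: u(z) is (φ/A) log z plus a constant, up to O(1/z).
  w : ℕ → R
  w z = ι A ⊗ u z ⊖ ι φ ⊗ L z

  w-eq : ∀ z → sum (λ i → unitDev i ⊗ inv i) z ⊕ ι φ ⊗ y z ≡ w z
  w-eq z = trans (cong (_⊕ ι φ ⊗ y z) (trans (sum-ext z (λ i → pt (ι A) (unit i) (ι φ) (inv i))) (trans (sum-⊖ _ _ z)
      (cong₂ _⊖_ (sum-⊗ (ι A) (λ i → unit i ⊗ inv i) z) (sum-⊗ (ι φ) inv z))))) (fin (ι A ⊗ u z) (ι φ) (harmonic z) (L z))
    where
    pt : ∀ a u f i → (a ⊗ u ⊖ f) ⊗ i ≡ a ⊗ (u ⊗ i) ⊖ f ⊗ i
    pt a u f i = ring 4 0 ((v0 :* v1 :- v2) :* v3) (v0 :* (v1 :* v3) :- v2 :* v3)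
    fin : ∀ x f h l → x ⊖ f ⊗ h ⊕ f ⊗ (h ⊖ l) ≡ x ⊖ f ⊗ l
    fin x f h l = ring 4 0 (v0 :- v1 :* v2 :+ v1 :* (v2 :- v3)) (v0 :- v1 :* v3)

  -- Abel summation for the mean-zero `unitDev`, together with the variation of `y`.
  w-diff : ∀ z k → 1 ≤ z → k + z ≤ N → Within (ι 5 ⊗ (Δ ⊗ inv z)) (w (k + z) ⊖ w z)
  w-diff z k 1≤z le = within-≡ (trans (e₁ _ _ _ _ (ι φ)) (cong₂ _⊖_ (w-eq (k + z)) (w-eq z)))
    (within-weaken weak (within-⊕ dev (within-⊗ (within-nonneg (0≤ι φ) φ≤Δ) (within-weaken less (y-diff z k 1≤z le)))))
    where
    dev : Within (ι 2 ⊗ (Δ ⊗ inv z)) (sum (λ i → unitDev i ⊗ inv i) (k + z) ⊖ sum (λ i → unitDev i ⊗ inv i) z)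
    dev = Summation.decreasing unitDev inv Δ unitDev-Δ z k (λ i z≤i _ → inv-anti (ℕ.≤-trans 1≤z z≤i) (ℕ.n≤1+n i)) (inv-nonneg _) (inv-nonneg _)
    less : ι 3 ⊗ (inv z ⊖ inv (k + z)) ⊑ ι 3 ⊗ inv z
    less = linear 2 0 (# 3 :* (v0 :- v1)) (# 3 :* v0) (# 3 :* # 0) (# 3 :* v1) (3 ⊙ inv-nonneg (k + z))
    weak : ι 2 ⊗ (Δ ⊗ inv z) ⊕ Δ ⊗ (ι 3 ⊗ inv z) ⊑ ι 5 ⊗ (Δ ⊗ inv z)
    weak = linear 1 1 (# 2 :* (n0 :* n0 :* v0) :+ n0 :* n0 :* (# 3 :* v0)) (# 5 :* (n0 :* n0 :* v0)) (# 0) (# 0) (⊑-refl {ι 0})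
    e₁ : ∀ a b c d f → a ⊖ b ⊕ f ⊗ (c ⊖ d) ≡ (a ⊕ f ⊗ c) ⊖ (b ⊕ f ⊗ d)
    e₁ a b c d f = ring 5 0 (v0 :- v1 :+ v2 :* (v3 :- v4)) (v0 :+ v2 :* v3 :- (v1 :+ v2 :* v4))

  -- Stands in for the limit of w, which a finite range cannot provide; by `w-diff` it is within
  -- O(1/z) of w(z).
  Γ : R
  Γ = w N

  w-Γ : ∀ z → 1 ≤ z → z ≤ N → Within (ι 5 ⊗ (Δ ⊗ inv z)) (Γ ⊖ w z)
  w-Γ z 1≤z z≤N = subst (λ t → Within (ι 5 ⊗ (Δ ⊗ inv z)) (w t ⊖ w z)) (ℕ.m∸n+n≡m z≤N)
    (w-diff z (N ∸ z) 1≤z (ℕ.≤-reflexive (ℕ.m∸n+n≡m z≤N)))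

  Γ-bound : 1 ≤ N → Within (ι 6 ⊗ Δ) Γ
  Γ-bound 1≤N = within-≡ (back Γ (w 1)) (within-weaken weak (within-⊕ (w-Γ 1 (s≤s z≤n) 1≤N) w1))
    where
    back : ∀ a b → a ⊖ b ⊕ b ≡ a
    back a b = ring 2 0 (v0 :- v1 :+ v1) v0
    w1≡ : w 1 ≡ ι A
    w1≡ = trans (cong₂ (λ p q → ι A ⊗ (ι 0 ⊕ p) ⊖ ι φ ⊗ q) (cong₂ _⊗_ unit-1 inv-1) L-1) (e (ι A) (ι φ))
      where
      e : ∀ a f → a ⊗ (ι 0 ⊕ ι 1 ⊗ ι 1) ⊖ f ⊗ ι 0 ≡ a
      e a f = ring 2 0 (v0 :* (# 0 :+ # 1 :* # 1) :- v1 :* # 0) v0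
    w1 : Within Δ (w 1)
    w1 = within-≡ (sym w1≡) (within-nonneg (0≤ι A) A≤Δ)
    weak : ι 5 ⊗ (Δ ⊗ inv 1) ⊕ Δ ⊑ ι 6 ⊗ Δ
    weak = linear 1 1
        (# 5 :* (n0 :* n0 :* v0) :+ n0 :* n0) (# 6 :* (n0 :* n0)) (# 5 :* (n0 :* n0 :* v0)) (# 5 :* (n0 :* n0 :* # 1))
        (5 ⊙ ⊗-monoˡ 0≤Δ (inv≤1 1 (s≤s z≤n)))

  -- The counterpart of 1 + γ in Selberg's formula without a modulus: with it, the sum of log n -
  -- z/n + C over the units n ≤ z has no terms in z log z or z.
  C₁ C : R
  C₁ = Γ ⊗ inv φ
  C = ι 1 ⊕ C₁

  φC₁ : ι φ ⊗ C₁ ≡ Γ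
  φC₁ = trans (e (ι φ) Γ (inv φ)) (trans (cong (_⊗ Γ) (inv-inverse φ 1≤φ)) (⊗-identityˡ _))
    where
    e : ∀ f g i → f ⊗ (g ⊗ i) ≡ f ⊗ i ⊗ g
    e f g i = ring 3 0 (v0 :* (v1 :* v2)) (v0 :* v2 :* v1)

  C₁-bound : 1 ≤ N → Within (ι 6 ⊗ Δ) C₁
  C₁-bound 1≤N = within-scale φ 1≤φ (within-≡ (sym φC₁) (Γ-bound 1≤N))

  C-bound : 1 ≤ N → Within (ι 7 ⊗ Δ) C
  C-bound 1≤N = within-weaken weak (within-⊕ (within-nonneg (0≤ι 1) 1≤Δ) (C₁-bound 1≤N))
    where
    weak : Δ ⊕ ι 6 ⊗ Δ ⊑ ι 7 ⊗ Δ
    weak = linear 0 1 (n0 :* n0 :+ # 6 :* (n0 :* n0)) (# 7 :* (n0 :* n0)) (# 0) (# 0) (⊑-refl {ι 0})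

  -- Summation by parts, in the form (z + 1) u(z + 1) - z u(z) = unit(z + 1) + u(z).
  zu : ∀ z → ι z ⊗ u z ≡ sum (λ i → unit i ⊕ u (i ∸ 1)) z
  zu zero    = ⊗-zeroˡ _
  zu (suc z) = trans (e (ι z) (u z) (unit (suc z)) (inv (suc z)) (ι (suc z)) (ι-+ 1 z)) (trans
    (cong₂ (λ p q → p ⊕ (unit (suc z) ⊗ q ⊕ u z)) (zu z) (inv-inverse (suc z) (s≤s z≤n))) (cong (λ t → sum _ z ⊕ (t ⊕ u z)) (trans (⊗-comm _ _) (⊗-identityˡ _))))
    where
    e : ∀ z u n i z′ → z′ ≡ ι 1 ⊕ z → z′ ⊗ (u ⊕ n ⊗ i) ≡ z ⊗ u ⊕ (n ⊗ (z′ ⊗ i) ⊕ u)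
    e z u n i z′ refl = ring 4 0 ((# 1 :+ v0) :* (v1 :+ v2 :* v3)) (v0 :* v1 :+ (v2 :* ((# 1 :+ v0) :* v3) :+ v1))

  Q : ℕ → R
  Q z = sum (λ i → unit i ⊗ L i) z ⊖ ι z ⊗ u z ⊕ C ⊗ sum unit z

  -- What is left of A Q after the mean-zero sums of `unitDev` are split off. By `P-eq` it consists
  -- of boundary terms and of Γ - w(j) = O(1/j), so it is O(log z).
  P : ℕ → R
  P = sum (λ i → ι φ ⊗ L i ⊕ Γ ⊖ ι A ⊗ u (i ∸ 1))

  AQ : ∀ z → sum (λ i → unitDev i ⊗ L i) z ⊕ C₁ ⊗ sum unitDev z ⊕ P z ≡ ι A ⊗ Q z
  AQ z = trans (cong (λ t → sum (λ i → unitDev i ⊗ L i) z ⊕ t ⊕ P z) (sym (sum-⊗ C₁ unitDev z)))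
    (trans (cong (_⊕ P z) (sym (sum-⊕ _ _ z))) (trans (sym (sum-⊕ _ _ z)) (trans (sum-ext z pt)
    (trans (sum-⊗ (ι A) _ z) (cong (ι A ⊗_) (trans (sum-⊕ _ _ z) (cong₂ _⊕_
      (trans (sum-⊖ _ _ z) (cong (sum (λ i → unit i ⊗ L i) z ⊖_) (sym (zu z)))) (sum-⊗ C unit z))))))))
    where
    pt : ∀ i → unitDev i ⊗ L i ⊕ C₁ ⊗ unitDev i ⊕ (ι φ ⊗ L i ⊕ Γ ⊖ ι A ⊗ u (i ∸ 1)) ≡ ι A ⊗ (unit i ⊗ L i ⊖ (unit i ⊕ u (i ∸ 1)) ⊕ C ⊗ unit i)
    pt i = pt′ (ι A) (unit i) (ι φ) (L i) C₁ Γ (u (i ∸ 1)) φC₁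
      where
      pt′ : ∀ a n f l c g v → f ⊗ c ≡ g → (a ⊗ n ⊖ f) ⊗ l ⊕ c ⊗ (a ⊗ n ⊖ f) ⊕ (f ⊗ l ⊕ g ⊖ a ⊗ v) ≡ a ⊗ (n ⊗ l ⊖ (n ⊕ v) ⊕ (ι 1 ⊕ c) ⊗ n)
      pt′ a n f l c g v refl = ring 6 0
          ((v0 :* v1 :- v2) :* v3 :+ v4 :* (v0 :* v1 :- v2) :+ (v2 :* v3 :+ v2 :* v4 :- v0 :* v5))
          (v0 :* (v1 :* v3 :- (v1 :+ v5) :+ (# 1 :+ v4) :* v1))

  P-eq : ∀ z → P (suc z) ≡ Γ ⊕ ι φ ⊗ L (suc z) ⊕ sum (λ j → Γ ⊖ w j) z
  P-eq zero = e (ι φ) (L 1) Γ (ι A)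
    where
    e : ∀ f l g a → ι 0 ⊕ (f ⊗ l ⊕ g ⊖ a ⊗ ι 0) ≡ g ⊕ f ⊗ l ⊕ ι 0
    e f l g a = ring 4 0 (# 0 :+ (v0 :* v1 :+ v2 :- v3 :* # 0)) (v2 :+ v0 :* v1 :+ # 0)
  P-eq (suc z) = trans (cong (_⊕ (ι φ ⊗ L (suc (suc z)) ⊕ Γ ⊖ ι A ⊗ u (suc z))) (P-eq z))
    (e Γ (ι φ) (L (suc z)) (sum (λ j → Γ ⊖ w j) z) (L (suc (suc z))) (ι A ⊗ u (suc z)))
    where
    e : ∀ g f l s l′ v → g ⊕ f ⊗ l ⊕ s ⊕ (f ⊗ l′ ⊕ g ⊖ v) ≡ g ⊕ f ⊗ l′ ⊕ (s ⊕ (g ⊖ (v ⊖ f ⊗ l)))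
    e g f l s l′ v = ring 6 0 (v0 :+ v1 :* v2 :+ v3 :+ (v1 :* v4 :+ v0 :- v5)) (v0 :+ v1 :* v4 :+ (v3 :+ (v0 :- (v5 :- v1 :* v2))))

  Q-bound : ∀ z → 1 ≤ z → z ≤ N → Within (ι 32 ⊗ (Δ ⊗ Δ ⊗ (ι 1 ⊕ L z))) (Q z)
  Q-bound zero () _
  Q-bound (suc z) _ z<N = within-scale A 1≤A (within-≡ (AQ (suc z)) (within-weaken weak
    (within-⊕ (within-⊕ dev (within-⊗ (C₁-bound 1≤N) (unitDev-Δ (suc z)))) (within-≡ (sym (P-eq z))
      (within-⊕ (within-⊕ (Γ-bound 1≤N) (within-⊗ (within-nonneg (0≤ι φ) φ≤Δ) (within-nonneg 0≤L ⊑-refl))) rest)))))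
    where
    1≤N : 1 ≤ N
    1≤N = ℕ.≤-trans (s≤s z≤n) z<N
    0≤L : ι 0 ⊑ L (suc z)
    0≤L = L-nonneg (s≤s z≤n) z<N
    dev : Within (ι 2 ⊗ (Δ ⊗ L (suc z))) (sum (λ i → unitDev i ⊗ L i) (suc z))
    dev = Summation.increasing unitDev L Δ unitDev-Δ (suc z) (λ i 1≤i i<z → L-suc i 1≤i (ℕ.≤-trans i<z z<N)) (s≤s z≤n) (L-nonneg (s≤s z≤n) 1≤N) 0≤L
    H≤ : harmonic z ⊑ L (suc z) ⊕ ι 4
    H≤ = ⊑-trans (sum-monoʳ inv (ℕ.n≤1+n z) (λ i _ _ → inv-nonneg i)) (harmonic-bound (suc z) (s≤s z≤n) z<N)
    rest : Within (ι 5 ⊗ Δ ⊗ (L (suc z) ⊕ ι 4)) (sum (λ j → Γ ⊖ w j) z)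
    rest = within-weaken (⊑-trans (≡⇒⊑ (trans (sum-ext z (λ j → sym (⊗-assoc _ _ _))) (sum-⊗ (ι 5 ⊗ Δ) inv z))) (⊗-monoˡ (⊗-nonneg (0≤ι 5) 0≤Δ) H≤))
      (within-sum z (λ j 1≤j j≤z → w-Γ j 1≤j (ℕ.≤-trans j≤z (ℕ.<⇒≤ z<N))))
    weak : ι 2 ⊗ (Δ ⊗ L (suc z)) ⊕ ι 6 ⊗ Δ ⊗ Δ ⊕ (ι 6 ⊗ Δ ⊕ Δ ⊗ L (suc z) ⊕ ι 5 ⊗ Δ ⊗ (L (suc z) ⊕ ι 4)) ⊑ ι 32 ⊗ (Δ ⊗ Δ ⊗ (ι 1 ⊕ L (suc z)))
    weak = linear 1 1
        (# 2 :* (n0 :* n0 :* v0) :+ # 6 :* (n0 :* n0) :* (n0 :* n0) :+ (# 6 :* (n0 :* n0) :+ n0 :* n0 :* v0 :+ # 5 :* (n0 :* n0) :* (v0 :+ # 4)))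
        (# 32 :* (n0 :* n0 :* (n0 :* n0) :* (# 1 :+ v0)))
        (# 26 :* (n0 :* n0) :+ # 8 :* (n0 :* n0 :* v0) :+ # 24 :* # 0)
        (# 26 :* (n0 :* n0 :* (n0 :* n0)) :+ # 8 :* (n0 :* n0 :* (n0 :* n0) :* v0) :+ # 24 :* (n0 :* n0 :* (n0 :* n0) :* v0))
        (26 ⊙ Δ≤DD ⊞ 8 ⊙ ⊗-monoʳ 0≤L Δ≤DD ⊞ 24 ⊙ ⊗-nonneg (⊗-nonneg 0≤Δ 0≤Δ) 0≤L)

  -- The class-c analogue of Σ_{n ≤ z} log n − y Σ 1/n + C Σ 1, for z ≤ y ≤ z + 1.
  G-bound : ∀ k c z yy → Coprime k A → z ≤ N → ι z ⊑ yy → yy ⊑ ι z ⊕ ι 1 → 1 ≤ z →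
    Within (ι 40 ⊗ (Δ ⊗ Δ ⊗ (ι 1 ⊕ L z))) (ι φ ⊗ sum (λ i → class k c i ⊗ L i) z ⊖ yy ⊗ u z ⊕ C ⊗ sum unit z)
  G-bound k c z yy cop z≤N lo hi 1≤z = within-≡ eq (within-weaken weak (within-⊖ (within-⊕ dev (Q-bound z 1≤z z≤N)) tail))
    where
    0≤L : ι 0 ⊑ L z
    0≤L = L-nonneg 1≤z z≤N
    dev : Within (ι 2 ⊗ (Δ ⊗ L z)) (sum (λ i → classDev k c i ⊗ L i) z)
    dev = Summation.increasing (classDev k c) L Δ (classDev-Δ k c cop) z (λ i 1≤i i<z → L-suc i 1≤i (ℕ.≤-trans i<z z≤N)) 1≤z
      (L-nonneg (s≤s z≤n) (ℕ.≤-trans 1≤z z≤N)) 0≤L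
    hi′ : yy ⊖ ι z ⊑ ι 1
    hi′ = linear 1 1 (v0 :- n0) (# 1) v0 (n0 :+ # 1) hi
    tail : Within (ι 1 ⊗ (L z ⊕ ι 4)) ((yy ⊖ ι z) ⊗ u z)
    tail = within-⊗ (within-nonneg (⊑⇒⊖ lo) hi′) (within-nonneg (u-nonneg z) (⊑-trans (u≤harmonic z) (harmonic-bound z 1≤z z≤N)))
    weak : ι 2 ⊗ (Δ ⊗ L z) ⊕ ι 32 ⊗ (Δ ⊗ Δ ⊗ (ι 1 ⊕ L z)) ⊕ ι 1 ⊗ (L z ⊕ ι 4) ⊑ ι 40 ⊗ (Δ ⊗ Δ ⊗ (ι 1 ⊕ L z))
    weak = linear 1 1
        (# 2 :* (n0 :* n0 :* v0) :+ # 32 :* (n0 :* n0 :* (n0 :* n0) :* (# 1 :+ v0)) :+ # 1 :* (v0 :+ # 4))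
        (# 40 :* (n0 :* n0 :* (n0 :* n0) :* (# 1 :+ v0)))
        (# 4 :* (n0 :* n0) :+ # 4 :* # 1 :+ # 3 :* (n0 :* n0 :* v0) :+ # 1 :* v0 :+ # 5 :* # 0 :+ # 4 :* # 0)
        (# 4 :* (n0 :* n0 :* (n0 :* n0)) :+ # 4 :* (n0 :* n0) :+ # 3 :* (n0 :* n0 :* (n0 :* n0) :* v0) :+ n0 :* n0 :* v0 :+ # 5 :* (n0 :* n0 :* (n0 :* n0) :* v0) :+ # 4 :* (n0 :* n0 :* (n0 :* n0)))
        (4 ⊙ Δ≤DD ⊞ 4 ⊙ 1≤Δ ⊞ 3 ⊙ ⊗-monoʳ 0≤L Δ≤DD ⊞ ⊗-monoʳ 0≤L 1≤Δ ⊞ 5 ⊙ ⊗-nonneg (⊗-nonneg 0≤Δ 0≤Δ) 0≤L ⊞ 4 ⊙ ⊗-nonneg 0≤Δ 0≤Δ)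
    split : sum (λ i → classDev k c i ⊗ L i) z ≡ ι φ ⊗ sum (λ i → class k c i ⊗ L i) z ⊖ sum (λ i → unit i ⊗ L i) z
    split = trans (sum-ext z (λ i → pt (ι φ) (class k c i) (unit i) (L i))) (trans (sum-⊖ _ _ z) (cong (_⊖ sum (λ i → unit i ⊗ L i) z) (sum-⊗ (ι φ) _ z)))
      where
      pt : ∀ f x n l → (f ⊗ x ⊖ n) ⊗ l ≡ f ⊗ (x ⊗ l) ⊖ n ⊗ l
      pt f x n l = ring 4 0 ((v0 :* v1 :- v2) :* v3) (v0 :* (v1 :* v3) :- v2 :* v3)
    eq : sum (λ i → classDev k c i ⊗ L i) z ⊕ Q z ⊖ (yy ⊖ ι z) ⊗ u z ≡ ι φ ⊗ sum (λ i → class k c i ⊗ L i) z ⊖ yy ⊗ u z ⊕ C ⊗ sum unit z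
    eq = trans (cong (λ t → t ⊕ Q z ⊖ (yy ⊖ ι z) ⊗ u z) split) (e (ι φ ⊗ sum (λ i → class k c i ⊗ L i) z) (sum (λ i → unit i ⊗ L i) z) (ι z) (u z) yy (C ⊗ sum unit z))
      where
      e : ∀ a b z u y c → a ⊖ b ⊕ (b ⊖ z ⊗ u ⊕ c) ⊖ (y ⊖ z) ⊗ u ≡ a ⊖ y ⊗ u ⊕ c
      e a b z u y c = ring 6 0 (v0 :- v1 :+ (v1 :- v2 :* v3 :+ v4) :- (v5 :- v2) :* v3) (v0 :- v5 :* v3 :+ v4)

÷-pos : ∀ {X d} → 1 ≤ d → d ≤ X → 1 ≤ X ÷ d
÷-pos {X} {d} 1≤d d≤X = ÷-greatest 1≤d (subst (_≤ X) (sym (ℕ.*-identityʳ d)) d≤X)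

module Formula {N : ℕ} (ls : LogSystem N) (A : ℕ) {{nz : NonZero A}} where
  open Densities ls A public

  unit-* : ∀ {k} n → Coprime k A → unit (k * n) ≡ unit n
  unit-* {k} n cop = χ-cong (coprime? (k * n) A) (coprime? n A) (coprime-*ʳ {k} {n}) (coprime-* cop)

  ψᶜ : ℕ → ℕ → ℕ → R
  ψᶜ k c = sum (λ m → class k c m ⊗ Λ m)

  ψᶜ-mono : ∀ k c {x y} → x ≤ y → ψᶜ k c x ⊑ ψᶜ k c y
  ψᶜ-mono k c x≤y = sum-monoʳ _ x≤y (λ i _ _ → ⊗-nonneg (class-nonneg k c i) (Λ-nonneg i))

  ψᶜ-nonneg : ∀ k c x → ι 0 ⊑ ψᶜ k c x
  ψᶜ-nonneg k c x = sum-nonneg x (λ i _ _ → ⊗-nonneg (class-nonneg k c i) (Λ-nonneg i))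

  ψᶜ≤ψ : ∀ k c x → ψᶜ k c x ⊑ ψ x
  ψᶜ≤ψ k c x = sum-mono x (λ i _ _ → ⊑-trans (⊗-monoʳ (Λ-nonneg i) (class≤1 k c i)) (≡⇒⊑ (⊗-identityˡ _)))

  ψᶜ-zero : ∀ {k c} x → Coprime c A → ¬ Coprime k A → ψᶜ k c x ≡ ι 0
  ψᶜ-zero {k} {c} x cc ¬ck = sum-zero x (λ m _ _ → trans (cong (_⊗ Λ m) (χ-no (k * m ≈? c) (λ h → ¬ck (proj₁ (class-coprime {k} {c} {m} cc h))))) (⊗-zeroˡ _))

  class-assoc : ∀ k c n m → class (k * n) c m ≡ class k c (n * m)
  class-assoc k c n m = cong (λ t → χ (t % A ℕ.≟ c % A)) (ℕ.*-assoc k n m)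

  -- Writes log i as the sum of Λ(m) over i = n m and sorts by n; if i is in the class c/k, then m
  -- is in the class c/(k n).
  ψᶜ-divisors : ∀ k c z → sum (λ n → ψᶜ (k * n) c (z ÷ n)) z ≡ sum (λ i → class k c i ⊗ L i) z
  ψᶜ-divisors k c z = trans (sum-hyperbola (λ n m → class (k * n) c m ⊗ Λ m) z)
    (trans (sum-cong z (λ m _ _ → trans (sum-ext (z ÷ m) (λ n → trans (cong (_⊗ Λ m) (trans (class-assoc k c n m) (cong (class k c) (ℕ.*-comm n m)))) (⊗-comm _ _)))
      (sum-⊗ (Λ m) (λ n → class k c (m * n)) (z ÷ m))))
    (trans (sum-divisorSum Λ (class k c) z) (sum-ext z (λ n → trans (⊗-comm _ _) (cong (class k c n ⊗_) (L-divisors n))))))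

  module At (κ c X : ℕ) (cκ : Coprime κ A) (cc : Coprime c A) (1≤X : 1 ≤ X) (X≤N : X ≤ N) where

    -- The deviation of φ ψ at X/k from its expected value. The shift by C makes the sums `G` over
    -- multiples logarithmically small.
    F : ℕ → R
    F k = ι φ ⊗ ψᶜ (κ * k) c (X ÷ k) ⊖ unit (κ * k) ⊗ (ι X ⊗ inv k ⊖ C)

    lx : ℕ → R
    lx k = L X ⊖ L k

    G : ℕ → R
    G d = sum (λ n → F (d * n)) (X ÷ d)

    G-eq : ∀ d → 1 ≤ d → Coprime (κ * d) A →
      ι φ ⊗ sum (λ i → class (κ * d) c i ⊗ L i) (X ÷ d) ⊖ ι X ⊗ inv d ⊗ u (X ÷ d) ⊕ C ⊗ sum unit (X ÷ d) ≡ G d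
    G-eq d 1≤d cop = sym (trans (sum-cong (X ÷ d) (λ n 1≤n _ → pt n 1≤n)) (trans (sum-⊕ _ _ z) (cong₂ _⊕_
      (trans (sum-⊖ _ _ z) (cong₂ _⊖_ (trans (sum-⊗ (ι φ) _ z) (cong (ι φ ⊗_) (ψᶜ-divisors (κ * d) c z)))
        (sum-⊗ (ι X ⊗ inv d) (λ n → unit n ⊗ inv n) z))) (sum-⊗ C unit z))))
      where
      z = X ÷ d
      pt : ∀ n → 1 ≤ n → F (d * n) ≡ ι φ ⊗ ψᶜ (κ * d * n) c (z ÷ n) ⊖ ι X ⊗ inv d ⊗ (unit n ⊗ inv n) ⊕ C ⊗ unit n
      pt n 1≤n = trans (cong₂ (λ p q → ι φ ⊗ p ⊖ q ⊗ (ι X ⊗ inv (d * n) ⊖ C))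
          (cong₂ (λ s t → ψᶜ s c t) (sym (ℕ.*-assoc κ d n)) (sym (÷-÷ X d n 1≤d 1≤n)))
          (trans (cong unit (sym (ℕ.*-assoc κ d n))) (unit-* n cop)))
        (trans (cong (λ t → ι φ ⊗ ψᶜ (κ * d * n) c (z ÷ n) ⊖ unit n ⊗ (ι X ⊗ t ⊖ C)) (inv-* d n 1≤d 1≤n))
          (e (ι φ ⊗ ψᶜ (κ * d * n) c (z ÷ n)) (unit n) (ι X) (inv d) (inv n) C))
        where
        e : ∀ p n x i j c → p ⊖ n ⊗ (x ⊗ (i ⊗ j) ⊖ c) ≡ p ⊖ x ⊗ i ⊗ (n ⊗ j) ⊕ c ⊗ n
        e p n x i j c = ring 6 0 (v0 :- v1 :* (v2 :* (v3 :* v4) :- v5)) (v0 :- v2 :* v3 :* (v1 :* v4) :+ v5 :* v1)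

    lx-nonneg : ∀ d → 1 ≤ d → d ≤ X → ι 0 ⊑ lx d
    lx-nonneg d 1≤d d≤X = ⊑⇒⊖ (L-mono 1≤d d≤X X≤N)

    L÷≤lx : ∀ d → 1 ≤ d → d ≤ X → L (X ÷ d) ⊑ lx d
    L÷≤lx d 1≤d d≤X = linear 4 0 v0 (v1 :- v2) (v2 :+ v0 :+ v3) (v3 :+ v1) (≡⇒⊒ (L-* d (X ÷ d) 1≤d 1≤z) ⊞ L-mono (*-pos 1≤d 1≤z) (÷-lower X d) X≤N)
      where 1≤z = ÷-pos 1≤d d≤X

    G-within : ∀ d → 1 ≤ d → d ≤ X → Within (ι 40 ⊗ (Δ ⊗ Δ ⊗ (ι 1 ⊕ lx d))) (G d)
    G-within d 1≤d d≤X with coprime? (κ * d) A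
    ... | yes cop = within-≡ (G-eq d 1≤d cop) (within-weaken
          (⊗-monoˡ (0≤ι 40) (⊗-monoˡ (⊗-nonneg 0≤Δ 0≤Δ) (⊕-mono (⊑-refl {ι 1}) (L÷≤lx d 1≤d d≤X))))
          (G-bound (κ * d) c (X ÷ d) (ι X ⊗ inv d) cop (ℕ.≤-trans (÷≤ X d) X≤N) (proj₁ (inv-÷ X d 1≤d)) (proj₂ (inv-÷ X d 1≤d)) (÷-pos 1≤d d≤X)))
    ... | no ¬cop = within-≡ (sym zero-G) (within-nonneg ⊑-refl (⊗-nonneg (0≤ι 40) (⊗-nonneg (⊗-nonneg 0≤Δ 0≤Δ) (⊕-nonneg (0≤ι 1) (lx-nonneg d 1≤d d≤X)))))
      where
      ¬c : ∀ n → ¬ Coprime (κ * (d * n)) A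
      ¬c n h = ¬cop (coprime-*ˡ {κ * d} {n} (subst (λ t → Coprime t A) (sym (ℕ.*-assoc κ d n)) h))
      zero-G : G d ≡ ι 0
      zero-G = sum-zero (X ÷ d) (λ n _ _ → trans (cong₂ (λ p q → ι φ ⊗ p ⊖ q ⊗ (ι X ⊗ inv (d * n) ⊖ C))
        (ψᶜ-zero (X ÷ (d * n)) cc (¬c n)) (χ-no (coprime? (κ * (d * n)) A) (¬c n))) (e (ι φ) (ι X ⊗ inv (d * n) ⊖ C)))
        where
        e : ∀ f t → f ⊗ ι 0 ⊖ ι 0 ⊗ t ≡ ι 0
        e f t = ring 2 0 (v0 :* # 0 :- # 0 :* v1) (# 0)

    -- The inversion of Tatuzawa and Iseki: because log(X/(k n)) + log n = log(X/k), the sum of `Tk`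
    -- over the multiples of k is log(X/k) times G(k).
    Tk : ℕ → R
    Tk k = F k ⊗ lx k ⊕ sum (λ j → Λ j ⊗ F (k * j)) (X ÷ k)

    sum-Tk : ∀ k → 1 ≤ k → sum (λ n → Tk (k * n)) (X ÷ k) ≡ lx k ⊗ G k
    sum-Tk k 1≤k = trans (sum-⊕ _ _ z) (trans (cong (sum (λ n → F (k * n) ⊗ lx (k * n)) z ⊕_) second)
      (trans (sym (sum-⊕ _ _ z)) (trans (sum-cong z (λ n 1≤n _ → pt n 1≤n)) (sum-⊗ (lx k) (λ n → F (k * n)) z))))
      where
      z = X ÷ k
      second : sum (λ n → sum (λ j → Λ j ⊗ F (k * n * j)) (X ÷ (k * n))) z ≡ sum (λ n → L n ⊗ F (k * n)) z
      second = trans (sum-cong z (λ n 1≤n _ → trans (cong (sum (λ j → Λ j ⊗ F (k * n * j))) (sym (÷-÷ X k n 1≤k 1≤n)))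
          (sum-ext (z ÷ n) (λ j → cong (λ t → Λ j ⊗ F t) (trans (ℕ.*-assoc k n j) (cong (k *_) (ℕ.*-comm n j)))))))
        (trans (sum-hyperbola (λ n j → Λ j ⊗ F (k * (j * n))) z)
        (trans (sum-ext z (λ j → sum-⊗ (Λ j) (λ n → F (k * (j * n))) (z ÷ j)))
        (trans (sum-divisorSum Λ (λ n → F (k * n)) z) (sum-ext z (λ n → cong (_⊗ F (k * n)) (L-divisors n))))))
      pt : ∀ n → 1 ≤ n → F (k * n) ⊗ lx (k * n) ⊕ L n ⊗ F (k * n) ≡ lx k ⊗ F (k * n)
      pt n 1≤n = trans (cong (λ t → F (k * n) ⊗ (L X ⊖ t) ⊕ L n ⊗ F (k * n)) (L-* k n 1≤k 1≤n)) (e (F (k * n)) (L X) (L k) (L n))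
        where
        e : ∀ f x k n → f ⊗ (x ⊖ (k ⊕ n)) ⊕ n ⊗ f ≡ (x ⊖ k) ⊗ f
        e f x k n = ring 4 0 (v0 :* (v1 :- (v2 :+ v3)) :+ v3 :* v0) ((v1 :- v2) :* v0)

    -- Möbius inversion of `sum-Tk`, which isolates k = 1.
    Tk-1 : Tk 1 ≡ sum (λ d → μ d ⊗ (lx d ⊗ G d)) X
    Tk-1 = sym (trans (sum-cong X (λ d 1≤d _ → cong (μ d ⊗_) (sym (sum-Tk d 1≤d)))) (trans (sum-divisorSum μ Tk X)
      (trans (sum-cong X (λ n 1≤n _ → cong (_⊗ Tk n) (μ-divisors n 1≤n))) (trans (sum-single (λ n → χ (n ℕ.≟ 1) ⊗ Tk n) 1 X (s≤s z≤n) 1≤X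
        (λ n _ _ n≢1 → trans (cong (_⊗ Tk n) (χ-no (n ℕ.≟ 1) n≢1)) (⊗-zeroˡ _))) (trans (cong (_⊗ Tk 1) (χ-yes (1 ℕ.≟ 1) refl)) (⊗-identityˡ _))))))

    -- The factors log(X/d) and log²(X/d) sum to O(X), so the trivial bound |μ| ≤ 1 is enough.
    Tk-within : Within (ι 720 ⊗ (Δ ⊗ Δ ⊗ ι X)) (Tk 1)
    Tk-within = within-≡ (sym Tk-1) (within-weaken bound (within-sum X (λ d 1≤d d≤X →
        within-⊗ (μ-within d) (within-⊗ (within-nonneg (lx-nonneg d 1≤d d≤X) ⊑-refl) (G-within d 1≤d d≤X)))))
      where
      K = ι 40 ⊗ (Δ ⊗ Δ)
      bound : sum (λ d → ι 1 ⊗ (lx d ⊗ (ι 40 ⊗ (Δ ⊗ Δ ⊗ (ι 1 ⊕ lx d))))) X ⊑ ι 720 ⊗ (Δ ⊗ Δ ⊗ ι X)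
      bound = ⊑-trans (≡⇒⊑ (trans (sum-ext X (λ d → e (lx d) Δ)) (trans (sum-⊗ K _ X) (cong (K ⊗_) (sum-⊕ _ _ X)))))
        (⊑-trans (⊗-monoˡ (⊗-nonneg (0≤ι 40) (⊗-nonneg 0≤Δ 0≤Δ)) (u¹-bound X 1≤X X≤N ⊞ u²-bound X 1≤X X≤N)) (e₂ Δ (ι X)))
        where
        e : ∀ l d → ι 1 ⊗ (l ⊗ (ι 40 ⊗ (d ⊗ d ⊗ (ι 1 ⊕ l)))) ≡ ι 40 ⊗ (d ⊗ d) ⊗ (l ⊕ l ⊗ l)
        e l d = (ring 2 0 (# 1 :* (v0 :* (# 40 :* (v1 :* v1 :* (# 1 :+ v0))))) (# 40 :* (v1 :* v1) :* (v0 :+ v0 :* v0)))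
        e₂ : ∀ d x → ι 40 ⊗ (d ⊗ d) ⊗ (ι 2 ⊗ x ⊕ ι 16 ⊗ x) ⊑ ι 720 ⊗ (d ⊗ d ⊗ x)
        e₂ d x = ≡⇒⊑ (ring 2 0 (# 40 :* (v0 :* v0) :* (# 2 :* v1 :+ # 16 :* v1)) (# 720 :* (v0 :* v0 :* v1)))

    S₂ : R
    S₂ = ψᶜ κ c X ⊗ L X ⊕ sum (λ j → Λ j ⊗ ψᶜ (κ * j) c (X ÷ j)) X

    sᵘ ψᵘ : R
    sᵘ = sum (λ j → unit j ⊗ (Λ j ⊗ inv j)) X
    ψᵘ = sum (λ j → unit j ⊗ Λ j) X

    Tk-eq : Tk 1 ≡ ι φ ⊗ S₂ ⊖ ι X ⊗ (L X ⊕ sᵘ) ⊕ C ⊗ (L X ⊕ ψᵘ)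
    Tk-eq = trans (cong₂ _⊕_ first second) (e (ι φ) (ψᶜ κ c X) (ι X) C (L X) (sum (λ j → Λ j ⊗ ψᶜ (κ * j) c (X ÷ j)) X) sᵘ ψᵘ)
      where
      κ1 : κ * 1 ≡ κ
      κ1 = ℕ.*-identityʳ κ
      unitκ : unit κ ≡ ι 1
      unitκ = χ-yes (coprime? κ A) cκ
      first : F 1 ⊗ lx 1 ≡ (ι φ ⊗ ψᶜ κ c X ⊖ ι 1 ⊗ (ι X ⊗ ι 1 ⊖ C)) ⊗ (L X ⊖ ι 0)
      first = cong₂ _⊗_ (trans (cong₂ (λ s t → ι φ ⊗ ψᶜ s c t ⊖ unit s ⊗ (ι X ⊗ inv 1 ⊖ C)) κ1 (÷-1 X))
        (cong₂ (λ s t → ι φ ⊗ ψᶜ κ c X ⊖ s ⊗ (ι X ⊗ t ⊖ C)) unitκ inv-1)) (cong (L X ⊖_) L-1)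
      second : sum (λ j → Λ j ⊗ F (1 * j)) (X ÷ 1) ≡ ι φ ⊗ sum (λ j → Λ j ⊗ ψᶜ (κ * j) c (X ÷ j)) X ⊖ ι X ⊗ sᵘ ⊕ C ⊗ ψᵘ
      second = trans (cong (sum (λ j → Λ j ⊗ F (1 * j))) (÷-1 X)) (trans (sum-ext X (λ j → trans (cong (λ t → Λ j ⊗ F t) (ℕ.*-identityˡ j))
          (trans (cong (λ t → Λ j ⊗ (ι φ ⊗ ψᶜ (κ * j) c (X ÷ j) ⊖ t ⊗ (ι X ⊗ inv j ⊖ C))) (unit-* j cκ))
            (e₂ (Λ j) (ι φ) (ψᶜ (κ * j) c (X ÷ j)) (unit j) (ι X) (inv j) C))))
        (trans (sum-⊕ _ _ X) (cong₂ _⊕_ (trans (sum-⊖ _ _ X) (cong₂ _⊖_ (sum-⊗ (ι φ) _ X) (sum-⊗ (ι X) _ X))) (sum-⊗ C _ X))))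
        where
        e₂ : ∀ l f p n x i c → l ⊗ (f ⊗ p ⊖ n ⊗ (x ⊗ i ⊖ c)) ≡ f ⊗ (l ⊗ p) ⊖ x ⊗ (n ⊗ (l ⊗ i)) ⊕ c ⊗ (n ⊗ l)
        e₂ l f p n x i c = ring 7 0
            (v0 :* (v1 :* v2 :- v3 :* (v4 :* v5 :- v6)))
            (v1 :* (v0 :* v2) :- v4 :* (v3 :* (v0 :* v5)) :+ v6 :* (v3 :* v0))
      e : ∀ f p x c l q s t → (f ⊗ p ⊖ ι 1 ⊗ (x ⊗ ι 1 ⊖ c)) ⊗ (l ⊖ ι 0) ⊕ (f ⊗ q ⊖ x ⊗ s ⊕ c ⊗ t) ≡ f ⊗ (p ⊗ l ⊕ q) ⊖ x ⊗ (l ⊕ s) ⊕ c ⊗ (l ⊕ t)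
      e f p x c l q s t = ring 8 0
          ((v0 :* v1 :- # 1 :* (v2 :* # 1 :- v3)) :* (v4 :- # 0) :+ (v0 :* v5 :- v2 :* v6 :+ v3 :* v7))
          (v0 :* (v1 :* v4 :+ v5) :- v2 :* (v4 :+ v6) :+ v3 :* (v4 :+ v7))

    sᵘ≤s : sᵘ ⊑ s X
    sᵘ≤s = sum-mono X (λ j _ _ → ⊑-trans (⊗-monoʳ (⊗-nonneg (Λ-nonneg j) (inv-nonneg j)) (unit≤1 j)) (≡⇒⊑ (⊗-identityˡ _)))

    ψᵘ≤ψ : ψᵘ ⊑ ψ X
    ψᵘ≤ψ = sum-mono X (λ j _ _ → ⊑-trans (⊗-monoʳ (Λ-nonneg j) (unit≤1 j)) (≡⇒⊑ (⊗-identityˡ _)))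

    ψᵘ-nonneg : ι 0 ⊑ ψᵘ
    ψᵘ-nonneg = sum-nonneg X (λ j _ _ → ⊗-nonneg (unit-nonneg j) (Λ-nonneg j))

    symmetry-sᵘ : Within (ι 790 ⊗ (Δ ⊗ Δ ⊗ ι X)) (ι φ ⊗ S₂ ⊖ ι X ⊗ (L X ⊕ sᵘ))
    symmetry-sᵘ = within-≡ (back (ι φ ⊗ S₂ ⊖ ι X ⊗ (L X ⊕ sᵘ)) (C ⊗ (L X ⊕ ψᵘ))) (within-weaken weak
      (within-⊖ (within-≡ Tk-eq Tk-within) (within-⊗ (C-bound (ℕ.≤-trans 1≤X X≤N)) (within-nonneg (⊕-nonneg (L-nonneg 1≤X X≤N) ψᵘ-nonneg) ten))))
      where
      ten : L X ⊕ ψᵘ ⊑ ι 10 ⊗ ι X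
      ten = linear 3 1 (v0 :+ v1) (# 10 :* n0) (v0 :+ v1 :+ v2) (# 2 :* n0 :+ v2 :+ # 8 :* n0) (L-linear X 1≤X X≤N ⊞ ψᵘ≤ψ ⊞ chebyshev X X≤N)
      back : ∀ a b → a ⊕ b ⊖ b ≡ a
      back a b = ring 2 0 (v0 :+ v1 :- v1) v0
      weak : ι 720 ⊗ (Δ ⊗ Δ ⊗ ι X) ⊕ ι 7 ⊗ Δ ⊗ (ι 10 ⊗ ι X) ⊑ ι 790 ⊗ (Δ ⊗ Δ ⊗ ι X)
      weak = linear 0 2
          (# 720 :* (n0 :* n0 :* (n0 :* n0) :* n1) :+ # 7 :* (n0 :* n0) :* (# 10 :* n1))
          (# 790 :* (n0 :* n0 :* (n0 :* n0) :* n1)) (# 70 :* (n0 :* n0 :* n1)) (# 70 :* (n0 :* n0 :* (n0 :* n0) :* n1))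
          (70 ⊙ ⊗-monoʳ (0≤ι X) Δ≤DD)

    -- Comparing the class of 1 with all integers bounds the mass of the prime powers prime to A from below.
    count-bound : ∀ d z → Coprime d A → ι A ⊗ (ι φ ⊗ sum (class d 1) z) ⊑ ι φ ⊗ ι z ⊕ ι 2 ⊗ (ι A ⊗ Δ)
    count-bound d z cop = linear 4 3
        (n0 :* (n1 :* v0)) (n1 :* n2 :+ # 2 :* (n0 :* (n0 :* n0)))
        (n0 :* v1 :+ v2 :+ n0 :* n0 :+ # 1 :* (n0 :* n0) :+ n0 :* (n1 :* v0 :- v3) :+ (n0 :* v3 :- n2 :* n1))
        (n0 :* (n0 :* n0) :+ n0 :* n0 :+ # 1 :* (n0 :* n0) :+ n0 :* (n0 :* n0) :+ n0 :* v1 :+ v2)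
        (⊗-monoˡ (0≤ι A) (proj₂ (classDev-Δ d 1 cop z)) ⊞ proj₂ (unitDev-Δ z) ⊞ ≡⇒⊒ (⊗-identityˡ Δ) ⊞ ⊗-monoʳ 0≤Δ (ι-mono 1≤A)
        ⊞ ⊗-monoˡ (0≤ι A) (≡⇒⊒ cd) ⊞ ≡⇒⊒ ud)
      where
      cd : sum (classDev d 1) z ≡ ι φ ⊗ sum (class d 1) z ⊖ sum unit z
      cd = trans (sum-⊖ _ _ z) (cong (_⊖ sum unit z) (sum-⊗ (ι φ) (class d 1) z))
      ud : sum unitDev z ≡ ι A ⊗ sum unit z ⊖ ι z ⊗ ι φ
      ud = trans (sum-⊖ _ _ z) (cong₂ _⊖_ (sum-⊗ (ι A) unit z) (sum-const (ι φ) z))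

    T¹ : R
    T¹ = sum (λ n → class 1 1 n ⊗ L n) X

    T¹-upper : ι A ⊗ (ι φ ⊗ T¹) ⊑ ι φ ⊗ (ι X ⊗ sᵘ) ⊕ ι 2 ⊗ (ι A ⊗ Δ) ⊗ ψᵘ
    T¹-upper = ⊑-trans (≡⇒⊑ expand) (⊑-trans (sum-mono X pt) (≡⇒⊑ (trans (sum-⊕ _ _ X) (cong₂ _⊕_
        (trans (sum-⊗ (ι φ) _ X) (cong (ι φ ⊗_) (sum-⊗ (ι X) _ X))) (sum-⊗ (ι 2 ⊗ (ι A ⊗ Δ)) _ X)))))
      where
      expand : ι A ⊗ (ι φ ⊗ T¹) ≡ sum (λ d → Λ d ⊗ (ι A ⊗ (ι φ ⊗ sum (class d 1) (X ÷ d)))) X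
      expand = trans (cong (λ t → ι A ⊗ (ι φ ⊗ t)) (trans (sum-ext X (λ n → trans (⊗-comm _ _) (cong (_⊗ class 1 1 n) (sym (L-divisors n)))))
          (trans (sym (sum-divisorSum Λ (class 1 1) X)) (sum-ext X (λ d → cong (Λ d ⊗_) (sum-ext (X ÷ d) (λ m → trans (sym (class-assoc 1 1 d m)) (cong (λ t → class t 1 m) (ℕ.*-identityˡ d)))))))))
        (trans (sym (⊗-assoc _ _ _)) (trans (sym (sum-⊗ (ι A ⊗ ι φ) _ X)) (sum-ext X (λ d → e (ι A) (ι φ) (Λ d) (sum (class d 1) (X ÷ d))))))
        where
        e : ∀ a f l s → a ⊗ f ⊗ (l ⊗ s) ≡ l ⊗ (a ⊗ (f ⊗ s))
        e a f l s = ring 4 0 (v0 :* v1 :* (v2 :* v3)) (v2 :* (v0 :* (v1 :* v3)))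
      pt : ∀ d → 1 ≤ d → d ≤ X → Λ d ⊗ (ι A ⊗ (ι φ ⊗ sum (class d 1) (X ÷ d))) ⊑ ι φ ⊗ (ι X ⊗ (unit d ⊗ (Λ d ⊗ inv d))) ⊕ ι 2 ⊗ (ι A ⊗ Δ) ⊗ (unit d ⊗ Λ d)
      pt d 1≤d _ with coprime? d A
      ... | yes cop = pt′ (⊗-monoˡ (Λ-nonneg d) (⊑-trans (count-bound d (X ÷ d) cop) (⊕-mono (⊗-monoˡ (0≤ι φ) (proj₁ (inv-÷ X d 1≤d))) ⊑-refl)))
        where
        pt′ : ∀ {l f x i k s} → l ⊗ s ⊑ l ⊗ (f ⊗ (x ⊗ i) ⊕ k) → l ⊗ s ⊑ f ⊗ (x ⊗ (ι 1 ⊗ (l ⊗ i))) ⊕ k ⊗ (ι 1 ⊗ l)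
        pt′ {l} {f} {x} {i} {k} {s} h = linear 6 0
            (v0 :* v1) (v2 :* (v3 :* (# 1 :* (v0 :* v4))) :+ v5 :* (# 1 :* v0)) (v0 :* v1)
            (v0 :* (v2 :* (v3 :* v4) :+ v5))
            h
      ... | no ¬cop = ≡⇒⊑ (trans (cong (λ t → Λ d ⊗ (ι A ⊗ (ι φ ⊗ t))) none) (e (Λ d) (ι A) (ι φ) (ι X) (inv d) (ι 2 ⊗ (ι A ⊗ Δ))))
        where
        none : sum (class d 1) (X ÷ d) ≡ ι 0
        none = sum-zero (X ÷ d) (λ m _ _ → χ-no (d * m ≈? 1) (λ h → ¬cop (proj₁ (class-coprime {d} {1} {m} (λ { (i , _) → ∣1 i }) h))))
          where
          ∣1 : ∀ {i} → i ∣ 1 → i ≡ 1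
          ∣1 = ∣1⇒≡1
        e : ∀ l a f x i k → l ⊗ (a ⊗ (f ⊗ ι 0)) ≡ f ⊗ (x ⊗ (ι 0 ⊗ (l ⊗ i))) ⊕ k ⊗ (ι 0 ⊗ l)
        e l a f x i k = ring 6 0 (v0 :* (v1 :* (v2 :* # 0))) (v2 :* (v3 :* (# 0 :* (v0 :* v4))) :+ v5 :* (# 0 :* v0))

    T¹-lower : ι φ ⊗ (ι X ⊗ L X) ⊑ ι A ⊗ (ι φ ⊗ T¹) ⊕ ι 2 ⊗ (ι φ ⊗ ι X) ⊕ ι 8 ⊗ (ι A ⊗ Δ ⊗ ι X)
    T¹-lower = linear 6 3
        (n0 :* (n1 :* v0)) (n2 :* (n0 :* v1) :+ # 2 :* (n0 :* n1) :+ # 8 :* (n2 :* (n2 :* n2) :* n1))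
        (n0 :* (n1 :* v0) :- # 2 :* (n2 :* n2 :* v0) :+ n2 :* (:- (# 2 :* (n2 :* n2 :* v0))) :+ # 2 :* (n2 :* n2 :* n2 :* v0) :+ # 2 :* (n2 :* n2 :* v0) :+ # 4 :* (# 1 :* (n2 :* n2 :* n1)) :+ n2 :* v2 :+ v3)
        (n0 :* (v4 :+ # 2 :* n1) :+ v3 :+ n2 :* v2 :+ # 2 :* (n2 :* n2 :* n2 :* (# 2 :* n1)) :+ # 2 :* (n2 :* n2 :* (# 2 :* n1)) :+ # 4 :* (n2 :* (n2 :* n2 :* n1)) :+ n2 :* (n0 :* v1 :- v5) :+ (n2 :* v5 :- n0 :* v4))
        (⊗-monoˡ (0≤ι φ) (T-lower X 1≤X X≤N) ⊞ proj₁ unitPart ⊞ ⊗-monoˡ (0≤ι A) (proj₁ classPart)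
        ⊞ 2 ⊙ ⊗-monoˡ (⊗-nonneg 0≤Δ (0≤ι A)) (L-linear X 1≤X X≤N) ⊞ 2 ⊙ ⊗-monoˡ 0≤Δ (L-linear X 1≤X X≤N) ⊞ 4 ⊙ ⊗-monoʳ (⊗-nonneg 0≤Δ (0≤ι X)) (ι-mono 1≤A)
        ⊞ ⊗-monoˡ (0≤ι A) (≡⇒⊑ cs) ⊞ ≡⇒⊑ us)
      where
      inc : ∀ i → 1 ≤ i → i < X → L i ⊑ L (suc i)
      inc i 1≤i i<X = L-suc i 1≤i (ℕ.≤-trans i<X X≤N)
      0≤L₁ : ι 0 ⊑ L 1
      0≤L₁ = ≡⇒⊒ L-1
      unitPart : Within (ι 2 ⊗ (Δ ⊗ L X)) (sum (λ i → unitDev i ⊗ L i) X)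
      unitPart = Summation.increasing unitDev L Δ unitDev-Δ X inc 1≤X 0≤L₁ (L-nonneg 1≤X X≤N)
      classPart : Within (ι 2 ⊗ (Δ ⊗ L X)) (sum (λ i → classDev 1 1 i ⊗ L i) X)
      classPart = Summation.increasing (classDev 1 1) L Δ (classDev-Δ 1 1 (λ { (i , _) → ∣1⇒≡1 i })) X inc 1≤X 0≤L₁ (L-nonneg 1≤X X≤N)
        where open import Data.Nat.Divisibility using (∣1⇒≡1)
      cs : sum (λ i → classDev 1 1 i ⊗ L i) X ≡ ι φ ⊗ T¹ ⊖ sum (λ i → unit i ⊗ L i) X
      cs = trans (sum-ext X (λ i → e (ι φ) (class 1 1 i) (unit i) (L i))) (trans (sum-⊖ _ _ X) (cong (_⊖ sum (λ i → unit i ⊗ L i) X) (sum-⊗ (ι φ) _ X)))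
        where
        e : ∀ f x n l → (f ⊗ x ⊖ n) ⊗ l ≡ f ⊗ (x ⊗ l) ⊖ n ⊗ l
        e f x n l = ring 4 0 ((v0 :* v1 :- v2) :* v3) (v0 :* (v1 :* v3) :- v2 :* v3)
      us : sum (λ i → unitDev i ⊗ L i) X ≡ ι A ⊗ sum (λ i → unit i ⊗ L i) X ⊖ ι φ ⊗ T X
      us = trans (sum-ext X (λ i → e (ι A) (unit i) (ι φ) (L i))) (trans (sum-⊖ _ _ X) (cong₂ _⊖_ (sum-⊗ (ι A) _ X) (sum-⊗ (ι φ) L X)))
        where
        e : ∀ a n f l → (a ⊗ n ⊖ f) ⊗ l ≡ a ⊗ (n ⊗ l) ⊖ f ⊗ l
        e a n f l = ring 4 0 ((v0 :* v1 :- v2) :* v3) (v0 :* (v1 :* v3) :- v2 :* v3)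

    -- An integer ≡ 1 has only prime power divisors prime to A. The logarithms of these integers
    -- therefore sum to at most (X/A) sᵘ + O(X), and on the other hand to (X/A) log X + O(X). The
    -- primes dividing A need no separate treatment.
    mertens-unit : L X ⊑ sᵘ ⊕ ι 26 ⊗ (Δ ⊗ Δ)
    mertens-unit = ⊗-cancelˡ (φ * X) (*-pos 1≤φ 1≤X) (linear 4 3
        (nat (n# 0 ∗ n# 1) :* v0) (nat (n# 0 ∗ n# 1) :* (v1 :+ # 26 :* (n2 :* n2 :* (n2 :* n2))))
        (n0 :* (n1 :* v0) :+ n2 :* (n0 :* v2) :+ # 2 :* (n2 :* (n2 :* n2) :* v3) :+ # 24 :* (n2 :* (n2 :* n2 :* n1)) :+ # 2 :* (n0 :* n1 :* # 1) :+ # 24 :* (# 1 :* (n2 :* n2 :* (n2 :* n2) :* n1)))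
        (n2 :* (n0 :* v2) :+ # 2 :* (n0 :* n1) :+ # 8 :* (n2 :* (n2 :* n2) :* n1) :+ (n0 :* (n1 :* v1) :+ # 2 :* (n2 :* (n2 :* n2)) :* v3) :+ # 2 :* (n2 :* (n2 :* n2) :* (# 8 :* n1)) :+ # 24 :* (n2 :* n2 :* (n2 :* n2 :* n1)) :+ # 2 :* (n0 :* n1 :* (n2 :* n2 :* (n2 :* n2))) :+ # 24 :* (n0 :* (n2 :* n2 :* (n2 :* n2) :* n1)))
        (T¹-lower ⊞ T¹-upper
        ⊞ 2 ⊙ ⊗-monoˡ (⊗-nonneg (0≤ι A) 0≤Δ) (⊑-trans ψᵘ≤ψ (chebyshev X X≤N))
        ⊞ 24 ⊙ ⊗-monoʳ (⊗-nonneg 0≤Δ (0≤ι X)) A≤Δ ⊞ 2 ⊙ ⊗-monoˡ (⊗-nonneg (0≤ι φ) (0≤ι X)) (⊑-trans 1≤Δ Δ≤DD)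
        ⊞ 24 ⊙ ⊗-monoʳ (⊗-nonneg (⊗-nonneg 0≤Δ 0≤Δ) (0≤ι X)) (ι-mono 1≤φ)))

    -- `symmetry-sᵘ` with sᵘ = log X + O(1): from below by `mertens-unit`, from above by Mertens.
    symmetry : Within (ι 824 ⊗ (Δ ⊗ Δ ⊗ ι X)) (ι φ ⊗ S₂ ⊖ ι 2 ⊗ (ι X ⊗ L X))
    symmetry = linear 4 3
        (:- (# 824 :* (n0 :* n0 :* (n0 :* n0) :* n1))) (n2 :* (v0 :* v1 :+ v2) :- # 2 :* (n1 :* v1))
        ((:- (# 790 :* (n0 :* n0 :* (n0 :* n0) :* n1))) :+ n1 :* v1 :+ # 8 :* # 0)
        (n2 :* (v0 :* v1 :+ v2) :- n1 :* (v1 :+ v3) :+ n1 :* (v3 :+ # 26 :* (n0 :* n0 :* (n0 :* n0))) :+ # 8 :* (n0 :* n0 :* (n0 :* n0) :* n1))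
        (proj₁ symmetry-sᵘ ⊞ ⊗-monoˡ (0≤ι X) mertens-unit ⊞ 8 ⊙ ⊗-nonneg (⊗-nonneg 0≤Δ 0≤Δ) (0≤ι X))
             , linear 4 3
                 (n0 :* (v0 :* v1 :+ v2) :- # 2 :* (n1 :* v1)) (# 824 :* (n2 :* n2 :* (n2 :* n2) :* n1))
                 (n0 :* (v0 :* v1 :+ v2) :- n1 :* (v1 :+ v3) :+ n1 :* v3 :+ # 34 :* (# 1 :* n1) :+ # 26 :* # 0)
                 (# 790 :* (n2 :* n2 :* (n2 :* n2) :* n1) :+ n1 :* (v1 :+ # 8) :+ # 34 :* (n2 :* n2 :* (n2 :* n2) :* n1) :+ # 26 :* n1)
                 (proj₂ symmetry-sᵘ ⊞ ⊗-monoˡ (0≤ι X) (⊑-trans sᵘ≤s (mertens-upper X 1≤X X≤N)) ⊞ 34 ⊙ ⊗-monoʳ (0≤ι X) (⊑-trans 1≤Δ Δ≤DD) ⊞ 26 ⊙ 0≤ι X)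

-- The Brun–Titchmarsh inequality and deficient classes

sum-diff : ∀ (f : ℕ → R) {m n} → m ≤ n → sum f n ⊖ sum f m ≡ sum (λ i → f (m + i)) (n ∸ m)
sum-diff f {m} {n} m≤n = trans (cong (_⊖ sum f m) (trans (cong (sum f) (sym (ℕ.m+[n∸m]≡n m≤n))) (sum-split f m (n ∸ m))))
  (e (sum f m) (sum (λ i → f (m + i)) (n ∸ m)))
  where
  e : ∀ a b → a ⊕ b ⊖ a ≡ b
  e a b = ring 2 0 (v0 :+ v1 :- v0) v1

sum-diff-mono : ∀ (f g : ℕ → R) {m n} → m ≤ n → (∀ i → m < i → i ≤ n → f i ⊑ g i) → sum f n ⊖ sum f m ⊑ sum g n ⊖ sum g m
sum-diff-mono f g {m} {n} m≤n h = ⊑-trans (≡⇒⊑ (sum-diff f m≤n)) (⊑-trans (sum-mono (n ∸ m) (λ i 1≤i i≤ → h (m + i)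
  (subst (_≤ m + i) (ℕ.+-comm m 1) (ℕ.+-monoʳ-≤ m 1≤i)) (subst (m + i ≤_) (ℕ.m+[n∸m]≡n m≤n) (ℕ.+-monoʳ-≤ m i≤)))) (≡⇒⊒ (sum-diff g m≤n)))

module Deficiency {N : ℕ} (ls : LogSystem N) (A : ℕ) {{nz : NonZero A}} where
  open Formula ls A public

  K K₁ : R
  K = ι 824 ⊗ (Δ ⊗ Δ)
  K₁ = ι 2 ⊗ K ⊕ ι 4

  0≤K : ι 0 ⊑ K
  0≤K = ⊗-nonneg (0≤ι 824) (⊗-nonneg 0≤Δ 0≤Δ)

  0≤K₁ : ι 0 ⊑ K₁
  0≤K₁ = ⊕-nonneg (⊗-nonneg (0≤ι 2) 0≤K) (0≤ι 4)

  conv : ℕ → ℕ → ℕ → R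
  conv κ c x = sum (λ j → Λ j ⊗ ψᶜ (κ * j) c (x ÷ j)) x

  symmetry : ∀ κ c x → Coprime κ A → Coprime c A → 1 ≤ x → x ≤ N →
    Within (K ⊗ ι x) (ι φ ⊗ (ψᶜ κ c x ⊗ L x ⊕ conv κ c x) ⊖ ι 2 ⊗ (ι x ⊗ L x))
  symmetry κ c x cκ cc 1≤x x≤N = within-weaken (≡⇒⊑ (e Δ (ι x))) (At.symmetry κ c x cκ cc 1≤x x≤N)
    where
    e : ∀ d x → ι 824 ⊗ (d ⊗ d ⊗ x) ≡ ι 824 ⊗ (d ⊗ d) ⊗ x
    e d x = ring 2 0 (# 824 :* (v0 :* v0 :* v1)) (# 824 :* (v0 :* v0) :* v1)

  L-gap : ∀ y k → 1 ≤ y → k + y ≤ N → ι y ⊗ (L (k + y) ⊖ L y) ⊑ ι 2 ⊗ ι k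
  L-gap y zero    1≤y _  = linear 1 1 (n0 :* (v0 :- v0)) (# 2 :* # 0) (# 0) (# 0) (⊑-refl {ι 0})
  L-gap y (suc k) 1≤y le = linear 3 2
      (n0 :* (v0 :- v1)) (# 2 :* nat (lit 1 ∔ n# 1)) (n0 :* (v2 :- v1) :+ nat (n# 1 ∔ n# 0) :* (v0 :- v2) :+ # 0)
      (# 2 :* n1 :+ # 2 :+ n1 :* (v0 :- v2))
      (L-gap y k 1≤y (ℕ.<⇒≤ le) ⊞ L-growth (k + y) (ℕ.≤-trans 1≤y (ℕ.m≤n+m y k)) le
    ⊞ ⊗-nonneg (0≤ι k) (⊑⇒⊖ (L-suc (k + y) (ℕ.≤-trans 1≤y (ℕ.m≤n+m y k)) le)))

  L-gap′ : ∀ {y x} → 1 ≤ y → y ≤ x → x ≤ N → ι y ⊗ (L x ⊖ L y) ⊑ ι 2 ⊗ ι x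
  L-gap′ {y} {x} 1≤y y≤x x≤N = ⊑-trans (subst (λ t → ι y ⊗ (L t ⊖ L y) ⊑ ι 2 ⊗ ι (x ∸ y)) (ℕ.m∸n+n≡m y≤x)
    (L-gap y (x ∸ y) 1≤y (subst (_≤ N) (sym (ℕ.m∸n+n≡m y≤x)) x≤N))) (2 ⊙ ι-mono (ℕ.m∸n≤m x y))

  conv-mono : ∀ κ c {y x} → y ≤ x → conv κ c y ⊑ conv κ c x
  conv-mono κ c {y} {x} y≤x = ⊑-trans (sum-mono y (λ j _ _ → ⊗-monoˡ (Λ-nonneg j) (ψᶜ-mono (κ * j) c (÷-monoˡ j y≤x))))
    (sum-monoʳ _ y≤x (λ j _ _ → ⊗-nonneg (Λ-nonneg j) (ψᶜ-nonneg (κ * j) c (x ÷ j))))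

  conv-nonneg : ∀ κ c x → ι 0 ⊑ conv κ c x
  conv-nonneg κ c x = sum-nonneg x (λ j _ _ → ⊗-nonneg (Λ-nonneg j) (ψᶜ-nonneg (κ * j) c (x ÷ j)))

  brun-titchmarsh : ∀ κ c y x → Coprime κ A → Coprime c A → y ≤ x → 1 ≤ x → x ≤ N →
    ι φ ⊗ (ψᶜ κ c x ⊖ ψᶜ κ c y) ⊗ L x ⊑ ι 2 ⊗ (ι x ⊖ ι y) ⊗ L x ⊕ K₁ ⊗ ι x
  brun-titchmarsh κ c zero x cκ cc y≤x 1≤x x≤N = fin (proj₂ (symmetry κ c x cκ cc 1≤x x≤N)) (⊗-nonneg (0≤ι φ) (conv-nonneg κ c x)) (⊗-nonneg 0≤K (0≤ι x)) (0≤ι x)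
    where
    fin : ∀ {f p l v x k} → f ⊗ (p ⊗ l ⊕ v) ⊖ ι 2 ⊗ (x ⊗ l) ⊑ k ⊗ x → ι 0 ⊑ f ⊗ v → ι 0 ⊑ k ⊗ x → ι 0 ⊑ x →
      f ⊗ (p ⊖ ι 0) ⊗ l ⊑ ι 2 ⊗ (x ⊖ ι 0) ⊗ l ⊕ (ι 2 ⊗ k ⊕ ι 4) ⊗ x
    fin {f} {p} {l} {v} {x} {k} a b c d = linear 6 0
        (v0 :* (v1 :- # 0) :* v2) (# 2 :* (v3 :- # 0) :* v2 :+ (# 2 :* v4 :+ # 4) :* v3)
        (v0 :* (v1 :* v2 :+ v5) :- # 2 :* (v3 :* v2) :+ # 0 :+ # 0 :+ # 4 :* # 0)
        (v4 :* v3 :+ v0 :* v5 :+ v4 :* v3 :+ # 4 :* v3)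
        (a ⊞ b ⊞ c ⊞ 4 ⊙ d)
  brun-titchmarsh κ c y@(suc _) x cκ cc y≤x 1≤x x≤N = linear 9 4
      (n0 :* (v0 :- (v1 :+ v2 :* v3)) :* v4)
      (# 2 :* (n1 :- nat (lit 1 ∔ n# 2)) :* v4 :+ (# 2 :* (# 824 :* (n3 :* n3 :* (n3 :* n3))) :+ # 4) :* n1)
      (n0 :* (v0 :* v4 :+ v5) :- # 2 :* (n1 :* v4) :- # 824 :* (n3 :* n3 :* (n3 :* n3)) :* nat (lit 1 ∔ n# 2) :+ n0 :* (v6 :+ v3 :* v7) :+ n0 :* (v1 :+ v2 :* v3) :* v8 :+ # 2 :* (nat (lit 1 ∔ n# 2) :* (v4 :- v8)) :+ # 824 :* (n3 :* n3 :* (n3 :* n3)) :* nat (lit 1 ∔ n# 2))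
      (# 824 :* (n3 :* n3 :* (n3 :* n3)) :* n1 :+ (n0 :* ((v1 :+ v2 :* v3) :* v8 :+ (v6 :+ v3 :* v7)) :- # 2 :* (nat (lit 1 ∔ n# 2) :* v8)) :+ n0 :* v5 :+ n0 :* (v1 :+ v2 :* v3) :* v4 :+ # 2 :* (# 2 :* n1) :+ # 824 :* (n3 :* n3 :* (n3 :* n3)) :* n1)
      (proj₂ (symmetry κ c x cκ cc 1≤x x≤N) ⊞ proj₁ (symmetry κ c y cκ cc (s≤s z≤n) (ℕ.≤-trans y≤x x≤N))
    ⊞ ⊗-monoˡ (0≤ι φ) (conv-mono κ c y≤x) ⊞ ⊗-monoˡ (⊗-nonneg (0≤ι φ) (ψᶜ-nonneg κ c y)) (L-mono (s≤s z≤n) y≤x x≤N)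
    ⊞ 2 ⊙ L-gap′ (s≤s z≤n) y≤x x≤N ⊞ ⊗-monoˡ 0≤K (ι-mono y≤x))

  -- Stated with a multiplier λ ≤ log x so that no division by log x is needed.
  brun-titchmarsh-λ : ∀ λ′ κ c y x → Coprime κ A → Coprime c A → y ≤ x → 1 ≤ x → x ≤ N → ι 0 ⊑ λ′ → λ′ ⊑ L x →
    λ′ ⊗ (ι φ ⊗ (ψᶜ κ c x ⊖ ψᶜ κ c y)) ⊑ ι 2 ⊗ λ′ ⊗ (ι x ⊖ ι y) ⊕ K₁ ⊗ ι x
  brun-titchmarsh-λ λ′ κ c y x cκ cc y≤x 1≤x x≤N 0≤λ λ≤L with ⊑-total (ι φ ⊗ (ψᶜ κ c x ⊖ ψᶜ κ c y)) (ι 2 ⊗ (ι x ⊖ ι y))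
  -- If the increment stays below its main term, nothing is to be shown; otherwise the excess is
  -- positive and λ may be raised to log x.
  ... | inj₁ h = linear 3 4
      (v0 :* (n0 :* (v1 :- v2)))
      (# 2 :* v0 :* (n1 :- n2) :+ (# 2 :* (# 824 :* (n3 :* n3 :* (n3 :* n3))) :+ # 4) :* n1)
      (v0 :* (n0 :* (v1 :- v2)) :+ # 0)
      (v0 :* (# 2 :* (n1 :- n2)) :+ (# 2 :* (# 824 :* (n3 :* n3 :* (n3 :* n3))) :+ # 4) :* n1)
      (⊗-monoˡ 0≤λ h ⊞ ⊗-nonneg 0≤K₁ (0≤ι x))
  ... | inj₂ h = linear 4 4
      (v0 :* (n0 :* (v1 :- v2)))
      (# 2 :* v0 :* (n1 :- n2) :+ (# 2 :* (# 824 :* (n3 :* n3 :* (n3 :* n3))) :+ # 4) :* n1)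
      (v0 :* (n0 :* (v1 :- v2) :- # 2 :* (n1 :- n2)) :+ n0 :* (v1 :- v2) :* v3)
      (v3 :* (n0 :* (v1 :- v2) :- # 2 :* (n1 :- n2)) :+ (# 2 :* (n1 :- n2) :* v3 :+ (# 2 :* (# 824 :* (n3 :* n3 :* (n3 :* n3))) :+ # 4) :* n1))
      (⊗-monoʳ (⊑⇒⊖ h) λ≤L ⊞ brun-titchmarsh κ c y x cκ cc y≤x 1≤x x≤N)

  ψ⁽ᶜ⁾ : ℕ → R
  ψ⁽ᶜ⁾ = sum Λᶜ

  -- Concerns primes only; proper prime powers in the interval are charged to `ψ⁽ᶜ⁾`.
  Free : ℕ → ℕ → ℕ → ℕ → Set
  Free k c y x = ∀ m → y < m → m ≤ x → Prime m → ¬ (k * m ≈ c)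

  free-bound : ∀ k c y x → y ≤ x → Free k c y x → ψᶜ k c x ⊖ ψᶜ k c y ⊑ ψ⁽ᶜ⁾ x
  free-bound k c y x y≤x free = ⊑-trans (sum-diff-mono _ Λᶜ y≤x pt) (less (sum-nonneg y (λ i _ _ → Λᶜ-nonneg i)))
    where
    less : ∀ {a b} → ι 0 ⊑ b → a ⊖ b ⊑ a
    less {a} {b} h = linear 2 0 (v0 :- v1) v0 (# 0) v1 h
    pt : ∀ m → y < m → m ≤ x → class k c m ⊗ Λ m ⊑ Λᶜ m
    pt m y<m m≤x with prime? m
    ... | yes pm = ≡⇒⊑ (trans (cong (_⊗ Λ m) (χ-no (k * m ≈? c) (free m y<m m≤x pm))) (trans (⊗-zeroˡ _) (sym (⊗-zeroˡ _))))
    ... | no _   = ⊗-monoʳ (Λ-nonneg m) (class≤1 k c m)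

  -- Brun-Titchmarsh for the class c/(κ j) on (y/j, x/j], with the length shortened by e. The 1 pays
  -- for the floors, the last term for prime powers inside a gap.
  TermBound : R → ℕ → ℕ → ℕ → ℕ → ℕ → R → Set
  TermBound λ′ κ c y x j e = λ′ ⊗ (ι φ ⊗ (ψᶜ (κ * j) c (x ÷ j) ⊖ ψᶜ (κ * j) c (y ÷ j))) ⊑
    ι 2 ⊗ λ′ ⊗ ((ι x ⊖ ι y) ⊗ inv j ⊕ ι 1 ⊖ e) ⊕ ι 2 ⊗ K₁ ⊗ (ι x ⊗ inv j) ⊕ λ′ ⊗ (ι φ ⊗ ψ⁽ᶜ⁾ (x ÷ j))

  ψ⁽ᶜ⁾-nonneg : ∀ x → ι 0 ⊑ ψ⁽ᶜ⁾ x
  ψ⁽ᶜ⁾-nonneg x = sum-nonneg x (λ i _ _ → Λᶜ-nonneg i)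

  module Term (λ′ : R) (κ c y x j : ℕ) (cκ : Coprime κ A) (cc : Coprime c A) (y≤x : y ≤ x) (x≤N : x ≤ N)
    (1≤j : 1 ≤ j) (j≤x : j ≤ x) (0≤λ : ι 0 ⊑ λ′) (λ≤ : λ′ ⊑ L (x ÷ j)) where

    yⱼ xⱼ : ℕ
    yⱼ = y ÷ j
    xⱼ = x ÷ j

    len : ι xⱼ ⊖ ι yⱼ ⊑ (ι x ⊖ ι y) ⊗ inv j ⊕ ι 1
    len = linear 1 4 (n0 :- n1) ((n2 :- n3) :* v0 :+ # 1) (n0 :+ n3 :* v0) (n2 :* v0 :+ (n1 :+ # 1)) (proj₁ (inv-÷ x j 1≤j) ⊞ proj₂ (inv-÷ y j 1≤j))

    xⱼ≤N : xⱼ ≤ N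
    xⱼ≤N = ℕ.≤-trans (÷≤ x j) x≤N

    1≤xⱼ : 1 ≤ xⱼ
    1≤xⱼ = ÷-pos 1≤j j≤x

    plain : TermBound λ′ κ c y x j (ι 0)
    plain with coprime? (κ * j) A
    ... | yes cop = fin (brun-titchmarsh-λ λ′ (κ * j) c yⱼ xⱼ cop cc (÷-monoˡ j y≤x) 1≤xⱼ xⱼ≤N 0≤λ λ≤)
          (⊗-monoˡ 0≤λ len) (⊗-monoˡ 0≤K₁ (proj₁ (inv-÷ x j 1≤j))) (⊗-nonneg 0≤K₁ (0≤ι xⱼ)) (⊗-nonneg 0≤λ (⊗-nonneg (0≤ι φ) (ψ⁽ᶜ⁾-nonneg xⱼ)))
      where
      fin : ∀ {l a b w k v i d} → l ⊗ a ⊑ ι 2 ⊗ l ⊗ b ⊕ k ⊗ v → l ⊗ b ⊑ l ⊗ (d ⊕ ι 1) → k ⊗ v ⊑ k ⊗ i → ι 0 ⊑ k ⊗ v → ι 0 ⊑ l ⊗ w →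
        l ⊗ a ⊑ ι 2 ⊗ l ⊗ (d ⊕ ι 1 ⊖ ι 0) ⊕ ι 2 ⊗ k ⊗ i ⊕ l ⊗ w
      fin {l} {a} {b} {w} {k} {v} {i} {d} h₁ h₂ h₃ h₄ h₅ = linear 8 0
          (v0 :* v1) (# 2 :* v0 :* (v2 :+ # 1 :- # 0) :+ # 2 :* v3 :* v4 :+ v0 :* v5)
          (v0 :* v1 :+ # 2 :* (v0 :* v6) :+ # 2 :* (v3 :* v7) :+ # 0 :+ # 0)
          (# 2 :* v0 :* v6 :+ v3 :* v7 :+ # 2 :* (v0 :* (v2 :+ # 1)) :+ # 2 :* (v3 :* v4) :+ v3 :* v7 :+ v0 :* v5)
          (h₁ ⊞ 2 ⊙ h₂ ⊞ 2 ⊙ h₃ ⊞ h₄ ⊞ h₅)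
    ... | no ¬cop = ⊑-trans (≡⇒⊑ (trans (cong₂ (λ p q → λ′ ⊗ (ι φ ⊗ (p ⊖ q))) (ψᶜ-zero xⱼ cc ¬cop) (ψᶜ-zero yⱼ cc ¬cop)) (e λ′ (ι φ))))
        (pos (⊗-nonneg 0≤λ (⊕-nonneg (⊗-nonneg (⊑⇒⊖ (ι-mono y≤x)) (inv-nonneg j)) (0≤ι 1))) (⊗-nonneg 0≤K₁ (⊗-nonneg (0≤ι x) (inv-nonneg j)))
          (⊗-nonneg 0≤λ (⊗-nonneg (0≤ι φ) (ψ⁽ᶜ⁾-nonneg xⱼ))))
      where
      e : ∀ l f → l ⊗ (f ⊗ (ι 0 ⊖ ι 0)) ≡ ι 0
      e l f = ring 2 0 (v0 :* (v1 :* (# 0 :- # 0))) (# 0)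
      pos : ∀ {l d k v w} → ι 0 ⊑ l ⊗ d → ι 0 ⊑ k ⊗ v → ι 0 ⊑ w → ι 0 ⊑ ι 2 ⊗ l ⊗ (d ⊖ ι 0) ⊕ ι 2 ⊗ k ⊗ v ⊕ w
      pos {l} {d} {k} {v} {w} a b c = linear 5 0
          (# 0) (# 2 :* v0 :* (v1 :- # 0) :+ # 2 :* v2 :* v3 :+ v4) (# 2 :* # 0 :+ # 2 :* # 0 :+ # 0)
          (# 2 :* (v0 :* v1) :+ # 2 :* (v2 :* v3) :+ v4)
          (2 ⊙ a ⊞ 2 ⊙ b ⊞ c)

    -- Brun-Titchmarsh is applied on the two sides of the gap (y′, x′] only; inside it the class has
    -- just proper prime powers.
    deficient : Coprime (κ * j) A → ∀ y′ x′ → yⱼ ≤ y′ → y′ ≤ x′ → x′ ≤ xⱼ → 1 ≤ y′ → λ′ ⊑ L y′ → Free (κ * j) c y′ x′ →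
      TermBound λ′ κ c y x j (ι x′ ⊖ ι y′)
    deficient cop y′ x′ h₁ h₂ h₃ 1≤y′ λ≤′ free = fin
      (brun-titchmarsh-λ λ′ (κ * j) c yⱼ y′ cop cc h₁ 1≤y′ (ℕ.≤-trans h₂ (ℕ.≤-trans h₃ xⱼ≤N)) 0≤λ λ≤′)
      (brun-titchmarsh-λ λ′ (κ * j) c x′ xⱼ cop cc h₃ 1≤xⱼ xⱼ≤N 0≤λ λ≤)
      (⊗-monoˡ 0≤λ (⊗-monoˡ (0≤ι φ) (⊑-trans (free-bound (κ * j) c y′ x′ h₂ free) (sum-monoʳ Λᶜ h₃ (λ i _ _ → Λᶜ-nonneg i)))))
      (⊗-monoˡ 0≤λ len) (⊗-monoˡ 0≤K₁ (proj₁ (inv-÷ x j 1≤j))) (⊗-monoˡ 0≤K₁ (ι-mono (ℕ.≤-trans h₂ h₃)))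
      where
      fin : ∀ {l f p₀ p₁ p₂ p₃ y₀ y₁ x₁ x₀ k w i d} →
        l ⊗ (f ⊗ (p₁ ⊖ p₀)) ⊑ ι 2 ⊗ l ⊗ (y₁ ⊖ y₀) ⊕ k ⊗ y₁ → l ⊗ (f ⊗ (p₃ ⊖ p₂)) ⊑ ι 2 ⊗ l ⊗ (x₀ ⊖ x₁) ⊕ k ⊗ x₀ →
        l ⊗ (f ⊗ (p₂ ⊖ p₁)) ⊑ l ⊗ (f ⊗ w) → l ⊗ (x₀ ⊖ y₀) ⊑ l ⊗ (d ⊕ ι 1) → k ⊗ x₀ ⊑ k ⊗ i → k ⊗ y₁ ⊑ k ⊗ x₀ →
        l ⊗ (f ⊗ (p₃ ⊖ p₀)) ⊑ ι 2 ⊗ l ⊗ (d ⊕ ι 1 ⊖ (x₁ ⊖ y₁)) ⊕ ι 2 ⊗ k ⊗ i ⊕ l ⊗ (f ⊗ w)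
      fin {l} {f} {p₀} {p₁} {p₂} {p₃} {y₀} {y₁} {x₁} {x₀} {k} {w} {i} {d} a b c d′ e g = linear 14 0
          (v0 :* (v1 :* (v2 :- v3))) (# 2 :* v0 :* (v4 :+ # 1 :- (v5 :- v6)) :+ # 2 :* v7 :* v8 :+ v0 :* (v1 :* v9))
          (v0 :* (v1 :* (v10 :- v3)) :+ v0 :* (v1 :* (v2 :- v11)) :+ v0 :* (v1 :* (v11 :- v10)) :+ # 2 :* (v0 :* (v12 :- v13)) :+ # 2 :* (v7 :* v12) :+ v7 :* v6)
          (# 2 :* v0 :* (v6 :- v13) :+ v7 :* v6 :+ (# 2 :* v0 :* (v12 :- v5) :+ v7 :* v12) :+ v0 :* (v1 :* v9) :+ # 2 :* (v0 :* (v4 :+ # 1)) :+ # 2 :* (v7 :* v8) :+ v7 :* v12)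
          (a ⊞ b ⊞ c ⊞ 2 ⊙ d′ ⊞ 2 ⊙ e ⊞ g)

  conv-diff : ∀ κ c {y x} → y ≤ x → sum (λ j → Λ j ⊗ (ψᶜ (κ * j) c (x ÷ j) ⊖ ψᶜ (κ * j) c (y ÷ j))) x ≡ conv κ c x ⊖ conv κ c y
  conv-diff κ c {y} {x} y≤x = trans (sum-ext x (λ j → dist (Λ j) (ψᶜ (κ * j) c (x ÷ j)) (ψᶜ (κ * j) c (y ÷ j)))) (trans (sum-⊖ _ _ x)
    (cong (conv κ c x ⊖_) (sum-trunc _ y≤x (λ j y<j _ → trans (cong (λ t → Λ j ⊗ ψᶜ (κ * j) c t)
      (÷-unique y j 0 (subst (_≤ y) (sym (ℕ.*-zeroʳ j)) z≤n) (subst (y <_) (sym (ℕ.*-identityʳ j)) y<j))) (trans (⊗-comm _ _) (⊗-zeroˡ _))))))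
    where
    dist : ∀ a b c → a ⊗ (b ⊖ c) ≡ a ⊗ b ⊖ a ⊗ c
    dist a b c = ring 3 0 (v0 :* (v1 :- v2)) (v0 :* v1 :- v0 :* v2)

  -- The opposite side of the symmetry formula: what the class lacks on (y, x] must be supplied by
  -- the convolution.
  conv-lower : ∀ κ c y x → Coprime κ A → Coprime c A → 1 ≤ y → y ≤ x → x ≤ N →
    ι 2 ⊗ (ι x ⊖ ι y) ⊗ L x ⊑ ι φ ⊗ (conv κ c x ⊖ conv κ c y) ⊕ (ι 2 ⊗ K ⊕ ι 16 ⊗ ι φ) ⊗ ι x ⊕ ι φ ⊗ (ψᶜ κ c x ⊖ ψᶜ κ c y) ⊗ L x
  conv-lower κ c y x cκ cc 1≤y y≤x x≤N = linear 7 3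
      (# 2 :* (n0 :- n1) :* v0) (n2 :* (v1 :- v2) :+ (# 2 :* v3 :+ # 16 :* n2) :* n0 :+ n2 :* (v4 :- v5) :* v0)
      ((:- (v3 :* n0)) :+ (n2 :* (v5 :* v6 :+ v2) :- # 2 :* (n1 :* v6)) :+ v3 :* n1 :+ # 2 :* # 0 :+ n2 :* (v5 :* (v0 :- v6)) :+ # 8 :* (n2 :* (n1 :* (v0 :- v6))))
      (n2 :* (v4 :* v0 :+ v1) :- # 2 :* (n0 :* v0) :+ v3 :* n1 :+ v3 :* n0 :+ # 2 :* (n1 :* (v0 :- v6)) :+ n2 :* (# 8 :* n1 :* (v0 :- v6)) :+ # 8 :* (n2 :* (# 2 :* n0)))
      (proj₁ (symmetry κ c x cκ cc (ℕ.≤-trans 1≤y y≤x) x≤N) ⊞ proj₂ (symmetry κ c y cκ cc 1≤y y≤N)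
    ⊞ ⊗-monoˡ 0≤K (ι-mono y≤x) ⊞ 2 ⊙ ⊗-nonneg (0≤ι y) 0≤δ
    ⊞ ⊗-monoˡ (0≤ι φ) (⊗-monoʳ 0≤δ (⊑-trans (ψᶜ≤ψ κ c y) (chebyshev y y≤N))) ⊞ 8 ⊙ ⊗-monoˡ (0≤ι φ) (L-gap′ 1≤y y≤x x≤N))
    where
    y≤N = ℕ.≤-trans y≤x x≤N
    0≤δ : ι 0 ⊑ L x ⊖ L y
    0≤δ = ⊑⇒⊖ (L-mono 1≤y y≤x x≤N)

  -- Exchanging the summations leaves Λᶜ(n) ψ(x/n), and Λᶜ(n)/n has a bounded sum.
  powers : ∀ x → x ≤ N → sum (λ j → Λ j ⊗ ψ⁽ᶜ⁾ (x ÷ j)) x ⊑ ι 256 ⊗ ι x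
  powers x x≤N = ⊑-trans (≡⇒⊑ (trans (sum-ext x (λ j → sym (sum-⊗ (Λ j) Λᶜ (x ÷ j)))) (trans (sum-hyperbola (λ j n → Λ j ⊗ Λᶜ n) x)
      (sum-ext x (λ n → trans (sum-ext (x ÷ n) (λ j → ⊗-comm _ _)) (sum-⊗ (Λᶜ n) Λ (x ÷ n)))))))
    (⊑-trans (sum-mono x (λ n 1≤n _ → ⊗-monoˡ (Λᶜ-nonneg n) (⊑-trans (chebyshev (x ÷ n) (ℕ.≤-trans (÷≤ x n) x≤N)) (8 ⊙ proj₁ (inv-÷ x n 1≤n)))))
    (⊑-trans (≡⇒⊑ (trans (sum-ext x (λ n → e (Λᶜ n) (ι x) (inv n))) (sum-⊗ (ι 8 ⊗ ι x) (λ n → Λᶜ n ⊗ inv n) x)))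
      (⊑-trans (⊗-monoˡ (⊗-nonneg (0≤ι 8) (0≤ι x)) (sum-Λᶜ x x≤N)) (e₂ (ι x)))))
    where
    e : ∀ l x i → l ⊗ (ι 8 ⊗ (x ⊗ i)) ≡ ι 8 ⊗ x ⊗ (l ⊗ i)
    e l x i = ring 3 0 (v0 :* (# 8 :* (v1 :* v2))) (# 8 :* v1 :* (v0 :* v2))
    e₂ : ∀ x → ι 8 ⊗ x ⊗ ι 32 ⊑ ι 256 ⊗ x
    e₂ x = ≡⇒⊑ (ring 1 0 (# 8 :* v0 :* # 32) (# 256 :* v0))

  -- The symmetry formula demands about 2 (x - y) log x from φ times the convolution, less what
  -- class c has in (y, x]. The term bounds over j ≤ Z offer the same amount less twice the sum of
  -- Λ(j) e(j), so that sum is small. The j > Z are bounded by Chebyshev, at the price of log x -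
  -- log Z.
  deficiency : ∀ λ′ κ c y x Z (e : ℕ → R) → Coprime κ A → Coprime c A → 1 ≤ y → y ≤ x → x ≤ N → 1 ≤ Z → Z ≤ x → ι 0 ⊑ λ′ →
    (∀ j → 1 ≤ j → j ≤ Z → TermBound λ′ κ c y x j (e j)) →
    ι 2 ⊗ λ′ ⊗ sum (λ j → Λ j ⊗ e j) Z ⊑
      ι x ⊗ K₁ ⊗ (ι 2 ⊗ λ′ ⊕ ι 2 ⊗ (L x ⊕ ι 8) ⊕ λ′ ⊗ (L x ⊖ L Z)) ⊕ λ′ ⊗ (ι φ ⊗ (ψᶜ κ c x ⊖ ψᶜ κ c y) ⊗ L x)
  deficiency λ′ κ c y x Z e cκ cc 1≤y y≤x x≤N 1≤Z Z≤x 0≤λ terms =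
    linear 14 4
        (# 2 :* v0 :* v1)
        (n0 :* (# 2 :* (# 824 :* (n1 :* n1 :* (n1 :* n1))) :+ # 4) :* (# 2 :* v0 :+ # 2 :* (v2 :+ # 8) :+ v0 :* (v2 :- v3)) :+ v0 :* (n2 :* (v4 :- v5) :* v2))
        (v0 :* (# 2 :* (n0 :- n3) :* v2) :+ v0 :* (n2 :* (v6 :- v7)) :+ v0 :* (n2 :* v8) :+ v0 :* n2 :* (v9 :- v8) :+ # 2 :* (v0 :* (n0 :- n3) :* v10) :+ # 16 :* # 0 :+ # 2 :* (v0 :* v11) :+ # 2 :* ((# 2 :* (# 824 :* (n1 :* n1 :* (n1 :* n1))) :+ # 4) :* n0 :* v10) :+ v0 :* n2 :* v12 :+ # 8 :* (v0 :* n2 :* n0 :* (v13 :+ v3)) :+ v0 :* n0 :* (# 32 :+ # 352 :* n2 :+ # 2 :* (# 824 :* (n1 :* n1 :* (n1 :* n1)))) :+ # 8 :* n2 :* (v0 :* n0 :* (v2 :- v3)))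
        (v0 :* (n2 :* (v6 :- v7) :+ (# 2 :* (# 824 :* (n1 :* n1 :* (n1 :* n1))) :+ # 16 :* n2) :* n0 :+ n2 :* (v4 :- v5) :* v2) :+ v0 :* (n2 :* v9) :+ (# 2 :* v0 :* ((n0 :- n3) :* v10 :+ v11 :- v1) :+ # 2 :* (# 2 :* (# 824 :* (n1 :* n1 :* (n1 :* n1))) :+ # 4) :* (n0 :* v10) :+ v0 :* (n2 :* v12)) :+ v0 :* n2 :* (# 8 :* n0 :* (v13 :- v10)) :+ # 2 :* (v0 :* (n0 :- n3) :* (v2 :+ # 8)) :+ # 16 :* (v0 :* n3) :+ # 2 :* (v0 :* (# 8 :* n0)) :+ # 2 :* ((# 2 :* (# 824 :* (n1 :* n1 :* (n1 :* n1))) :+ # 4) :* n0 :* (v2 :+ # 8)) :+ v0 :* n2 :* (# 256 :* n0) :+ # 8 :* (v0 :* n2 :* n0 :* (v2 :+ # 8 :+ (v10 :+ # 2))) :+ v0 :* n0 :* (# 2 :* (# 2 :* (# 824 :* (n1 :* n1 :* (n1 :* n1))) :+ # 4)) :+ (# 2 :* (# 824 :* (n1 :* n1 :* (n1 :* n1))) :+ # 4) :* (v0 :* n0 :* (v2 :- v3)))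
        (⊗-monoˡ 0≤λ (conv-lower κ c y x cκ cc 1≤y y≤x x≤N) ⊞ ≡⇒⊒ (cong (λ t → λ′ ⊗ (ι φ ⊗ t)) (conv-diff κ c y≤x))
      ⊞ head ⊞ ⊗-monoˡ (⊗-nonneg 0≤λ (0≤ι φ)) tail
      ⊞ 2 ⊙ ⊗-monoˡ (⊗-nonneg 0≤λ (⊑⇒⊖ (ι-mono y≤x))) (⊑-trans (s-mono Z≤x) s≤)
      ⊞ 16 ⊙ ⊗-nonneg 0≤λ (0≤ι y)
      ⊞ 2 ⊙ ⊗-monoˡ 0≤λ (⊑-trans (chebyshev Z (ℕ.≤-trans Z≤x x≤N)) (8 ⊙ ι-mono Z≤x))
      ⊞ 2 ⊙ ⊗-monoˡ (⊗-nonneg 0≤K₁ (0≤ι x)) (⊑-trans (s-mono Z≤x) s≤)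
      ⊞ ⊗-monoˡ (⊗-nonneg 0≤λ (0≤ι φ)) powersZ
      ⊞ 8 ⊙ ⊗-monoˡ (⊗-nonneg (⊗-nonneg 0≤λ (0≤ι φ)) (0≤ι x)) (⊕-mono s≤ (mertens-lower Z 1≤Z (ℕ.≤-trans Z≤x x≤N)))
      ⊞ ⊗-monoˡ (⊗-nonneg 0≤λ (0≤ι x)) const₁
      ⊞ ⊗-monoʳ (⊗-nonneg (⊗-nonneg 0≤λ (0≤ι x)) (⊑⇒⊖ (L-mono 1≤Z Z≤x x≤N))) const₂)
    where
    f : ℕ → R
    f j = Λ j ⊗ (ψᶜ (κ * j) c (x ÷ j) ⊖ ψᶜ (κ * j) c (y ÷ j))
    s≤ : s x ⊑ L x ⊕ ι 8
    s≤ = mertens-upper x (ℕ.≤-trans 1≤y y≤x) x≤N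
    const₂ : ι 8 ⊗ ι φ ⊑ K₁
    const₂ = linear 0 2
        (# 8 :* n0) (# 2 :* (# 824 :* (n1 :* n1 :* (n1 :* n1))) :+ # 4)
        (# 8 :* n0 :+ # 8 :* (n1 :* n1) :+ # 1640 :* # 0)
        (# 8 :* (n1 :* n1) :+ # 8 :* (n1 :* n1 :* (n1 :* n1)) :+ # 1640 :* (n1 :* n1 :* (n1 :* n1)))
        (8 ⊙ φ≤Δ ⊞ 8 ⊙ Δ≤DD ⊞ 1640 ⊙ ⊗-nonneg 0≤Δ 0≤Δ)
    const₁ : ι 32 ⊕ ι 352 ⊗ ι φ ⊕ ι 2 ⊗ K ⊑ ι 2 ⊗ K₁
    const₁ = linear 0 2
        (# 32 :+ # 352 :* n0 :+ # 2 :* (# 824 :* (n1 :* n1 :* (n1 :* n1))))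
        (# 2 :* (# 2 :* (# 824 :* (n1 :* n1 :* (n1 :* n1))) :+ # 4))
        (# 352 :* n0 :+ # 352 :* (n1 :* n1) :+ # 24 :* # 1 :+ # 1272 :* # 0)
        (# 352 :* (n1 :* n1) :+ # 352 :* (n1 :* n1 :* (n1 :* n1)) :+ # 24 :* (n1 :* n1 :* (n1 :* n1)) :+ # 1272 :* (n1 :* n1 :* (n1 :* n1)))
        (352 ⊙ φ≤Δ ⊞ 352 ⊙ Δ≤DD ⊞ 24 ⊙ (⊑-trans 1≤Δ Δ≤DD) ⊞ 1272 ⊙ ⊗-nonneg 0≤Δ 0≤Δ)
    powersZ : sum (λ j → Λ j ⊗ ψ⁽ᶜ⁾ (x ÷ j)) Z ⊑ ι 256 ⊗ ι x
    powersZ = ⊑-trans (sum-monoʳ _ Z≤x (λ j _ _ → ⊗-nonneg (Λ-nonneg j) (ψ⁽ᶜ⁾-nonneg (x ÷ j)))) (powers x x≤N)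
    tail : sum f x ⊖ sum f Z ⊑ ι 8 ⊗ ι x ⊗ (s x ⊖ s Z)
    tail = ⊑-trans (sum-diff-mono f (λ j → ι 8 ⊗ ι x ⊗ (Λ j ⊗ inv j)) Z≤x pt) (≡⇒⊑ (trans (cong₂ _⊖_ (sum-⊗ _ _ x) (sum-⊗ _ _ Z)) (dist (ι 8 ⊗ ι x) (s x) (s Z))))
      where
      dist : ∀ a b c → a ⊗ b ⊖ a ⊗ c ≡ a ⊗ (b ⊖ c)
      dist a b c = ring 3 0 (v0 :* v1 :- v0 :* v2) (v0 :* (v1 :- v2))
      pt : ∀ j → Z < j → j ≤ x → f j ⊑ ι 8 ⊗ ι x ⊗ (Λ j ⊗ inv j)
      pt j Z<j _ = pt′ (⊗-monoˡ (Λ-nonneg j) (⊑-trans (⊑-trans (ψᶜ≤ψ (κ * j) c (x ÷ j)) (chebyshev (x ÷ j) (ℕ.≤-trans (÷≤ x j) x≤N)))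
        (8 ⊙ proj₁ (inv-÷ x j (ℕ.≤-trans (s≤s z≤n) Z<j))))) (⊗-nonneg (Λ-nonneg j) (ψᶜ-nonneg (κ * j) c (y ÷ j)))
        where
        pt′ : ∀ {l p q x i} → l ⊗ p ⊑ l ⊗ (ι 8 ⊗ (x ⊗ i)) → ι 0 ⊑ l ⊗ q → l ⊗ (p ⊖ q) ⊑ ι 8 ⊗ x ⊗ (l ⊗ i)
        pt′ {l} {p} {q} {x} {i} h k = linear 5 0
            (v0 :* (v1 :- v2)) (# 8 :* v3 :* (v0 :* v4)) (v0 :* v1 :+ # 0) (v0 :* (# 8 :* (v3 :* v4)) :+ v0 :* v2)
            (h ⊞ k)
    head : λ′ ⊗ (ι φ ⊗ sum f Z) ⊑ ι 2 ⊗ λ′ ⊗ ((ι x ⊖ ι y) ⊗ s Z ⊕ ψ Z ⊖ sum (λ j → Λ j ⊗ e j) Z) ⊕ ι 2 ⊗ K₁ ⊗ (ι x ⊗ s Z) ⊕ λ′ ⊗ (ι φ ⊗ sum (λ j → Λ j ⊗ ψ⁽ᶜ⁾ (x ÷ j)) Z)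
    head = ⊑-trans (≡⇒⊑ (trans (sym (⊗-assoc _ _ _)) (trans (sym (sum-⊗ (λ′ ⊗ ι φ) f Z)) (sum-ext Z (λ j → r₁ λ′ (ι φ) (Λ j) (ψᶜ (κ * j) c (x ÷ j) ⊖ ψᶜ (κ * j) c (y ÷ j)))))))
      (⊑-trans (sum-mono Z (λ j 1≤j j≤Z → ⊗-monoˡ (Λ-nonneg j) (terms j 1≤j j≤Z))) (≡⇒⊑ (trans (sum-ext Z (λ j → r₂ (Λ j) λ′ (ι x ⊖ ι y) (inv j) (e j) K₁ (ι x) (ι φ) (ψ⁽ᶜ⁾ (x ÷ j))))
        (trans (sum-⊕ _ _ Z) (cong₂ _⊕_ (trans (sum-⊕ _ _ Z) (cong₂ _⊕_ (trans (sum-⊗ (ι 2 ⊗ λ′) _ Z) (cong (ι 2 ⊗ λ′ ⊗_)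
          (trans (sum-⊖ _ _ Z) (cong (_⊖ sum (λ j → Λ j ⊗ e j) Z) (trans (sum-⊕ _ _ Z) (cong (_⊕ ψ Z) (sum-⊗ (ι x ⊖ ι y) _ Z)))))))
          (trans (sum-⊗ (ι 2 ⊗ K₁) _ Z) (cong (ι 2 ⊗ K₁ ⊗_) (sum-⊗ (ι x) _ Z))))) (trans (sum-⊗ (λ′ ⊗ ι φ) _ Z) (⊗-assoc _ _ _)))))))
      where
      r₁ : ∀ l f a p → l ⊗ f ⊗ (a ⊗ p) ≡ a ⊗ (l ⊗ (f ⊗ p))
      r₁ l f a p = ring 4 0 (v0 :* v1 :* (v2 :* v3)) (v2 :* (v0 :* (v1 :* v3)))
      r₂ : ∀ a l d i e k x f w → a ⊗ (ι 2 ⊗ l ⊗ (d ⊗ i ⊕ ι 1 ⊖ e) ⊕ ι 2 ⊗ k ⊗ (x ⊗ i) ⊕ l ⊗ (f ⊗ w)) ≡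
        ι 2 ⊗ l ⊗ (d ⊗ (a ⊗ i) ⊕ a ⊖ a ⊗ e) ⊕ ι 2 ⊗ k ⊗ (x ⊗ (a ⊗ i)) ⊕ l ⊗ f ⊗ (a ⊗ w)
      r₂ a l d i e k x f w = ring 9 0
          (v0 :* (# 2 :* v1 :* (v2 :* v3 :+ # 1 :- v4) :+ # 2 :* v5 :* (v6 :* v3) :+ v1 :* (v7 :* v8)))
          (# 2 :* v1 :* (v2 :* (v0 :* v3) :+ v0 :- v0 :* v4) :+ # 2 :* v5 :* (v6 :* (v0 :* v3)) :+ v1 :* v7 :* (v0 :* v8))

-- Zones without primes of a given class

sqrt : ∀ x → 1 ≤ x → Σ ℕ λ r → 1 ≤ r × r * r ≤ x × x ≤ r * r + 2 * r
sqrt (suc zero)    _ = 1 , s≤s z≤n , ℕ.≤-refl , s≤s z≤n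
sqrt (suc (suc x)) _ with sqrt (suc x) (s≤s z≤n)
... | r , 1≤r , lo , hi with ℕ.m≤n⇒m<n∨m≡n hi
...   | inj₁ lt = r , 1≤r , ℕ.m≤n⇒m≤1+n lo , lt
...   | inj₂ eq = suc r , s≤s z≤n , ι-cancel (linear 0 2
    (nat ((lit 1 ∔ n# 0) ∗ (lit 1 ∔ n# 0))) (nat (lit 1 ∔ (lit 1 ∔ n# 1)))
    (nat (n# 0 ∗ n# 0 ∔ (n# 0 ∔ (n# 0 ∔ lit 0))) :+ # 0 :* # 0 :+ # 0 :* # 0)
    (nat (lit 1 ∔ n# 1) :+ # 0 :* n0 :+ # 0 :* n1)
    (ι-mono (ℕ.≤-reflexive (sym eq)) ⊞ at# r ⊞ at# x)) , ι-cancel (linear 0 2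
    (nat (lit 1 ∔ (lit 1 ∔ n# 0)))
    (nat ((lit 1 ∔ n# 1) ∗ (lit 1 ∔ n# 1) ∔ (lit 1 ∔ n# 1 ∔ (lit 1 ∔ n# 1 ∔ lit 0))))
    (nat (lit 1 ∔ n# 0) :+ # 2 :* # 0) (nat (n# 1 ∗ n# 1 ∔ (n# 1 ∔ (n# 1 ∔ lit 0))) :+ # 2 :* n1)
    (ι-mono (ℕ.≤-reflexive eq) ⊞ 2 ⊙ 0≤ι r))

module Pointwise {N : ℕ} (ls : LogSystem N) (A : ℕ) {{nz : NonZero A}} where
  open Deficiency ls A public

  χ-sum≤ : ∀ k x → 1 ≤ k → sum (λ n → χ (n ℕ.≟ k)) x ⊑ χ (k ℕ.≤? x)
  χ-sum≤ k x 1≤k with k ℕ.≤? x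
  ... | yes k≤x = ≡⇒⊑ (trans (sum-single _ k x 1≤k k≤x (λ i _ _ i≢k → χ-no (i ℕ.≟ k) i≢k)) (χ-yes (k ℕ.≟ k) refl))
  ... | no k≰x = ≡⇒⊑ (sum-zero x (λ i _ i≤x → χ-no (i ℕ.≟ k) (λ { refl → k≰x i≤x })))

  -- By `Λᶜ-squares` each m is charged at most two proper prime powers, both at least m², so only m
  -- ≤ r matter.
  ψ⁽ᶜ⁾-root : ∀ x r → r ≤ x → (∀ m → m * m ≤ x → m ≤ r) → ψ⁽ᶜ⁾ x ⊑ ι 2 ⊗ ψ r
  ψ⁽ᶜ⁾-root x r r≤x root = ⊑-trans (sum-mono x (λ n 1≤n n≤x → ⊑-trans (Λᶜ-squares n 1≤n)
      (sum-monoʳ _ n≤x (λ m _ _ → ⊗-nonneg (Λ-nonneg m) (hit-nonneg n m)))))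
    (⊑-trans (≡⇒⊑ (sum-swap (λ n m → Λ m ⊗ hit n m) x x)) (⊑-trans (sum-mono x inner)
      (≡⇒⊑ (trans (sum-trunc (λ m → ι 2 ⊗ (Λ m ⊗ χ (m ℕ.≤? r))) r≤x (λ m r<m _ → trans (cong (λ t → ι 2 ⊗ (Λ m ⊗ t)) (χ-no (m ℕ.≤? r) (ℕ.<⇒≱ r<m))) (z (Λ m))))
        (trans (sum-⊗ (ι 2) _ r) (cong (ι 2 ⊗_) (sum-cong r (λ m _ m≤r → trans (cong (Λ m ⊗_) (χ-yes (m ℕ.≤? r) m≤r)) (trans (⊗-comm _ _) (⊗-identityˡ _))))))))))
    where
    z : ∀ a → ι 2 ⊗ (a ⊗ ι 0) ≡ ι 0
    z a = ring 1 0 (# 2 :* (v0 :* # 0)) (# 0)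
    hits : ∀ m k → 1 ≤ k → m * m ≤ k → sum (λ n → χ (n ℕ.≟ k)) x ⊑ χ (m ℕ.≤? r)
    hits m k 1≤k mm≤k = ⊑-trans (χ-sum≤ k x 1≤k) below
      where
      below : χ (k ℕ.≤? x) ⊑ χ (m ℕ.≤? r)
      below with k ℕ.≤? x
      ... | yes k≤x = ≡⇒⊒ (χ-yes (m ℕ.≤? r) (root m (ℕ.≤-trans mm≤k k≤x)))
      ... | no _    = χ-nonneg (m ℕ.≤? r)
    inner : ∀ m → 1 ≤ m → m ≤ x → sum (λ n → Λ m ⊗ hit n m) x ⊑ ι 2 ⊗ (Λ m ⊗ χ (m ℕ.≤? r))
    inner m 1≤m _ = ⊑-trans (≡⇒⊑ (trans (sum-⊗ (Λ m) _ x) (cong (Λ m ⊗_) (sum-⊕ _ _ x))))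
      (⊑-trans (⊗-monoˡ (Λ-nonneg m) (⊕-mono (hits m (m * m) (*-pos 1≤m 1≤m) ℕ.≤-refl)
        (hits m (m * m * base m) (*-pos (*-pos 1≤m 1≤m) (base≥1 m)) (ℕ.m≤m*n (m * m) (base m) {{ℕ.>-nonZero (base≥1 m)}})))) (e (Λ m) (χ (m ℕ.≤? r))))
      where
      e : ∀ a b → a ⊗ (b ⊕ b) ⊑ ι 2 ⊗ (a ⊗ b)
      e a b = ≡⇒⊑ (ring 2 0 (v0 :* (v1 :+ v1)) (# 2 :* (v0 :* v1)))

  -- With r the integer square root of x, both factors are O(r): ψ⁽ᶜ⁾(x) ≤ 2 ψ(r) and log x = 2 log
  -- r + O(1).
  powers-pointwise : ∀ x → 1 ≤ x → x ≤ N → ψ⁽ᶜ⁾ x ⊗ L x ⊑ ι 160 ⊗ ι x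
  powers-pointwise x 1≤x x≤N with sqrt x 1≤x
  ... | r , 1≤r , lo , hi = ⊑-trans (⊗-mono (ψ⁽ᶜ⁾-nonneg x) (L-nonneg 1≤x x≤N) (⊑-trans (ψ⁽ᶜ⁾-root x r r≤x root) (2 ⊙ chebyshev r (ℕ.≤-trans r≤x x≤N))) Lx)
      (fin (ι-mono lo) )
    where
    1≤rr = *-pos 1≤r 1≤r
    r≤x : r ≤ x
    r≤x = ℕ.≤-trans (ℕ.m≤m*n r r {{ℕ.>-nonZero 1≤r}}) lo
    root : ∀ m → m * m ≤ x → m ≤ r
    root m mm≤x with m ℕ.≤? r
    ... | yes h = h
    ... | no m≰r = contradiction (ι-mono (ℕ.≤-trans (ℕ.*-mono-≤ (ℕ.≰⇒> m≰r) (ℕ.≰⇒> m≰r)) (ℕ.≤-trans mm≤x hi))) absurd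
      where
      absurd : ¬ (ι (suc r * suc r) ⊑ ι (r * r + 2 * r))
      absurd h = contradiction (ι-cancel {1} {0} (linear 0 1
          (# 1) (# 0) (nat ((lit 1 ∔ n# 0) ∗ (lit 1 ∔ n# 0)) :+ # 0 :* # 0)
          (nat (n# 0 ∗ n# 0 ∔ lit 2 ∗ n# 0) :+ # 0 :* n0)
          (h ⊞ at# r))) (λ ())
    gap : L x ⊖ L (r * r) ⊑ ι 6
    gap = ⊗-cancelˡ (r * r) 1≤rr (linear 2 2
        (nat (n# 0 ∗ n# 0) :* (v0 :- v1)) (nat (n# 0 ∗ n# 0) :* # 6)
        (nat (n# 0 ∗ n# 0) :* (v0 :- v1) :+ # 2 :* n1 :+ # 4 :* (# 1 :* n0))
        (# 2 :* n1 :+ # 2 :* nat (n# 0 ∗ n# 0 ∔ (n# 0 ∔ (n# 0 ∔ lit 0))) :+ # 4 :* (n0 :* n0))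
        (L-gap′ 1≤rr lo x≤N ⊞ 2 ⊙ ι-mono hi ⊞ 4 ⊙ ⊗-monoʳ (0≤ι r) (ι-mono 1≤r)))
    Lx : L x ⊑ ι 10 ⊗ ι r
    Lx = linear 3 1
        v0 (# 10 :* n0) (v0 :- v1 :+ v1 :+ # 2 :* v2 :+ # 6 :* # 1)
        (# 6 :+ (v2 :+ v2) :+ # 2 :* (# 2 :* n0) :+ # 6 :* n0)
        (gap ⊞ ≡⇒⊑ (L-* r r 1≤r 1≤r) ⊞ 2 ⊙ L-linear r 1≤r (ℕ.≤-trans r≤x x≤N) ⊞ 6 ⊙ ι-mono 1≤r)
    fin : ι (r * r) ⊑ ι x → ι 2 ⊗ (ι 8 ⊗ ι r) ⊗ (ι 10 ⊗ ι r) ⊑ ι 160 ⊗ ι x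
    fin h = linear 0 2 (# 2 :* (# 8 :* n0) :* (# 10 :* n0)) (# 160 :* n1) (# 160 :* nat (n# 0 ∗ n# 0)) (# 160 :* n1) (160 ⊙ h)

-- The negation of the claim about primes, up to scale p ^ Kmax.
record Window (p A b B G Kmax : ℕ) {{nz : NonZero A}} : Set where
  open Residues A
  field
    p-prime : Prime p
    5≤p : 5 ≤ p
    5≤A : 5 ≤ A
    b-unit : Coprime b A
    win : ∀ k m d → k ≤ Kmax → Prime m → G < m → p ^ k < m → m < p ^ suc k → 1 ≤ d → d < A → d * m ≈ b → d * m ≤ 2 * A * p ^ k + B

module FreeZones {p A b B G Kmax : ℕ} {{nz : NonZero A}} (W : Window p A b B G Kmax) {N : ℕ} (ls : LogSystem N) where
  open Window W public
  open Pointwise ls A public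

  1≤p : 1 ≤ p
  1≤p = ℕ.≤-trans (s≤s z≤n) 5≤p

  ¬0≥1 : ¬ (ι 1 ⊑ ι 0)
  ¬0≥1 h = contradiction (ι-cancel {1} {0} h) (λ ())

  -- Primes m with d m ≡ b satisfy d m ≤ 2AQ + B on (Q, pQ), Q = p ^ i; y is chosen past that bound.
  free-window : ∀ i d k c y x → i ≤ Kmax → 1 ≤ d → d < A → (∀ m → k * m ≈ c → d * m ≈ b) →
    G ≤ y → 2 * A * p ^ i + B ≤ d * y → x < p ^ suc i → Free k c y x
  free-window i d k c y x i≤ 1≤d d<A cls G≤y past x< m y<m m≤x pm h =
    ℕ.<⇒≱ (ℕ.≤-<-trans past (ℕ.*-monoʳ-< d {{ℕ.>-nonZero 1≤d}} y<m))
      (win i m d i≤ pm (ℕ.≤-<-trans G≤y y<m) Q<m (ℕ.≤-<-trans m≤x x<) 1≤d d<A (cls m h))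
    where
    Q<m : p ^ i < m
    Q<m with p ^ i ℕ.<? m
    ... | yes q = q
    -- Otherwise 2 A p^i ≤ d y < d m ≤ A p^i.
    ... | no ¬q = ⊥-elim (¬0≥1 (linear 0 6
        (# 1) (# 0)
        (nat ((n# 0 ∔ (n# 0 ∔ lit 0)) ∗ n# 1 ∔ n# 2) :+ n3 :* nat (lit 1 ∔ n# 4) :+ n3 :* n5 :+ n3 :* n1 :+ # 0 :+ # 0 :+ # 1)
        (nat (n# 3 ∗ n# 4) :+ n3 :* n5 :+ n3 :* n1 :+ n0 :* n1 :+ n0 :* n1 :+ n2 :+ n3)
        (ι-mono past ⊞ d ⊙ ι-mono y<m ⊞ d ⊙ ι-mono (ℕ.≮⇒≥ ¬q) ⊞ ⊗-monoʳ (0≤ι (p ^ i)) (ι-mono (ℕ.<⇒≤ d<A)) ⊞ ⊗-nonneg (0≤ι A) (0≤ι (p ^ i)) ⊞ 0≤ι B ⊞ ι-mono 1≤d)))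

  A∸1 : ℕ
  A∸1 = A ∸ 1

  A≡ : A ≡ suc A∸1
  A≡ = sym (ℕ.m+[n∸m]≡n 1≤A)

  A∸1<A : A∸1 < A
  A∸1<A = subst (A∸1 <_) (sym A≡) ℕ.≤-refl

  A∸1-unit : Coprime A∸1 A
  A∸1-unit {i} (d , d′) = ∣1⇒≡1 (∣m+n∣m⇒∣n {m = A∸1} (subst (i ∣_) (trans A≡ (ℕ.+-comm 1 A∸1)) d′) d)
    where open import Data.Nat.Divisibility using (_∣_; ∣1⇒≡1; ∣m+n∣m⇒∣n)

  -- The case d = A - 1: as A ≥ 5, the ratio 2A/(A - 1) is at most 5/2, so the gap covers everything
  -- from 5/2 p^i + B to p^(i + 1).
  free-top : ∀ i k y x → i ≤ Kmax → k ≈ 1 → G ≤ y → 5 * p ^ i + 2 * B ≤ 2 * y → x < p ^ suc i → Free (A∸1 * k) b y x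
  free-top i k y x i≤ k≈1 G≤y past x< = free-window i A∸1 (A∸1 * k) b y x i≤ 1≤a A∸1<A
      (λ m h → trans (cong (_% A) (sym (ℕ.*-identityʳ (A∸1 * m)))) (trans (sym (≈-*ˡ (A∸1 * m) {k} {1} k≈1)) (trans (cong (_% A) (comm m)) h))) G≤y past′ x<
    where
    comm : ∀ m → A∸1 * m * k ≡ A∸1 * k * m
    comm m = trans (ℕ.*-assoc A∸1 m k) (trans (cong (A∸1 *_) (ℕ.*-comm m k)) (sym (ℕ.*-assoc A∸1 k m)))
    4≤a : 4 ≤ A∸1
    4≤a = ℕ.≤-pred (subst (5 ≤_) A≡ 5≤A)
    1≤a : 1 ≤ A∸1
    1≤a = ℕ.≤-trans (s≤s z≤n) 4≤a
    past′ : 2 * A * p ^ i + B ≤ A∸1 * y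
    past′ = ι-cancel (⊗-cancelˡ 2 (s≤s z≤n) (linear 0 5 {ν = _ , _ , _ , _ , y , _}
        (# 2 :* nat (lit 2 ∗ n# 0 ∗ n# 1 ∔ n# 2)) (# 2 :* nat (n# 3 ∗ n# 4))
        (n3 :* nat (lit 5 ∗ n# 1 ∔ lit 2 ∗ n# 2) :+ # 4 :* n1 :+ # 2 :* (# 1 :* n2) :+ # 4 :* (n0 :* n1))
        (n3 :* nat (lit 2 ∗ n# 4) :+ n3 :* n1 :+ # 2 :* (n3 :* n2) :+ # 4 :* (nat (lit 1 ∔ n# 3) :* n1))
        (A∸1 ⊙ ι-mono past ⊞ ⊗-monoʳ (0≤ι (p ^ i)) (ι-mono 4≤a) ⊞ 2 ⊙ ⊗-monoʳ (0≤ι B) (ι-mono 1≤a)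
      ⊞ 4 ⊙ ⊗-monoʳ (0≤ι (p ^ i)) (ι-mono (ℕ.≤-reflexive A≡)))))

  -- From b k ≡ d and k m ≡ 1 follows d m ≡ b, and d ≥ (A + 1)/2 bounds the ratio 2A/d by 4A/(A +
  -- 1).
  free-upper : ∀ i k d y x → i ≤ Kmax → 1 ≤ d → d < A → suc A ≤ 2 * d → b * k ≈ d → G ≤ y → 4 * A * p ^ i + 2 * B ≤ suc A * y → x < p ^ suc i → Free (1 * k) 1 y x
  free-upper i k d y x i≤ 1≤d d<A 2d bk G≤y past x< = free-window i d (1 * k) 1 y x i≤ 1≤d d<A cls G≤y past′ x<
    where
    cls : ∀ m → 1 * k * m ≈ 1 → d * m ≈ b
    cls m h = trans (sym (≈-*ʳ m {b * k} {d} bk)) (trans (cong (_% A) (trans (ℕ.*-assoc b k m) (cong (λ t → b * (t * m)) (sym (ℕ.*-identityˡ k)))))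
      (trans (≈-*ˡ b {1 * k * m} {1} h) (cong (_% A) (ℕ.*-identityʳ b))))
    past′ : 2 * A * p ^ i + B ≤ d * y
    past′ = ι-cancel (⊗-cancelˡ 2 (s≤s z≤n) (linear 0 5 {ν = A , (p ^ i) , B , d , _ , _}
        (# 2 :* nat (lit 2 ∗ n# 0 ∗ n# 1 ∔ n# 2)) (# 2 :* nat (n# 3 ∗ n# 4))
        (nat (lit 4 ∗ n# 0 ∗ n# 1 ∔ lit 2 ∗ n# 2) :+ nat (lit 1 ∔ n# 0) :* n4)
        (nat ((lit 1 ∔ n# 0) ∗ n# 4) :+ nat (lit 2 ∗ n# 3) :* n4)
        (ι-mono past ⊞ ⊗-monoʳ (0≤ι y) (ι-mono 2d))))

  -- If b m ≡ d then d′ m ≡ b, because d d′ ≡ b². The condition p d′ > 2A places the start of this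
  -- gap below p^(i + 1).
  free-scale : ∀ i d d′ y x → i ≤ Kmax → 1 ≤ d′ → d′ < A → suc (2 * A) ≤ p * d′ → d * d′ ≈ b * b → G ≤ y →
    p * (2 * A * p ^ i + B) ≤ suc (2 * A) * y → x < p ^ suc i → Free b d y x
  free-scale i d d′ y x i≤ 1≤d d<A big dd G≤y past x< = free-window i d′ b d y x i≤ 1≤d d<A cls G≤y past′ x<
    where
    cls : ∀ m → b * m ≈ d → d′ * m ≈ b
    cls m h = ≈-cancel b {d′ * m} {b} b-unit (trans (cong (_% A) (trans (sym (ℕ.*-assoc b d′ m)) (trans (cong (_* m) (ℕ.*-comm b d′)) (ℕ.*-assoc d′ b m))))
      (trans (≈-*ˡ d′ {b * m} {d} h) (trans (cong (_% A) (ℕ.*-comm d′ d)) dd)))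
    past′ : 2 * A * p ^ i + B ≤ d′ * y
    past′ = ι-cancel (⊗-cancelˡ p 1≤p (linear 0 6 {ν = p , A , (p ^ i) , B , d′ , _ , _}
        (n0 :* nat (lit 2 ∗ n# 1 ∗ n# 2 ∔ n# 3)) (n0 :* nat (n# 4 ∗ n# 5))
        (nat (n# 0 ∗ (lit 2 ∗ n# 1 ∗ n# 2 ∔ n# 3)) :+ nat (lit 1 ∔ lit 2 ∗ n# 1) :* n5)
        (nat ((lit 1 ∔ lit 2 ∗ n# 1) ∗ n# 5) :+ nat (n# 0 ∗ n# 4) :* n5)
        (ι-mono past ⊞ ⊗-monoʳ (0≤ι y) (ι-mono big))))

-- Inequalities between the endpoints of gaps

*-cancel-≤ : ∀ k {a b} → 1 ≤ k → k * a ≤ k * b → a ≤ b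
*-cancel-≤ k 1≤k h = ℕ.*-cancelˡ-≤ k {{ℕ.>-nonZero 1≤k}} h

*-cancel-< : ∀ k {a b} → k * a < k * b → a < b
*-cancel-< k {a} {b} h = ℕ.*-cancelˡ-< k a b h

-- In the endpoint inequalities m stands for 8A + 6.
endpoint₁ : ∀ P B y m → 2 * y ≤ 5 * P + 2 * B + 2 → 4 * suc m * (2 * B + 3) ≤ P → 2 * y ≤ 2 * (5 * P)
endpoint₁ P B y m h big = ι-cancel (linear 0 4 {ν = y , P , m , B , _}
    (nat (lit 2 ∗ n# 0)) (nat (lit 2 ∗ (lit 5 ∗ n# 1)))
    (nat (lit 2 ∗ n# 0) :+ nat (lit 4 ∗ (lit 1 ∔ n# 2) ∗ (lit 2 ∗ n# 3 ∔ lit 3)) :+ # 4 :* # 0 :+ # 6 :* # 0 :+ # 8 :* # 0 :+ # 12 :* # 0 :+ # 0)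
    (nat (lit 5 ∗ n# 1 ∔ lit 2 ∗ n# 3 ∔ lit 2) :+ n1 :+ # 4 :* n1 :+ # 6 :* n3 :+ # 8 :* (n2 :* n3) :+ # 12 :* n2 :+ # 10)
    (ι-mono h ⊞ ι-mono big ⊞ 4 ⊙ 0≤ι P ⊞ 6 ⊙ 0≤ι B ⊞ 8 ⊙ ⊗-nonneg (0≤ι m) (0≤ι B) ⊞ 12 ⊙ 0≤ι m ⊞ 0≤ι 10))

endpoint₂ : ∀ k τ yⱼ y P B → k * τ ≤ P → 5 * P + 2 * B + 1 ≤ 2 * y → y < k * suc yⱼ → k * τ ≤ k * (yⱼ + B + 1)
endpoint₂ k τ yⱼ y P B h₁ h₂ h₃ = ι-cancel (⊗-cancelˡ 2 (s≤s z≤n) (linear 0 6 {ν = k , τ , yⱼ , _ , P , y , _}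
    (# 2 :* nat (n# 0 ∗ n# 1)) (# 2 :* nat (n# 0 ∗ (n# 2 ∔ n# 3 ∔ lit 1)))
    (# 2 :* nat (n# 0 ∗ n# 1) :+ nat (lit 5 ∗ n# 4 ∔ lit 2 ∗ n# 3 ∔ lit 1) :+ # 2 :* nat (lit 1 ∔ n# 5) :+ # 3 :* # 0 :+ # 2 :* # 0 :+ # 2 :* # 0 :+ # 0)
    (# 2 :* n4 :+ nat (lit 2 ∗ n# 5) :+ # 2 :* nat (n# 0 ∗ (lit 1 ∔ n# 2)) :+ # 3 :* n4 :+ # 2 :* n3 :+ # 2 :* (n0 :* n3) :+ # 3)
    (2 ⊙ ι-mono h₁ ⊞ ι-mono h₂ ⊞ 2 ⊙ ι-mono h₃ ⊞ 3 ⊙ 0≤ι P ⊞ 2 ⊙ 0≤ι B ⊞ 2 ⊙ ⊗-nonneg (0≤ι k) (0≤ι B) ⊞ 0≤ι 3)))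

endpoint₃ : ∀ k Q pP yⱼ y P B → k ≤ pP → P ≡ pP * Q → 5 * P + 2 * B + 1 ≤ 2 * y → y < k * suc yⱼ → k * (5 * Q + 2 * B) ≤ k * (2 * (yⱼ + B + 1))
endpoint₃ k Q pP yⱼ y P B h₀ e h₁ h₂ = ι-cancel (linear 0 7 {ν = k , _ , _ , yⱼ , pP , P , y , _}
    (nat (n# 0 ∗ (lit 5 ∗ n# 1 ∔ lit 2 ∗ n# 2))) (nat (n# 0 ∗ (lit 2 ∗ (n# 3 ∔ n# 2 ∔ lit 1))))
    (# 5 :* (n0 :* n1) :+ # 5 :* nat (n# 4 ∗ n# 1) :+ nat (lit 5 ∗ n# 5 ∔ lit 2 ∗ n# 2 ∔ lit 1) :+ # 2 :* nat (lit 1 ∔ n# 6) :+ # 2 :* # 0 :+ # 0)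
    (# 5 :* (n4 :* n1) :+ # 5 :* n5 :+ nat (lit 2 ∗ n# 6) :+ # 2 :* nat (n# 0 ∗ (lit 1 ∔ n# 3)) :+ # 2 :* n2 :+ # 3)
    (5 ⊙ ⊗-monoʳ (0≤ι Q) (ι-mono h₀) ⊞ 5 ⊙ ι-mono (ℕ.≤-reflexive (sym e)) ⊞ ι-mono h₁ ⊞ 2 ⊙ ι-mono h₂ ⊞ 2 ⊙ 0≤ι B ⊞ 0≤ι 3))

endpoint₄ : ∀ m k x P → 2 * suc m * k * x ≤ 5 * suc (suc m) * P → 2 * suc m * (k * x) ≤ 2 * suc m * (5 * P)
endpoint₄ m k x P h = ι-cancel (linear 0 4 {ν = m , k , x , P , _}
    (nat (lit 2 ∗ (lit 1 ∔ n# 0) ∗ (n# 1 ∗ n# 2))) (nat (lit 2 ∗ (lit 1 ∔ n# 0) ∗ (lit 5 ∗ n# 3)))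
    (nat (lit 2 ∗ (lit 1 ∔ n# 0) ∗ n# 1 ∗ n# 2) :+ # 5 :* # 0)
    (nat (lit 5 ∗ (lit 1 ∔ (lit 1 ∔ n# 0)) ∗ n# 3) :+ # 5 :* (n0 :* n3))
    (ι-mono h ⊞ 5 ⊙ ⊗-nonneg (0≤ι m) (0≤ι P)))

-- The interval from 5P/(2k) to (1 + 1/(m + 1)) times that has length 5P/(2 (m + 1) k); half of it
-- is given up to B and to rounding.
length₁ : ∀ m k x P B yⱼ y τ → 1 ≤ k → 5 * suc (suc m) * P < 2 * suc m * k * suc x → k * yⱼ ≤ y → 2 * y ≤ 5 * P + 2 * B + 2 → k * τ ≤ P → 4 * suc m * (2 * B + 3) ≤ τ →
  5 * P + 4 * suc m * k * (yⱼ + B + 1) ≤ 4 * suc m * k * x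
length₁ m k x P B yⱼ y τ 1≤k h₁ h₂ h₃ h₄ h₅ = ι-cancel (linear 0 8 {ν = P , m , k , yⱼ , B , x , y , τ , _}
    (nat (lit 5 ∗ n# 0 ∔ lit 4 ∗ (lit 1 ∔ n# 1) ∗ n# 2 ∗ (n# 3 ∔ n# 4 ∔ lit 1)))
    (nat (lit 4 ∗ (lit 1 ∔ n# 1) ∗ n# 2 ∗ n# 5))
    (# 2 :* nat (lit 1 ∔ lit 5 ∗ (lit 1 ∔ (lit 1 ∔ n# 1)) ∗ n# 0) :+ # 4 :* (nat (lit 1 ∔ n# 1) :* nat (n# 2 ∗ n# 3)) :+ # 2 :* (nat (lit 1 ∔ n# 1) :* nat (lit 2 ∗ n# 6)) :+ nat (n# 2 ∗ n# 7) :+ n2 :* nat (lit 4 ∗ (lit 1 ∔ n# 1) ∗ (lit 2 ∗ n# 4 ∔ lit 3)) :+ # 4 :* # 0 :+ # 4 :* (# 1 :* (nat (lit 1 ∔ n# 1) :* (n4 :+ # 1))) :+ # 0)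
    (# 2 :* nat (lit 2 ∗ (lit 1 ∔ n# 1) ∗ n# 2 ∗ (lit 1 ∔ n# 5)) :+ # 4 :* (nat (lit 1 ∔ n# 1) :* n6) :+ # 2 :* (nat (lit 1 ∔ n# 1) :* nat (lit 5 ∗ n# 0 ∔ lit 2 ∗ n# 4 ∔ lit 2)) :+ n0 :+ n2 :* n7 :+ # 4 :* n0 :+ # 4 :* (n2 :* (nat (lit 1 ∔ n# 1) :* (n4 :+ # 1))) :+ # 2)
    (2 ⊙ ι-mono h₁
  ⊞ 4 ⊙ ⊗-monoˡ (0≤ι (suc m)) (ι-mono h₂) ⊞ 2 ⊙ ⊗-monoˡ (0≤ι (suc m)) (ι-mono h₃) ⊞ ι-mono h₄ ⊞ k ⊙ ι-mono h₅ ⊞ 4 ⊙ 0≤ι P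
  ⊞ 4 ⊙ ⊗-monoʳ (⊗-nonneg (0≤ι (suc m)) (⊕-nonneg (0≤ι B) (0≤ι 1))) (ι-mono 1≤k) ⊞ 0≤ι 2))

endpoint₅ : ∀ k yⱼ y′ y P Q B → 1 ≤ k → k * yⱼ ≤ y → 2 * y ≤ 5 * P + 2 * B + 2 → P ≤ k * Q → 5 * Q + 2 * B + 3 ≤ 2 * y′ → 2 * k * yⱼ ≤ 2 * k * y′
endpoint₅ k yⱼ y′ y P Q B 1≤k h₁ h₂ h₃ h₄ = ι-cancel (linear 0 7 {ν = k , yⱼ , y′ , y , P , Q , _ , _}
    (nat (lit 2 ∗ n# 0 ∗ n# 1)) (nat (lit 2 ∗ n# 0 ∗ n# 2))
    (# 2 :* nat (n# 0 ∗ n# 1) :+ nat (lit 2 ∗ n# 3) :+ # 5 :* n4 :+ n0 :* nat (lit 5 ∗ n# 5 ∔ lit 2 ∗ n# 6 ∔ lit 3) :+ # 2 :* (# 1 :* n6) :+ # 3 :* # 1 :+ # 0)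
    (# 2 :* n3 :+ nat (lit 5 ∗ n# 4 ∔ lit 2 ∗ n# 6 ∔ lit 2) :+ # 5 :* nat (n# 0 ∗ n# 5) :+ n0 :* nat (lit 2 ∗ n# 2) :+ # 2 :* (n0 :* n6) :+ # 3 :* n0 :+ # 1)
    (2 ⊙ ι-mono h₁ ⊞ ι-mono h₂ ⊞ 5 ⊙ ι-mono h₃ ⊞ k ⊙ ι-mono h₄
  ⊞ 2 ⊙ ⊗-monoʳ (0≤ι B) (ι-mono 1≤k) ⊞ 3 ⊙ ι-mono 1≤k ⊞ 0≤ι 1))

endpoint₆ : ∀ k p P Q → 5 ≤ p → P < k * Q → 5 * P < k * (p * Q)
endpoint₆ k p P Q h₁ h₂ = ι-cancel (linear 0 4 {ν = P , k , p , Q , _}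
    (nat (lit 1 ∔ lit 5 ∗ n# 0)) (nat (n# 1 ∗ (n# 2 ∗ n# 3)))
    (# 5 :* nat (lit 1 ∔ n# 0) :+ # 5 :* (n1 :* n3) :+ # 0) (# 5 :* nat (n# 1 ∗ n# 3) :+ n2 :* (n1 :* n3) :+ # 4)
    (5 ⊙ ι-mono h₂ ⊞ ⊗-monoʳ (⊗-nonneg (0≤ι k) (0≤ι Q)) (ι-mono h₁) ⊞ 0≤ι 4))

-- The upper bound on k makes 5P/k - 5Q/2 at least 5P/((m + 1) k), four times the length required.
length₂ : ∀ m k x y′ P B Q τ pP → 5 * P < k * suc x → 2 * y′ ≤ 5 * Q + 2 * B + 4 → suc m * k ≤ 2 * m * pP → P ≡ pP * Q → k * τ ≤ P → 4 * suc m * (2 * B + 3) ≤ τ →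
  5 * P + 4 * suc m * k * y′ ≤ 4 * suc m * k * x
length₂ m k x y′ P B Q τ pP h₁ h₂ h₃ e h₄ h₅ = ι-cancel (linear 0 9 {ν = P , m , k , y′ , x , Q , pP , τ , B , _}
    (nat (lit 5 ∗ n# 0 ∔ lit 4 ∗ (lit 1 ∔ n# 1) ∗ n# 2 ∗ n# 3)) (nat (lit 4 ∗ (lit 1 ∔ n# 1) ∗ n# 2 ∗ n# 4))
    (# 4 :* (nat (lit 1 ∔ n# 1) :* nat (lit 1 ∔ lit 5 ∗ n# 0)) :+ # 2 :* (nat (lit 1 ∔ n# 1) :* n2 :* nat (lit 2 ∗ n# 3)) :+ # 10 :* (nat ((lit 1 ∔ n# 1) ∗ n# 2) :* n5) :+ # 20 :* (n1 :* nat (n# 6 ∗ n# 5)) :+ nat (n# 2 ∗ n# 7) :+ n2 :* nat (lit 4 ∗ (lit 1 ∔ n# 1) ∗ (lit 2 ∗ n# 8 ∔ lit 3)) :+ # 14 :* # 0 :+ # 4 :* # 0 :+ # 4 :* # 0)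
    (# 4 :* (nat (lit 1 ∔ n# 1) :* nat (n# 2 ∗ (lit 1 ∔ n# 4))) :+ # 2 :* (nat (lit 1 ∔ n# 1) :* n2 :* nat (lit 5 ∗ n# 5 ∔ lit 2 ∗ n# 8 ∔ lit 4)) :+ # 10 :* (nat (lit 2 ∗ n# 1 ∗ n# 6) :* n5) :+ # 20 :* (n1 :* n0) :+ n0 :+ n2 :* n7 :+ # 14 :* n0 :+ # 4 :* nat (lit 1 ∔ n# 1) :+ # 4 :* (nat (lit 1 ∔ n# 1) :* n2 :* n8))
    (4 ⊙ ⊗-monoˡ (0≤ι (suc m)) (ι-mono h₁)
  ⊞ 2 ⊙ ⊗-monoˡ (⊗-nonneg (0≤ι (suc m)) (0≤ι k)) (ι-mono h₂) ⊞ 10 ⊙ ⊗-monoʳ (0≤ι Q) (ι-mono h₃) ⊞ 20 ⊙ ⊗-monoˡ (0≤ι m) (ι-mono (ℕ.≤-reflexive (sym e)))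
  ⊞ ι-mono h₄ ⊞ k ⊙ ι-mono h₅ ⊞ 14 ⊙ 0≤ι P ⊞ 4 ⊙ 0≤ι (suc m) ⊞ 4 ⊙ ⊗-nonneg (⊗-nonneg (0≤ι (suc m)) (0≤ι k)) (0≤ι B)))

endpoint₇ : ∀ m p q h → suc m * h ≤ 2 * m * (p * q) → 2 * suc m * h ≤ 5 * suc (suc m) * (p * q)
endpoint₇ m p q h le = ι-cancel (linear 0 4 {ν = m , h , p , q , _}
    (nat (lit 2 ∗ (lit 1 ∔ n# 0) ∗ n# 1)) (nat (lit 5 ∗ (lit 1 ∔ (lit 1 ∔ n# 0)) ∗ (n# 2 ∗ n# 3)))
    (# 2 :* nat ((lit 1 ∔ n# 0) ∗ n# 1) :+ # 0 :+ # 10 :* # 0)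
    (# 2 :* nat (lit 2 ∗ n# 0 ∗ (n# 2 ∗ n# 3)) :+ n0 :* (n2 :* n3) :+ # 10 :* (n2 :* n3))
    (2 ⊙ ι-mono le ⊞ ⊗-nonneg (0≤ι m) (⊗-nonneg (0≤ι p) (0≤ι q)) ⊞ 10 ⊙ ⊗-nonneg (0≤ι p) (0≤ι q)))

endpoint₈ : ∀ m p q l → 1 ≤ m → 5 ≤ p → 2 * suc m * l ≤ 5 * suc (suc m) * q → 2 * (suc m * l) ≤ 2 * (2 * m * (p * q))
endpoint₈ m p q l 1≤m 5≤p le = ι-cancel (linear 0 4 {ν = m , l , p , q , _}
    (nat (lit 2 ∗ ((lit 1 ∔ n# 0) ∗ n# 1))) (nat (lit 2 ∗ (lit 2 ∗ n# 0 ∗ (n# 2 ∗ n# 3))))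
    (nat (lit 2 ∗ (lit 1 ∔ n# 0) ∗ n# 1) :+ # 4 :* (# 5 :* (n0 :* n3)) :+ # 10 :* (# 1 :* n3) :+ # 5 :* # 0)
    (nat (lit 5 ∗ (lit 1 ∔ (lit 1 ∔ n# 0)) ∗ n# 3) :+ # 4 :* (n2 :* (n0 :* n3)) :+ # 10 :* (n0 :* n3) :+ # 5 :* (n0 :* n3))
    (ι-mono le ⊞ 4 ⊙ ⊗-monoʳ (⊗-nonneg (0≤ι m) (0≤ι q)) (ι-mono 5≤p) ⊞ 10 ⊙ ⊗-monoʳ (0≤ι q) (ι-mono 1≤m) ⊞ 5 ⊙ ⊗-nonneg (0≤ι m) (0≤ι q)))

endpoint₁₀ : ∀ m p q h → 2 ≤ p → suc m * h ≤ 2 * m * q → suc m * h ≤ suc m * (p * q)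
endpoint₁₀ m p q h 2≤p le = ι-cancel (linear 0 4 {ν = m , h , p , q , _}
    (nat ((lit 1 ∔ n# 0) ∗ n# 1)) (nat ((lit 1 ∔ n# 0) ∗ (n# 2 ∗ n# 3)))
    (nat ((lit 1 ∔ n# 0) ∗ n# 1) :+ # 2 :* (n0 :* n3) :+ # 0)
    (nat (lit 2 ∗ n# 0 ∗ n# 3) :+ n2 :* (n0 :* n3) :+ n2 :* n3)
    (ι-mono le ⊞ ⊗-monoʳ (⊗-nonneg (0≤ι m) (0≤ι q)) (ι-mono 2≤p) ⊞ ⊗-nonneg (0≤ι p) (0≤ι q)))

module _ (m P y x p : ℕ) (fy : 2 * suc m * y ≤ 5 * suc (suc m) * P) (fy′ : 5 * suc (suc m) * P < 2 * suc m * suc y)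
         (fx : suc m * x ≤ 2 * m * (p * P)) (m≤P : 12 * suc m ≤ P) where

  2P≤y-scaled : 2 * suc m * (2 * P) ≤ 2 * suc m * y
  2P≤y-scaled = ι-cancel (linear 0 3 {ν = m , P , y , _}
      (nat (lit 2 ∗ (lit 1 ∔ n# 0) ∗ (lit 2 ∗ n# 1))) (nat (lit 2 ∗ (lit 1 ∔ n# 0) ∗ n# 2))
      (nat (lit 1 ∔ lit 5 ∗ (lit 1 ∔ (lit 1 ∔ n# 0)) ∗ n# 1) :+ nat (lit 1 ∔ n# 0) :* nat (lit 12 ∗ (lit 1 ∔ n# 0)) :+ # 5 :* # 0 :+ # 12 :* # 0 :+ # 10 :* # 0 :+ # 0)
      (nat (lit 2 ∗ (lit 1 ∔ n# 0) ∗ (lit 1 ∔ n# 2)) :+ nat (lit 1 ∔ n# 0) :* n1 :+ # 5 :* n1 :+ # 12 :* (n0 :* nat (lit 1 ∔ n# 0)) :+ # 10 :* nat (lit 1 ∔ n# 0) :+ # 1)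
      (ι-mono fy′ ⊞ ⊗-monoˡ (0≤ι (suc m)) (ι-mono m≤P) ⊞ 5 ⊙ 0≤ι P ⊞ 12 ⊙ ⊗-nonneg (0≤ι m) (0≤ι (suc m)) ⊞ 10 ⊙ 0≤ι (suc m) ⊞ 0≤ι 1))

  y≤3P-scaled : 4 ≤ m → 2 * suc m * y ≤ 2 * suc m * (3 * P)
  y≤3P-scaled 4≤m = ι-cancel (linear 0 3 {ν = m , y , P , _}
      (nat (lit 2 ∗ (lit 1 ∔ n# 0) ∗ n# 1)) (nat (lit 2 ∗ (lit 1 ∔ n# 0) ∗ (lit 3 ∗ n# 2)))
      (nat (lit 2 ∗ (lit 1 ∔ n# 0) ∗ n# 1) :+ # 4 :* n2) (nat (lit 5 ∗ (lit 1 ∔ (lit 1 ∔ n# 0)) ∗ n# 2) :+ n0 :* n2)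
      (ι-mono fy ⊞ ⊗-monoʳ (0≤ι P) (ι-mono 4≤m)))

  x≤2pP-scaled : suc m * x ≤ suc m * (2 * (p * P))
  x≤2pP-scaled = ι-cancel (linear 0 4 {ν = m , x , p , P , _}
      (nat ((lit 1 ∔ n# 0) ∗ n# 1)) (nat ((lit 1 ∔ n# 0) ∗ (lit 2 ∗ (n# 2 ∗ n# 3))))
      (nat ((lit 1 ∔ n# 0) ∗ n# 1) :+ # 2 :* # 0) (nat (lit 2 ∗ n# 0 ∗ (n# 2 ∗ n# 3)) :+ # 2 :* (n2 :* n3))
      (ι-mono fx ⊞ 2 ⊙ ⊗-nonneg (0≤ι p) (0≤ι P)))

2pP≤py : ∀ p P x y → x ≤ 2 * (p * P) → 2 * P ≤ y → x ≤ p * y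
2pP≤py p P x y h₁ h₂ = ι-cancel (linear 0 4 {ν = x , p , y , P , _}
    n0 (nat (n# 1 ∗ n# 2)) (n0 :+ n1 :* nat (lit 2 ∗ n# 3)) (nat (lit 2 ∗ (n# 1 ∗ n# 3)) :+ n1 :* n2)
    (ι-mono h₁ ⊞ p ⊙ ι-mono h₂))

-- This fixes the value M = 8A + 6. The ratio x/y is close to 4pM/(5 (M + 2)), which is at least
-- 4M/(M + 2) = (4A + 3)/(A + 1); the spare 1/(A + 1) pays for rounding.
ratio-scaled : ∀ A P y x p → 5 ≤ p → 2 * suc (8 * A + 6) * y ≤ 5 * suc (suc (8 * A + 6)) * P → 2 * (8 * A + 6) * (p * P) < suc (8 * A + 6) * suc x → 12 * suc (8 * A + 6) ≤ P →
  2 * suc (8 * A + 6) * ((4 * A + 2) * y) ≤ 2 * suc (8 * A + 6) * (suc A * x)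
ratio-scaled A P y x p 5≤p h₁ h₂ h₃ = ι-cancel (linear 0 5 {ν = A , y , x , p , P , _}
    (nat (lit 2 ∗ (lit 1 ∔ (lit 8 ∗ n# 0 ∔ lit 6)) ∗ ((lit 4 ∗ n# 0 ∔ lit 2) ∗ n# 1)))
    (nat (lit 2 ∗ (lit 1 ∔ (lit 8 ∗ n# 0 ∔ lit 6)) ∗ ((lit 1 ∔ n# 0) ∗ n# 2)))
    (nat (lit 4 ∗ n# 0 ∔ lit 2) :* nat (lit 2 ∗ (lit 1 ∔ (lit 8 ∗ n# 0 ∔ lit 6)) ∗ n# 1) :+ # 2 :* (nat (lit 1 ∔ n# 0) :* nat (lit 1 ∔ lit 2 ∗ (lit 8 ∗ n# 0 ∔ lit 6) ∗ (n# 3 ∗ n# 4))) :+ # 4 :* (nat (lit 1 ∔ n# 0) :* (nat (lit 8 ∗ n# 0 ∔ lit 6) :* n4) :* # 5) :+ # 2 :* (nat (lit 1 ∔ n# 0) :* nat (lit 12 ∗ (lit 1 ∔ (lit 8 ∗ n# 0 ∔ lit 6)))) :+ # 38 :* # 0 :+ # 22 :* # 0 :+ # 2 :* # 0)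
    (nat (lit 4 ∗ n# 0 ∔ lit 2) :* nat (lit 5 ∗ (lit 1 ∔ (lit 1 ∔ (lit 8 ∗ n# 0 ∔ lit 6))) ∗ n# 4) :+ # 2 :* (nat (lit 1 ∔ n# 0) :* nat ((lit 1 ∔ (lit 8 ∗ n# 0 ∔ lit 6)) ∗ (lit 1 ∔ n# 2))) :+ # 4 :* (nat (lit 1 ∔ n# 0) :* (nat (lit 8 ∗ n# 0 ∔ lit 6) :* n4) :* n3) :+ # 2 :* (nat (lit 1 ∔ n# 0) :* n4) :+ # 38 :* (nat (lit 1 ∔ n# 0) :* n4) :+ # 22 :* (nat (lit 1 ∔ n# 0) :* nat (lit 1 ∔ (lit 8 ∗ n# 0 ∔ lit 6))) :+ # 2 :* nat (lit 1 ∔ n# 0))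
    ((4 * A + 2) ⊙ ι-mono h₁ ⊞ 2 ⊙ ⊗-monoˡ (0≤ι (suc A)) (ι-mono h₂)
  ⊞ 4 ⊙ ⊗-monoˡ (⊗-nonneg (0≤ι (suc A)) (⊗-nonneg (0≤ι (8 * A + 6)) (0≤ι P))) (ι-mono 5≤p) ⊞ 2 ⊙ ⊗-monoˡ (0≤ι (suc A)) (ι-mono h₃) ⊞ 38 ⊙ ⊗-nonneg (0≤ι (suc A)) (0≤ι P) ⊞ 22 ⊙ ⊗-nonneg (0≤ι (suc A)) (0≤ι (suc (8 * A + 6))) ⊞ 2 ⊙ 0≤ι (suc A)))

2y≤x-scaled : ∀ A y x → (4 * A + 2) * y ≤ suc A * x → suc A * (2 * y) ≤ suc A * x
2y≤x-scaled A y x h = ι-cancel (linear 0 3 {ν = A , y , x , _}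
    (nat ((lit 1 ∔ n# 0) ∗ (lit 2 ∗ n# 1))) (nat ((lit 1 ∔ n# 0) ∗ n# 2))
    (nat ((lit 4 ∗ n# 0 ∔ lit 2) ∗ n# 1) :+ # 2 :* # 0) (nat ((lit 1 ∔ n# 0) ∗ n# 2) :+ # 2 :* (n0 :* n1))
    (ι-mono h ⊞ 2 ⊙ ⊗-nonneg (0≤ι A) (0≤ι y)))

-- The free interval taken at scale Q runs from 4A/(A + 1) Q to (4A + 1)/(A + 1) Q, the first piece
-- that is free for every d > A/2; k times it has to fit into (y₂, x₂].
module Zone (A B k p v x y Q x₂ y₂ : ℕ) where

  zone₁ : ∀ yⱼ → k * yⱼ ≤ y₂ → suc A * y₂ ≤ 4 * A * (k * Q) → k * (suc A * yⱼ) ≤ k * (4 * A * Q)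
  zone₁ yⱼ h z = ι-cancel (linear 0 5 {ν = k , A , yⱼ , Q , y₂ , _}
      (nat (n# 0 ∗ ((lit 1 ∔ n# 1) ∗ n# 2))) (nat (n# 0 ∗ (lit 4 ∗ n# 1 ∗ n# 3)))
      (nat (lit 1 ∔ n# 1) :* nat (n# 0 ∗ n# 2) :+ nat ((lit 1 ∔ n# 1) ∗ n# 4))
      (nat (lit 1 ∔ n# 1) :* n4 :+ nat (lit 4 ∗ n# 1 ∗ (n# 0 ∗ n# 3)))
      (suc A ⊙ ι-mono h ⊞ ι-mono z))

  zone₂ : suc A * x ≤ (4 * A + 1) * Q → (4 * A + 1) * (k * Q) ≤ suc A * x₂ → suc A * (k * x) ≤ suc A * x₂
  zone₂ h z = ι-cancel (linear 0 5 {ν = A , k , x , x₂ , Q , _}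
      (nat ((lit 1 ∔ n# 0) ∗ (n# 1 ∗ n# 2))) (nat ((lit 1 ∔ n# 0) ∗ n# 3))
      (n1 :* nat ((lit 1 ∔ n# 0) ∗ n# 2) :+ nat ((lit 4 ∗ n# 0 ∔ lit 1) ∗ (n# 1 ∗ n# 4)))
      (n1 :* nat ((lit 4 ∗ n# 0 ∔ lit 1) ∗ n# 4) :+ nat ((lit 1 ∔ n# 0) ∗ n# 3))
      (k ⊙ ι-mono h ⊞ ι-mono z))

  zone₃ : 4 * A * Q < suc A * suc v → 4 * A * Q + 2 * B ≤ suc A * (v + 2 * B + 1)
  zone₃ h = ι-cancel (linear 0 4 {ν = A , Q , _ , v , _}
      (nat (lit 4 ∗ n# 0 ∗ n# 1 ∔ lit 2 ∗ n# 2)) (nat ((lit 1 ∔ n# 0) ∗ (n# 3 ∔ lit 2 ∗ n# 2 ∔ lit 1)))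
      (nat (lit 1 ∔ lit 4 ∗ n# 0 ∗ n# 1) :+ # 2 :* # 0 :+ # 0)
      (nat ((lit 1 ∔ n# 0) ∗ (lit 1 ∔ n# 3)) :+ # 2 :* (n0 :* n2) :+ # 1)
      (ι-mono h ⊞ 2 ⊙ ⊗-nonneg (0≤ι A) (0≤ι B) ⊞ 0≤ι 1))

  zone₄ : ∀ w C → 1 ≤ A → 4 * A * Q + C ≤ suc A * w → suc A * Q ≤ suc A * w
  zone₄ w C 1≤A h = ι-cancel (linear 0 4 {ν = A , Q , w , _ , _}
      (nat ((lit 1 ∔ n# 0) ∗ n# 1)) (nat ((lit 1 ∔ n# 0) ∗ n# 2))
      (nat (lit 4 ∗ n# 0 ∗ n# 1 ∔ n# 3) :+ # 0 :+ # 3 :* (# 1 :* n1) :+ # 2 :* # 0)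
      (nat ((lit 1 ∔ n# 0) ∗ n# 2) :+ n3 :+ # 3 :* (n0 :* n1) :+ # 2 :* n1)
      (ι-mono h ⊞ 0≤ι C ⊞ 3 ⊙ ⊗-monoʳ (0≤ι Q) (ι-mono 1≤A) ⊞ 2 ⊙ 0≤ι Q))

  zone₅ : 5 ≤ p → 1 ≤ Q → (4 * A + 1) * Q < suc A * (p * Q)
  zone₅ 5≤p 1≤Q = ι-cancel (linear 0 3 {ν = A , Q , p , _}
      (nat (lit 1 ∔ (lit 4 ∗ n# 0 ∔ lit 1) ∗ n# 1)) (nat ((lit 1 ∔ n# 0) ∗ (n# 2 ∗ n# 1)))
      (# 5 :* (nat (lit 1 ∔ n# 0) :* n1) :+ # 0 :+ # 3 :* # 0 :+ # 1)
      (n2 :* (nat (lit 1 ∔ n# 0) :* n1) :+ n0 :* n1 :+ # 3 :* n1 :+ n1)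
      (⊗-monoʳ (⊗-nonneg (0≤ι (suc A)) (0≤ι Q)) (ι-mono 5≤p) ⊞ ⊗-nonneg (0≤ι A) (0≤ι Q) ⊞ 3 ⊙ 0≤ι Q ⊞ ι-mono 1≤Q))

  zone₆ : 4 * suc (8 * A + 6) * (2 * B + 3) ≤ Q → 2 * suc A * (2 * B + 2) ≤ Q
  zone₆ h = ι-cancel (linear 0 3 {ν = A , B , Q , _}
      (nat (lit 2 ∗ (lit 1 ∔ n# 0) ∗ (lit 2 ∗ n# 1 ∔ lit 2))) n2
      (nat (lit 4 ∗ (lit 1 ∔ (lit 8 ∗ n# 0 ∔ lit 6)) ∗ (lit 2 ∗ n# 1 ∔ lit 3)) :+ # 60 :* # 0 :+ # 92 :* # 0 :+ # 52 :* # 0 :+ # 0)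
      (n2 :+ # 60 :* (n0 :* n1) :+ # 92 :* n0 :+ # 52 :* n1 :+ # 76)
      (ι-mono h ⊞ 60 ⊙ ⊗-nonneg (0≤ι A) (0≤ι B) ⊞ 92 ⊙ 0≤ι A ⊞ 52 ⊙ 0≤ι B ⊞ 0≤ι 76))

  zone-length : x₂ ≤ p * y₂ → suc A * y₂ ≤ 4 * A * (k * Q) → suc A * v ≤ 4 * A * Q → (4 * A + 1) * Q < suc A * suc x → 2 * suc A * (2 * B + 2) ≤ Q →
    suc A * (x₂ + 8 * p * suc (8 * A + 6) * k * (v + 2 * B + 1)) ≤ suc A * (8 * p * suc (8 * A + 6) * k * x)
  zone-length h₁ z₁ h₂ h₃ h₄ = ι-cancel (linear 0 9
      (nat ((lit 1 ∔ n# 0) ∗ (n# 1 ∔ lit 8 ∗ n# 2 ∗ (lit 1 ∔ (lit 8 ∗ n# 0 ∔ lit 6)) ∗ n# 3 ∗ (n# 4 ∔ lit 2 ∗ n# 5 ∔ lit 1))))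
      (nat ((lit 1 ∔ n# 0) ∗ (lit 8 ∗ n# 2 ∗ (lit 1 ∔ (lit 8 ∗ n# 0 ∔ lit 6)) ∗ n# 3 ∗ n# 6)))
      (# 0 :* # 0 :+ # 0 :* # 0 :+ # 0 :* # 0 :+ # 0 :* # 0 :+ # 0 :* # 0 :+ # 0 :* # 0 :+ # 0 :* # 0 :+ # 0 :* # 0 :+ # 0 :* # 0 :+ nat (lit 1 ∔ n# 0) :* n1 :+ n2 :* nat ((lit 1 ∔ n# 0) ∗ n# 7) :+ # 8 :* (n2 :* (nat (lit 1 ∔ (lit 8 ∗ n# 0 ∔ lit 6)) :* n3) :* nat ((lit 1 ∔ n# 0) ∗ n# 4)) :+ # 8 :* (n2 :* (nat (lit 1 ∔ (lit 8 ∗ n# 0 ∔ lit 6)) :* n3) :* nat (lit 1 ∔ (lit 4 ∗ n# 0 ∔ lit 1) ∗ n# 8)) :+ # 4 :* (n2 :* (nat (lit 1 ∔ (lit 8 ∗ n# 0 ∔ lit 6)) :* n3) :* nat (lit 2 ∗ (lit 1 ∔ n# 0) ∗ (lit 2 ∗ n# 5 ∔ lit 2))) :+ # 28 :* # 0 :+ # 28 :* # 0 :+ # 8 :* # 0)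
      (# 0 :* n0 :+ # 0 :* n5 :+ # 0 :* n3 :+ # 0 :* n2 :+ # 0 :* n4 :+ # 0 :* n6 :+ # 0 :* n1 :+ # 0 :* n7 :+ # 0 :* n8 :+ nat (lit 1 ∔ n# 0) :* nat (n# 2 ∗ n# 7) :+ n2 :* nat (lit 4 ∗ n# 0 ∗ (n# 3 ∗ n# 8)) :+ # 8 :* (n2 :* (nat (lit 1 ∔ (lit 8 ∗ n# 0 ∔ lit 6)) :* n3) :* nat (lit 4 ∗ n# 0 ∗ n# 8)) :+ # 8 :* (n2 :* (nat (lit 1 ∔ (lit 8 ∗ n# 0 ∔ lit 6)) :* n3) :* nat ((lit 1 ∔ n# 0) ∗ (lit 1 ∔ n# 6))) :+ # 4 :* (n2 :* (nat (lit 1 ∔ (lit 8 ∗ n# 0 ∔ lit 6)) :* n3) :* n8) :+ # 28 :* (n2 :* (n3 :* n8) :* n0) :+ # 28 :* (n2 :* (n3 :* n8)) :+ # 8 :* (n2 :* (nat (lit 1 ∔ (lit 8 ∗ n# 0 ∔ lit 6)) :* n3)))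
      (at# A ⊞ at# B ⊞ at# k ⊞ at# p ⊞ at# v ⊞ at# x ⊞ at# x₂ ⊞ at# y₂ ⊞ at# Q
      ⊞ suc A ⊙ ι-mono h₁ ⊞ p ⊙ ι-mono z₁ ⊞ 8 ⊙ ⊗-monoˡ C₀ (ι-mono h₂) ⊞ 8 ⊙ ⊗-monoˡ C₀ (ι-mono h₃) ⊞ 4 ⊙ ⊗-monoˡ C₀ (ι-mono h₄)
      ⊞ 28 ⊙ ⊗-nonneg pkQ (0≤ι A) ⊞ 28 ⊙ pkQ ⊞ 8 ⊙ C₀))
    where
    C₀ : ι 0 ⊑ ι p ⊗ (ι (suc (8 * A + 6)) ⊗ ι k)
    C₀ = ⊗-nonneg (0≤ι p) (⊗-nonneg (0≤ι (suc (8 * A + 6))) (0≤ι k))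
    pkQ : ι 0 ⊑ ι p ⊗ (ι k ⊗ ι Q)
    pkQ = ⊗-nonneg (0≤ι p) (⊗-nonneg (0≤ι k) (0≤ι Q))

middle₁ : ∀ m k x y₂ x₂ → suc m * k * x ≤ suc (suc m) * y₂ → 2 * y₂ ≤ x₂ → suc m * (k * x) ≤ suc m * x₂
middle₁ m k x y₂ x₂ h₁ h₂ = ι-cancel (linear 0 5 {ν = m , k , x , x₂ , y₂ , _}
    (nat ((lit 1 ∔ n# 0) ∗ (n# 1 ∗ n# 2))) (nat ((lit 1 ∔ n# 0) ∗ n# 3))
    (nat ((lit 1 ∔ n# 0) ∗ n# 1 ∗ n# 2) :+ nat (lit 1 ∔ n# 0) :* nat (lit 2 ∗ n# 4) :+ # 0)
    (nat ((lit 1 ∔ (lit 1 ∔ n# 0)) ∗ n# 4) :+ nat (lit 1 ∔ n# 0) :* n3 :+ n0 :* n4)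
    (ι-mono h₁ ⊞ suc m ⊙ ι-mono h₂ ⊞ ⊗-nonneg (0≤ι m) (0≤ι y₂)))

middle₂ : ∀ A k B Q yⱼ y₂ → 4 * A * (k * Q) ≤ suc A * y₂ → y₂ < k * suc yⱼ → k * (4 * A * Q + 2 * B) ≤ k * (suc A * (yⱼ + 2 * B + 1))
middle₂ A k B Q yⱼ y₂ h₁ h₂ = ι-cancel (linear 0 6 {ν = k , A , Q , B , yⱼ , y₂ , _}
    (nat (n# 0 ∗ (lit 4 ∗ n# 1 ∗ n# 2 ∔ lit 2 ∗ n# 3)))
    (nat (n# 0 ∗ ((lit 1 ∔ n# 1) ∗ (n# 4 ∔ lit 2 ∗ n# 3 ∔ lit 1))))
    (nat (lit 4 ∗ n# 1 ∗ (n# 0 ∗ n# 2)) :+ nat (lit 1 ∔ n# 1) :* nat (lit 1 ∔ n# 5) :+ # 2 :* # 0 :+ # 0)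
    (nat ((lit 1 ∔ n# 1) ∗ n# 5) :+ nat (lit 1 ∔ n# 1) :* nat (n# 0 ∗ (lit 1 ∔ n# 4)) :+ # 2 :* (n0 :* (n1 :* n3)) :+ nat (lit 1 ∔ n# 1))
    (ι-mono h₁ ⊞ suc A ⊙ ι-mono h₂ ⊞ 2 ⊙ ⊗-nonneg (0≤ι k) (⊗-nonneg (0≤ι A) (0≤ι B)) ⊞ 0≤ι (suc A)))

middle-length : ∀ m B k p yⱼ x x₂ y₂ τ → x₂ ≤ p * y₂ → suc (suc m) * y₂ < suc m * k * suc x → k * yⱼ ≤ y₂ → k * τ ≤ y₂ → 4 * suc m * (2 * B + 3) ≤ τ →
  x₂ + 8 * p * suc m * k * (yⱼ + 2 * B + 1) ≤ 8 * p * suc m * k * x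
middle-length m B k p yⱼ x x₂ y₂ τ h₁ h₂ h₃ h₄ h₅ = ι-cancel (linear 0 9 {ν = x₂ , p , m , k , yⱼ , B , x , y₂ , τ , _}
    (nat (n# 0 ∔ lit 8 ∗ n# 1 ∗ (lit 1 ∔ n# 2) ∗ n# 3 ∗ (n# 4 ∔ lit 2 ∗ n# 5 ∔ lit 1)))
    (nat (lit 8 ∗ n# 1 ∗ (lit 1 ∔ n# 2) ∗ n# 3 ∗ n# 6))
    (n0 :+ # 8 :* (n1 :* nat (lit 1 ∔ (lit 1 ∔ (lit 1 ∔ n# 2)) ∗ n# 7)) :+ # 8 :* (n1 :* nat (lit 1 ∔ n# 2) :* nat (n# 3 ∗ n# 4)) :+ # 7 :* (n1 :* nat (n# 3 ∗ n# 8)) :+ # 7 :* (n1 :* n3 :* nat (lit 4 ∗ (lit 1 ∔ n# 2) ∗ (lit 2 ∗ n# 5 ∔ lit 3))) :+ # 40 :* # 0 :+ # 68 :* # 0 :+ # 8 :* # 0)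
    (nat (n# 1 ∗ n# 7) :+ # 8 :* (n1 :* nat ((lit 1 ∔ n# 2) ∗ n# 3 ∗ (lit 1 ∔ n# 6))) :+ # 8 :* (n1 :* nat (lit 1 ∔ n# 2) :* n7) :+ # 7 :* (n1 :* n7) :+ # 7 :* (n1 :* n3 :* n8) :+ # 40 :* (n1 :* (n3 :* nat (lit 1 ∔ n# 2)) :* n5) :+ # 68 :* (n1 :* (n3 :* nat (lit 1 ∔ n# 2))) :+ # 8 :* n1)
    (ι-mono h₁
    ⊞ 8 ⊙ (p ⊙ ι-mono h₂) ⊞ 8 ⊙ ⊗-monoˡ (⊗-nonneg (0≤ι p) (0≤ι (suc m))) (ι-mono h₃)
    ⊞ 7 ⊙ (p ⊙ ι-mono h₄) ⊞ 7 ⊙ ⊗-monoˡ (⊗-nonneg (0≤ι p) (0≤ι k)) (ι-mono h₅) ⊞ 40 ⊙ ⊗-nonneg pkM (0≤ι B) ⊞ 68 ⊙ pkM ⊞ 8 ⊙ 0≤ι p))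
  where
  pkM : ι 0 ⊑ ι p ⊗ (ι k ⊗ ι (suc m))
  pkM = ⊗-nonneg (0≤ι p) (⊗-nonneg (0≤ι k) (0≤ι (suc m)))

case₁ : ∀ A k Q y₂ x₂ → k * Q ≤ y₂ → (4 * A + 2) * y₂ ≤ suc A * x₂ → (4 * A + 1) * (k * Q) ≤ suc A * x₂
case₁ A k Q y₂ x₂ h₁ h₂ = ι-cancel (linear 0 5 {ν = A , k , Q , x₂ , y₂ , _}
    (nat ((lit 4 ∗ n# 0 ∔ lit 1) ∗ (n# 1 ∗ n# 2))) (nat ((lit 1 ∔ n# 0) ∗ n# 3))
    (nat (lit 4 ∗ n# 0 ∔ lit 2) :* nat (n# 1 ∗ n# 2) :+ nat ((lit 4 ∗ n# 0 ∔ lit 2) ∗ n# 4) :+ # 0)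
    (nat (lit 4 ∗ n# 0 ∔ lit 2) :* n4 :+ nat ((lit 1 ∔ n# 0) ∗ n# 3) :+ n1 :* n2)
    ((4 * A + 2) ⊙ ι-mono h₁ ⊞ ι-mono h₂ ⊞ ⊗-nonneg (0≤ι k) (0≤ι Q)))

case₂ : ∀ A k Q y₂ → 1 ≤ A → y₂ ≤ k * Q → suc A * y₂ ≤ 4 * A * (k * Q)
case₂ A k Q y₂ 1≤A h = ι-cancel (linear 0 4 {ν = A , y₂ , k , Q , _}
    (nat ((lit 1 ∔ n# 0) ∗ n# 1)) (nat (lit 4 ∗ n# 0 ∗ (n# 2 ∗ n# 3)))
    (nat (lit 1 ∔ n# 0) :* n1 :+ # 1 :* (n2 :* n3) :+ # 2 :* # 0)
    (nat (lit 1 ∔ n# 0) :* nat (n# 2 ∗ n# 3) :+ n0 :* (n2 :* n3) :+ # 2 :* (n0 :* (n2 :* n3)))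
    (suc A ⊙ ι-mono h ⊞ ⊗-monoʳ (⊗-nonneg (0≤ι k) (0≤ι Q)) (ι-mono 1≤A) ⊞ 2 ⊙ ⊗-nonneg (0≤ι A) (⊗-nonneg (0≤ι k) (0≤ι Q))))

case₃ : ∀ A k Q y₂ x₂ → suc (8 * A + 6) * k * Q ≤ suc (suc (8 * A + 6)) * y₂ → (4 * A + 2) * y₂ ≤ suc A * x₂ →
  suc (8 * A + 6) * ((4 * A + 1) * (k * Q)) ≤ suc (8 * A + 6) * (suc A * x₂)
case₃ A k Q y₂ x₂ h₁ h₂ = ι-cancel (linear 0 5 {ν = A , k , Q , x₂ , y₂ , _}
    (nat ((lit 1 ∔ (lit 8 ∗ n# 0 ∔ lit 6)) ∗ ((lit 4 ∗ n# 0 ∔ lit 1) ∗ (n# 1 ∗ n# 2))))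
    (nat ((lit 1 ∔ (lit 8 ∗ n# 0 ∔ lit 6)) ∗ ((lit 1 ∔ n# 0) ∗ n# 3)))
    (nat (lit 4 ∗ n# 0 ∔ lit 1) :* nat ((lit 1 ∔ (lit 8 ∗ n# 0 ∔ lit 6)) ∗ n# 1 ∗ n# 2) :+ nat (lit 1 ∔ (lit 8 ∗ n# 0 ∔ lit 6)) :* nat ((lit 4 ∗ n# 0 ∔ lit 2) ∗ n# 4) :+ # 4 :* # 0 :+ # 6 :* # 0)
    (nat (lit 4 ∗ n# 0 ∔ lit 1) :* nat ((lit 1 ∔ (lit 1 ∔ (lit 8 ∗ n# 0 ∔ lit 6))) ∗ n# 4) :+ nat (lit 1 ∔ (lit 8 ∗ n# 0 ∔ lit 6)) :* nat ((lit 1 ∔ n# 0) ∗ n# 3) :+ # 4 :* (n0 :* n4) :+ # 6 :* n4)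
    ((4 * A + 1) ⊙ ι-mono h₁ ⊞ suc (8 * A + 6) ⊙ ι-mono h₂ ⊞ 4 ⊙ ⊗-nonneg (0≤ι A) (0≤ι y₂) ⊞ 6 ⊙ 0≤ι y₂))

12M≤τ : ∀ m B τ → 4 * suc m * (2 * B + 3) ≤ τ → 12 * suc m ≤ τ
12M≤τ m B τ h = ι-cancel (linear 0 3 {ν = m , τ , B , _}
    (nat (lit 12 ∗ (lit 1 ∔ n# 0))) n1 (nat (lit 4 ∗ (lit 1 ∔ n# 0) ∗ (lit 2 ∗ n# 2 ∔ lit 3)) :+ # 8 :* # 0)
    (n1 :+ # 8 :* (nat (lit 1 ∔ n# 0) :* n2))
    (ι-mono h ⊞ 8 ⊙ ⊗-nonneg (0≤ι (suc m)) (0≤ι B)))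

-- Primes congruent to 1 modulo A

endpoint₁₁ : ∀ τ Q y C → τ ≤ Q → 5 * Q + C + 3 ≤ 2 * y → 2 * τ ≤ 2 * y
endpoint₁₁ τ Q y C h₁ h₂ = ι-cancel (linear 0 4 {ν = τ , y , _ , _ , _}
    (nat (lit 2 ∗ n# 0)) (nat (lit 2 ∗ n# 1))
    (# 2 :* n0 :+ nat (lit 5 ∗ n# 2 ∔ n# 3 ∔ lit 3) :+ # 3 :* # 0 :+ # 0 :+ # 0)
    (# 2 :* n2 :+ nat (lit 2 ∗ n# 1) :+ # 3 :* n2 :+ n3 :+ # 3)
    (2 ⊙ ι-mono h₁ ⊞ ι-mono h₂ ⊞ 3 ⊙ 0≤ι Q ⊞ 0≤ι C ⊞ 0≤ι 3))

module Scales {p A b B G Kmax : ℕ} {{nz : NonZero A}} (W : Window p A b B G Kmax) {N : ℕ} (ls : LogSystem N) where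
  open FreeZones W ls public

  M₀ : ℕ
  M₀ = 8 * A + 6

  1≤M₀ : 1 ≤ M₀
  1≤M₀ = ℕ.≤-trans (s≤s z≤n) (ℕ.m≤n+m 6 (8 * A))

  -- J i consists of the integers in (5/2 (1 + 1/M) p^i, 2 (1 - 1/M) p^(i+1)].
  lo hi : ℕ → ℕ
  lo i = (5 * suc (suc M₀) * p ^ i) ÷ (2 * (suc M₀))
  hi i = (2 * M₀ * p ^ suc i) ÷ (suc M₀)

  pᵖ : ∀ i → 1 ≤ p ^ i
  pᵖ i = ^-pos i 1≤p

  lo-spec : ∀ {i k} → lo i < k → 5 * suc (suc M₀) * p ^ i < 2 * (suc M₀) * k
  lo-spec {i} {k} h = ℕ.<-≤-trans (÷-upper (5 * suc (suc M₀) * p ^ i) (2 * (suc M₀)) (s≤s z≤n)) (ℕ.*-monoʳ-≤ (2 * (suc M₀)) h)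

  hi-spec : ∀ {i k} → k ≤ hi i → (suc M₀) * k ≤ 2 * M₀ * p ^ suc i
  hi-spec {i} {k} h = ℕ.≤-trans (ℕ.*-monoʳ-≤ (suc M₀) h) (÷-lower (2 * M₀ * p ^ suc i) (suc M₀))

  -- Since 2 < 5/2, the intervals J i are disjoint.
  hi≤lo : ∀ i → hi i ≤ lo (suc i)
  hi≤lo i = ÷-greatest {5 * suc (suc M₀) * p ^ suc i} {2 * suc M₀} (s≤s z≤n) (endpoint₇ M₀ p (p ^ i) (hi i) (hi-spec {i} ℕ.≤-refl))

  hi≤lo-mono : ∀ i k → hi i ≤ lo (k + suc i)
  hi≤lo-mono i zero    = hi≤lo i
  hi≤lo-mono i (suc k) = ℕ.≤-trans (hi≤lo-mono i k) (÷-monoˡ (2 * (suc M₀)) (ℕ.*-monoʳ-≤ (5 * suc (suc M₀)) (ℕ.m≤n*m (p ^ (k + suc i)) p {{ℕ.>-nonZero 1≤p}})))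

  inJ? : ∀ i k → Dec (lo i < k × k ≤ hi i)
  inJ? i k = (lo i ℕ.<? k) ×-dec (k ℕ.≤? hi i)

  multiplicity : ℕ → ℕ → ℕ → R
  multiplicity T n k = sum (λ i → χ (inJ? (T + i) k)) n

  multiplicity-0/1 : ∀ T n k → multiplicity T n k ≡ ι 0 ⊎
    Σ ℕ λ i → 1 ≤ i × i ≤ n × lo (T + i) < k × k ≤ hi (T + i) × multiplicity T n k ≡ ι 1
  multiplicity-0/1 T zero    k = inj₁ refl
  multiplicity-0/1 T (suc n) k with inJ? (T + suc n) k
  ... | yes (l , h) = inj₂ (suc n , s≤s z≤n , ℕ.≤-refl , l , h , trans (cong (_⊕ ι 1) (sum-zero n (λ i _ i≤n → χ-no (inJ? (T + i) k)
        (λ { (_ , h′) → ℕ.<⇒≱ l (ℕ.≤-trans h′ (subst (λ s → hi (T + i) ≤ lo s) (idx i i≤n) (hi≤lo-mono (T + i) (n ∸ i)))) })))) (⊕-identityˡ _))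
    where
    idx : ∀ i → i ≤ n → n ∸ i + suc (T + i) ≡ T + suc n
    idx i i≤n = trans (ℕ.+-suc (n ∸ i) (T + i)) (trans (cong suc (trans (ℕ.+-comm (n ∸ i) (T + i)) (trans (ℕ.+-assoc T i (n ∸ i)) (cong (λ t → T + t) (ℕ.m+[n∸m]≡n i≤n))))) (sym (ℕ.+-suc T n)))
  ... | no _ with multiplicity-0/1 T n k
  ...   | inj₁ z = inj₁ (trans (⊕-identityʳ _) z)
  ...   | inj₂ (i , 1≤i , i≤n , l , h , z) = inj₂ (i , 1≤i , ℕ.m≤n⇒m≤1+n i≤n , l , h , trans (⊕-identityʳ _) z)

  termBound-weaken : ∀ {λ′ κ c y x j e e′} → ι 0 ⊑ λ′ → e′ ⊑ e → TermBound λ′ κ c y x j e → TermBound λ′ κ c y x j e′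
  termBound-weaken {λ′} {κ} {c} {y} {x} {j} {e} {e′} 0≤λ h = fin (⊗-monoˡ 0≤λ h)
    where
    fin : ∀ {l d e e′ k v a} → l ⊗ e′ ⊑ l ⊗ e → a ⊑ ι 2 ⊗ l ⊗ (d ⊕ ι 1 ⊖ e) ⊕ k ⊕ v → a ⊑ ι 2 ⊗ l ⊗ (d ⊕ ι 1 ⊖ e′) ⊕ k ⊕ v
    fin {l} {d} {e} {e′} {k} {v} {a} h₁ h₂ = linear 7 0
        v0 (# 2 :* v1 :* (v2 :+ # 1 :- v3) :+ v4 :+ v5) (# 2 :* (v1 :* v3) :+ v0)
        (# 2 :* (v1 :* v6) :+ (# 2 :* v1 :* (v2 :+ # 1 :- v6) :+ v4 :+ v5))
        (2 ⊙ h₁ ⊞ h₂)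

  -- A subinterval of length at least x / (c k) is enough.
  length⇒e : ∀ c x k x′ y′ → 1 ≤ c → 1 ≤ k → x + c * k * y′ ≤ c * k * x′ → ι x ⊗ inv c ⊗ inv k ⊑ ι x′ ⊖ ι y′
  length⇒e c x k x′ y′ 1≤c 1≤k h = ⊗-cancelˡ (c * k) (*-pos 1≤c 1≤k) (linear 2 5 {ν = c , k , x , x′ , y′ , _}
      (nat (n# 0 ∗ n# 1) :* (n2 :* v0 :* v1)) (nat (n# 0 ∗ n# 1) :* (n3 :- n4))
      (nat (n# 2 ∔ n# 0 ∗ n# 1 ∗ n# 4) :+ n2 :* (n0 :* v0) :* (n1 :* v1) :+ n2 :* # 1 :* (n1 :* v1))
      (nat (n# 0 ∗ n# 1 ∗ n# 3) :+ n2 :* # 1 :* (n1 :* v1) :+ n2 :* # 1 :* # 1)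
      (ι-mono h
    ⊞ ≡⇒⊑ (cong (λ t → ι x ⊗ t ⊗ (ι k ⊗ inv k)) (inv-inverse c 1≤c)) ⊞ ≡⇒⊑ (cong (λ t → ι x ⊗ ι 1 ⊗ t) (inv-inverse k 1≤k))))

  -- Step (i) at one large scale: (y₁, x₁] is about (5/2 P₁, 5 P₁] and lies in a gap of b/(A - 1).
  -- The cutoff k ≤ Z₁ keeps x₁/k at least p^t, so the single multiplier `λ₁` serves all k.
  module FirstGap (e₁ t T n : ℕ) (t≤e₁ : t ≤ e₁) (Tn : T + n + suc t ≤ e₁) (e₁≤K : e₁ ≤ Kmax) (1≤T : 1 ≤ T)
    (pe≤N : p ^ suc e₁ ≤ N) (big : 4 * (suc M₀) * (2 * B + 3) + G ≤ p ^ t) where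

    P₁ y₁ x₁ Z₁ : ℕ
    P₁ = p ^ e₁
    y₁ = (5 * P₁) ÷ 2 + B + 1
    x₁ = 5 * P₁
    Z₁ = p ^ (e₁ ∸ t)

    P≡ : P₁ ≡ Z₁ * p ^ t
    P≡ = trans (cong (p ^_) (sym (ℕ.m∸n+n≡m t≤e₁))) (ℕ.^-distribˡ-+-* p (e₁ ∸ t) t)

    big₁ : 4 * (suc M₀) * (2 * B + 3) ≤ p ^ t
    big₁ = ℕ.≤-trans (ℕ.m≤m+n _ _) big

    big₂ : G ≤ p ^ t
    big₂ = ℕ.≤-trans (ℕ.m≤n+m _ _) big

    y-lower : 5 * P₁ + 2 * B + 1 ≤ 2 * y₁
    y-lower = ι-cancel (linear 0 3
        (nat (n# 0 ∔ (n# 0 ∔ (n# 0 ∔ (n# 0 ∔ (n# 0 ∔ lit 0)))) ∔ (n# 1 ∔ (n# 1 ∔ lit 0)) ∔ lit 1))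
        (nat (n# 2 ∔ n# 1 ∔ lit 1 ∔ (n# 2 ∔ n# 1 ∔ lit 1 ∔ lit 0)))
        (# 0 :* # 0 :+ # 0 :* # 0 :+ # 0 :* # 0 :+ nat (lit 1 ∔ (n# 0 ∔ (n# 0 ∔ (n# 0 ∔ (n# 0 ∔ (n# 0 ∔ lit 0)))))))
        (# 0 :* n0 :+ # 0 :* n1 :+ # 0 :* n2 :+ nat (lit 1 ∔ (n# 2 ∔ (lit 1 ∔ (n# 2 ∔ lit 0)))))
        (at# P₁ ⊞ at# B ⊞ at# ((5 * P₁) ÷ 2) ⊞ ι-mono (÷-upper (5 * P₁) 2 (s≤s z≤n))))

    y-upper : 2 * y₁ ≤ 5 * P₁ + 2 * B + 2
    y-upper = ι-cancel (linear 0 3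
        (nat (n# 0 ∔ n# 1 ∔ lit 1 ∔ (n# 0 ∔ n# 1 ∔ lit 1 ∔ lit 0)))
        (nat (n# 2 ∔ (n# 2 ∔ (n# 2 ∔ (n# 2 ∔ (n# 2 ∔ lit 0)))) ∔ (n# 1 ∔ (n# 1 ∔ lit 0)) ∔ lit 2))
        (# 0 :* # 0 :+ # 0 :* # 0 :+ # 0 :* # 0 :+ nat (n# 0 ∔ (n# 0 ∔ lit 0)))
        (# 0 :* n2 :+ # 0 :* n1 :+ # 0 :* n0 :+ nat (n# 2 ∔ (n# 2 ∔ (n# 2 ∔ (n# 2 ∔ (n# 2 ∔ lit 0))))))
        (at# P₁ ⊞ at# B ⊞ at# ((5 * P₁) ÷ 2) ⊞ ι-mono (÷-lower (5 * P₁) 2)))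

    P≥ : 4 * (suc M₀) * (2 * B + 3) ≤ P₁
    P≥ = ℕ.≤-trans big₁ (subst (p ^ t ≤_) (sym P≡) (ℕ.m≤n*m (p ^ t) Z₁ {{ℕ.>-nonZero (pᵖ (e₁ ∸ t))}}))

    y≤x : y₁ ≤ x₁
    y≤x = *-cancel-≤ 2 (s≤s z≤n) (endpoint₁ P₁ B y₁ M₀ y-upper P≥)

    1≤y : 1 ≤ y₁
    1≤y = ℕ.m≤n+m 1 _

    x≤N : x₁ ≤ N
    x≤N = ℕ.≤-trans (ℕ.*-monoˡ-≤ P₁ 5≤p) pe≤N

    k≤P/τ : ∀ {k} → k ≤ Z₁ → k * p ^ t ≤ P₁
    k≤P/τ {k} h = subst (k * p ^ t ≤_) (sym P≡) (ℕ.*-monoˡ-≤ (p ^ t) h)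

    λ₁ : R
    λ₁ = L (p ^ t)

    pt≤N : p ^ t ≤ N
    pt≤N = ℕ.≤-trans (ℕ.^-monoʳ-≤ p {{ℕ.>-nonZero 1≤p}} (ℕ.m≤n⇒m≤1+n t≤e₁)) pe≤N

    0≤λ : ι 0 ⊑ λ₁
    0≤λ = L-nonneg (pᵖ t) pt≤N

    τ≤x÷ : ∀ {k} → 1 ≤ k → k ≤ Z₁ → p ^ t ≤ x₁ ÷ k
    τ≤x÷ {k} 1≤k h = ÷-greatest 1≤k (ℕ.≤-trans (k≤P/τ h) (ℕ.m≤n*m P₁ 5))

    x÷≤N : ∀ k → x₁ ÷ k ≤ N
    x÷≤N k = ℕ.≤-trans (÷≤ x₁ k) x≤N

    e′ : ℕ → R
    e′ k = ι x₁ ⊗ inv (4 * (suc M₀)) ⊗ inv k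

    -- Here P₁ = p p^κ Q with Q = p^q, and for k in J κ the interval (y₁/k, x₁/k] overlaps the gap
    -- from 5/2 Q to p Q in an interval of proportionate length.
    module Deficit (k i : ℕ) (1≤k : 1 ≤ k) (k≤Z : k ≤ Z₁) (k≈1 : k ≈ 1) (i≤ : T + i + suc t ≤ e₁) (l : lo (T + i) < k) (h : k ≤ hi (T + i)) where
      κ q P′ Qq : ℕ
      κ = T + i
      q = e₁ ∸ suc κ
      P′ = p ^ κ
      Qq = p ^ q

      sκ≤e : suc κ ≤ e₁
      sκ≤e = ℕ.≤-trans (ℕ.≤-trans (s≤s (ℕ.m≤m+n κ t)) (ℕ.≤-reflexive (sym (ℕ.+-suc κ t)))) i≤

      PQ : P₁ ≡ p * P′ * Qq
      PQ = trans (cong (p ^_) (sym (ℕ.m+[n∸m]≡n sκ≤e))) (ℕ.^-distribˡ-+-* p (suc κ) q)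

      q≤K : q ≤ Kmax
      q≤K = ℕ.≤-trans (ℕ.m∸n≤m e₁ (suc κ)) e₁≤K

      kτ : k * p ^ t ≤ P₁
      kτ = k≤P/τ k≤Z

      cop : Coprime (A∸1 * k) A
      cop = coprime-* A∸1-unit (≈-coprime {1} {k} (sym k≈1) (λ { (d , _) → ∣1⇒≡1 d }))
        where open import Data.Nat.Divisibility using (∣1⇒≡1)

      open Term λ₁ A∸1 b y₁ x₁ k A∸1-unit b-unit y≤x x≤N 1≤k (ℕ.≤-trans k≤Z (ℕ.≤-trans (subst (Z₁ ≤_) (sym P≡) (ℕ.m≤m*n Z₁ (p ^ t) {{ℕ.>-nonZero (pᵖ t)}})) (ℕ.m≤n*m P₁ 5)))
        0≤λ (L-mono (pᵖ t) (τ≤x÷ 1≤k k≤Z) (x÷≤N k))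

      finish : ∀ y′ x′ → yⱼ ≤ y′ → x′ ≤ xⱼ → p ^ t ≤ y′ → 5 * Qq + 2 * B ≤ 2 * y′ → x′ < p ^ suc q → x₁ + 4 * (suc M₀) * k * y′ ≤ 4 * (suc M₀) * k * x′ →
        TermBound λ₁ A∸1 b y₁ x₁ k (e′ k)
      finish y′ x′ h₁ h₃ τ≤ past x< len′ = termBound-weaken {κ = A∸1} {b} {y₁} {x₁} {k} 0≤λ (length⇒e (4 * (suc M₀)) x₁ k x′ y′ (s≤s z≤n) 1≤k len′)
        (deficient cop y′ x′ h₁ h₂ h₃ (ℕ.≤-trans (pᵖ t) τ≤) (L-mono (pᵖ t) τ≤ (ℕ.≤-trans h₂ (ℕ.≤-trans h₃ xⱼ≤N)))
          (free-top q k y′ x′ q≤K k≈1 (ℕ.≤-trans big₂ τ≤) past x<))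
        where
        h₂ : y′ ≤ x′
        h₂ = *-cancel-≤ (4 * suc M₀ * k) (*-pos {4 * suc M₀} {k} (s≤s z≤n) 1≤k) (ℕ.≤-trans (ℕ.m≤n+m _ x₁) len′)

      yu : y₁ < k * suc yⱼ
      yu = ÷-upper y₁ k 1≤k

      yl : k * yⱼ ≤ y₁
      yl = ÷-lower y₁ k

      result : TermBound λ₁ A∸1 b y₁ x₁ k (e′ k)
      result with k ℕ.≤? p * P′
      -- P₁/k ≥ Q, so y₁/k is already past 5/2 Q up to a bounded error, and k > `lo κ` keeps x′,
      -- about 5/2 (1 + 1/(M₀ + 1)) P₁/k, below p Q.
      ... | yes k≤pP′ = finish (yⱼ + B + 1) x′ (ℕ.≤-trans (ℕ.m≤m+n yⱼ B) (ℕ.m≤m+n _ 1)) x′≤ τ≤ past x< len′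
        where
        x′ = (5 * suc (suc M₀) * P₁) ÷ (2 * (suc M₀) * k)
        2Ek≥1 : 1 ≤ 2 * (suc M₀) * k
        2Ek≥1 = *-pos {2 * suc M₀} {k} (s≤s z≤n) 1≤k
        τ≤ : p ^ t ≤ yⱼ + B + 1
        τ≤ = *-cancel-≤ k 1≤k (endpoint₂ k (p ^ t) yⱼ y₁ P₁ B kτ y-lower yu)
        past : 5 * Qq + 2 * B ≤ 2 * (yⱼ + B + 1)
        past = *-cancel-≤ k 1≤k (endpoint₃ k Qq (p * P′) yⱼ y₁ P₁ B k≤pP′ PQ y-lower yu)
        x< : x′ < p ^ suc q
        x< = *-cancel-< (2 * (suc M₀) * k) (ℕ.≤-<-trans (÷-lower (5 * suc (suc M₀) * P₁) (2 * (suc M₀) * k)) (subst (_< 2 * (suc M₀) * k * p ^ suc q) (sym (trans (cong (5 * suc (suc M₀) *_) PQ) (comm (5 * suc (suc M₀)) p P′ Qq)))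
            (ℕ.*-monoˡ-< (p ^ suc q) {{ℕ.>-nonZero (pᵖ (suc q))}} (lo-spec {κ} l))))
          where
          comm : ∀ a p P₁ Q → a * (p * P₁ * Q) ≡ a * P₁ * (p * Q)
          comm = solve-∀
        x′≤ : x′ ≤ xⱼ
        x′≤ = ÷-greatest 1≤k (*-cancel-≤ (2 * suc M₀) (s≤s z≤n) (endpoint₄ M₀ k x′ P₁ (÷-lower (5 * suc (suc M₀) * P₁) (2 * suc M₀ * k))))
        len′ : 5 * P₁ + 4 * (suc M₀) * k * (yⱼ + B + 1) ≤ 4 * (suc M₀) * k * x′
        len′ = length₁ M₀ k x′ P₁ B yⱼ y₁ (p ^ t) 1≤k (÷-upper (5 * suc (suc M₀) * P₁) (2 * suc M₀ * k) 2Ek≥1) yl y-upper kτ big₁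
      -- P₁/k < Q, so x₁/k stays below 5 Q ≤ p Q. The free interval starts near 5/2 Q, and k ≤
      -- `hi κ` gives it its length.
      ... | no k≰pP′ = finish y′ xⱼ yⱼ≤ ℕ.≤-refl τ≤ past x< len′
        where
        y′ = (5 * Qq) ÷ 2 + B + 2
        hi′ : suc M₀ * k ≤ 2 * M₀ * (p * P′)
        hi′ = hi-spec {κ} h
        k>pP′ : suc (p * P′) ≤ k
        k>pP′ = ℕ.≰⇒> k≰pP′
        P≤kQ : P₁ ≤ k * Qq
        P≤kQ = subst (_≤ k * Qq) (sym PQ) (ℕ.*-monoˡ-≤ Qq (ℕ.<⇒≤ k>pP′))
        P<kQ : P₁ < k * Qq
        P<kQ = subst (_< k * Qq) (sym PQ) (ℕ.*-monoˡ-< Qq {{ℕ.>-nonZero (pᵖ q)}} k>pP′)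
        y′l : 5 * Qq + 2 * B + 3 ≤ 2 * y′
        y′l = ι-cancel (linear 0 3
            (nat (n# 0 ∔ (n# 0 ∔ (n# 0 ∔ (n# 0 ∔ (n# 0 ∔ lit 0)))) ∔ (n# 1 ∔ (n# 1 ∔ lit 0)) ∔ lit 3))
            (nat (n# 2 ∔ n# 1 ∔ lit 2 ∔ (n# 2 ∔ n# 1 ∔ lit 2 ∔ lit 0)))
            (# 0 :* # 0 :+ # 0 :* # 0 :+ # 0 :* # 0 :+ nat (lit 1 ∔ (n# 0 ∔ (n# 0 ∔ (n# 0 ∔ (n# 0 ∔ (n# 0 ∔ lit 0)))))))
            (# 0 :* n0 :+ # 0 :* n1 :+ # 0 :* n2 :+ nat (lit 1 ∔ (n# 2 ∔ (lit 1 ∔ (n# 2 ∔ lit 0)))))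
            (at# Qq ⊞ at# B ⊞ at# ((5 * Qq) ÷ 2) ⊞ ι-mono (÷-upper (5 * Qq) 2 (s≤s z≤n))))
        y′u : 2 * y′ ≤ 5 * Qq + 2 * B + 4
        y′u = ι-cancel (linear 0 3
            (nat (n# 0 ∔ n# 1 ∔ lit 2 ∔ (n# 0 ∔ n# 1 ∔ lit 2 ∔ lit 0)))
            (nat (n# 2 ∔ (n# 2 ∔ (n# 2 ∔ (n# 2 ∔ (n# 2 ∔ lit 0)))) ∔ (n# 1 ∔ (n# 1 ∔ lit 0)) ∔ lit 4))
            (# 0 :* # 0 :+ # 0 :* # 0 :+ # 0 :* # 0 :+ nat (n# 0 ∔ (n# 0 ∔ lit 0)))
            (# 0 :* n2 :+ # 0 :* n1 :+ # 0 :* n0 :+ nat (n# 2 ∔ (n# 2 ∔ (n# 2 ∔ (n# 2 ∔ (n# 2 ∔ lit 0))))))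
            (at# Qq ⊞ at# B ⊞ at# ((5 * Qq) ÷ 2) ⊞ ι-mono (÷-lower (5 * Qq) 2)))
        yⱼ≤ : yⱼ ≤ y′
        yⱼ≤ = *-cancel-≤ (2 * k) (*-pos {2} {k} (s≤s z≤n) 1≤k) (endpoint₅ k yⱼ y′ y₁ P₁ Qq B 1≤k yl y-upper P≤kQ y′l)
        past : 5 * Qq + 2 * B ≤ 2 * y′
        past = ℕ.≤-trans (ℕ.m≤m+n _ 3) y′l
        τ≤Q : p ^ t ≤ Qq
        τ≤Q = *-cancel-≤ k 1≤k (ℕ.≤-trans kτ P≤kQ)
        τ≤ : p ^ t ≤ y′
        τ≤ = *-cancel-≤ 2 (s≤s z≤n) (endpoint₁₁ (p ^ t) Qq y′ (2 * B) τ≤Q y′l)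
        x< : xⱼ < p ^ suc q
        x< = *-cancel-< k (ℕ.≤-<-trans (÷-lower x₁ k) (endpoint₆ k p P₁ Qq 5≤p P<kQ))
        len′ : 5 * P₁ + 4 * (suc M₀) * k * y′ ≤ 4 * (suc M₀) * k * xⱼ
        len′ = length₂ M₀ k xⱼ y′ P₁ B Qq (p ^ t) (p * P′) (÷-upper (5 * P₁) k 1≤k) y′u hi′ PQ kτ big₁

product-not-prime : ∀ a b → 2 ≤ a → 2 ≤ b → ¬ Prime (a * b)
product-not-prime a b 2≤a 2≤b pr with prime⇒irreducible pr (m∣m*n {a} b)
... | inj₁ refl = contradiction 2≤a (λ { (s≤s ()) })
... | inj₂ e = ℕ.<⇒≢ (ℕ.m<m*n a b {{ℕ.>-nonZero (ℕ.<⇒≤ 2≤a)}} 2≤b) e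

argmin : ∀ (f : ℕ → R) n → Σ ℕ λ i → 1 ≤ i × i ≤ suc n × (∀ j → 1 ≤ j → j ≤ suc n → f i ⊑ f j)
argmin f zero = 1 , s≤s z≤n , s≤s z≤n , λ { (suc zero) _ _ → ⊑-refl ; (suc (suc j)) _ (s≤s ()) }
argmin f (suc n) with argmin f n
... | i , 1≤i , i≤ , best with ⊑-total (f i) (f (suc (suc n)))
...   | inj₁ h = i , 1≤i , ℕ.m≤n⇒m≤1+n i≤ , λ j 1≤j j≤ → pick j 1≤j (ℕ.m≤n⇒m<n∨m≡n j≤)
  where
  pick : ∀ j → 1 ≤ j → j < suc (suc n) ⊎ j ≡ suc (suc n) → f i ⊑ f j
  pick j 1≤j (inj₁ (s≤s j≤)) = best j 1≤j j≤
  pick j 1≤j (inj₂ refl) = h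
...   | inj₂ h = suc (suc n) , s≤s z≤n , ℕ.≤-refl , λ j 1≤j j≤ → pick j 1≤j (ℕ.m≤n⇒m<n∨m≡n j≤)
  where
  pick : ∀ j → 1 ≤ j → j < suc (suc n) ⊎ j ≡ suc (suc n) → f (suc (suc n)) ⊑ f j
  pick j 1≤j (inj₁ (s≤s j≤)) = ⊑-trans h (best j 1≤j j≤)
  pick j 1≤j (inj₂ refl) = ⊑-refl

pigeonhole : ∀ (f : ℕ → R) n → Σ ℕ λ i → 1 ≤ i × i ≤ suc n × ι (suc n) ⊗ f i ⊑ sum f (suc n)
pigeonhole f n with argmin f n
... | i , 1≤i , i≤ , best = i , 1≤i , i≤ , ⊑-trans (≡⇒⊒ (sum-const (f i) (suc n))) (sum-mono (suc n) best)

2P≤2y : ∀ P y C → 5 * P + C + 1 ≤ 2 * y → 2 * P ≤ 2 * y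
2P≤2y P y C h = ι-cancel (linear 0 3 {ν = _ , y , _ , _}
    (nat (lit 2 ∗ n# 0)) (nat (lit 2 ∗ n# 1)) (nat (lit 5 ∗ n# 0 ∔ n# 2 ∔ lit 1) :+ # 3 :* # 0 :+ # 0 :+ # 0)
    (nat (lit 2 ∗ n# 1) :+ # 3 :* n0 :+ n2 :+ # 1)
    (ι-mono h ⊞ 3 ⊙ 0≤ι P ⊞ 0≤ι C ⊞ 0≤ι 1))

index≤ : ∀ T₀ i n t e → i ≤ n → T₀ + n + suc (suc t) ≤ e → suc (suc (T₀ + i)) + t ≤ e
index≤ T₀ i n t e h₁ h₂ = ι-cancel (linear 0 5 {ν = T₀ , _ , t , _ , n , _}
    (nat (lit 1 ∔ (lit 1 ∔ (n# 0 ∔ n# 1)) ∔ n# 2)) n3 (n1 :+ nat (n# 0 ∔ n# 4 ∔ (lit 1 ∔ (lit 1 ∔ n# 2))))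
    (n4 :+ n3)
    (ι-mono h₁ ⊞ ι-mono h₂))

module FirstBound {p A b B G Kmax : ℕ} {{nz : NonZero A}} (W : Window p A b B G Kmax) {N : ℕ} (ls : LogSystem N)
  (e₁ t T₀ n : ℕ) (t≤e₁ : t ≤ e₁) (Tn₂ : T₀ + n + suc (suc t) ≤ e₁) (e₁≤K : e₁ ≤ Kmax) (1≤T : 1 ≤ T₀)
  (pe≤N : p ^ suc e₁ ≤ N) where
  open Scales W ls public

  Tn : T₀ + n + suc t ≤ e₁
  Tn = ℕ.≤-trans (ℕ.+-monoʳ-≤ (T₀ + n) (ℕ.n≤1+n (suc t))) Tn₂

  module Conclude (big : 4 * suc M₀ * (2 * B + 3) + G ≤ p ^ t) where
    open FirstGap e₁ t T₀ n t≤e₁ Tn e₁≤K 1≤T pe≤N big public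

    free₁ : Free A∸1 b y₁ x₁
    free₁ m y<m m≤x pm h with ℕ.m≤n⇒m<n∨m≡n m≤x
    -- For p = 5 the endpoint 5 P₁ is p^(e₁ + 1), outside the open window; it is composite in any
    -- case.
    ... | inj₂ refl = product-not-prime 5 P₁ (s≤s (s≤s z≤n)) (ℕ.≤-trans (ℕ.≤-trans (s≤s (s≤s z≤n)) 5≤p) (subst (_≤ P₁) (ℕ.*-identityʳ p)
          (ℕ.^-monoʳ-≤ p {{ℕ.>-nonZero 1≤p}} {1} (ℕ.≤-trans 1≤T (ℕ.≤-trans (ℕ.m≤m+n T₀ n) (ℕ.≤-trans (ℕ.m≤m+n (T₀ + n) (suc t)) Tn)))))) pm
    ... | inj₁ m<x = free-top e₁ 1 y₁ m e₁≤K refl (ℕ.≤-trans big₂ τ≤y) (ℕ.≤-trans (ℕ.m≤m+n _ 1) y-lower) (ℕ.<-≤-trans m<x (ℕ.*-monoˡ-≤ P₁ 5≤p))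
          m y<m ℕ.≤-refl pm (trans (cong (λ s → s * m % A) (ℕ.*-identityʳ A∸1)) h)
      where
      τ≤y : p ^ t ≤ y₁
      τ≤y = ℕ.≤-trans (ℕ.^-monoʳ-≤ p {{ℕ.>-nonZero 1≤p}} t≤e₁) (*-cancel-≤ 2 (s≤s z≤n) (2P≤2y P₁ y₁ (2 * B) y-lower))

    weight : ℕ → R
    weight k = class 1 1 k ⊗ multiplicity T₀ n k

    terms : ∀ k → 1 ≤ k → k ≤ Z₁ → TermBound λ₁ A∸1 b y₁ x₁ k (e′ k ⊗ weight k)
    terms k 1≤k k≤Z with multiplicity-0/1 T₀ n k
    ... | inj₁ z = termBound-weaken {κ = A∸1} {b} {y₁} {x₁} {k} 0≤λ (≡⇒⊑ (trans (cong (λ s → e′ k ⊗ (class 1 1 k ⊗ s)) z) (zz (e′ k) (class 1 1 k)))) (Term.plain λ₁ A∸1 b y₁ x₁ k A∸1-unit b-unit y≤x x≤N 1≤k k≤x 0≤λ λ≤)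
      where
      k≤x : k ≤ x₁
      k≤x = ℕ.≤-trans k≤Z (ℕ.≤-trans (subst (Z₁ ≤_) (sym P≡) (ℕ.m≤m*n Z₁ (p ^ t) {{ℕ.>-nonZero (pᵖ t)}})) (ℕ.m≤n*m P₁ 5))
      λ≤ : λ₁ ⊑ L (x₁ ÷ k)
      λ≤ = L-mono (pᵖ t) (τ≤x÷ 1≤k k≤Z) (x÷≤N k)
      zz : ∀ a c → a ⊗ (c ⊗ ι 0) ≡ ι 0
      zz a c = ring 2 0 (v0 :* (v1 :* # 0)) (# 0)
    ... | inj₂ (i , 1≤i , i≤n , l , h , o) with 1 * k ≈? 1
    ...   | yes k1 = termBound-weaken {κ = A∸1} {b} {y₁} {x₁} {k} 0≤λ (≡⇒⊑ (trans (cong (λ s → e′ k ⊗ (ι 1 ⊗ s)) o) (oo (e′ k))))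
              (Deficit.result k i 1≤k k≤Z (trans (cong (_% A) (sym (ℕ.*-identityˡ k))) k1) (ℕ.≤-trans (ℕ.+-monoˡ-≤ (suc t) (ℕ.+-monoʳ-≤ T₀ i≤n)) Tn) l h)
      where
      oo : ∀ a → a ⊗ (ι 1 ⊗ ι 1) ≡ a
      oo a = ring 1 0 (v0 :* (# 1 :* # 1)) v0
    ...   | no _ = termBound-weaken {κ = A∸1} {b} {y₁} {x₁} {k} 0≤λ (≡⇒⊑ (zz (e′ k) (multiplicity T₀ n k))) (Term.plain λ₁ A∸1 b y₁ x₁ k A∸1-unit b-unit y≤x x≤N 1≤k k≤x 0≤λ λ≤)
      where
      k≤x : k ≤ x₁
      k≤x = ℕ.≤-trans k≤Z (ℕ.≤-trans (subst (Z₁ ≤_) (sym P≡) (ℕ.m≤m*n Z₁ (p ^ t) {{ℕ.>-nonZero (pᵖ t)}})) (ℕ.m≤n*m P₁ 5))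
      λ≤ : λ₁ ⊑ L (x₁ ÷ k)
      λ≤ = L-mono (pᵖ t) (τ≤x÷ 1≤k k≤Z) (x÷≤N k)
      zz : ∀ a c → a ⊗ (ι 0 ⊗ c) ≡ ι 0
      zz a c = ring 2 0 (v0 :* (# 0 :* v1)) (# 0)

    S₁ : R
    S₁ = sum (λ k → Λ k ⊗ (inv k ⊗ weight k)) Z₁

    Z₁≤x₁ : Z₁ ≤ x₁
    Z₁≤x₁ = ℕ.≤-trans (subst (Z₁ ≤_) (sym P≡) (ℕ.m≤m*n Z₁ (p ^ t) {{ℕ.>-nonZero (pᵖ t)}})) (ℕ.m≤n*m P₁ 5)

    1≤x₁ : 1 ≤ x₁
    1≤x₁ = ℕ.≤-trans 1≤y y≤x

    -- `deficiency` for the class b/(A - 1) on (y₁, x₁], where that class has only proper prime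
    -- powers, with e supported on the k ≡ 1 lying in some J i.
    S₁-bound : ι 2 ⊗ λ₁ ⊗ (inv (4 * suc M₀) ⊗ S₁) ⊑ K₁ ⊗ (ι 2 ⊗ λ₁ ⊕ ι 2 ⊗ (L x₁ ⊕ ι 8) ⊕ λ₁ ⊗ (L x₁ ⊖ L Z₁)) ⊕ λ₁ ⊗ (ι 160 ⊗ ι φ)
    S₁-bound = ⊗-cancelˡ x₁ 1≤x₁ (fin {ι x₁} {λ₁} {inv (4 * suc M₀)} {S₁}
        (⊑-trans (≡⇒⊒ (cong (ι 2 ⊗ λ₁ ⊗_) pull)) (deficiency λ₁ A∸1 b y₁ x₁ Z₁ (λ k → e′ k ⊗ weight k) A∸1-unit b-unit 1≤y y≤x x≤N (pᵖ (e₁ ∸ t)) Z₁≤x₁ 0≤λ terms))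
        (⊗-monoˡ 0≤λ (⊗-monoˡ (0≤ι φ) (⊑-trans (⊗-monoʳ (L-nonneg 1≤x₁ x≤N) (free-bound A∸1 b y₁ x₁ y≤x free₁)) (powers-pointwise x₁ 1≤x₁ x≤N)))))
      where
      pull : sum (λ k → Λ k ⊗ (e′ k ⊗ weight k)) Z₁ ≡ ι x₁ ⊗ (inv (4 * suc M₀) ⊗ S₁)
      pull = trans (sum-ext Z₁ (λ k → r (Λ k) (ι x₁) (inv (4 * suc M₀)) (inv k) (weight k))) (trans (sum-⊗ (ι x₁ ⊗ inv (4 * suc M₀)) _ Z₁) (⊗-assoc _ _ _))
        where
        r : ∀ l x m i w → l ⊗ (x ⊗ m ⊗ i ⊗ w) ≡ x ⊗ m ⊗ (l ⊗ (i ⊗ w))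
        r l x m i w = ring 5 0 (v0 :* (v1 :* v2 :* v3 :* v4)) (v1 :* v2 :* (v0 :* (v3 :* v4)))
      fin : ∀ {x l m s k q f ψd Lx} → ι 2 ⊗ l ⊗ (x ⊗ (m ⊗ s)) ⊑ x ⊗ k ⊗ q ⊕ l ⊗ (f ⊗ ψd ⊗ Lx) → l ⊗ (f ⊗ (ψd ⊗ Lx)) ⊑ l ⊗ (f ⊗ (ι 160 ⊗ x)) →
        x ⊗ (ι 2 ⊗ l ⊗ (m ⊗ s)) ⊑ x ⊗ (k ⊗ q ⊕ l ⊗ (ι 160 ⊗ f))
      fin {x} {l} {m} {s} {k} {q} {f} {ψd} {Lx} a c = linear 9 0
          (v0 :* (# 2 :* v1 :* (v2 :* v3))) (v0 :* (v4 :* v5 :+ v1 :* (# 160 :* v6)))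
          (# 2 :* v1 :* (v0 :* (v2 :* v3)) :+ v1 :* (v6 :* (v7 :* v8)))
          (v0 :* v4 :* v5 :+ v1 :* (v6 :* v7 :* v8) :+ v1 :* (v6 :* (# 160 :* v0)))
          (a ⊞ c)

    -- As 1/k is at least the reciprocal of the right endpoint, this bounds from below the sum of
    -- Λ(k)/k over the k ≡ 1 in J i.
    density : ℕ → R
    density i = inv (hi i) ⊗ (ψᶜ 1 1 (hi i) ⊖ ψᶜ 1 1 (lo i))

    lo≤hi : ∀ i → lo i ≤ hi i
    lo≤hi i = ÷-greatest {2 * M₀ * p ^ suc i} {suc M₀} (s≤s z≤n) (*-cancel-≤ 2 (s≤s z≤n) (endpoint₈ M₀ p (p ^ i) (lo i) 1≤M₀ 5≤p (÷-lower (5 * suc (suc M₀) * p ^ i) (2 * suc M₀))))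

    hi≤Z : ∀ i → i ≤ n → hi (T₀ + i) ≤ Z₁
    hi≤Z i i≤n = ℕ.≤-trans (*-cancel-≤ (suc M₀) (s≤s z≤n) (endpoint₁₀ M₀ p (p ^ suc (T₀ + i)) (hi (T₀ + i)) 2≤p (hi-spec {T₀ + i} ℕ.≤-refl)))
      (ℕ.^-monoʳ-≤ p {{ℕ.>-nonZero 1≤p}} le)
      where
      2≤p : 2 ≤ p
      2≤p = ℕ.≤-trans (s≤s (s≤s z≤n)) 5≤p
      le : suc (suc (T₀ + i)) ≤ e₁ ∸ t
      le = ℕ.m+n≤o⇒m≤o∸n (suc (suc (T₀ + i))) (index≤ T₀ i n t e₁ i≤n Tn₂)

    -- The densities sum to at most `S₁`, so the least of them is at most the average.
    found : ∀ n₀ → n ≡ suc n₀ → Σ ℕ λ i → 1 ≤ i × i ≤ n × ι n ⊗ density (T₀ + i) ⊑ S₁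
    found n₀ refl with pigeonhole (λ i → density (T₀ + i)) n₀
    ... | i , 1≤i , i≤ , h = i , 1≤i , i≤ , ⊑-trans h (⊑-trans (sum-mono n (λ j _ j≤n → each j j≤n))
          (≡⇒⊑ (trans (sum-swap (λ j k → χ (inJ? (T₀ + j) k) ⊗ (Λ k ⊗ (inv k ⊗ class 1 1 k))) n Z₁) (sum-ext Z₁ pull))))
      where
      pull : ∀ k → sum (λ j → χ (inJ? (T₀ + j) k) ⊗ (Λ k ⊗ (inv k ⊗ class 1 1 k))) n ≡ Λ k ⊗ (inv k ⊗ weight k)
      pull k = trans (sum-ext n (λ j → ⊗-comm _ _)) (trans (sum-⊗ _ _ n) (r (Λ k) (inv k) (class 1 1 k) (multiplicity T₀ n k)))
        where
        r : ∀ a b c d → a ⊗ (b ⊗ c) ⊗ d ≡ a ⊗ (b ⊗ (c ⊗ d))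
        r a b c d = ring 4 0 (v0 :* (v1 :* v2) :* v3) (v0 :* (v1 :* (v2 :* v3)))
      each : ∀ j → j ≤ n → density (T₀ + j) ⊑ sum (λ k → χ (inJ? (T₀ + j) k) ⊗ (Λ k ⊗ (inv k ⊗ class 1 1 k))) Z₁
      each j j≤n = ⊑-trans (≡⇒⊑ (trans (dist _ _ _) (cong₂ _⊖_ (sym (sum-⊗ _ _ (hi κ))) (sym (sum-⊗ _ _ (lo κ))))))
        (⊑-trans (sum-diff-mono (λ k → inv (hi κ) ⊗ (class 1 1 k ⊗ Λ k)) f (lo≤hi κ) pt)
          (⊑-trans (less (sum-nonneg (lo κ) (λ k _ _ → f≥0 k))) (sum-monoʳ f (hi≤Z j j≤n) (λ k _ _ → f≥0 k))))
        where
        κ = T₀ + j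
        f : ℕ → R
        f k = χ (inJ? κ k) ⊗ (Λ k ⊗ (inv k ⊗ class 1 1 k))
        f≥0 : ∀ k → ι 0 ⊑ f k
        f≥0 k = ⊗-nonneg (χ-nonneg (inJ? κ k)) (⊗-nonneg (Λ-nonneg k) (⊗-nonneg (inv-nonneg k) (class-nonneg 1 1 k)))
        less : ∀ {a b} → ι 0 ⊑ b → a ⊖ b ⊑ a
        less {a} {b} h = linear 2 0 (v0 :- v1) v0 (# 0) v1 h
        dist : ∀ a b c → a ⊗ (b ⊖ c) ≡ a ⊗ b ⊖ a ⊗ c
        dist a b c = ring 3 0 (v0 :* (v1 :- v2)) (v0 :* v1 :- v0 :* v2)
        pt : ∀ k → lo κ < k → k ≤ hi κ → inv (hi κ) ⊗ (class 1 1 k ⊗ Λ k) ⊑ f k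
        pt k l h = ⊑-trans (⊗-monoʳ (⊗-nonneg (class-nonneg 1 1 k) (Λ-nonneg k)) (inv-anti (ℕ.≤-trans (s≤s z≤n) l) h))
          (≡⇒⊑ (trans (r (inv k) (class 1 1 k) (Λ k)) (cong (_⊗ (Λ k ⊗ (inv k ⊗ class 1 1 k))) (sym (χ-yes (inJ? κ k) (l , h))))))
          where
          r : ∀ i c l → i ⊗ (c ⊗ l) ≡ ι 1 ⊗ (l ⊗ (i ⊗ c))
          r i c l = ring 3 0 (v0 :* (v1 :* v2)) (# 1 :* (v2 :* (v0 :* v1)))

-- Classes above A/2

floorLog : ∀ p → 2 ≤ p → ∀ z → 1 ≤ z → Σ ℕ λ q → p ^ q ≤ z × z < p ^ suc q
floorLog p 2≤p (suc zero) _ = 0 , s≤s z≤n , subst (2 ≤_) (sym (ℕ.*-identityʳ p)) 2≤p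
floorLog p 2≤p (suc (suc z)) _ with floorLog p 2≤p (suc z) (s≤s z≤n)
... | q , l , h with ℕ.m≤n⇒m<n∨m≡n h
...   | inj₁ lt = q , ℕ.m≤n⇒m≤1+n l , lt
...   | inj₂ e = suc q , ℕ.≤-reflexive (sym e) , subst (_< p ^ suc (suc q)) (sym e) (ℕ.^-monoʳ-< p 2≤p (ℕ.n<1+n (suc q)))

-- Step (ii) on J κ. The cutoff `Z₂` leaves an extra factor p, so that rounding y₂/k down to a power
-- of p still gives at least τ.
module SecondGap {p A b B G Kmax : ℕ} {{nz : NonZero A}} (W : Window p A b B G Kmax) {N : ℕ} (ls : LogSystem N) (κ t′ : ℕ)
  (st≤κ : suc t′ ≤ κ) (sκ≤K : suc κ ≤ Kmax) (pκ≤N : p ^ suc (suc κ) ≤ N) where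
  open Scales W ls public

  1-unit : Coprime 1 A
  1-unit (d , _) = ∣1⇒≡1 d

  module Main (big : 4 * suc M₀ * (2 * B + 3) + G ≤ p ^ t′) where

    Pκ τ y₂ x₂ Z₂ : ℕ
    Pκ = p ^ κ
    τ = p ^ t′
    y₂ = lo κ
    x₂ = hi κ
    Z₂ = p ^ (κ ∸ suc t′)

    Pκ≡ : Pκ ≡ Z₂ * (p * τ)
    Pκ≡ = trans (cong (p ^_) (sym (ℕ.m∸n+n≡m st≤κ))) (ℕ.^-distribˡ-+-* p (κ ∸ suc t′) (suc t′))

    big₁ : 4 * suc M₀ * (2 * B + 3) ≤ τ
    big₁ = ℕ.≤-trans (ℕ.m≤m+n _ _) big

    big₂ : G ≤ τ
    big₂ = ℕ.≤-trans (ℕ.m≤n+m _ _) big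

    M≤τ : 12 * suc M₀ ≤ τ
    M≤τ = 12M≤τ M₀ B τ big₁

    τ≤P : p * τ ≤ Pκ
    τ≤P = subst (p * τ ≤_) (sym Pκ≡) (ℕ.m≤n*m (p * τ) Z₂ {{ℕ.>-nonZero (pᵖ (κ ∸ suc t′))}})

    M≤P : 12 * suc M₀ ≤ Pκ
    M≤P = ℕ.≤-trans M≤τ (ℕ.≤-trans (ℕ.m≤n*m τ p {{ℕ.>-nonZero 1≤p}}) τ≤P)

    fy : 2 * suc M₀ * y₂ ≤ 5 * suc (suc M₀) * Pκ
    fy = ÷-lower (5 * suc (suc M₀) * Pκ) (2 * suc M₀)

    fy′ : 5 * suc (suc M₀) * Pκ < 2 * suc M₀ * suc y₂
    fy′ = ÷-upper (5 * suc (suc M₀) * Pκ) (2 * suc M₀) (s≤s z≤n)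

    fx : suc M₀ * x₂ ≤ 2 * M₀ * (p * Pκ)
    fx = ÷-lower (2 * M₀ * (p * Pκ)) (suc M₀)

    fx′ : 2 * M₀ * (p * Pκ) < suc M₀ * suc x₂
    fx′ = ÷-upper (2 * M₀ * (p * Pκ)) (suc M₀) (s≤s z≤n)

    2P≤y : 2 * Pκ ≤ y₂
    2P≤y = *-cancel-≤ (2 * suc M₀) (s≤s z≤n) (2P≤y-scaled M₀ Pκ y₂ x₂ p fy fy′ fx M≤P)

    y≤3P : y₂ ≤ 3 * Pκ
    y≤3P = *-cancel-≤ (2 * suc M₀) (s≤s z≤n) (y≤3P-scaled M₀ Pκ y₂ x₂ p fy fy′ fx M≤P 4≤M)
      where
      4≤M : 4 ≤ M₀
      4≤M = ℕ.≤-trans (s≤s (s≤s (s≤s (s≤s z≤n)))) (ℕ.m≤n+m 6 (8 * A))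

    x≤2pP : x₂ ≤ 2 * (p * Pκ)
    x≤2pP = *-cancel-≤ (suc M₀) (s≤s z≤n) (x≤2pP-scaled M₀ Pκ y₂ x₂ p fy fy′ fx M≤P)

    x≤py : x₂ ≤ p * y₂
    x≤py = 2pP≤py p Pκ x₂ y₂ x≤2pP 2P≤y

    ratio : (4 * A + 2) * y₂ ≤ suc A * x₂
    ratio = *-cancel-≤ (2 * suc (8 * A + 6)) (s≤s z≤n) (ratio-scaled A Pκ y₂ x₂ p 5≤p fy fx′ M≤P)

    2y≤x : 2 * y₂ ≤ x₂
    2y≤x = *-cancel-≤ (suc A) (s≤s z≤n) (2y≤x-scaled A y₂ x₂ ratio)

    y≤x : y₂ ≤ x₂
    y≤x = ℕ.≤-trans (ℕ.m≤n*m y₂ 2) 2y≤x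

    1≤Pκ : 1 ≤ Pκ
    1≤Pκ = pᵖ κ

    1≤y : 1 ≤ y₂
    1≤y = ℕ.≤-trans (ℕ.≤-trans 1≤Pκ (ℕ.m≤n*m Pκ 2)) 2P≤y

    x≤N : x₂ ≤ N
    x≤N = ℕ.≤-trans x≤2pP (ℕ.≤-trans (ℕ.*-monoˡ-≤ (p * Pκ) (ℕ.≤-trans (s≤s (s≤s z≤n)) 5≤p)) pκ≤N)

    λ₂ : R
    λ₂ = L τ

    τ≤Pκ : τ ≤ Pκ
    τ≤Pκ = ℕ.≤-trans (ℕ.m≤n*m τ p {{ℕ.>-nonZero 1≤p}}) τ≤P

    P≤x : Pκ ≤ x₂
    P≤x = ℕ.≤-trans (ℕ.m≤n*m Pκ 2) (ℕ.≤-trans 2P≤y y≤x)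

    0≤λ : ι 0 ⊑ λ₂
    0≤λ = L-nonneg (pᵖ t′) (ℕ.≤-trans τ≤Pκ (ℕ.≤-trans P≤x x≤N))

    kτ : ∀ {k} → k ≤ Z₂ → k * (p * τ) ≤ Pκ
    kτ {k} h = subst (k * (p * τ) ≤_) (sym Pκ≡) (ℕ.*-monoˡ-≤ (p * τ) h)

    Z≤x : Z₂ ≤ x₂
    Z≤x = ℕ.≤-trans (subst (Z₂ ≤_) (sym Pκ≡) (ℕ.m≤m*n Z₂ (p * τ) {{ℕ.>-nonZero (*-pos 1≤p (pᵖ t′))}})) P≤x

    c₂ : ℕ
    c₂ = 8 * p * suc M₀

    e″ : ℕ → R
    e″ k = ι x₂ ⊗ inv c₂ ⊗ inv k

    module Prepare (k : ℕ) (1≤k : 1 ≤ k) (k≤Z : k ≤ Z₂) where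

      pτ≤y÷ : p * τ ≤ y₂ ÷ k
      pτ≤y÷ = ÷-greatest 1≤k (ℕ.≤-trans (kτ k≤Z) (ℕ.≤-trans (ℕ.m≤n*m Pκ 2) 2P≤y))

      τ≤x÷ : τ ≤ x₂ ÷ k
      τ≤x÷ = ℕ.≤-trans (ℕ.≤-trans (ℕ.m≤n*m τ p {{ℕ.>-nonZero 1≤p}}) pτ≤y÷) (÷-monoˡ k y≤x)

      open Term λ₂ 1 1 y₂ x₂ k 1-unit 1-unit y≤x x≤N 1≤k (ℕ.≤-trans k≤Z Z≤x) 0≤λ (L-mono (pᵖ t′) τ≤x÷ (ℕ.≤-trans (÷≤ x₂ k) x≤N)) public

      module Found (d : ℕ) (1≤d : 1 ≤ d) (d<A : d < A) (2d : suc A ≤ 2 * d) (d-unit : Coprime d A) (bk : b * k ≈ d) where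

        cop : Coprime (1 * k) A
        cop = subst (λ s → Coprime s A) (sym (ℕ.*-identityˡ k)) (proj₂ (class-coprime {b} {d} {k} d-unit bk))

        finish : ∀ q y′ x′ → q ≤ Kmax → yⱼ ≤ y′ → x′ ≤ xⱼ → τ ≤ y′ → 4 * A * p ^ q + 2 * B ≤ suc A * y′ → x′ < p ^ suc q → x₂ + c₂ * k * y′ ≤ c₂ * k * x′ →
          TermBound λ₂ 1 1 y₂ x₂ k (e″ k)
        finish q y′ x′ q≤K h₁ h₃ τ≤ past x< len′ = termBound-weaken {κ = 1} {1} {y₂} {x₂} {k} 0≤λ (length⇒e c₂ x₂ k x′ y′ 1≤c 1≤k len′)
          (deficient cop y′ x′ h₁ h₂ h₃ (ℕ.≤-trans (pᵖ t′) τ≤) (L-mono (pᵖ t′) τ≤ (ℕ.≤-trans h₂ (ℕ.≤-trans h₃ xⱼ≤N)))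
            (free-upper q k d y′ x′ q≤K 1≤d d<A 2d bk (ℕ.≤-trans big₂ τ≤) past x<))
          where
          1≤c : 1 ≤ c₂
          1≤c = *-pos {8 * p} {suc M₀} (*-pos {8} {p} (s≤s z≤n) 1≤p) (s≤s z≤n)
          h₂ : y′ ≤ x′
          h₂ = *-cancel-≤ (c₂ * k) (*-pos {c₂} {k} 1≤c 1≤k) (ℕ.≤-trans (ℕ.m≤n+m _ x₂) len′)

        yu : y₂ < k * suc yⱼ
        yu = ÷-upper y₂ k 1≤k

        yl : k * yⱼ ≤ y₂
        yl = ÷-lower y₂ k

        zone : ∀ q Qq → Qq ≡ p ^ q → q ≤ Kmax → τ ≤ Qq → suc A * y₂ ≤ 4 * A * (k * Qq) → (4 * A + 1) * (k * Qq) ≤ suc A * x₂ → TermBound λ₂ 1 1 y₂ x₂ k (e″ k)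
        zone q Qq refl q≤K τ≤Q z₁ z₂ = finish q y′ x′ q≤K yⱼ≤ x′≤ τ≤ past x< len′
          where
          vq = (4 * A * Qq) ÷ suc A
          y′ = vq + 2 * B + 1
          x′ = ((4 * A + 1) * Qq) ÷ suc A
          vu : 4 * A * Qq < suc A * suc vq
          vu = ÷-upper (4 * A * Qq) (suc A) (s≤s z≤n)
          vl : suc A * vq ≤ 4 * A * Qq
          vl = ÷-lower (4 * A * Qq) (suc A)
          xl : suc A * x′ ≤ (4 * A + 1) * Qq
          xl = ÷-lower ((4 * A + 1) * Qq) (suc A)
          xu : (4 * A + 1) * Qq < suc A * suc x′
          xu = ÷-upper ((4 * A + 1) * Qq) (suc A) (s≤s z≤n)
          open Zone A B k p vq x′ y′ Qq x₂ y₂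
          yⱼ≤ : yⱼ ≤ vq + 2 * B + 1
          yⱼ≤ = ℕ.≤-trans (÷-greatest {4 * A * Qq} {suc A} (s≤s z≤n) (*-cancel-≤ k 1≤k (zone₁ yⱼ yl z₁))) (ℕ.≤-trans (ℕ.m≤m+n vq (2 * B)) (ℕ.m≤m+n _ 1))
          x′≤ : x′ ≤ xⱼ
          x′≤ = ÷-greatest 1≤k (*-cancel-≤ (suc A) (s≤s z≤n) (zone₂ xl z₂))
          past : 4 * A * Qq + 2 * B ≤ suc A * (vq + 2 * B + 1)
          past = zone₃ vu
          τ≤ : τ ≤ vq + 2 * B + 1
          τ≤ = ℕ.≤-trans τ≤Q (*-cancel-≤ (suc A) (s≤s z≤n) (zone₄ (vq + 2 * B + 1) (2 * B) 1≤A past))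
          x< : x′ < p * Qq
          x< = *-cancel-< (suc A) (ℕ.≤-<-trans xl (zone₅ 5≤p (pᵖ q)))
          bigQ : 4 * suc (8 * A + 6) * (2 * B + 3) ≤ Qq
          bigQ = ℕ.≤-trans big₁ τ≤Q
          len′ : x₂ + 8 * p * suc (8 * A + 6) * k * (vq + 2 * B + 1) ≤ 8 * p * suc (8 * A + 6) * k * x′
          len′ = *-cancel-≤ (suc A) (s≤s z≤n) (zone-length x≤py z₁ vl xu (zone₆ bigQ))

        middle : ∀ q → q ≤ Kmax → 4 * A * (k * p ^ q) ≤ suc A * y₂ → suc (suc M₀) * y₂ < suc M₀ * k * p ^ suc q → TermBound λ₂ 1 1 y₂ x₂ k (e″ k)
        middle q q≤K past₀ top = finish q (yⱼ + 2 * B + 1) x′ q≤K (ℕ.≤-trans (ℕ.m≤m+n yⱼ (2 * B)) (ℕ.m≤m+n _ 1)) x′≤ τ≤ past x< len′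
          where
          x′ = (suc (suc M₀) * y₂) ÷ (suc M₀ * k)
          Mk≥1 : 1 ≤ suc M₀ * k
          Mk≥1 = *-pos {suc M₀} {k} (s≤s z≤n) 1≤k
          ylow : k * τ ≤ y₂
          ylow = ℕ.≤-trans (ℕ.≤-trans (ℕ.*-monoʳ-≤ k (ℕ.m≤n*m τ p {{ℕ.>-nonZero 1≤p}})) (kτ k≤Z)) (ℕ.≤-trans (ℕ.m≤n*m Pκ 2) 2P≤y)
          τ≤ : τ ≤ yⱼ + 2 * B + 1
          τ≤ = ℕ.≤-trans (÷-greatest 1≤k ylow) (ℕ.≤-trans (ℕ.m≤m+n yⱼ (2 * B)) (ℕ.m≤m+n _ 1))
          x< : x′ < p ^ suc q
          x< = *-cancel-< (suc M₀ * k) (ℕ.≤-<-trans (÷-lower (suc (suc M₀) * y₂) (suc M₀ * k)) top)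
          x′≤ : x′ ≤ xⱼ
          x′≤ = ÷-greatest 1≤k (*-cancel-≤ (suc M₀) (s≤s z≤n) (middle₁ M₀ k x′ y₂ x₂ (÷-lower (suc (suc M₀) * y₂) (suc M₀ * k)) 2y≤x))
          past : 4 * A * p ^ q + 2 * B ≤ suc A * (yⱼ + 2 * B + 1)
          past = *-cancel-≤ k 1≤k (middle₂ A k B (p ^ q) yⱼ y₂ past₀ yu)
          len′ : x₂ + 8 * p * suc M₀ * k * (yⱼ + 2 * B + 1) ≤ 8 * p * suc M₀ * k * x′
          len′ = middle-length M₀ B k p yⱼ x′ x₂ y₂ τ x≤py (÷-upper (suc (suc M₀) * y₂) (suc M₀ * k) Mk≥1) yl ylow big₁

        -- J κ has endpoint ratio at least (4A + 2)/(A + 1), too large for its quotient by k to fit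
        -- between consecutive gaps. With Q = p^q the power of p just below y₂/k, three positions of
        -- y₂/k are distinguished.
        result : TermBound λ₂ 1 1 y₂ x₂ k (e″ k)
        result with floorLog p (ℕ.≤-trans (s≤s (s≤s z≤n)) 5≤p) yⱼ (ℕ.≤-trans (*-pos 1≤p (pᵖ t′)) pτ≤y÷)
        ... | q , Q≤y , y<pQ = cases (suc A * y₂ ℕ.≤? 4 * A * (k * p ^ q)) (suc (suc M₀) * y₂ ℕ.<? suc M₀ * k * p ^ suc q)
          where
          q≤κ : q ≤ κ
          q≤κ with q ℕ.≤? κ
          ... | yes h = h
          ... | no q≰κ = ⊥-elim (ℕ.<⇒≱ (ℕ.≤-<-trans (ℕ.≤-trans Q≤y (ℕ.≤-trans (÷≤ y₂ k) y≤3P)) (ℕ.*-monoˡ-< Pκ {{ℕ.>-nonZero 1≤Pκ}} (ℕ.≤-trans (s≤s (s≤s (s≤s (s≤s z≤n)))) 5≤p)))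
                    (ℕ.^-monoʳ-≤ p {{ℕ.>-nonZero 1≤p}} (ℕ.≰⇒> q≰κ)))
          kQ≤y : k * p ^ q ≤ y₂
          kQ≤y = ℕ.≤-trans (ℕ.*-monoʳ-≤ k Q≤y) yl
          y<kpQ : y₂ < k * p ^ suc q
          y<kpQ = ℕ.<-≤-trans yu (ℕ.*-monoʳ-≤ k y<pQ)
          τ≤Q : τ ≤ p ^ q
          τ≤Q = *-cancel-≤ p 1≤p (ℕ.<⇒≤ (ℕ.≤-<-trans pτ≤y÷ y<pQ))
          cases : Dec (suc A * y₂ ≤ 4 * A * (k * p ^ q)) → Dec (suc (suc M₀) * y₂ < suc M₀ * k * p ^ suc q) → TermBound λ₂ 1 1 y₂ x₂ k (e″ k)
          -- The gap of scale q starts only after y₂/k; its first piece still ends before x₂/k.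
          cases (yes z₁) _ = zone q (p ^ q) refl (ℕ.≤-trans q≤κ (ℕ.≤-trans (ℕ.n≤1+n κ) sκ≤K)) τ≤Q z₁
            (case₁ A k (p ^ q) y₂ x₂ kQ≤y ratio)
          -- y₂/k lies inside the gap of scale q, with a factor 1 + 1/(M₀ + 1) to spare before its
          -- end.
          cases (no ¬z) (yes top) = middle q (ℕ.≤-trans q≤κ (ℕ.≤-trans (ℕ.n≤1+n κ) sκ≤K)) (ℕ.<⇒≤ (ℕ.≰⇒> ¬z)) top
          -- y₂/k is nearly p Q, so the gap of the next scale is taken.
          cases (no ¬z) (no ¬top) = zone (suc q) (p ^ suc q) refl (ℕ.≤-trans (s≤s q≤κ) sκ≤K) (ℕ.≤-trans τ≤Q (ℕ.m≤n*m (p ^ q) p {{ℕ.>-nonZero 1≤p}}))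
            (case₂ A k (p ^ suc q) y₂ 1≤A (ℕ.<⇒≤ y<kpQ))
            (*-cancel-≤ (suc (8 * A + 6)) (s≤s z≤n) (case₃ A k (p ^ suc q) y₂ x₂ top′ ratio))
            where
            top′ : suc (8 * A + 6) * k * p ^ suc q ≤ suc (suc (8 * A + 6)) * y₂
            top′ = ℕ.≮⇒≥ ¬top

    S₂ᵈ : ℕ → R
    S₂ᵈ d = sum (λ k → Λ k ⊗ (inv k ⊗ class b d k)) Z₂

    -- `deficiency` for class 1 on J κ: for j in the class d/b, the class 1/j consists of the m with
    -- d m ≡ b. The last term carries the density made small in step (i).
    S₂ᵈ-bound : ∀ d → 1 ≤ d → d < A → suc A ≤ 2 * d → Coprime d A →
      ι 2 ⊗ λ₂ ⊗ (inv c₂ ⊗ S₂ᵈ d) ⊑ K₁ ⊗ (ι 2 ⊗ λ₂ ⊕ ι 2 ⊗ (L x₂ ⊕ ι 8) ⊕ λ₂ ⊗ (L x₂ ⊖ L Z₂)) ⊕ λ₂ ⊗ (ι φ ⊗ (inv x₂ ⊗ (ψᶜ 1 1 x₂ ⊖ ψᶜ 1 1 y₂)) ⊗ L x₂)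
    S₂ᵈ-bound d 1≤d d<A 2d d-unit = ⊗-cancelˡ x₂ 1≤x (fin {ι x₂} {λ₂} {inv c₂} {S₂ᵈ d} {K₁}
        (⊑-trans (≡⇒⊒ (cong (ι 2 ⊗ λ₂ ⊗_) pull)) (deficiency λ₂ 1 1 y₂ x₂ Z₂ (λ k → e″ k ⊗ class b d k) 1-unit 1-unit 1≤y y≤x x≤N (pᵖ (κ ∸ suc t′)) Z≤x 0≤λ terms))
        (inv-inverse x₂ 1≤x))
      where
      1≤x : 1 ≤ x₂
      1≤x = ℕ.≤-trans 1≤y y≤x
      terms : ∀ k → 1 ≤ k → k ≤ Z₂ → TermBound λ₂ 1 1 y₂ x₂ k (e″ k ⊗ class b d k)
      terms k 1≤k k≤Z with b * k ≈? d
      ... | yes bk = termBound-weaken {κ = 1} {1} {y₂} {x₂} {k} 0≤λ (≡⇒⊑ (trans (⊗-comm _ _) (⊗-identityˡ _))) (Prepare.Found.result k 1≤k k≤Z d 1≤d d<A 2d d-unit bk)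
      ... | no _   = termBound-weaken {κ = 1} {1} {y₂} {x₂} {k} 0≤λ (≡⇒⊑ (trans (⊗-comm _ _) (⊗-zeroˡ _))) (Prepare.plain k 1≤k k≤Z)
      pull : sum (λ k → Λ k ⊗ (e″ k ⊗ class b d k)) Z₂ ≡ ι x₂ ⊗ (inv c₂ ⊗ S₂ᵈ d)
      pull = trans (sum-ext Z₂ (λ k → r (Λ k) (ι x₂) (inv c₂) (inv k) (class b d k))) (trans (sum-⊗ (ι x₂ ⊗ inv c₂) _ Z₂) (⊗-assoc _ _ _))
        where
        r : ∀ l x m i w → l ⊗ (x ⊗ m ⊗ i ⊗ w) ≡ x ⊗ m ⊗ (l ⊗ (i ⊗ w))
        r l x m i w = ring 5 0 (v0 :* (v1 :* v2 :* v3 :* v4)) (v1 :* v2 :* (v0 :* (v3 :* v4)))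
      fin : ∀ {x l m s k q f ψd Lx i} → ι 2 ⊗ l ⊗ (x ⊗ (m ⊗ s)) ⊑ x ⊗ k ⊗ q ⊕ l ⊗ (f ⊗ ψd ⊗ Lx) → x ⊗ i ≡ ι 1 →
        x ⊗ (ι 2 ⊗ l ⊗ (m ⊗ s)) ⊑ x ⊗ (k ⊗ q ⊕ l ⊗ (f ⊗ (i ⊗ ψd) ⊗ Lx))
      fin {x} {l} {m} {s} {k} {q} {f} {ψd} {Lx} {i} a c = linear 10 0
          (v0 :* (# 2 :* v1 :* (v2 :* v3))) (v0 :* (v4 :* v5 :+ v1 :* (v6 :* (v7 :* v8) :* v9)))
          (# 2 :* v1 :* (v0 :* (v2 :* v3)) :+ # 1 :* (v1 :* v6 :* v8 :* v9))
          (v0 :* v4 :* v5 :+ v1 :* (v6 :* v8 :* v9) :+ v0 :* v7 :* (v1 :* v6 :* v8 :* v9))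
          (a ⊞ ≡⇒⊒ (cong (λ t → t ⊗ (l ⊗ f ⊗ ψd ⊗ Lx)) c))

-- Logarithmic mass of the classes below A/2

sum-head : ∀ (f : ℕ → R) n → sum f (suc n) ≡ f 1 ⊕ sum (λ i → f (suc i)) n
sum-head f n = trans (sum-split f 1 n) (cong (_⊕ sum (λ i → f (suc i)) n) (⊕-identityˡ (f 1)))

sum-reverse : ∀ (f : ℕ → R) n → sum f n ≡ sum (λ i → f (suc n ∸ i)) n
sum-reverse f zero    = refl
sum-reverse f (suc n) = trans (cong (_⊕ f (suc n)) (sum-reverse f n)) (trans (⊕-comm _ _) (sym (sum-head (λ i → f (suc (suc n) ∸ i)) n)))

module LogMass {p A b B G Kmax : ℕ} {{nz : NonZero A}} (W : Window p A b B G Kmax) {N : ℕ} (ls : LogSystem N) where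
  open Scales W ls public

  sᵈ : ℕ → ℕ → R
  sᵈ d = sum (λ m → class b d m ⊗ (Λ m ⊗ inv m))

  sᵈ-nonneg : ∀ d x → ι 0 ⊑ sᵈ d x
  sᵈ-nonneg d x = sum-nonneg x (λ m _ _ → ⊗-nonneg (class-nonneg b d m) (⊗-nonneg (Λ-nonneg m) (inv-nonneg m)))

  sᶜ : ℕ → R
  sᶜ = sum (λ m → Λᶜ m ⊗ inv m)

  sᶜ-mono : ∀ {x y} → x ≤ y → sᶜ x ⊑ sᶜ y
  sᶜ-mono h = sum-monoʳ _ h (λ m _ _ → ⊗-nonneg (Λᶜ-nonneg m) (inv-nonneg m))

  -- Partial summation turns Brun-Titchmarsh on the intervals (P, P + k] into a bound for the
  -- weights Λ(m)/m.
  part : ∀ λ′ d P v → Coprime d A → 1 ≤ P → P ≤ v → v ≤ p * P → p * P ≤ N → ι 0 ⊑ λ′ → λ′ ⊑ L P →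
    λ′ ⊗ (ι φ ⊗ (sᵈ d v ⊖ sᵈ d P)) ⊑ ι 2 ⊗ λ′ ⊗ (harmonic v ⊖ harmonic P) ⊕ K₁ ⊗ ι p
  part λ′ d P v cd 1≤P P≤v v≤ pP≤N 0≤λ λ≤ = ⊑-trans (≡⇒⊑ left) (⊑-trans (sum-dominate a bb w′ n partial dec (λ i _ _ → inv-nonneg (P + i)))
      (⊑-trans (≡⇒⊑ right) (⊕-mono (≡⇒⊑ (cong (ι 2 ⊗ λ′ ⊗_) (sym (sum-diff inv P≤v)))) last)))
    where
    n = v ∸ P
    a bb w′ : ℕ → R
    a i = λ′ ⊗ ι φ ⊗ (class b d (P + i) ⊗ Λ (P + i))
    -- The Brun-Titchmarsh error, at most `K₁` times p P on this range, is placed at the first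
    -- index; all partial sums then contain it once.
    bb i = ι 2 ⊗ λ′ ⊕ χ (i ℕ.≟ 1) ⊗ (K₁ ⊗ ι (p * P))
    w′ i = inv (P + i)
    dec : ∀ i → 1 ≤ i → i < n → inv (P + suc i) ⊑ inv (P + i)
    dec i _ _ = inv-anti (ℕ.≤-trans 1≤P (ℕ.m≤m+n P i)) (ℕ.+-monoʳ-≤ P (ℕ.n≤1+n i))
    left : λ′ ⊗ (ι φ ⊗ (sᵈ d v ⊖ sᵈ d P)) ≡ sum (λ i → a i ⊗ w′ i) n
    left = trans (cong (λ t → λ′ ⊗ (ι φ ⊗ t)) (sum-diff _ P≤v)) (trans (sym (⊗-assoc _ _ _)) (trans (sym (sum-⊗ (λ′ ⊗ ι φ) _ n)) (sum-ext n (λ i → r (λ′ ⊗ ι φ) (class b d (P + i)) (Λ (P + i)) (inv (P + i))))))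
      where
      r : ∀ a c l i → a ⊗ (c ⊗ (l ⊗ i)) ≡ a ⊗ (c ⊗ l) ⊗ i
      r a c l i = ring 4 0 (v0 :* (v1 :* (v2 :* v3))) (v0 :* (v1 :* v2) :* v3)
    right : sum (λ i → bb i ⊗ w′ i) n ≡ ι 2 ⊗ λ′ ⊗ sum (λ i → inv (P + i)) n ⊕ sum (λ i → χ (i ℕ.≟ 1) ⊗ (K₁ ⊗ ι (p * P) ⊗ inv (P + i))) n
    right = trans (sum-ext n (λ i → r (ι 2 ⊗ λ′) (χ (i ℕ.≟ 1)) (K₁ ⊗ ι (p * P)) (inv (P + i)))) (trans (sum-⊕ _ _ n) (cong (_⊕ sum (λ i → χ (i ℕ.≟ 1) ⊗ (K₁ ⊗ ι (p * P) ⊗ inv (P + i))) n) (sum-⊗ (ι 2 ⊗ λ′) _ n)))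
      where
      r : ∀ a c k i → (a ⊕ c ⊗ k) ⊗ i ≡ a ⊗ i ⊕ c ⊗ (k ⊗ i)
      r a c k i = ring 4 0 ((v0 :+ v1 :* v2) :* v3) (v0 :* v3 :+ v1 :* (v2 :* v3))
    last : sum (λ i → χ (i ℕ.≟ 1) ⊗ (K₁ ⊗ ι (p * P) ⊗ inv (P + i))) n ⊑ K₁ ⊗ ι p
    last = ⊑-trans (sum-delta (λ i → K₁ ⊗ ι (p * P) ⊗ inv (P + i)) 1 n (s≤s z≤n) (⊗-nonneg (⊗-nonneg 0≤K₁ (0≤ι (p * P))) (inv-nonneg (P + 1))))
      (⊑-trans (⊗-monoˡ (⊗-nonneg 0≤K₁ (0≤ι (p * P))) (inv-anti 1≤P (ℕ.m≤m+n P 1))) (≡⇒⊑ (trans (cong (λ t → K₁ ⊗ t ⊗ inv P) (ι-* p P)) (trans (r K₁ (ι p) (ι P) (inv P)) (trans (cong (K₁ ⊗ ι p ⊗_) (inv-inverse P 1≤P)) (trans (⊗-comm _ _) (⊗-identityˡ _)))))))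
      where
      r : ∀ k p q i → k ⊗ (p ⊗ q) ⊗ i ≡ k ⊗ p ⊗ (q ⊗ i)
      r k p q i = ring 4 0 (v0 :* (v1 :* v2) :* v3) (v0 :* v1 :* (v2 :* v3))
    sumb : ∀ k → sum bb (suc k) ≡ ι (suc k) ⊗ (ι 2 ⊗ λ′) ⊕ K₁ ⊗ ι (p * P)
    sumb k = trans (sum-⊕ _ _ (suc k)) (cong₂ _⊕_ (sum-const _ (suc k)) (trans (sum-single (λ i → χ (i ℕ.≟ 1) ⊗ (K₁ ⊗ ι (p * P))) 1 (suc k) (s≤s z≤n) (s≤s z≤n) (λ i _ _ i≢ → trans (cong (_⊗ (K₁ ⊗ ι (p * P))) (χ-no (i ℕ.≟ 1) i≢)) (⊗-zeroˡ _)))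
      (trans (cong (_⊗ (K₁ ⊗ ι (p * P))) (χ-yes (1 ℕ.≟ 1) refl)) (⊗-identityˡ _))))
    partial : ∀ k → k ≤ n → sum a k ⊑ sum bb k
    partial zero    _  = ⊑-refl
    partial (suc k) k≤ = ⊑-trans (≡⇒⊑ (trans (sum-⊗ (λ′ ⊗ ι φ) _ (suc k)) (trans (⊗-assoc _ _ _) (cong (λ t → λ′ ⊗ (ι φ ⊗ t)) diff))))
      (⊑-trans (brun-titchmarsh-λ λ′ b d P (P + suc k) b-unit cd (ℕ.m≤m+n P (suc k)) (ℕ.≤-trans 1≤P (ℕ.m≤m+n P (suc k))) Pk≤N 0≤λ (⊑-trans λ≤ (L-mono 1≤P (ℕ.m≤m+n P (suc k)) Pk≤N)))
        (⊑-trans (⊕-mono (len P (suc k)) (⊗-monoˡ 0≤K₁ (ι-mono Pk≤))) (≡⇒⊒ (sumb k))))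
      where
      Pk≤ : P + suc k ≤ p * P
      Pk≤ = ℕ.≤-trans (subst (P + suc k ≤_) (ℕ.m+[n∸m]≡n P≤v) (ℕ.+-monoʳ-≤ P k≤)) v≤
      Pk≤N = ℕ.≤-trans Pk≤ pP≤N
      len : ∀ P k → ι 2 ⊗ λ′ ⊗ (ι (P + k) ⊖ ι P) ⊑ ι k ⊗ (ι 2 ⊗ λ′)
      len P k = linear 1 2
          (# 2 :* v0 :* (nat (n# 0 ∔ n# 1) :- n0)) (n1 :* (# 2 :* v0)) (# 0 :* # 0 :+ # 0 :* # 0)
          (# 0 :* n0 :+ # 0 :* n1)
          (at# P ⊞ at# k)
      diff : sum (λ i → class b d (P + i) ⊗ Λ (P + i)) (suc k) ≡ ψᶜ b d (P + suc k) ⊖ ψᶜ b d P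
      diff = sym (trans (sum-diff (λ m → class b d m ⊗ Λ m) (ℕ.m≤m+n P (suc k))) (cong (sum (λ i → class b d (P + i) ⊗ Λ (P + i))) (ℕ.m+n∸m≡n P (suc k))))

  free-part : ∀ d v x → v ≤ x → Free b d v x → sᵈ d x ⊖ sᵈ d v ⊑ sᶜ x ⊖ sᶜ v
  free-part d v x v≤x free = sum-diff-mono _ _ v≤x (λ m v<m m≤x → ⊑-trans (≡⇒⊒ (⊗-assoc _ _ _)) (⊗-monoʳ (inv-nonneg m) (pt m v<m m≤x)))
    where
    pt : ∀ m → v < m → m ≤ x → class b d m ⊗ Λ m ⊑ Λᶜ m
    pt m v<m m≤x with prime? m
    ... | yes pm = ≡⇒⊑ (trans (cong (_⊗ Λ m) (χ-no (b * m ≈? d) (free m v<m m≤x pm))) (trans (⊗-zeroˡ _) (sym (⊗-zeroˡ _))))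
    ... | no _   = ⊗-monoʳ (Λ-nonneg m) (class≤1 b d m)

  -- The missing part of every scale has logarithmic length at least δ.
  δ : R
  δ = inv (2 * suc (2 * A))

  module Range (k₀ : ℕ) (1≤k₀ : 1 ≤ k₀) (big : 4 * suc M₀ * (2 * B + 3) + G ≤ p ^ k₀) where

    x₀ : ℕ
    x₀ = p ^ k₀

    λ₀ : R
    λ₀ = L x₀

    mono-x : ∀ j → p ^ k₀ ≤ p ^ (j + k₀)
    mono-x j = ℕ.^-monoʳ-≤ p {{ℕ.>-nonZero 1≤p}} (ℕ.m≤n+m k₀ j)

    λ₀≤ : ∀ j → p ^ (j + k₀) ≤ N → ι 0 ⊑ λ₀ × λ₀ ⊑ L (p ^ (j + k₀))
    λ₀≤ j le = L-nonneg (pᵖ k₀) (ℕ.≤-trans (mono-x j) le) , L-mono (pᵖ k₀) (mono-x j) le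

    -- One `part` per scale. The error K₁ p of each scale is outweighed later by the size of λ₀.
    full : ∀ d j → Coprime d A → p ^ (j + k₀) ≤ N →
      λ₀ ⊗ (ι φ ⊗ (sᵈ d (p ^ (j + k₀)) ⊖ sᵈ d x₀)) ⊑ ι 2 ⊗ λ₀ ⊗ (harmonic (p ^ (j + k₀)) ⊖ harmonic x₀) ⊕ ι j ⊗ (K₁ ⊗ ι p)
    full d zero    cd le = ≡⇒⊑ (z λ₀ (ι φ) (sᵈ d x₀) (harmonic x₀) (K₁ ⊗ ι p))
      where
      z : ∀ l f s h k → l ⊗ (f ⊗ (s ⊖ s)) ≡ ι 2 ⊗ l ⊗ (h ⊖ h) ⊕ ι 0 ⊗ k
      z l f s h k = ring 5 0 (v0 :* (v1 :* (v2 :- v2))) (# 2 :* v0 :* (v3 :- v3) :+ # 0 :* v4)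
    full d (suc j) cd le = add (full d j cd le′) (part λ₀ d (p ^ (j + k₀)) (p * p ^ (j + k₀)) cd (pᵖ (j + k₀)) (ℕ.m≤n*m (p ^ (j + k₀)) p {{ℕ.>-nonZero 1≤p}}) ℕ.≤-refl le (proj₁ (λ₀≤ j le′)) (proj₂ (λ₀≤ j le′)))
      where
      le′ = ℕ.≤-trans (ℕ.m≤n*m (p ^ (j + k₀)) p {{ℕ.>-nonZero 1≤p}}) le
      add : ∀ {l f s₀ s₁ s₂ h₀ h₁ h₂ k} → l ⊗ (f ⊗ (s₁ ⊖ s₀)) ⊑ ι 2 ⊗ l ⊗ (h₁ ⊖ h₀) ⊕ ι j ⊗ k → l ⊗ (f ⊗ (s₂ ⊖ s₁)) ⊑ ι 2 ⊗ l ⊗ (h₂ ⊖ h₁) ⊕ k →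
        l ⊗ (f ⊗ (s₂ ⊖ s₀)) ⊑ ι 2 ⊗ l ⊗ (h₂ ⊖ h₀) ⊕ ι (suc j) ⊗ k
      add {l} {f} {s₀} {s₁} {s₂} {h₀} {h₁} {h₂} {k} u₁ u₂ = linear 9 1
          (v0 :* (v1 :* (v2 :- v3))) (# 2 :* v0 :* (v4 :- v5) :+ nat (lit 1 ∔ n# 0) :* v6)
          (v0 :* (v1 :* (v7 :- v3)) :+ v0 :* (v1 :* (v2 :- v7)))
          (# 2 :* v0 :* (v8 :- v5) :+ n0 :* v6 :+ (# 2 :* v0 :* (v4 :- v8) :+ v6))
          (u₁ ⊞ u₂)

    module Deficient (d d′ : ℕ) (cd : Coprime d A) (1≤d′ : 1 ≤ d′) (d′<A : d′ < A) (big′ : suc (2 * A) ≤ p * d′) (dd : d * d′ ≈ b * b) where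

      -- `part` is applied only up to vᵢ, where the gap of the class d/b begins; the rest of the
      -- scale has harmonic length at least δ.
      scale : ∀ i → k₀ ≤ i → i ≤ Kmax → p ^ suc i ≤ N →
        λ₀ ⊗ (ι φ ⊗ (sᵈ d (p ^ suc i) ⊖ sᵈ d (p ^ i))) ⊑ ι 2 ⊗ λ₀ ⊗ (harmonic (p ^ suc i) ⊖ harmonic (p ^ i) ⊖ δ) ⊕ K₁ ⊗ ι p ⊕ λ₀ ⊗ (ι φ ⊗ (sᶜ (p ^ suc i) ⊖ sᶜ (p ^ i)))
      scale i k₀≤i i≤K le = add (part λ₀ d Pᵢ vᵢ cd (pᵖ i) P≤v v≤ le 0≤λ λ≤) (⊗-monoˡ 0≤λ (⊗-monoˡ (0≤ι φ) (⊑-trans (free-part d vᵢ (p * Pᵢ) v≤ free) (less (sᶜ-mono P≤v))))) (⊗-monoˡ 0≤λ missing)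
        where
        Pᵢ = p ^ i
        -- The gap begins where d′ y ≥ 2 A p^i + B; since p d′ ≥ 2A + 1, it is enough that (2A + 1)
        -- y ≥ p (2 A p^i + B).
        vᵢ = (p * (2 * A * Pᵢ + B)) ÷ suc (2 * A) + 1
        0≤λ : ι 0 ⊑ λ₀
        0≤λ = L-nonneg (pᵖ k₀) (ℕ.≤-trans (ℕ.^-monoʳ-≤ p {{ℕ.>-nonZero 1≤p}} (ℕ.m≤n⇒m≤1+n k₀≤i)) le)
        x₀≤P : x₀ ≤ Pᵢ
        x₀≤P = ℕ.^-monoʳ-≤ p {{ℕ.>-nonZero 1≤p}} k₀≤i
        λ≤ : λ₀ ⊑ L Pᵢ
        λ≤ = L-mono (pᵖ k₀) x₀≤P (ℕ.≤-trans (ℕ.m≤n*m Pᵢ p {{ℕ.>-nonZero 1≤p}}) le)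
        past : p * (2 * A * Pᵢ + B) ≤ suc (2 * A) * vᵢ
        past = ℕ.<⇒≤ (subst (λ t → p * (2 * A * Pᵢ + B) < suc (2 * A) * t) (ℕ.+-comm 1 _) (÷-upper (p * (2 * A * Pᵢ + B)) (suc (2 * A)) (s≤s z≤n)))
        dist : ∀ c q → c * (q + 1) ≡ c * q + c
        dist c q = trans (ℕ.*-distribˡ-+ c q 1) (cong (λ t → c * q + t) (ℕ.*-identityʳ c))
        vl : suc (2 * A) * vᵢ ≤ p * (2 * A * Pᵢ + B) + suc (2 * A)
        vl = subst (_≤ p * (2 * A * Pᵢ + B) + suc (2 * A)) (sym (dist (suc (2 * A)) ((p * (2 * A * Pᵢ + B)) ÷ suc (2 * A)))) (ℕ.+-monoˡ-≤ (suc (2 * A)) (÷-lower (p * (2 * A * Pᵢ + B)) (suc (2 * A))))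
        bigP : 4 * suc (8 * A + 6) * (2 * B + 3) ≤ Pᵢ
        bigP = ℕ.≤-trans (ℕ.≤-trans (ℕ.m≤m+n _ G) big) x₀≤P
        P≤v : Pᵢ ≤ vᵢ
        P≤v = *-cancel-≤ (suc (2 * A)) (s≤s z≤n) (ℕ.≤-trans (s₁ p A Pᵢ B 5≤p 1≤A) past)
          where
          s₁ : ∀ p A Pᵢ B → 5 ≤ p → 1 ≤ A → suc (2 * A) * Pᵢ ≤ p * (2 * A * Pᵢ + B)
          s₁ p A Pᵢ B h₁ h₂ = ι-cancel (linear 0 4 {ν = A , Pᵢ , p , B , _}
              (nat ((lit 1 ∔ lit 2 ∗ n# 0) ∗ n# 1)) (nat (n# 2 ∗ (lit 2 ∗ n# 0 ∗ n# 1 ∔ n# 3)))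
              (# 2 :* (# 5 :* (n0 :* n1)) :+ # 1 :* n1 :+ # 7 :* # 0 :+ # 0)
              (# 2 :* (n2 :* (n0 :* n1)) :+ n0 :* n1 :+ # 7 :* (n0 :* n1) :+ n2 :* n3)
              (2 ⊙ ⊗-monoʳ (⊗-nonneg (0≤ι A) (0≤ι Pᵢ)) (ι-mono h₁) ⊞ ⊗-monoʳ (0≤ι Pᵢ) (ι-mono h₂) ⊞ 7 ⊙ ⊗-nonneg (0≤ι A) (0≤ι Pᵢ) ⊞ ⊗-nonneg (0≤ι p) (0≤ι B)))
        -- vᵢ is near 2A/(2A + 1) times p Pᵢ; half of the remaining length p Pᵢ/(2A + 1) is given up
        -- to B and to rounding.
        gap : p * Pᵢ + 2 * suc (2 * A) * vᵢ ≤ 2 * suc (2 * A) * (p * Pᵢ)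
        gap = s₂ p A Pᵢ B vᵢ 5≤p vl bigP
          where
          s₂ : ∀ p A Pᵢ B vᵢ → 5 ≤ p → suc (2 * A) * vᵢ ≤ p * (2 * A * Pᵢ + B) + suc (2 * A) → 4 * suc (8 * A + 6) * (2 * B + 3) ≤ Pᵢ → p * Pᵢ + 2 * suc (2 * A) * vᵢ ≤ 2 * suc (2 * A) * (p * Pᵢ)
          s₂ p A Pᵢ B vᵢ h₁ h₂ h₃ = ι-cancel (linear 0 5 {ν = p , Pᵢ , A , vᵢ , B , _}
              (nat (n# 0 ∗ n# 1 ∔ lit 2 ∗ (lit 1 ∔ lit 2 ∗ n# 2) ∗ n# 3))
              (nat (lit 2 ∗ (lit 1 ∔ lit 2 ∗ n# 2) ∗ (n# 0 ∗ n# 1)))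
              (# 2 :* nat ((lit 1 ∔ lit 2 ∗ n# 2) ∗ n# 3) :+ n0 :* nat (lit 4 ∗ (lit 1 ∔ (lit 8 ∗ n# 2 ∔ lit 6)) ∗ (lit 2 ∗ n# 4 ∔ lit 3)) :+ # 64 :* # 0 :+ # 54 :* # 0 :+ # 96 :* (# 5 :* n2) :+ # 84 :* # 5 :+ # 476 :* # 0 :+ # 0)
              (# 2 :* nat (n# 0 ∗ (lit 2 ∗ n# 2 ∗ n# 1 ∔ n# 4) ∔ (lit 1 ∔ lit 2 ∗ n# 2)) :+ n0 :* n1 :+ # 64 :* (n0 :* (n2 :* n4)) :+ # 54 :* (n0 :* n4) :+ # 96 :* (n0 :* n2) :+ # 84 :* n0 :+ # 476 :* n2 :+ # 418)
              (2 ⊙ ι-mono h₂ ⊞ p ⊙ ι-mono h₃ ⊞ 64 ⊙ ⊗-nonneg (0≤ι p) (⊗-nonneg (0≤ι A) (0≤ι B)) ⊞ 54 ⊙ ⊗-nonneg (0≤ι p) (0≤ι B)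
            ⊞ 96 ⊙ ⊗-monoʳ (0≤ι A) (ι-mono h₁) ⊞ 84 ⊙ ι-mono h₁ ⊞ 476 ⊙ 0≤ι A ⊞ 0≤ι 418))
        v≤ : vᵢ ≤ p * Pᵢ
        v≤ = *-cancel-≤ (2 * suc (2 * A)) (s≤s z≤n) (ℕ.≤-trans (ℕ.m≤n+m _ (p * Pᵢ)) gap)
        free : Free b d vᵢ (p * Pᵢ)
        free m v<m m≤x pm h with ℕ.m≤n⇒m<n∨m≡n m≤x
        -- The right endpoint p^(i + 1) falls outside the open window but is not prime.
        ... | inj₂ refl = product-not-prime p Pᵢ (ℕ.≤-trans (s≤s (s≤s z≤n)) 5≤p) (ℕ.≤-trans (ℕ.≤-trans (s≤s (s≤s z≤n)) 5≤p) (subst (_≤ Pᵢ) (ℕ.*-identityʳ p) (ℕ.^-monoʳ-≤ p {{ℕ.>-nonZero 1≤p}} {1} (ℕ.≤-trans 1≤k₀ k₀≤i)))) pm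
        ... | inj₁ m<x = free-scale i d d′ vᵢ m i≤K 1≤d′ d′<A big′ dd (ℕ.≤-trans (ℕ.≤-trans (ℕ.≤-trans (ℕ.m≤n+m G _) big) x₀≤P) P≤v) past m<x m v<m ℕ.≤-refl pm h
        missing : δ ⊑ harmonic (p * Pᵢ) ⊖ harmonic vᵢ
        missing = ⊑-trans (short (p * Pᵢ) (2 * suc (2 * A)) vᵢ (*-pos 1≤p (pᵖ i)) (s≤s z≤n) gap) (⊑-trans low (≡⇒⊒ (sum-diff inv v≤)))
          where
          short : ∀ x c vᵢ → 1 ≤ x → 1 ≤ c → x + c * vᵢ ≤ c * x → inv c ⊑ (ι x ⊖ ι vᵢ) ⊗ inv x
          short x c vᵢ 1≤x 1≤c h = ⊗-cancelˡ c 1≤c (linear 2 3 {ν = c , x , vᵢ , _}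
              (n0 :* v0) (n0 :* ((n1 :- n2) :* v1)) (nat (n# 1 ∔ n# 0 ∗ n# 2) :* v1 :+ n0 :* v0 :+ # 1)
              (nat (n# 0 ∗ n# 1) :* v1 :+ # 1 :+ n1 :* v1)
              (⊗-monoʳ (inv-nonneg x) (ι-mono h) ⊞ ≡⇒⊑ (inv-inverse c 1≤c) ⊞ ≡⇒⊒ (inv-inverse x 1≤x)))
          low : (ι (p * Pᵢ) ⊖ ι vᵢ) ⊗ inv (p * Pᵢ) ⊑ sum (λ i → inv (vᵢ + i)) (p * Pᵢ ∸ vᵢ)
          low = ⊑-trans (≡⇒⊑ (trans (cong (λ t → (t ⊖ ι vᵢ) ⊗ inv (p * Pᵢ)) (trans (cong ι (sym (ℕ.m+[n∸m]≡n v≤))) (ι-+ vᵢ (p * Pᵢ ∸ vᵢ)))) (r (ι vᵢ) (ι (p * Pᵢ ∸ vᵢ)) (inv (p * Pᵢ)))))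
            (⊑-trans (≡⇒⊒ (sum-const (inv (p * Pᵢ)) (p * Pᵢ ∸ vᵢ))) (sum-mono (p * Pᵢ ∸ vᵢ) (λ i 1≤i i≤ → inv-anti (ℕ.≤-trans 1≤i (ℕ.m≤n+m i vᵢ)) (subst (vᵢ + i ≤_) (ℕ.m+[n∸m]≡n v≤) (ℕ.+-monoʳ-≤ vᵢ i≤)))))
            where
            r : ∀ a b i → (a ⊕ b ⊖ a) ⊗ i ≡ b ⊗ i
            r a b i = ring 3 0 ((v0 :+ v1 :- v0) :* v2) (v1 :* v2)
        less : ∀ {a b c} → a ⊑ b → c ⊖ b ⊑ c ⊖ a
        less {a} {b} {c} h = linear 3 0 (v0 :- v1) (v0 :- v2) v2 v1 h
        add : ∀ {l f s₀ s₁ s₂ h₀ h₁ h₂ k c dd} → l ⊗ (f ⊗ (s₁ ⊖ s₀)) ⊑ ι 2 ⊗ l ⊗ (h₁ ⊖ h₀) ⊕ k → l ⊗ (f ⊗ (s₂ ⊖ s₁)) ⊑ l ⊗ (f ⊗ c) → l ⊗ dd ⊑ l ⊗ (h₂ ⊖ h₁) →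
          l ⊗ (f ⊗ (s₂ ⊖ s₀)) ⊑ ι 2 ⊗ l ⊗ (h₂ ⊖ h₀ ⊖ dd) ⊕ k ⊕ l ⊗ (f ⊗ c)
        add {l} {f} {s₀} {s₁} {s₂} {h₀} {h₁} {h₂} {k} {c} {dd} u₁ u₂ u₃ = linear 11 0
            (v0 :* (v1 :* (v2 :- v3))) (# 2 :* v0 :* (v4 :- v5 :- v6) :+ v7 :+ v0 :* (v1 :* v8))
            (v0 :* (v1 :* (v9 :- v3)) :+ v0 :* (v1 :* (v2 :- v9)) :+ # 2 :* (v0 :* v6))
            (# 2 :* v0 :* (v10 :- v5) :+ v7 :+ v0 :* (v1 :* v8) :+ # 2 :* (v0 :* (v4 :- v10)))
            (u₁ ⊞ u₂ ⊞ 2 ⊙ u₃)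

      deficient-sum : ∀ j → j + k₀ ≤ suc Kmax → p ^ (j + k₀) ≤ N →
        λ₀ ⊗ (ι φ ⊗ (sᵈ d (p ^ (j + k₀)) ⊖ sᵈ d x₀)) ⊑ ι 2 ⊗ λ₀ ⊗ (harmonic (p ^ (j + k₀)) ⊖ harmonic x₀ ⊖ ι j ⊗ δ) ⊕ ι j ⊗ (K₁ ⊗ ι p) ⊕ λ₀ ⊗ (ι φ ⊗ (sᶜ (p ^ (j + k₀)) ⊖ sᶜ x₀))
      deficient-sum zero    _ le = ≡⇒⊑ (z λ₀ (ι φ) (sᵈ d x₀) (harmonic x₀) δ (K₁ ⊗ ι p) (sᶜ x₀))
        where
        z : ∀ l f s h d k c → l ⊗ (f ⊗ (s ⊖ s)) ≡ ι 2 ⊗ l ⊗ (h ⊖ h ⊖ ι 0 ⊗ d) ⊕ ι 0 ⊗ k ⊕ l ⊗ (f ⊗ (c ⊖ c))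
        z l f s h d k c = ring 7 0 (v0 :* (v1 :* (v2 :- v2))) (# 2 :* v0 :* (v3 :- v3 :- # 0 :* v4) :+ # 0 :* v5 :+ v0 :* (v1 :* (v6 :- v6)))
      deficient-sum (suc j) jk le = add (deficient-sum j (ℕ.<⇒≤ jk) (ℕ.≤-trans (ℕ.m≤n*m (p ^ (j + k₀)) p {{ℕ.>-nonZero 1≤p}}) le)) (scale (j + k₀) (ℕ.m≤n+m k₀ j) (ℕ.≤-pred jk) le)
        where
        add : ∀ {l f s₀ s₁ s₂ h₀ h₁ h₂ k c₀ c₁ c₂ dd} → l ⊗ (f ⊗ (s₁ ⊖ s₀)) ⊑ ι 2 ⊗ l ⊗ (h₁ ⊖ h₀ ⊖ ι j ⊗ dd) ⊕ ι j ⊗ k ⊕ l ⊗ (f ⊗ (c₁ ⊖ c₀)) →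
          l ⊗ (f ⊗ (s₂ ⊖ s₁)) ⊑ ι 2 ⊗ l ⊗ (h₂ ⊖ h₁ ⊖ dd) ⊕ k ⊕ l ⊗ (f ⊗ (c₂ ⊖ c₁)) →
          l ⊗ (f ⊗ (s₂ ⊖ s₀)) ⊑ ι 2 ⊗ l ⊗ (h₂ ⊖ h₀ ⊖ ι (suc j) ⊗ dd) ⊕ ι (suc j) ⊗ k ⊕ l ⊗ (f ⊗ (c₂ ⊖ c₀))
        add {l} {f} {s₀} {s₁} {s₂} {h₀} {h₁} {h₂} {k} {c₀} {c₁} {c₂} {dd} u₁ u₂ = linear 13 1
            (v0 :* (v1 :* (v2 :- v3)))
            (# 2 :* v0 :* (v4 :- v5 :- nat (lit 1 ∔ n# 0) :* v6) :+ nat (lit 1 ∔ n# 0) :* v7 :+ v0 :* (v1 :* (v8 :- v9)))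
            (v0 :* (v1 :* (v10 :- v3)) :+ v0 :* (v1 :* (v2 :- v10)))
            (# 2 :* v0 :* (v11 :- v5 :- n0 :* v6) :+ n0 :* v7 :+ v0 :* (v1 :* (v12 :- v9)) :+ (# 2 :* v0 :* (v4 :- v11 :- v6) :+ v7 :+ v0 :* (v1 :* (v8 :- v12))))
            (u₁ ⊞ u₂)

-- Positivity of l is expressed by 1 ≤ 4 l, in terms of the weak order; the 4 fits the bound L(2) ≥
-- 1/4.
cancel-pos : ∀ {l a c} → ι 1 ⊑ ι 4 ⊗ l → l ⊗ a ⊑ l ⊗ c → a ⊑ c
cancel-pos {l} {a} {c} pos h with ⊑-total a c
... | inj₁ le = le
... | inj₂ ge = linear 3 0
    v0 v1 (# 1 :* (v0 :- v1) :+ # 4 :* (v2 :* v0)) (# 4 :* v2 :* (v0 :- v1) :+ # 4 :* (v2 :* v1))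
    (⊗-monoʳ (⊑⇒⊖ ge) pos ⊞ 4 ⊙ h)

module TotalMass {p A b B G Kmax : ℕ} {{nz : NonZero A}} (W : Window p A b B G Kmax) {N : ℕ} (ls : LogSystem N) where
  open LogMass W ls public

  ¬unit-A : ¬ Coprime A A
  ¬unit-A c = contradiction (subst (5 ≤_) (c (∣-refl , ∣-refl)) 5≤A) (λ { (s≤s ()) })

  2d≢A : ∀ {d} → Coprime d A → 2 * d ≢ A
  2d≢A {d} c e with c (∣-refl {d} , divides 2 (sym e))
  ... | refl = contradiction (subst (5 ≤_) (sym e) 5≤A) (λ { (s≤s (s≤s ())) })

  unit-reflect : ∀ d → d ≤ A → unit (A ∸ d) ≡ unit d
  unit-reflect d d≤A = χ-cong (coprime? (A ∸ d) A) (coprime? d A)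
    (λ c {i} h → c (∣m+n∣m⇒∣n {m = d} (subst (i ∣_) (sym (ℕ.m+[n∸m]≡n d≤A)) (proj₂ h)) (proj₁ h) , proj₂ h))
    (λ c {i} h → c (∣m+n∣m⇒∣n {m = A ∸ d} (subst (i ∣_) (sym (ℕ.m∸n+n≡m d≤A)) (proj₂ h)) (proj₁ h) , proj₂ h))

  sum-unit : sum unit A∸1 ≡ ι φ
  sum-unit = trans (sym (trans (cong (sum unit) A≡) (trans (cong (sum unit A∸1 ⊕_) (trans (cong unit (sym A≡)) (χ-no (coprime? A A) ¬unit-A))) (⊕-identityʳ _)))) (count-unit A)

  low high : ℕ → R
  low d = χ (2 * d ℕ.<? A)
  high d = χ (A ℕ.<? 2 * d)

  -- The reflection d ↦ A - d exchanges the units below and above A/2, and no unit equals A/2.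
  half-units : ι 2 ⊗ sum (λ d → unit d ⊗ low d) A∸1 ≡ ι φ
  half-units = trans (two (sum (λ d → unit d ⊗ low d) A∸1)) (trans (cong (sum (λ d → unit d ⊗ low d) A∸1 ⊕_) reflect) (trans (sym (sum-⊕ _ _ A∸1)) (trans (sum-cong A∸1 (λ d _ _ → one d)) sum-unit)))
    where
    two : ∀ x → ι 2 ⊗ x ≡ x ⊕ x
    two x = ring 1 0 (# 2 :* v0) (v0 :+ v0)
    reflect : sum (λ d → unit d ⊗ low d) A∸1 ≡ sum (λ d → unit d ⊗ high d) A∸1
    reflect = trans (sum-reverse (λ d → unit d ⊗ low d) A∸1) (sum-cong A∸1 (λ d 1≤d d≤ → trans (cong (λ t → unit (t ∸ d) ⊗ low (t ∸ d)) (sym A≡))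
      (cong₂ _⊗_ (unit-reflect d (le d d≤)) (χ-cong (2 * (A ∸ d) ℕ.<? A) (A ℕ.<? 2 * d) (λ h → fwd A d (A ∸ d) (ℕ.m∸n+n≡m (le d d≤)) h) (λ h → bwd A d (A ∸ d) (ℕ.m∸n+n≡m (le d d≤)) h)))))
      where
      le : ∀ d → d ≤ A∸1 → d ≤ A
      le d h = ℕ.≤-trans h (ℕ.<⇒≤ A∸1<A)
      fwd : ∀ A d e → e + d ≡ A → 2 * e < A → A < 2 * d
      fwd _ d e refl h = ι-cancel (linear 0 2 {ν = e , d , _}
          (nat (lit 1 ∔ (n# 0 ∔ n# 1))) (nat (lit 2 ∗ n# 1)) (nat (lit 1 ∔ lit 2 ∗ n# 0)) (nat (n# 0 ∔ n# 1))
          (ι-mono h))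
      bwd : ∀ A d e → e + d ≡ A → A < 2 * d → 2 * e < A
      bwd _ d e refl h = ι-cancel (linear 0 2 {ν = e , d , _}
          (nat (lit 1 ∔ lit 2 ∗ n# 0)) (nat (n# 0 ∔ n# 1)) (nat (lit 1 ∔ (n# 0 ∔ n# 1))) (nat (lit 2 ∗ n# 1))
          (ι-mono h))
    one : ∀ d → unit d ⊗ low d ⊕ unit d ⊗ high d ≡ unit d
    one d with coprime? d A
    ... | no _ = z (low d) (high d)
      where
      z : ∀ a c → ι 0 ⊗ a ⊕ ι 0 ⊗ c ≡ ι 0
      z a c = ring 2 0 (# 0 :* v0 :+ # 0 :* v1) (# 0)
    ... | yes c with ℕ.<-cmp (2 * d) A
    ...   | tri< lt _ ¬gt = trans (cong₂ (λ s t → ι 1 ⊗ s ⊕ ι 1 ⊗ t) (χ-yes (2 * d ℕ.<? A) lt) (χ-no (A ℕ.<? 2 * d) ¬gt)) (ring 0 0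
        (# 1 :* # 1 :+ # 1 :* # 0) (# 1))
    ...   | tri≈ _ eq _ = ⊥-elim (2d≢A c eq)
    ...   | tri> ¬lt _ gt = trans (cong₂ (λ s t → ι 1 ⊗ s ⊕ ι 1 ⊗ t) (χ-no (2 * d ℕ.<? A) ¬lt) (χ-yes (A ℕ.<? 2 * d) gt)) (ring 0 0
        (# 1 :* # 0 :+ # 1 :* # 1) (# 1))

  sᵘ : ℕ → R
  sᵘ = sum (λ j → unit j ⊗ (Λ j ⊗ inv j))

  -- Every m prime to A lies in exactly one class d/b with d a unit below A.
  classes : ∀ x → sum (λ d → unit d ⊗ sᵈ d x) A∸1 ≡ sᵘ x
  classes x = trans (sum-ext A∸1 (λ d → sym (sum-⊗ (unit d) _ x))) (trans (sum-swap (λ d m → unit d ⊗ (class b d m ⊗ (Λ m ⊗ inv m))) A∸1 x) (sum-ext x pt))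
    where
    pt : ∀ m → sum (λ d → unit d ⊗ (class b d m ⊗ (Λ m ⊗ inv m))) A∸1 ≡ unit m ⊗ (Λ m ⊗ inv m)
    pt m with coprime? m A
    ... | no ¬c = trans (sum-zero A∸1 (λ d _ _ → zero-term d)) (sym (⊗-zeroˡ _))
      where
      zero-term : ∀ d → unit d ⊗ (class b d m ⊗ (Λ m ⊗ inv m)) ≡ ι 0
      zero-term d with coprime? d A
      ... | no _   = ⊗-zeroˡ _
      ... | yes cd = trans (⊗-identityˡ _) (trans (cong (_⊗ (Λ m ⊗ inv m)) (χ-no (b * m ≈? d) (λ h → ¬c (proj₂ (class-coprime {b} {d} {m} cd h))))) (⊗-zeroˡ _))
    ... | yes c with rep-spec (b * m)
    ...   | 1≤r , r≤A , r≈ = trans (sum-single _ r A∸1 1≤r r≤A∸1 (λ d 1≤d d≤ d≢r → trans (cong (λ t → unit d ⊗ (t ⊗ (Λ m ⊗ inv m))) (χ-no (b * m ≈? d)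
              (λ h → d≢r (≈-unique 1≤d (ℕ.≤-trans d≤ (ℕ.<⇒≤ A∸1<A)) 1≤r r≤A (trans (sym h) (sym r≈)))))) (z (unit d) (Λ m ⊗ inv m))))
            (trans (cong₂ (λ s t → s ⊗ (t ⊗ (Λ m ⊗ inv m))) (χ-yes (coprime? r A) cr) (χ-yes (b * m ≈? r) (sym r≈))) (⊗-identityˡ _))
      where
      r = rep (b * m)
      cr : Coprime r A
      cr = ≈-coprime {b * m} {r} (sym r≈) (coprime-* b-unit c)
      r≤A∸1 : r ≤ A∸1
      r≤A∸1 = ℕ.≤-pred (subst (r <_) A≡ (ℕ.≤∧≢⇒< r≤A (λ e → ¬unit-A (subst (λ t → Coprime t A) e cr))))
      z : ∀ a c → a ⊗ (ι 0 ⊗ c) ≡ ι 0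
      z a c = ring 2 0 (v0 :* (# 0 :* v1)) (# 0)

  sᵘ-lower : ∀ X → 1 ≤ X → X ≤ N → L X ⊑ sᵘ X ⊕ ι 26 ⊗ (Δ ⊗ Δ)
  sᵘ-lower X 1≤X X≤N = At.mertens-unit 1 1 X (λ { (d , _) → ∣1⇒≡1 d }) (λ { (d , _) → ∣1⇒≡1 d }) 1≤X X≤N

  sᵘ-upper : ∀ X → 1 ≤ X → X ≤ N → sᵘ X ⊑ L X ⊕ ι 8
  sᵘ-upper X 1≤X X≤N = ⊑-trans (At.sᵘ≤s 1 1 X (λ { (d , _) → ∣1⇒≡1 d }) (λ { (d , _) → ∣1⇒≡1 d }) 1≤X X≤N) (mertens-upper X 1≤X X≤N)

  module Total (k₀ j : ℕ) (1≤k₀ : 1 ≤ k₀) (big : 4 * suc M₀ * (2 * B + 3) + G ≤ p ^ k₀) (jk : j + k₀ ≤ suc Kmax) (le : p ^ (j + k₀) ≤ N)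
    (d* d′ : ℕ) (cd : Coprime d* A) (1≤d* : 1 ≤ d*) (2d* : 2 * d* < A) (1≤d′ : 1 ≤ d′) (d′<A : d′ < A) (big′ : suc (2 * A) ≤ p * d′) (dd : d* * d′ ≈ b * b)
    (Smax : R) (0≤S : ι 0 ⊑ Smax) (small : ∀ d → 1 ≤ d → d < A → suc A ≤ 2 * d → Coprime d A → sᵈ d (p ^ (j + k₀)) ⊑ Smax) where
    open Range k₀ 1≤k₀ big

    x₁ : ℕ
    x₁ = p ^ (j + k₀)

    -- `U` bounds any single class, `V` is the correction to `U` for `d*`, and `Sx` bounds a class
    -- above A/2.
    U V Sx : R
    U = ι 2 ⊗ λ₀ ⊗ (harmonic x₁ ⊖ harmonic x₀) ⊕ ι j ⊗ (K₁ ⊗ ι p)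
    V = λ₀ ⊗ (ι φ ⊗ ι 32) ⊖ ι 2 ⊗ λ₀ ⊗ (ι j ⊗ δ)
    Sx = λ₀ ⊗ (ι φ ⊗ Smax)

    0≤λ₀ : ι 0 ⊑ λ₀
    0≤λ₀ = proj₁ (λ₀≤ j le)

    0≤Sx : ι 0 ⊑ Sx
    0≤Sx = ⊗-nonneg 0≤λ₀ (⊗-nonneg (0≤ι φ) 0≤S)

    Dd : ℕ → R
    Dd d = λ₀ ⊗ (ι φ ⊗ (sᵈ d x₁ ⊖ sᵈ d x₀))

    special : Dd d* ⊑ U ⊕ V
    special = fin (Deficient.deficient-sum d* d′ cd 1≤d′ d′<A big′ dd j jk le) (⊗-monoˡ 0≤λ₀ (⊗-monoˡ (0≤ι φ) (⊑-trans (drop (sum-nonneg x₀ (λ m _ _ → ⊗-nonneg (Λᶜ-nonneg m) (inv-nonneg m)))) (sum-Λᶜ x₁ le))))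
      where
      drop : ∀ {a c} → ι 0 ⊑ c → a ⊖ c ⊑ a
      drop {a} {c} h = linear 2 0 (v0 :- v1) v0 (# 0) v1 h
      fin : ∀ {D l h k f c jd} → D ⊑ ι 2 ⊗ l ⊗ (h ⊖ jd) ⊕ k ⊕ l ⊗ (f ⊗ c) → l ⊗ (f ⊗ c) ⊑ l ⊗ (f ⊗ ι 32) → D ⊑ ι 2 ⊗ l ⊗ h ⊕ k ⊕ (l ⊗ (f ⊗ ι 32) ⊖ ι 2 ⊗ l ⊗ jd)
      fin {D} {l} {h} {k} {f} {c} {jd} u₁ u₂ = linear 7 0
          v0 (# 2 :* v1 :* v2 :+ v3 :+ (v1 :* (v4 :* # 32) :- # 2 :* v1 :* v5)) (v0 :+ v1 :* (v4 :* v6))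
          (# 2 :* v1 :* (v2 :- v5) :+ v3 :+ v1 :* (v4 :* v6) :+ v1 :* (v4 :* # 32))
          (u₁ ⊞ u₂)

    each : ∀ d → 1 ≤ d → d ≤ A∸1 → unit d ⊗ Dd d ⊑ U ⊗ (unit d ⊗ low d) ⊕ Sx ⊗ unit d ⊕ χ (d ℕ.≟ d*) ⊗ V
    each d 1≤d d≤ with coprime? d A
    ... | no ¬c = ≡⇒⊑ (trans (⊗-zeroˡ _) (trans (z U (low d) Sx) (cong (λ t → U ⊗ (ι 0 ⊗ low d) ⊕ Sx ⊗ ι 0 ⊕ t) (sym (trans (cong (_⊗ V) (χ-no (d ℕ.≟ d*) (λ { refl → ¬c cd }))) (⊗-zeroˡ V))))))
      where
      z : ∀ u l s → ι 0 ≡ u ⊗ (ι 0 ⊗ l) ⊕ s ⊗ ι 0 ⊕ ι 0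
      z u l s = ring 3 0 (# 0) (v0 :* (# 0 :* v1) :+ v2 :* # 0 :+ # 0)
    ... | yes c with d ℕ.≟ d*
    ...   | yes refl = ⊑-trans (f₁ special 0≤Sx) (≡⇒⊒ (cong (λ t → U ⊗ (ι 1 ⊗ t) ⊕ Sx ⊗ ι 1 ⊕ ι 1 ⊗ V) (χ-yes (2 * d ℕ.<? A) 2d*)))
      where
      f₁ : ∀ {D u v s} → D ⊑ u ⊕ v → ι 0 ⊑ s → ι 1 ⊗ D ⊑ u ⊗ (ι 1 ⊗ ι 1) ⊕ s ⊗ ι 1 ⊕ ι 1 ⊗ v
      f₁ {D} {u} {v} {s} h k = linear 4 0 (# 1 :* v0) (v1 :* (# 1 :* # 1) :+ v2 :* # 1 :+ # 1 :* v3) (v0 :+ # 0) (v1 :+ v3 :+ v2) (h ⊞ k)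
    ...   | no _ with 2 * d ℕ.<? A
    ...     | yes _ = f₂ (full d j c le) 0≤Sx
      where
      f₂ : ∀ {D u v s} → D ⊑ u → ι 0 ⊑ s → ι 1 ⊗ D ⊑ u ⊗ (ι 1 ⊗ ι 1) ⊕ s ⊗ ι 1 ⊕ ι 0 ⊗ v
      f₂ {D} {u} {v} {s} h k = linear 4 0 (# 1 :* v0) (v1 :* (# 1 :* # 1) :+ v2 :* # 1 :+ # 0 :* v3) (v0 :+ # 0) (v1 :+ v2) (h ⊞ k)
    ...     | no 2d≮ = f₃ (⊗-monoˡ 0≤λ₀ (⊗-monoˡ (0≤ι φ) (⊑-trans (drop (sᵈ-nonneg d x₀)) (small d 1≤d (ℕ.≤-<-trans d≤ A∸1<A) (ℕ.≤∧≢⇒< (ℕ.≮⇒≥ 2d≮) (λ e → 2d≢A c (sym e))) c))))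
      where
      drop : ∀ {a c} → ι 0 ⊑ c → a ⊖ c ⊑ a
      drop {a} {c} h = linear 2 0 (v0 :- v1) v0 (# 0) v1 h
      f₃ : ∀ {D u v s} → D ⊑ s → ι 1 ⊗ D ⊑ u ⊗ (ι 1 ⊗ ι 0) ⊕ s ⊗ ι 1 ⊕ ι 0 ⊗ v
      f₃ {D} {u} {v} {s} h = linear 4 0 (# 1 :* v0) (v1 :* (# 1 :* # 0) :+ v2 :* # 1 :+ # 0 :* v3) v0 v2 h

    total : λ₀ ⊗ (ι φ ⊗ (sᵘ x₁ ⊖ sᵘ x₀)) ⊑ U ⊗ sum (λ d → unit d ⊗ low d) A∸1 ⊕ Sx ⊗ ι φ ⊕ V
    total = ⊑-trans (≡⇒⊑ left) (⊑-trans (sum-mono A∸1 each) (≡⇒⊑ (trans (sum-⊕ _ _ A∸1) (cong₂ _⊕_ (trans (sum-⊕ _ _ A∸1) (cong₂ _⊕_ (sum-⊗ U _ A∸1) (trans (sum-⊗ Sx unit A∸1) (cong (Sx ⊗_) sum-unit)))) delta))))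
      where
      left : λ₀ ⊗ (ι φ ⊗ (sᵘ x₁ ⊖ sᵘ x₀)) ≡ sum (λ d → unit d ⊗ Dd d) A∸1
      left = trans (cong (λ t → λ₀ ⊗ (ι φ ⊗ t)) (cong₂ _⊖_ (sym (classes x₁)) (sym (classes x₀)))) (trans (cong (λ t → λ₀ ⊗ (ι φ ⊗ t)) (sym (sum-⊖ _ _ A∸1)))
        (trans (sym (⊗-assoc _ _ _)) (trans (sym (sum-⊗ (λ₀ ⊗ ι φ) _ A∸1)) (sum-ext A∸1 (λ d → r λ₀ (ι φ) (unit d) (sᵈ d x₁) (sᵈ d x₀))))))
        where
        r : ∀ l f u s t → l ⊗ f ⊗ (u ⊗ s ⊖ u ⊗ t) ≡ u ⊗ (l ⊗ (f ⊗ (s ⊖ t)))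
        r l f u s t = ring 5 0 (v0 :* v1 :* (v2 :* v3 :- v2 :* v4)) (v2 :* (v0 :* (v1 :* (v3 :- v4))))
      d*≤ : d* ≤ A∸1
      d*≤ = ℕ.≤-pred (subst (d* <_) A≡ (ℕ.≤-<-trans (ℕ.m≤n*m d* 2) 2d*))
      delta : sum (λ d → χ (d ℕ.≟ d*) ⊗ V) A∸1 ≡ V
      delta = trans (sum-single _ d* A∸1 1≤d* d*≤ (λ d _ _ d≢ → trans (cong (_⊗ V) (χ-no (d ℕ.≟ d*) d≢)) (⊗-zeroˡ V))) (trans (cong (_⊗ V) (χ-yes (d* ℕ.≟ d*) refl)) (⊗-identityˡ V))

    harmonic-diff : harmonic x₁ ⊖ harmonic x₀ ⊑ L x₁ ⊖ L x₀ ⊕ ι 3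
    harmonic-diff = fin (proj₂ dif) (inv-nonneg x₁) (inv≤1 x₀ (pᵖ k₀))
      where
      le₀ : x₀ ≤ x₁
      le₀ = mono-x j
      dif : Within (ι 3 ⊗ (inv x₀ ⊖ inv x₁)) (harmonic x₁ ⊖ L x₁ ⊖ (harmonic x₀ ⊖ L x₀))
      dif = subst (λ t → Within (ι 3 ⊗ (inv x₀ ⊖ inv t)) (harmonic t ⊖ L t ⊖ (harmonic x₀ ⊖ L x₀))) (ℕ.m∸n+n≡m le₀) (y-diff x₀ (x₁ ∸ x₀) (pᵖ k₀) (subst (_≤ N) (sym (ℕ.m∸n+n≡m le₀)) le))
      fin : ∀ {h₁ h₀ l₁ l₀ i₀ i₁} → h₁ ⊖ l₁ ⊖ (h₀ ⊖ l₀) ⊑ ι 3 ⊗ (i₀ ⊖ i₁) → ι 0 ⊑ i₁ → i₀ ⊑ ι 1 → h₁ ⊖ h₀ ⊑ l₁ ⊖ l₀ ⊕ ι 3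
      fin {h₁} {h₀} {l₁} {l₀} {i₀} {i₁} u₁ u₂ u₃ = linear 6 0
          (v0 :- v1) (v2 :- v3 :+ # 3) (v0 :- v2 :- (v1 :- v3) :+ # 3 :* # 0 :+ # 3 :* v4)
          (# 3 :* (v4 :- v5) :+ # 3 :* v5 :+ # 3 :* # 1)
          (u₁ ⊞ 3 ⊙ u₂ ⊞ 3 ⊙ u₃)

    -- By the first hypothesis half of the deficit 2 λ₀ j δ absorbs the errors K₁ p of the j scales.
    -- The constant 43 is 8 + 3 + 32, from Mertens, from the comparison of harmonic sums with L, and
    -- from the prime powers.
    conclusion : ι φ ⊗ (K₁ ⊗ ι p) ⊑ ι 2 ⊗ (λ₀ ⊗ δ) → ι 1 ⊑ ι 4 ⊗ λ₀ → ι j ⊗ δ ⊑ ι φ ⊗ (ι 26 ⊗ (Δ ⊗ Δ) ⊕ ι 43) ⊕ ι φ ⊗ (ι φ ⊗ Smax)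
    conclusion hλ pos = cancel-pos pos (fin {λ₀} {ι φ} {sᵘ x₁} {sᵘ x₀} {harmonic x₁ ⊖ harmonic x₀} {ι j} {K₁ ⊗ ι p} {sum (λ d → unit d ⊗ low d) A∸1} {Smax} {δ} {L x₁} {L x₀} {Δ ⊗ Δ}
        total half-units (⊗-monoˡ (⊗-nonneg 0≤λ₀ (0≤ι φ)) harmonic-diff) (⊗-monoˡ (⊗-nonneg 0≤λ₀ (0≤ι φ)) (sᵘ-lower x₁ (pᵖ (j + k₀)) le ⊞ sᵘ-upper x₀ (pᵖ k₀) (ℕ.≤-trans (mono-x j) le))) (⊗-monoˡ (0≤ι j) hλ))
      where
      fin : ∀ {l f s₁ s₀ h J k e S d l₁ l₀ q} →
        l ⊗ (f ⊗ (s₁ ⊖ s₀)) ⊑ (ι 2 ⊗ l ⊗ h ⊕ J ⊗ k) ⊗ e ⊕ l ⊗ (f ⊗ S) ⊗ f ⊕ (l ⊗ (f ⊗ ι 32) ⊖ ι 2 ⊗ l ⊗ (J ⊗ d)) → ι 2 ⊗ e ≡ f →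
        l ⊗ f ⊗ h ⊑ l ⊗ f ⊗ (l₁ ⊖ l₀ ⊕ ι 3) → l ⊗ f ⊗ (l₁ ⊕ s₀) ⊑ l ⊗ f ⊗ (s₁ ⊕ ι 26 ⊗ q ⊕ (l₀ ⊕ ι 8)) → J ⊗ (f ⊗ k) ⊑ J ⊗ (ι 2 ⊗ (l ⊗ d)) →
        l ⊗ (J ⊗ d) ⊑ l ⊗ (f ⊗ (ι 26 ⊗ q ⊕ ι 43) ⊕ f ⊗ (f ⊗ S))
      fin {l} {f} {s₁} {s₀} {h} {J} {k} {e} {S} {d} {l₁} {l₀} {q} u₁ refl u₂ u₃ u₄ = ⊗-cancelˡ 2 (s≤s z≤n) (linear 12 0
          (# 2 :* (v0 :* (v1 :* v2)))
          (# 2 :* (v0 :* (# 2 :* v3 :* (# 26 :* v4 :+ # 43) :+ # 2 :* v3 :* (# 2 :* v3 :* v5))))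
          (# 2 :* (v0 :* (# 2 :* v3 :* (v6 :- v7))) :+ # 2 :* (v0 :* (# 2 :* v3) :* v8) :+ # 2 :* (v0 :* (# 2 :* v3) :* (v9 :+ v7)) :+ v1 :* (# 2 :* v3 :* v10))
          (# 2 :* ((# 2 :* v0 :* v8 :+ v1 :* v10) :* v3 :+ v0 :* (# 2 :* v3 :* v5) :* (# 2 :* v3) :+ (v0 :* (# 2 :* v3 :* # 32) :- # 2 :* v0 :* (v1 :* v2))) :+ # 2 :* (v0 :* (# 2 :* v3) :* (v9 :- v11 :+ # 3)) :+ # 2 :* (v0 :* (# 2 :* v3) :* (v6 :+ # 26 :* v4 :+ (v11 :+ # 8))) :+ v1 :* (# 2 :* (v0 :* v2)))
          (2 ⊙ u₁ ⊞ 2 ⊙ u₂ ⊞ 2 ⊙ u₃ ⊞ u₄))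

-- Choice of the scales

unscale : ∀ c {S X} → 1 ≤ c → ι 0 ⊑ S → ι 2 ⊗ (inv c ⊗ S) ⊑ X → S ⊑ ι c ⊗ X
unscale c {S} {X} 1≤c 0≤S h = linear 3 1
    v0 (n0 :* v1) (n0 :* (# 2 :* (v2 :* v0)) :+ # 2 :* (# 1 :* v0) :+ # 0)
    (n0 :* v1 :+ # 2 :* (n0 :* v2 :* v0) :+ v0)
    (⊗-monoˡ (0≤ι c) h ⊞ 2 ⊙ ≡⇒⊒ (cong (_⊗ S) (inv-inverse c 1≤c)) ⊞ 0≤S)

-- Here ℓ is log p and λ′ is t ℓ. Since log x is O(t λ′) and log x - log Z is O(t ℓ), dividing the
-- deficiency inequality by λ′ leaves O(t).
module Estimates (λ′ ℓ K φ p t : R) (0≤λ : ι 0 ⊑ λ′) (0≤K : ι 0 ⊑ K) (0≤φ : ι 0 ⊑ φ) (0≤p : ι 0 ⊑ p) (1≤t : ι 1 ⊑ t)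
  (λ≡ : λ′ ≡ t ⊗ ℓ) (pos : ι 1 ⊑ ι 4 ⊗ λ′) (ℓ≤λ : ℓ ⊑ λ′) (ℓ≤2p : ℓ ⊑ ι 2 ⊗ p) (φ≤K : φ ⊑ K) where

  0≤t : ι 0 ⊑ t
  0≤t = ⊑-trans (0≤ι 1) 1≤t

  first : ∀ {m S Lx LZ} → ι 2 ⊗ λ′ ⊗ (m ⊗ S) ⊑ K ⊗ (ι 2 ⊗ λ′ ⊕ ι 2 ⊗ (Lx ⊕ ι 8) ⊕ λ′ ⊗ (Lx ⊖ LZ)) ⊕ λ′ ⊗ (ι 160 ⊗ φ) →
    Lx ⊑ ι 2 ⊗ (t ⊗ λ′) ⊕ ℓ → Lx ⊖ LZ ⊑ (t ⊕ ι 1) ⊗ ℓ → ι 2 ⊗ (m ⊗ S) ⊑ K ⊗ (ι 232 ⊕ ι 4 ⊗ p) ⊗ t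
  first {m} {S} {Lx} {LZ} h h₁ h₂ = cancel-pos pos (linear 10 0
      (v0 :* (# 2 :* (v1 :* v2))) (v0 :* (v3 :* (# 232 :+ # 4 :* v4) :* v5))
      (# 2 :* v0 :* (v1 :* v2) :+ # 2 :* (v3 :* v6) :+ v3 :* v0 :* (v6 :- v7) :+ v3 :* v0 :* (v5 :+ # 1) :* v8 :+ # 2 :* (v3 :* v8) :+ # 16 :* (v3 :* # 1) :+ # 160 :* (v0 :* v9) :+ # 228 :* (v3 :* v0 :* # 1) :+ # 2 :* (v3 :* v0 :* v4 :* # 1))
      (v3 :* (# 2 :* v0 :+ # 2 :* (v6 :+ # 8) :+ v0 :* (v6 :- v7)) :+ v0 :* (# 160 :* v9) :+ # 2 :* (v3 :* (# 2 :* (v5 :* v0) :+ v8)) :+ v3 :* v0 :* ((v5 :+ # 1) :* v8) :+ v3 :* v0 :* (v5 :+ # 1) :* (# 2 :* v4) :+ # 2 :* (v3 :* v0) :+ # 16 :* (v3 :* (# 4 :* v0)) :+ # 160 :* (v0 :* v3) :+ # 228 :* (v3 :* v0 :* v5) :+ # 2 :* (v3 :* v0 :* v4 :* v5))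
      (h ⊞ 2 ⊙ ⊗-monoˡ 0≤K h₁ ⊞ ⊗-monoˡ 0≤Kλ h₂ ⊞ ⊗-monoˡ (⊗-nonneg 0≤Kλ (⊕-nonneg 0≤t (0≤ι 1))) ℓ≤2p
    ⊞ 2 ⊙ ⊗-monoˡ 0≤K ℓ≤λ ⊞ 16 ⊙ ⊗-monoˡ 0≤K pos ⊞ 160 ⊙ ⊗-monoˡ 0≤λ φ≤K ⊞ 228 ⊙ ⊗-monoˡ 0≤Kλ 1≤t ⊞ 2 ⊙ ⊗-monoˡ (⊗-nonneg 0≤Kλ 0≤p) 1≤t))
    where
    0≤Kλ : ι 0 ⊑ K ⊗ λ′
    0≤Kλ = ⊗-nonneg 0≤K 0≤λ

  -- The last term of the hypothesis, divided by λ′, is φ dens log x with dens = O(1/t) and log x =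
  -- O(t λ′), hence O(λ′) and so O(t).
  second : ∀ {m S Lx LZ dens C} → ι 0 ⊑ dens → ι 0 ⊑ C → ι 2 ⊗ λ′ ⊗ (m ⊗ S) ⊑ K ⊗ (ι 2 ⊗ λ′ ⊕ ι 2 ⊗ (Lx ⊕ ι 8) ⊕ λ′ ⊗ (Lx ⊖ LZ)) ⊕ λ′ ⊗ (φ ⊗ dens ⊗ Lx) →
    Lx ⊑ ι 2 ⊗ (t ⊗ λ′) → Lx ⊖ LZ ⊑ (t ⊕ ι 3) ⊗ ℓ → t ⊗ dens ⊑ ι 2 ⊗ C → ι 2 ⊗ (m ⊗ S) ⊑ (K ⊗ (ι 70 ⊕ ι 8 ⊗ p) ⊕ ι 8 ⊗ (φ ⊗ (C ⊗ p))) ⊗ t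
  second {m} {S} {Lx} {LZ} {dens} {C} 0≤d 0≤C h h₁ h₂ h₃ = cancel-pos pos (linear 12 0
      (v0 :* (# 2 :* (v1 :* v2))) (v0 :* ((v3 :* (# 70 :+ # 8 :* v4) :+ # 8 :* (v5 :* (v6 :* v4))) :* v7))
      (# 2 :* v0 :* (v1 :* v2) :+ # 2 :* (v3 :* v8) :+ v3 :* v0 :* (v8 :- v9) :+ v3 :* v0 :* (v7 :+ # 3) :* v10 :+ # 16 :* (v3 :* # 1) :+ # 66 :* (v3 :* v0 :* # 1) :+ # 6 :* (v3 :* v0 :* v4 :* # 1) :+ v0 :* (v5 :* v11) :* v8 :+ # 2 :* (v0 :* (v5 :* v0) :* (v7 :* v11)) :+ # 4 :* (v0 :* v5 :* v6 :* v0) :+ # 4 :* (v0 :* (v5 :* v6) :* v7 :* v10))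
      (v3 :* (# 2 :* v0 :+ # 2 :* (v8 :+ # 8) :+ v0 :* (v8 :- v9)) :+ v0 :* (v5 :* v11 :* v8) :+ # 2 :* (v3 :* (# 2 :* (v7 :* v0))) :+ v3 :* v0 :* ((v7 :+ # 3) :* v10) :+ v3 :* v0 :* (v7 :+ # 3) :* (# 2 :* v4) :+ # 16 :* (v3 :* (# 4 :* v0)) :+ # 66 :* (v3 :* v0 :* v7) :+ # 6 :* (v3 :* v0 :* v4 :* v7) :+ v0 :* (v5 :* v11) :* (# 2 :* (v7 :* v0)) :+ # 2 :* (v0 :* (v5 :* v0) :* (# 2 :* v6)) :+ # 4 :* (v0 :* v5 :* v6 :* (v7 :* v10)) :+ # 4 :* (v0 :* (v5 :* v6) :* v7 :* (# 2 :* v4)))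
      (h ⊞ 2 ⊙ ⊗-monoˡ 0≤K h₁ ⊞ ⊗-monoˡ 0≤Kλ h₂ ⊞ ⊗-monoˡ (⊗-nonneg 0≤Kλ (⊕-nonneg 0≤t (0≤ι 3))) ℓ≤2p
    ⊞ 16 ⊙ ⊗-monoˡ 0≤K pos ⊞ 66 ⊙ ⊗-monoˡ 0≤Kλ 1≤t ⊞ 6 ⊙ ⊗-monoˡ (⊗-nonneg 0≤Kλ 0≤p) 1≤t
    ⊞ ⊗-monoˡ (⊗-nonneg 0≤λ (⊗-nonneg 0≤φ 0≤d)) h₁ ⊞ 2 ⊙ ⊗-monoˡ (⊗-nonneg 0≤λ (⊗-nonneg 0≤φ 0≤λ)) h₃
    ⊞ 4 ⊙ ≡⇒⊑ (cong (λ′ ⊗ φ ⊗ C ⊗_) λ≡) ⊞ 4 ⊙ ⊗-monoˡ (⊗-nonneg (⊗-nonneg 0≤λ (⊗-nonneg 0≤φ 0≤C)) 0≤t) ℓ≤2p))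
    where
    0≤Kλ : ι 0 ⊑ K ⊗ λ′
    0≤Kλ = ⊗-nonneg 0≤K 0≤λ

-- A quadratic number of scales against a linear bound on them.
square-beats : ∀ {t C D k j} → ι 1 ⊑ t → ι 0 ⊑ C → ι 0 ⊑ k → t ⊗ t ⊑ j ⊕ t ⊕ k → j ⊑ C ⊕ D ⊗ t → C ⊕ D ⊕ k ⊕ ι 2 ⊑ t → ⊥
square-beats {t} {C} {D} {k} {j} 1≤t 0≤C 0≤k h₁ h₂ h₃ = contradiction (ι-cancel {1} {0} (linear 5 0
    (# 1) (# 0) (v0 :* v0 :+ v1 :+ (v2 :+ v3 :+ v4 :+ # 2) :* v0 :+ v2 :* # 1 :+ v4 :* # 1 :+ # 1)
    (v1 :+ v0 :+ v4 :+ (v2 :+ v3 :* v0) :+ v0 :* v0 :+ v2 :* v0 :+ v4 :* v0 :+ v0)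
    (h₁ ⊞ h₂ ⊞ ⊗-monoʳ (⊑-trans (0≤ι 1) 1≤t) h₃ ⊞ ⊗-monoˡ 0≤C 1≤t ⊞ ⊗-monoˡ 0≤k 1≤t ⊞ 1≤t))) (λ ())

-- N depends on t, so all constants are fixed before there is a logarithm system; `Kᶜ` and `D₀`
-- repeat `K₁` and the denominator of `δ`.
module Constants (p A B G : ℕ) {{nz : NonZero A}} where
  open Residues A using (φ)

  Kᶜ Cᴬ Cᴮ : R
  Kᶜ = ι 2 ⊗ (ι 824 ⊗ (ι A ⊗ ι A ⊗ (ι A ⊗ ι A))) ⊕ ι 4
  Cᴬ = ι (4 * suc (8 * A + 6)) ⊗ (Kᶜ ⊗ (ι 232 ⊕ ι 4 ⊗ ι p))
  Cᴮ = ι (8 * p * suc (8 * A + 6)) ⊗ (Kᶜ ⊗ (ι 70 ⊕ ι 8 ⊗ ι p) ⊕ ι 8 ⊗ (ι φ ⊗ (Cᴬ ⊗ ι p)))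

  D₀ : ℕ
  D₀ = 2 * suc (2 * A)

  Cᶜ Cᴰ : R
  Cᶜ = ι D₀ ⊗ (ι φ ⊗ (ι 26 ⊗ (ι A ⊗ ι A ⊗ (ι A ⊗ ι A)) ⊕ ι 43))
  Cᴰ = ι D₀ ⊗ (ι φ ⊗ (ι φ ⊗ Cᴮ))

  k₀ t : ℕ
  -- The first summand makes the error per scale at most half of the deficit; the second puts p^k₀
  -- beyond B and G.
  k₀ = suc (proj₁ (archimedean (ι 2 ⊗ (ι D₀ ⊗ (ι φ ⊗ (Kᶜ ⊗ ι p))))) + (4 * suc (8 * A + 6) * (2 * B + 3) + G))
  t = proj₁ (archimedean (Cᶜ ⊕ Cᴰ ⊕ ι k₀ ⊕ ι 2)) + (k₀ + 4)

  k₀-large : ι 2 ⊗ (ι D₀ ⊗ (ι φ ⊗ (Kᶜ ⊗ ι p))) ⊑ ι k₀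
  k₀-large = ⊑-trans (proj₂ (archimedean (ι 2 ⊗ (ι D₀ ⊗ (ι φ ⊗ (Kᶜ ⊗ ι p)))))) (ι-mono (ℕ.m≤n⇒m≤1+n (ℕ.m≤m+n (proj₁ (archimedean (ι 2 ⊗ (ι D₀ ⊗ (ι φ ⊗ (Kᶜ ⊗ ι p)))))) (4 * suc (8 * A + 6) * (2 * B + 3) + G))))

  k₀-big : 4 * suc (8 * A + 6) * (2 * B + 3) + G ≤ k₀
  k₀-big = ℕ.m≤n⇒m≤1+n (ℕ.m≤n+m (4 * suc (8 * A + 6) * (2 * B + 3) + G) (proj₁ (archimedean (ι 2 ⊗ (ι D₀ ⊗ (ι φ ⊗ (Kᶜ ⊗ ι p)))))))

  t-large : Cᶜ ⊕ Cᴰ ⊕ ι k₀ ⊕ ι 2 ⊑ ι t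
  t-large = ⊑-trans (proj₂ (archimedean (Cᶜ ⊕ Cᴰ ⊕ ι k₀ ⊕ ι 2))) (ι-mono (ℕ.m≤m+n _ _))

  k₀≤t : k₀ + 4 ≤ t
  k₀≤t = ℕ.m≤n+m (k₀ + 4) _

-- Which t is used matters only through these consequences; keeping it a variable keeps terms small.
module Clash {p A b B G : ℕ} {{nz : NonZero A}} (t k₀ : ℕ) (W : Window p A b B G (2 * (t * t)))
  (k₀-large : ι 2 ⊗ (ι (Constants.D₀ p A B G) ⊗ (ι (Residues.φ A) ⊗ (Constants.Kᶜ p A B G ⊗ ι p))) ⊑ ι k₀)
  (k₀-big : 4 * suc (8 * A + 6) * (2 * B + 3) + G ≤ k₀) (1≤k₀ : 1 ≤ k₀)
  (t-large : Constants.Cᶜ p A B G ⊕ Constants.Cᴰ p A B G ⊕ ι k₀ ⊕ ι 2 ⊑ ι t) (k₀≤t : k₀ + 4 ≤ t)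
  (d* d′ : ℕ) (cd : Coprime d* A) (1≤d* : 1 ≤ d*) (2d* : 2 * d* < A) (1≤d′ : 1 ≤ d′) (d′<A : d′ < A) (big′ : suc (2 * A) ≤ p * d′)
  (dd : Residues._≈_ A (d* * d′) (b * b)) where
  open Constants p A B G using (Kᶜ; Cᴬ; Cᴮ; D₀; Cᶜ; Cᴰ)

  -- The J i in use have T² < i ≤ T² + n. Starting at t² leaves about t² scales below each of them
  -- for step (iii); stopping t + 2 short of 2 t² makes room for the cutoff p^t in step (i).
  T² Nᶜ n : ℕ
  T² = t * t
  Nᶜ = p ^ suc (2 * T²)
  n = T² ∸ (t + 2)

  private module W′ = Window W

  1≤p′ : 1 ≤ p
  1≤p′ = ℕ.≤-trans (s≤s z≤n) W′.5≤p

  ls : LogSystem Nᶜ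
  ls = logSystem Nᶜ (^-pos (suc (2 * T²)) 1≤p′)

  open TotalMass W ls

  4≤t : 4 ≤ t
  4≤t = ℕ.≤-trans (ℕ.m≤n+m 4 k₀) k₀≤t

  n-facts : n + (t + 2) ≡ T² × T² ≤ 2 * n
  n-facts = eq , s₂ t n 4≤t eq
    where
    s₁ : ∀ t → 4 ≤ t → t + 2 ≤ t * t
    s₁ t h = ι-cancel (linear 0 1 {ν = t , _}
        (nat (n# 0 ∔ lit 2)) (nat (n# 0 ∗ n# 0)) (# 4 :* n0 :+ # 3 :* # 4 :+ # 0) (n0 :* n0 :+ # 3 :* n0 :+ # 10)
        (⊗-monoʳ (0≤ι t) (ι-mono h) ⊞ 3 ⊙ ι-mono h ⊞ 0≤ι 10))
    eq : n + (t + 2) ≡ T²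
    eq = ℕ.m∸n+n≡m (s₁ t 4≤t)
    s₂ : ∀ t n → 4 ≤ t → n + (t + 2) ≡ t * t → t * t ≤ 2 * n
    s₂ t n h e = ι-cancel (linear 0 2 {ν = t , n , _}
        (nat (n# 0 ∗ n# 0)) (nat (lit 2 ∗ n# 1)) (# 2 :* nat (n# 0 ∗ n# 0) :+ # 4 :* n0 :+ # 2 :* # 4 :+ # 0)
        (# 2 :* nat (n# 1 ∔ (n# 0 ∔ lit 2)) :+ n0 :* n0 :+ # 2 :* n0 :+ # 4)
        (2 ⊙ ι-mono (ℕ.≤-reflexive (sym e)) ⊞ ⊗-monoʳ (0≤ι t) (ι-mono h) ⊞ 2 ⊙ ι-mono h ⊞ 0≤ι 4))

  p^-big : ∀ k → k₀ ≤ k → 4 * suc M₀ * (2 * B + 3) + G ≤ p ^ k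
  p^-big k h = ℕ.≤-trans k₀-big (ℕ.≤-trans h (ℕ.≤-trans (ℕ.<⇒≤ (n<2^n k)) (ℕ.^-monoˡ-≤ k (ℕ.≤-trans (s≤s (s≤s z≤n)) 5≤p))))

  t-big : 4 * suc M₀ * (2 * B + 3) + G ≤ p ^ t
  t-big = p^-big t (ℕ.≤-trans (ℕ.m≤m+n k₀ 4) k₀≤t)

  ℓ : R
  ℓ = L p

  p≤N : p ≤ Nᶜ
  p≤N = ℕ.m≤m*n p (p ^ (2 * T²)) {{ℕ.>-nonZero (^-pos (2 * T²) 1≤p′)}}

  L-^ : ∀ k → L (p ^ k) ≡ ι k ⊗ ℓ
  L-^ zero    = trans L-1 (sym (⊗-zeroˡ ℓ))
  L-^ (suc k) = trans (L-* p (p ^ k) 1≤p (pᵖ k)) (trans (cong (ℓ ⊕_) (L-^ k)) (e ℓ k))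
    where
    e : ∀ l k → l ⊕ ι k ⊗ l ≡ ι (suc k) ⊗ l
    e l k = ring 1 1 (v0 :+ n0 :* v0) (nat (lit 1 ∔ n# 0) :* v0)

  ^≤N : ∀ {k} → k ≤ suc (2 * T²) → p ^ k ≤ Nᶜ
  ^≤N h = ℕ.^-monoʳ-≤ p {{ℕ.>-nonZero 1≤p}} h

  -- L(2) ≥ 1/2 - 1/4 by `L-step` at 1.
  ℓ-lower : ι 1 ⊑ ι 4 ⊗ ℓ
  ℓ-lower = ⊑-trans (fin (proj₁ (L-step 1 (s≤s z≤n) 2≤N)) L-1 (inv-inverse 2 (s≤s z≤n))) (4 ⊙ L-mono (s≤s z≤n) 2≤p p≤N)
    where
    2≤p : 2 ≤ p
    2≤p = ℕ.≤-trans (s≤s (s≤s z≤n)) 5≤p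
    2≤N = ℕ.≤-trans 2≤p p≤N
    fin : ∀ {l₁ l₂ i} → l₁ ⊕ i ⊑ l₂ ⊕ i ⊗ i → l₁ ≡ ι 0 → ι 2 ⊗ i ≡ ι 1 → ι 1 ⊑ ι 4 ⊗ l₂
    fin {l₁} {l₂} {i} h refl e = linear 2 0
        (# 1) (# 4 :* v0) (# 4 :* (# 0 :+ v1) :+ # 1 :+ # 2 :* (v1 :* (# 2 :* v1)))
        (# 4 :* (v0 :+ v1 :* v1) :+ # 2 :* v1 :+ # 2 :* (v1 :* # 1))
        (4 ⊙ h ⊞ ≡⇒⊒ e ⊞ 2 ⊙ ≡⇒⊑ (cong (i ⊗_) e))

  ℓ-upper : ℓ ⊑ ι 2 ⊗ ι p
  ℓ-upper = L-linear p 1≤p p≤N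

  λ₁ : R
  λ₁ = L (p ^ t)

  1≤ιt : ι 1 ⊑ ι t
  1≤ιt = ι-mono (ℕ.≤-trans (s≤s z≤n) 4≤t)

  0≤ℓ : ι 0 ⊑ ℓ
  0≤ℓ = L-nonneg 1≤p p≤N

  ℓ≤λ : ℓ ⊑ λ₁
  ℓ≤λ = ⊑-trans (≡⇒⊒ (⊗-identityˡ ℓ)) (⊑-trans (⊗-monoʳ 0≤ℓ 1≤ιt) (≡⇒⊒ (L-^ t)))

  pos : ι 1 ⊑ ι 4 ⊗ λ₁
  pos = ⊑-trans ℓ-lower (4 ⊙ ℓ≤λ)

  φ≤K₁ : ι φ ⊑ K₁
  φ≤K₁ = fin φ≤Δ Δ≤DD (⊗-nonneg 0≤Δ 0≤Δ)
    where
    fin : ∀ {f d q} → f ⊑ d → d ⊑ q → ι 0 ⊑ q → f ⊑ ι 2 ⊗ (ι 824 ⊗ q) ⊕ ι 4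
    fin {f} {d} {q} a c e = linear 3 0 v0 (# 2 :* (# 824 :* v1) :+ # 4) (v0 :+ v2 :+ # 1647 :* # 0) (v2 :+ v1 :+ # 1647 :* v1) (a ⊞ c ⊞ 1647 ⊙ e)

  module Est = Estimates λ₁ ℓ K₁ (ι φ) (ι p) (ι t) (⊑-trans 0≤ℓ ℓ≤λ) 0≤K₁ (0≤ι φ) (0≤ι p) 1≤ιt (L-^ t) pos ℓ≤λ ℓ-upper φ≤K₁

  t≤2T : t ≤ 2 * T²
  t≤2T = ℕ.≤-trans (ℕ.m≤m*n t t {{ℕ.>-nonZero (ℕ.≤-trans (s≤s z≤n) 4≤t)}}) (ℕ.m≤n*m T² 2)

  index : T² + n + suc (suc t) ≤ 2 * T²
  index = s₁ T² n t (proj₁ n-facts)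
    where
    s₁ : ∀ T n t → n + (t + 2) ≡ T → T + n + suc (suc t) ≤ 2 * T
    s₁ T n t e = ι-cancel (linear 0 3 {ν = T , n , t , _}
        (nat (n# 0 ∔ n# 1 ∔ (lit 1 ∔ (lit 1 ∔ n# 2)))) (nat (lit 2 ∗ n# 0)) (nat (n# 1 ∔ (n# 2 ∔ lit 2))) n0
        (ι-mono (ℕ.≤-reflexive e)))

  1≤T : 1 ≤ T²
  1≤T = *-pos (ℕ.≤-trans (s≤s z≤n) 4≤t) (ℕ.≤-trans (s≤s z≤n) 4≤t)

  module O = FirstBound W ls (2 * T²) t T² n t≤2T index ℕ.≤-refl 1≤T ℕ.≤-refl
  module Oc = O.Conclude t-big

  S₁-final : Oc.S₁ ⊑ Cᴬ ⊗ ι t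
  S₁-final = ⊑-trans (unscale (4 * suc M₀) (s≤s z≤n) nonneg (Est.first Oc.S₁-bound Lx Lz)) (≡⇒⊑ (sym (⊗-assoc _ _ _)))
    where
    nonneg : ι 0 ⊑ Oc.S₁
    nonneg = sum-nonneg Oc.Z₁ (λ k _ _ → ⊗-nonneg (Λ-nonneg k) (⊗-nonneg (inv-nonneg k) (⊗-nonneg (class-nonneg 1 1 k) (sum-nonneg n (λ i _ _ → χ-nonneg (O.inJ? (T² + i) k))))))
    up : L Oc.x₁ ⊑ ι (suc (2 * T²)) ⊗ ℓ
    up = ⊑-trans (L-mono Oc.1≤x₁ (ℕ.*-monoˡ-≤ (p ^ (2 * T²)) 5≤p) ℕ.≤-refl) (≡⇒⊑ (L-^ (suc (2 * T²))))
    Lx : L Oc.x₁ ⊑ ι 2 ⊗ (ι t ⊗ λ₁) ⊕ ℓ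
    Lx = ⊑-trans up (fin t ℓ (L-^ t))
      where
      fin : ∀ t l {m} → m ≡ ι t ⊗ l → ι (suc (2 * (t * t))) ⊗ l ⊑ ι 2 ⊗ (ι t ⊗ m) ⊕ l
      fin t l refl = ≡⇒⊑ (ring 1 1 (nat (lit 1 ∔ lit 2 ∗ (n# 0 ∗ n# 0)) :* v0) (# 2 :* (n0 :* (n0 :* v0)) :+ v0))
    Lz : L Oc.x₁ ⊖ L Oc.Z₁ ⊑ (ι t ⊕ ι 1) ⊗ ℓ
    Lz = fin (2 * T² ∸ t) t (2 * T²) ℓ (ℕ.m∸n+n≡m t≤2T) up (L-^ (2 * T² ∸ t))
      where
      fin : ∀ a t c l {x z} → a + t ≡ c → x ⊑ ι (suc c) ⊗ l → z ≡ ι a ⊗ l → x ⊖ z ⊑ (ι t ⊕ ι 1) ⊗ l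
      fin a t c l refl h refl = linear 2 2 {ν = a , _ , _} (v0 :- n0 :* v1) ((n1 :+ # 1) :* v1) v0 (nat (lit 1 ∔ (n# 0 ∔ n# 1)) :* v1) (h)

  module Pick (i : ℕ) (1≤i : 1 ≤ i) (i≤n : i ≤ n) (dense : ι n ⊗ Oc.density (T² + i) ⊑ Oc.S₁) where

    κ : ℕ
    κ = T² + i

    dens : R
    dens = Oc.density κ

    0≤dens : ι 0 ⊑ dens
    0≤dens = ⊗-nonneg (inv-nonneg (O.hi κ)) (⊑⇒⊖ (ψᶜ-mono 1 1 (Oc.lo≤hi κ)))

    0≤Cᴬ : ι 0 ⊑ Cᴬ
    0≤Cᴬ = ⊗-nonneg (0≤ι (4 * suc (8 * A + 6))) (⊗-nonneg 0≤K₁ (⊕-nonneg (0≤ι 232) (⊗-nonneg (0≤ι 4) (0≤ι p))))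

    -- Combines n dens ≤ S₁ ≤ Cᴬ t with t² ≤ 2 n.
    t-dens : ι t ⊗ dens ⊑ ι 2 ⊗ Cᴬ
    t-dens = ⊗-cancelˡ t (ℕ.≤-trans (s≤s z≤n) 4≤t) (fin (⊑-trans dense S₁-final) (⊗-monoʳ 0≤dens (ι-mono (proj₂ n-facts))))
      where
      fin : ∀ {n t d c} → ι n ⊗ d ⊑ c ⊗ ι t → ι (t * t) ⊗ d ⊑ ι (2 * n) ⊗ d → ι t ⊗ (ι t ⊗ d) ⊑ ι t ⊗ (ι 2 ⊗ c)
      fin {n} {t} {d} {c} h k = linear 2 2
          (n0 :* (n0 :* v0)) (n0 :* (# 2 :* v1)) (# 2 :* (n1 :* v0) :+ nat (n# 0 ∗ n# 0) :* v0)
          (# 2 :* (v1 :* n0) :+ nat (lit 2 ∗ n# 1) :* v0)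
          (2 ⊙ h ⊞ k)

    κ-upper : κ + (t + 2) ≤ 2 * T²
    κ-upper = s₁ T² i n t i≤n (proj₁ n-facts)
      where
      s₁ : ∀ T i n t → i ≤ n → n + (t + 2) ≡ T → T + i + (t + 2) ≤ 2 * T
      s₁ T i n t h e = ι-cancel (linear 0 4 {ν = T , _ , t , n , _}
          (nat (n# 0 ∔ n# 1 ∔ (n# 2 ∔ lit 2))) (nat (lit 2 ∗ n# 0)) (n1 :+ nat (n# 3 ∔ (n# 2 ∔ lit 2))) (n3 :+ n0)
          (ι-mono h ⊞ ι-mono (ℕ.≤-reflexive e)))

    ssκ≤ : suc (suc κ) ≤ 2 * T²
    ssκ≤ = ℕ.≤-trans (ℕ.≤-reflexive (ℕ.+-comm 2 κ)) (ℕ.≤-trans (ℕ.+-monoʳ-≤ κ (ℕ.m≤n+m 2 t)) κ-upper)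

    t+k₀≤T : suc t + k₀ ≤ T²
    t+k₀≤T = s₁ t k₀ 4≤t k₀≤t
      where
      s₁ : ∀ t k → 4 ≤ t → k + 4 ≤ t → suc t + k ≤ t * t
      s₁ t k h h′ = ι-cancel (linear 0 2 {ν = t , k , _}
          (nat (lit 1 ∔ n# 0 ∔ n# 1)) (nat (n# 0 ∗ n# 0)) (# 4 :* n0 :+ nat (n# 1 ∔ lit 4) :+ # 2 :* # 4 :+ # 0)
          (n0 :* n0 :+ n0 :+ # 2 :* n0 :+ # 11)
          (⊗-monoʳ (0≤ι t) (ι-mono h) ⊞ ι-mono h′ ⊞ 2 ⊙ ι-mono h ⊞ 0≤ι 11))

    st≤κ : suc t ≤ κ
    st≤κ = ℕ.≤-trans (ℕ.≤-trans (ℕ.m≤m+n (suc t) k₀) t+k₀≤T) (ℕ.m≤m+n T² i)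

    module Tw = SecondGap W ls κ t st≤κ (ℕ.≤-trans (ℕ.n≤1+n (suc κ)) ssκ≤) (^≤N (ℕ.m≤n⇒m≤1+n ssκ≤))
    module Tm = Tw.Main t-big

    Smax : R
    Smax = Cᴮ ⊗ ι t

    S₂-final : ∀ d → 1 ≤ d → d < A → suc A ≤ 2 * d → Coprime d A → Tm.S₂ᵈ d ⊑ Smax
    S₂-final d 1≤d d<A 2d c = ⊑-trans (unscale Tm.c₂ 1≤c nonneg (Est.second 0≤dens 0≤Cᴬ (Tm.S₂ᵈ-bound d 1≤d d<A 2d c) Lx Lz t-dens)) (≡⇒⊑ (sym (⊗-assoc _ _ _)))
      where
      1≤c : 1 ≤ Tm.c₂
      1≤c = *-pos {8 * p} {suc M₀} (*-pos {8} {p} (s≤s z≤n) 1≤p) (s≤s z≤n)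
      nonneg : ι 0 ⊑ Tm.S₂ᵈ d
      nonneg = sum-nonneg Tm.Z₂ (λ k _ _ → ⊗-nonneg (Λ-nonneg k) (⊗-nonneg (inv-nonneg k) (class-nonneg b d k)))
      up : L Tm.x₂ ⊑ ι (suc (suc κ)) ⊗ ℓ
      up = ⊑-trans (L-mono (ℕ.≤-trans Tm.1≤y Tm.y≤x) (ℕ.≤-trans Tm.x≤2pP (ℕ.*-monoˡ-≤ (p * p ^ κ) (ℕ.≤-trans (s≤s (s≤s z≤n)) 5≤p))) (^≤N (ℕ.m≤n⇒m≤1+n ssκ≤))) (≡⇒⊑ (L-^ (suc (suc κ))))
      Lx : L Tm.x₂ ⊑ ι 2 ⊗ (ι t ⊗ λ₁)
      Lx = ⊑-trans up (fin (suc (suc κ)) t ℓ (L-^ t) 0≤ℓ ssκ≤)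
        where
        fin : ∀ k t l {m} → m ≡ ι t ⊗ l → ι 0 ⊑ l → k ≤ 2 * (t * t) → ι k ⊗ l ⊑ ι 2 ⊗ (ι t ⊗ m)
        fin k t l refl h h′ = linear 1 2
            (n0 :* v0) (# 2 :* (n1 :* (n1 :* v0))) (n0 :* v0 :+ # 0 :* # 0)
            (nat (lit 2 ∗ (n# 1 ∗ n# 1)) :* v0 :+ # 0 :* n1)
            (⊗-monoʳ h (ι-mono h′) ⊞ at# t)
      Lz : L Tm.x₂ ⊖ L Tm.Z₂ ⊑ (ι t ⊕ ι 3) ⊗ ℓ
      Lz = fin (κ ∸ suc t) t κ ℓ (ℕ.m∸n+n≡m st≤κ) up (L-^ (κ ∸ suc t))
        where
        fin : ∀ a t c l {x z} → a + suc t ≡ c → x ⊑ ι (suc (suc c)) ⊗ l → z ≡ ι a ⊗ l → x ⊖ z ⊑ (ι t ⊕ ι 3) ⊗ l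
        fin a t c l refl h refl = linear 2 2 {ν = a , _ , _}
            (v0 :- n0 :* v1) ((n1 :+ # 3) :* v1) v0 (nat (lit 1 ∔ (lit 1 ∔ (n# 0 ∔ (lit 1 ∔ n# 1)))) :* v1)
            (h)

    -- Counts the scales from p^k₀ up to p^(κ - t - 1), the cutoff of step (ii).
    j : ℕ
    j = κ ∸ suc t ∸ k₀

    j≡ : j + k₀ ≡ κ ∸ suc t
    j≡ = ℕ.m∸n+n≡m (ℕ.m+n≤o⇒m≤o∸n k₀ (ℕ.≤-trans (ℕ.≤-reflexive (ℕ.+-comm k₀ (suc t))) (ℕ.≤-trans t+k₀≤T (ℕ.m≤m+n T² i))))

    j+k₀≤ : j + k₀ ≤ 2 * T²
    j+k₀≤ = ℕ.≤-trans (ℕ.≤-reflexive j≡) (ℕ.≤-trans (ℕ.m∸n≤m κ (suc t)) (ℕ.≤-trans (ℕ.≤-trans (ℕ.n≤1+n κ) (ℕ.n≤1+n (suc κ))) ssκ≤))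

    small : ∀ d → 1 ≤ d → d < A → suc A ≤ 2 * d → Coprime d A → sᵈ d (p ^ (j + k₀)) ⊑ Smax
    small d 1≤d d<A 2d c = ⊑-trans (≡⇒⊑ (trans (cong (λ e → sᵈ d (p ^ e)) j≡) (sum-ext (p ^ (κ ∸ suc t)) (λ m → r (class b d m) (Λ m) (inv m))))) (S₂-final d 1≤d d<A 2d c)
      where
      r : ∀ c l i → c ⊗ (l ⊗ i) ≡ l ⊗ (i ⊗ c)
      r c l i = ring 3 0 (v0 :* (v1 :* v2)) (v1 :* (v2 :* v0))

    0≤Cᴮ : ι 0 ⊑ Cᴮ
    0≤Cᴮ = ⊗-nonneg (0≤ι (8 * p * suc (8 * A + 6))) (⊕-nonneg (⊗-nonneg 0≤K₁ (⊕-nonneg (0≤ι 70) (⊗-nonneg (0≤ι 8) (0≤ι p)))) (⊗-nonneg (0≤ι 8) (⊗-nonneg (0≤ι φ) (⊗-nonneg 0≤Cᴬ (0≤ι p)))))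

    module Tt = Total k₀ j 1≤k₀ (p^-big k₀ ℕ.≤-refl) (ℕ.m≤n⇒m≤1+n j+k₀≤) (^≤N (ℕ.m≤n⇒m≤1+n j+k₀≤)) d* d′ cd 1≤d* 2d* 1≤d′ d′<A big′ dd Smax (⊗-nonneg 0≤Cᴮ (0≤ι t)) small

    λ₀ : R
    λ₀ = L (p ^ k₀)

    hλ : ι φ ⊗ (K₁ ⊗ ι p) ⊑ ι 2 ⊗ (λ₀ ⊗ δ)
    hλ = ⊗-cancelˡ (2 * D₀) (s≤s z≤n) (fin {D₀} {ι φ ⊗ (K₁ ⊗ ι p)} {k₀} {ℓ} {λ₀} {δ} k₀-large (L-^ k₀) (inv-inverse D₀ (s≤s z≤n)) (⊗-monoˡ (0≤ι k₀) ℓ-lower))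
      where
      fin : ∀ {D X k l m d} → ι 2 ⊗ (ι D ⊗ X) ⊑ ι k → m ≡ ι k ⊗ l → ι D ⊗ d ≡ ι 1 → ι k ⊗ ι 1 ⊑ ι k ⊗ (ι 4 ⊗ l) → ι (2 * D) ⊗ X ⊑ ι (2 * D) ⊗ (ι 2 ⊗ (m ⊗ d))
      fin {D} {X} {k} {l} {m} {d} h refl e h′ = linear 3 2 {ν = D , _ , _}
          (nat (lit 2 ∗ n# 0) :* v0) (nat (lit 2 ∗ n# 0) :* (# 2 :* (n1 :* v1 :* v2)))
          (# 2 :* (n0 :* v0) :+ n1 :* # 1 :+ # 4 :* (# 1 :* (n1 :* v1)))
          (n1 :+ n1 :* (# 4 :* v1) :+ # 4 :* (n0 :* v2 :* (n1 :* v1)))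
          (h ⊞ h′ ⊞ 4 ⊙ ≡⇒⊒ (cong (λ z → z ⊗ (ι k ⊗ l)) e))

    pos₀ : ι 1 ⊑ ι 4 ⊗ λ₀
    pos₀ = ⊑-trans ℓ-lower (4 ⊙ ⊑-trans (≡⇒⊒ (⊗-identityˡ ℓ)) (⊑-trans (⊗-monoʳ 0≤ℓ (ι-mono 1≤k₀)) (≡⇒⊒ (L-^ k₀))))

    j-bound : ι j ⊑ Cᶜ ⊕ Cᴰ ⊗ ι t
    j-bound = fin {D₀} {ι j} {δ} {ι φ} {Δ ⊗ Δ} {Cᴮ} {ι t} (Tt.conclusion hλ pos₀) (inv-inverse D₀ (s≤s z≤n))
      where
      fin : ∀ {D j d f q C t} → j ⊗ d ⊑ f ⊗ (ι 26 ⊗ q ⊕ ι 43) ⊕ f ⊗ (f ⊗ (C ⊗ t)) → ι D ⊗ d ≡ ι 1 → j ⊑ ι D ⊗ (f ⊗ (ι 26 ⊗ q ⊕ ι 43)) ⊕ ι D ⊗ (f ⊗ (f ⊗ C)) ⊗ t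
      fin {D} {j} {d} {f} {q} {C} {t} h e = linear 6 1
          v0 (n0 :* (v1 :* (# 26 :* v2 :+ # 43)) :+ n0 :* (v1 :* (v1 :* v3)) :* v4) (n0 :* (v0 :* v5) :+ # 1 :* v0)
          (n0 :* (v1 :* (# 26 :* v2 :+ # 43) :+ v1 :* (v1 :* (v3 :* v4))) :+ n0 :* v5 :* v0)
          (⊗-monoˡ (0≤ι D) h ⊞ ≡⇒⊒ (cong (_⊗ j) e))

    T≤ : ι t ⊗ ι t ⊑ ι j ⊕ ι t ⊕ ι k₀
    T≤ = s₁ t j k₀ i (κ ∸ suc t) 1≤i j≡ (ℕ.m∸n+n≡m st≤κ)
      where
      s₁ : ∀ t j k i a → 1 ≤ i → j + k ≡ a → a + suc t ≡ t * t + i → ι t ⊗ ι t ⊑ ι j ⊕ ι t ⊕ ι k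
      s₁ t j k i _ h refl e = linear 0 4
          (n0 :* n0) (n1 :+ n0 :+ n2) (nat (n# 0 ∗ n# 0 ∔ n# 3) :+ # 1) (nat (n# 1 ∔ n# 2 ∔ (lit 1 ∔ n# 0)) :+ n3)
          (ι-mono (ℕ.≤-reflexive (sym e)) ⊞ ι-mono h)

    0≤Cᶜ : ι 0 ⊑ Cᶜ
    0≤Cᶜ = ⊗-nonneg (0≤ι D₀) (⊗-nonneg (0≤ι φ) (⊕-nonneg (⊗-nonneg (0≤ι 26) (⊗-nonneg 0≤Δ 0≤Δ)) (0≤ι 43)))

    impossible : ⊥
    impossible = square-beats {ι t} {Cᶜ} {Cᴰ} {ι k₀} {ι j} 1≤ιt 0≤Cᶜ (0≤ι k₀) T≤ j-bound t-large

  clash : ⊥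
  clash = go n refl
    where
    go : ∀ m → n ≡ m → ⊥
    go zero e = contradiction (subst (T² ≤_) (cong (2 *_) e) (proj₂ n-facts)) (ℕ.<⇒≱ 1≤T)
    go (suc n₀) e with Oc.found n₀ e
    ... | i , 1≤i , i≤n , h = Pick.impossible i 1≤i i≤n h

-- The bound on the scales depends on the parameters alone, which makes the final search finite.
window-impossible : ∀ p A b B G {{nz : NonZero A}} (d* d′ : ℕ) → Coprime d* A → 1 ≤ d* → 2 * d* < A → 1 ≤ d′ → d′ < A → suc (2 * A) ≤ p * d′ →
  Residues._≈_ A (d* * d′) (b * b) → Σ ℕ λ Kmax → ¬ Window p A b B G Kmax
window-impossible p A b B G d* d′ cd 1≤d* 2d* 1≤d′ d′<A big′ dd = 2 * (t * t) , λ W →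
  Clash.clash t k₀ W k₀-large k₀-big (s≤s z≤n) t-large k₀≤t d* d′ cd 1≤d* 2d* 1≤d′ d′<A big′ dd
  where open Constants p A B G

-- Two classes with product b²

-- The class `d*`/b lies below A/2 and equals b/`d′`, which by `large` has a gap at every scale.
record Pair (p A b : ℕ) {{nz : NonZero A}} : Set where
  field
    d* d′ : ℕ
    unit* : Coprime d* A
    1≤d* : 1 ≤ d*
    2d*<A : 2 * d* < A
    1≤d′ : 1 ≤ d′
    d′<A : d′ < A
    large : suc (2 * A) ≤ p * d′
    square : Residues._≈_ A (d* * d′) (b * b)

-- If d₀ lies strictly between 2A/p and A/2, one of d₀ and b²/d₀ is below A/2 and the other above 2A/p.
fromSeed : ∀ p A b {{nz : NonZero A}} → 5 ≤ p → 5 ≤ A → Coprime b A → ∀ d₀ → Coprime d₀ A → 1 ≤ d₀ → 2 * d₀ < A → suc (2 * A) ≤ p * d₀ → Pair p A b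
fromSeed p A b 5≤p 5≤A cb d₀ c₀ 1≤d₀ 2d₀ big with Residues.solve A d₀ (b * b) c₀
... | i , 1≤i , i≤A , e = choose (2 * i ℕ.<? A)
  where
  open Residues A
  ci : Coprime i A
  ci = coprime-*ʳ {d₀} {i} (≈-coprime {b * b} {d₀ * i} (sym e) (coprime-* cb cb))
  i<A : i < A
  i<A = ℕ.≤∧≢⇒< i≤A (λ { refl → contradiction (subst (5 ≤_) (ci (∣-refl , ∣-refl)) 5≤A) (λ { (s≤s ()) }) })
  d₀<A : d₀ < A
  d₀<A = ℕ.≤-<-trans (ℕ.m≤n*m d₀ 2) 2d₀
  choose : Dec (2 * i < A) → Pair p A b
  choose (yes 2i) = record { d* = i ; d′ = d₀ ; unit* = ci ; 1≤d* = 1≤i ; 2d*<A = 2i ; 1≤d′ = 1≤d₀ ; d′<A = d₀<A ; large = big ; square = trans (cong (_% A) (ℕ.*-comm i d₀)) e }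
  choose (no 2i≮) = record { d* = d₀ ; d′ = i ; unit* = c₀ ; 1≤d* = 1≤d₀ ; 2d*<A = 2d₀ ; 1≤d′ = 1≤i ; d′<A = i<A ; large = s₁ p A i 5≤p 5≤A 2i> ; square = e }
    where
    2i> : suc A ≤ 2 * i
    2i> = ℕ.≤∧≢⇒< (ℕ.≮⇒≥ 2i≮) (λ A≡ → odd A≡)
      where
      odd : A ≡ 2 * i → ⊥
      odd A≡ with ci (∣-refl {i} , divides 2 A≡)
      ... | refl = contradiction (subst (5 ≤_) A≡ 5≤A) (λ { (s≤s (s≤s ())) })
    s₁ : ∀ p A i → 5 ≤ p → 5 ≤ A → suc A ≤ 2 * i → suc (2 * A) ≤ p * i
    s₁ p A i h₁ h₂ h₃ = ι-cancel (⊗-cancelˡ 2 (s≤s z≤n) (linear 0 3 {ν = A , p , i , _}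
        (# 2 :* nat (lit 1 ∔ lit 2 ∗ n# 0)) (# 2 :* nat (n# 1 ∗ n# 2))
        (# 2 :* (# 5 :* n2) :+ # 5 :* nat (lit 1 ∔ n# 0) :+ # 0 :+ # 0)
        (# 2 :* (n1 :* n2) :+ # 5 :* nat (lit 2 ∗ n# 2) :+ n0 :+ # 3)
        (2 ⊙ ⊗-monoʳ (0≤ι i) (ι-mono h₁) ⊞ 5 ⊙ ι-mono h₃ ⊞ 0≤ι A ⊞ 0≤ι 3)))

-- A common divisor of m and 2 m + c divides c.
coprime-pred : ∀ m c n → n ≡ 2 * m + c → (∀ {i} → i ∣ m → i ∣ c → i ≡ 1) → Coprime m n
coprime-pred m c _ refl h {i} (d , d′) = h d (∣m+n∣m⇒∣n {m = 2 * m} d′ (∣-trans d (n∣m*n 2)))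

-- An odd square is 1 modulo 4, hence prime to 4.
odd∣4 : ∀ {m i} → i ∣ suc (2 * m) → i ∣ 4 → i ≡ 1
odd∣4 {m} {i} d d′ = coprime-lemma (i∣ , d′)
  where
  i∣ : i ∣ suc (2 * m) * suc (2 * m)
  i∣ = ∣-trans d (m∣m*n (suc (2 * m)))
  coprime-lemma : Coprime (suc (2 * m) * suc (2 * m)) 4
  coprime-lemma {j} (a , a′) = ∣1⇒≡1 (∣m+n∣m⇒∣n {m = 4 * (m * suc m)} (subst (j ∣_) (eq m) a) (∣-trans a′ (m∣m*n (m * suc m))))
    where
    eq : ∀ m → suc (2 * m) * suc (2 * m) ≡ 4 * (m * suc m) + 1
    eq = solve-∀

small-prime : ∀ {p} → Prime p → 5 ≤ p → ∀ q → q ≤ 4 → 1 ≤ q → ¬ p ∣ q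
small-prime pp 5≤p (suc q) q≤4 _ d = ℕ.<⇒≱ (ℕ.≤-trans (s≤s q≤4) 5≤p) (∣⇒≤ d)

quarter : ∀ A → Σ ℕ λ m → A ≡ suc (2 * m) ⊎ A ≡ 4 * m ⊎ A ≡ 4 * m + 2
quarter zero = 0 , inj₂ (inj₁ refl)
quarter (suc zero) = 0 , inj₁ refl
quarter (suc (suc A)) with quarter A
... | m , inj₁ e = suc m , inj₁ (cong (λ t → suc (suc t)) (trans e (eq m)))
  where
  eq : ∀ m → suc (2 * m) ≡ m + suc (m + 0)
  eq = solve-∀
... | m , inj₂ (inj₁ e) = m , inj₂ (inj₂ (trans (cong (λ t → suc (suc t)) e) (ℕ.+-comm 2 (4 * m))))
... | m , inj₂ (inj₂ e) = suc m , inj₂ (inj₁ (trans (cong (λ t → suc (suc t)) e) (eq m)))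
  where
  eq : ∀ m → suc (suc (4 * m + 2)) ≡ 4 * suc m
  eq = solve-∀

¬coprime : ∀ {a n} d → 2 ≤ d → d ∣ a → d ∣ n → ¬ Coprime a n
¬coprime d 2≤d x y c = contradiction (subst (2 ≤_) (c (x , y)) 2≤d) (λ { (s≤s ()) })

-- With p = 5 there is no seed: the larger candidate 2 has 2 p < 2A + 1. Instead b² ≡ 1 or -1, and
-- the products 2 · 3 and 1 · 4 cover both.
pair₅ : ∀ p b → 5 ≤ p → b < 5 → Coprime b 5 → Pair p 5 b
pair₅ p b 5≤p b<5 cb = go b b<5 cb
  where
  c₁ : Coprime 1 5
  c₁ (d , _) = ∣1⇒≡1 d
  c₂ : Coprime 2 5
  c₂ (d , d′) = ∣1⇒≡1 (∣m+n∣m⇒∣n {m = 4} d′ (∣-trans d (divides 2 refl)))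
  one : ∀ b → Residues._≈_ 5 (2 * 3) (b * b) → Pair p 5 b
  one b e = record { d* = 2 ; d′ = 3 ; unit* = c₂ ; 1≤d* = s≤s z≤n ; 2d*<A = ℕ.≤-refl ; 1≤d′ = s≤s z≤n ; d′<A = s≤s (s≤s (s≤s (s≤s z≤n)))
    ; large = ℕ.≤-trans (ℕ.m≤m+n 11 4) (ℕ.*-monoˡ-≤ 3 5≤p) ; square = e }
  four : ∀ b → Residues._≈_ 5 (1 * 4) (b * b) → Pair p 5 b
  four b e = record { d* = 1 ; d′ = 4 ; unit* = c₁ ; 1≤d* = s≤s z≤n ; 2d*<A = s≤s (s≤s (s≤s z≤n)) ; 1≤d′ = s≤s z≤n ; d′<A = ℕ.≤-refl
    ; large = ℕ.≤-trans (ℕ.m≤m+n 11 9) (ℕ.*-monoˡ-≤ 4 5≤p) ; square = e }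
  go : ∀ b → b < 5 → Coprime b 5 → Pair p 5 b
  go 0 _ c = ⊥-elim (¬coprime 5 (s≤s (s≤s z≤n)) (divides 0 refl) ∣-refl c)
  go 1 _ _ = one 1 refl
  go 2 _ _ = four 2 refl
  go 3 _ _ = four 3 refl
  go 4 _ _ = one 4 refl
  go (suc (suc (suc (suc (suc b))))) (s≤s (s≤s (s≤s (s≤s (s≤s ()))))) _

-- With p = 5 there is no seed: the units below 5 are 1 and 3, and 3 p < 2A + 1. Again b² ≡ 1 or -1,
-- covered by 3 · 7 and 1 · 9.
pair₁₀ : ∀ p b → 5 ≤ p → b < 10 → Coprime b 10 → Pair p 10 b
pair₁₀ p b 5≤p b<10 cb = go b b<10 cb
  where
  c₁ : Coprime 1 10
  c₁ (d , _) = ∣1⇒≡1 d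
  c₃ : Coprime 3 10
  c₃ (d , d′) = ∣1⇒≡1 (∣m+n∣m⇒∣n {m = 9} d′ (∣-trans d (divides 3 refl)))
  one : ∀ b → Residues._≈_ 10 (3 * 7) (b * b) → Pair p 10 b
  one b e = record { d* = 3 ; d′ = 7 ; unit* = c₃ ; 1≤d* = s≤s z≤n ; 2d*<A = ℕ.m≤m+n 7 3 ; 1≤d′ = s≤s z≤n ; d′<A = ℕ.m≤m+n 8 2
    ; large = ℕ.≤-trans (ℕ.m≤m+n 21 14) (ℕ.*-monoˡ-≤ 7 5≤p) ; square = e }
  nine : ∀ b → Residues._≈_ 10 (1 * 9) (b * b) → Pair p 10 b
  nine b e = record { d* = 1 ; d′ = 9 ; unit* = c₁ ; 1≤d* = s≤s z≤n ; 2d*<A = ℕ.m≤m+n 3 7 ; 1≤d′ = s≤s z≤n ; d′<A = ℕ.≤-refl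
    ; large = ℕ.≤-trans (ℕ.m≤m+n 21 24) (ℕ.*-monoˡ-≤ 9 5≤p) ; square = e }
  even : ∀ {b} k → b ≡ k * 2 → ¬ Coprime b 10
  even k e = ¬coprime 2 (s≤s (s≤s z≤n)) (divides k e) (divides 5 refl)
  go : ∀ b → b < 10 → Coprime b 10 → Pair p 10 b
  go 0 _ c = ⊥-elim (even 0 refl c)
  go 1 _ _ = one 1 refl
  go 2 _ c = ⊥-elim (even 1 refl c)
  go 3 _ _ = nine 3 refl
  go 4 _ c = ⊥-elim (even 2 refl c)
  go 5 _ c = ⊥-elim (¬coprime 5 (s≤s (s≤s z≤n)) ∣-refl (divides 2 refl) c)
  go 6 _ c = ⊥-elim (even 3 refl c)
  go 7 _ _ = nine 7 refl
  go 8 _ c = ⊥-elim (even 4 refl c)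
  go 9 _ _ = one 9 refl
  go (suc (suc (suc (suc (suc (suc (suc (suc (suc (suc b)))))))))) (s≤s (s≤s (s≤s (s≤s (s≤s (s≤s (s≤s (s≤s (s≤s (s≤s ())))))))))) _

-- The seed is the largest unit below A/2: (A - 1)/2 for A odd, A/2 - 1 for A divisible by 4, A/2 -
-- 2 for A ≡ 2 modulo 4. It exceeds 2A/p except for a few small A, which are treated singly or have
-- no prime divisor p ≥ 5.
pair : ∀ p A b {{nz : NonZero A}} → Prime p → 5 ≤ p → p ∣ A → 5 ≤ A → b < A → Coprime b A → Pair p A b
pair p A b pp 5≤p p∣A 5≤A b<A cb with quarter A
... | suc (suc zero) , inj₁ refl = pair₅ p b 5≤p b<A cb
... | m@(suc (suc (suc m₀))) , inj₁ refl = fromSeed p A b 5≤p 5≤A cb m (coprime-pred m 1 _ (ℕ.+-comm 1 (2 * m)) (λ _ d → ∣1⇒≡1 d)) (s≤s z≤n) ℕ.≤-refl (s₁ p m₀ 5≤p)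
  where
  s₁ : ∀ p m → 5 ≤ p → suc (2 * suc (2 * suc (suc (suc m)))) ≤ p * suc (suc (suc m))
  s₁ p m h = ι-cancel (linear 0 2 {ν = m , p , _}
      (nat (lit 1 ∔ lit 2 ∗ (lit 1 ∔ lit 2 ∗ (lit 1 ∔ (lit 1 ∔ (lit 1 ∔ n# 0))))))
      (nat (n# 1 ∗ (lit 1 ∔ (lit 1 ∔ (lit 1 ∔ n# 0))))) (# 5 :* nat (lit 1 ∔ (lit 1 ∔ (lit 1 ∔ n# 0))) :+ # 0)
      (n1 :* nat (lit 1 ∔ (lit 1 ∔ (lit 1 ∔ n# 0))) :+ n0)
      (⊗-monoʳ (0≤ι (suc (suc (suc m)))) (ι-mono h) ⊞ 0≤ι m))
... | zero , inj₁ refl = contradiction 5≤A (λ { (s≤s ()) })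
... | suc zero , inj₁ refl = contradiction 5≤A (λ { (s≤s (s≤s (s≤s ()))) })
... | zero , inj₂ (inj₁ refl) = contradiction 5≤A (λ ())
... | suc zero , inj₂ (inj₁ refl) = contradiction 5≤A (λ { (s≤s (s≤s (s≤s (s≤s ())))) })
... | suc (suc zero) , inj₂ (inj₁ refl) = ⊥-elim (bad (euclidsLemma 2 4 pp p∣A))
  where
  bad : (p ∣ 2) ⊎ (p ∣ 4) → ⊥
  bad (inj₁ d) = small-prime pp 5≤p 2 (ℕ.m≤m+n 2 2) (s≤s z≤n) d
  bad (inj₂ d) = small-prime pp 5≤p 4 ℕ.≤-refl (s≤s z≤n) d
... | suc (suc (suc m)) , inj₂ (inj₁ refl) = fromSeed p A b 5≤p 5≤A cb (suc (2 * suc (suc m)))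
      (coprime-pred (suc (2 * suc (suc m))) 2 _ (e₁ m) (λ d d′ → odd∣4 {suc (suc m)} d (∣-trans d′ (divides 2 refl)))) (s≤s z≤n) (s₂ m) (s₁ p m 5≤p)
  where
  e₁ : ∀ m → 4 * suc (suc (suc m)) ≡ 2 * suc (2 * suc (suc m)) + 2
  e₁ = solve-∀
  s₂ : ∀ m → 2 * suc (2 * suc (suc m)) < 4 * suc (suc (suc m))
  s₂ m = ι-cancel (linear 0 1 {ν = m , _}
      (nat (lit 1 ∔ lit 2 ∗ (lit 1 ∔ lit 2 ∗ (lit 1 ∔ (lit 1 ∔ n# 0)))))
      (nat (lit 4 ∗ (lit 1 ∔ (lit 1 ∔ (lit 1 ∔ n# 0))))) (# 0) (# 1)
      (0≤ι 1))
  s₁ : ∀ p m → 5 ≤ p → suc (2 * (4 * suc (suc (suc m)))) ≤ p * suc (2 * suc (suc m))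
  s₁ p m h = ι-cancel (linear 0 2 {ν = m , p , _}
      (nat (lit 1 ∔ lit 2 ∗ (lit 4 ∗ (lit 1 ∔ (lit 1 ∔ (lit 1 ∔ n# 0))))))
      (nat (n# 1 ∗ (lit 1 ∔ lit 2 ∗ (lit 1 ∔ (lit 1 ∔ n# 0)))))
      (# 5 :* nat (lit 1 ∔ lit 2 ∗ (lit 1 ∔ (lit 1 ∔ n# 0))) :+ # 2 :* # 0)
      (n1 :* nat (lit 1 ∔ lit 2 ∗ (lit 1 ∔ (lit 1 ∔ n# 0))) :+ # 2 :* n0)
      (⊗-monoʳ (0≤ι (suc (2 * suc (suc m)))) (ι-mono h) ⊞ 2 ⊙ 0≤ι m))
... | zero , inj₂ (inj₂ refl) = contradiction 5≤A (λ { (s≤s (s≤s ())) })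
... | suc zero , inj₂ (inj₂ refl) = ⊥-elim (bad (euclidsLemma 2 3 pp p∣A))
  where
  bad : (p ∣ 2) ⊎ (p ∣ 3) → ⊥
  bad (inj₁ d) = small-prime pp 5≤p 2 (ℕ.m≤m+n 2 2) (s≤s z≤n) d
  bad (inj₂ d) = small-prime pp 5≤p 3 (ℕ.m≤m+n 3 1) (s≤s z≤n) d
... | suc (suc zero) , inj₂ (inj₂ refl) = pair₁₀ p b 5≤p b<A cb
-- A = 14 with seed 5 requires 5 p > 28, so p = 5 has to be excluded.
... | suc (suc (suc zero)) , inj₂ (inj₂ refl) = fromSeed p A b 5≤p 5≤A cb 5 (coprime-pred 5 4 14 refl (λ d d′ → odd∣4 {2} d d′)) (s≤s z≤n) (ℕ.m≤m+n 11 3)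
      (ℕ.≤-trans (ℕ.m≤m+n 29 6) (ℕ.*-monoˡ-≤ 5 7≤p))
  where
  7≤p : 7 ≤ p
  7≤p with euclidsLemma 2 7 pp p∣A
  ... | inj₁ d = ⊥-elim (small-prime pp 5≤p 2 (ℕ.m≤m+n 2 2) (s≤s z≤n) d)
  ... | inj₂ (divides (suc zero) e) = ℕ.≤-reflexive (trans e (ℕ.+-identityʳ p))
  ... | inj₂ (divides (suc (suc q)) e) = contradiction (subst (10 ≤_) (sym e) (ℕ.≤-trans (ℕ.+-mono-≤ 5≤p (ℕ.≤-trans 5≤p (ℕ.m≤m+n p (q * p)))) ℕ.≤-refl)) (ℕ.<⇒≱ (ℕ.m≤m+n 8 2))
... | suc (suc (suc (suc zero))) , inj₂ (inj₂ refl) = ⊥-elim (bad (euclidsLemma 2 9 pp p∣A))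
  where
  bad : (p ∣ 2) ⊎ (p ∣ 9) → ⊥
  bad (inj₁ d) = small-prime pp 5≤p 2 (ℕ.m≤m+n 2 2) (s≤s z≤n) d
  bad (inj₂ d) with euclidsLemma 3 3 pp d
  ... | inj₁ d = small-prime pp 5≤p 3 (ℕ.m≤m+n 3 1) (s≤s z≤n) d
  ... | inj₂ d = small-prime pp 5≤p 3 (ℕ.m≤m+n 3 1) (s≤s z≤n) d
... | suc (suc (suc (suc (suc m)))) , inj₂ (inj₂ refl) = fromSeed p A b 5≤p 5≤A cb (suc (2 * suc (suc (suc (suc m)))))
      (coprime-pred (suc (2 * suc (suc (suc (suc m))))) 4 _ (e₁ m) (odd∣4 {suc (suc (suc (suc m)))})) (s≤s z≤n) (s₂ m) (s₁ p m 5≤p)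
  where
  e₁ : ∀ m → 4 * suc (suc (suc (suc (suc m)))) + 2 ≡ 2 * suc (2 * suc (suc (suc (suc m)))) + 4
  e₁ = solve-∀
  s₂ : ∀ m → 2 * suc (2 * suc (suc (suc (suc m)))) < 4 * suc (suc (suc (suc (suc m)))) + 2
  s₂ m = ι-cancel (linear 0 1 {ν = m , _}
      (nat (lit 1 ∔ lit 2 ∗ (lit 1 ∔ lit 2 ∗ (lit 1 ∔ (lit 1 ∔ (lit 1 ∔ (lit 1 ∔ n# 0)))))))
      (nat (lit 4 ∗ (lit 1 ∔ (lit 1 ∔ (lit 1 ∔ (lit 1 ∔ (lit 1 ∔ n# 0))))) ∔ lit 2)) (# 0) (# 3)
      (0≤ι 3))
  s₁ : ∀ p m → 5 ≤ p → suc (2 * (4 * suc (suc (suc (suc (suc m)))) + 2)) ≤ p * suc (2 * suc (suc (suc (suc m))))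
  s₁ p m h = ι-cancel (linear 0 2 {ν = m , p , _}
      (nat (lit 1 ∔ lit 2 ∗ (lit 4 ∗ (lit 1 ∔ (lit 1 ∔ (lit 1 ∔ (lit 1 ∔ (lit 1 ∔ n# 0))))) ∔ lit 2)))
      (nat (n# 1 ∗ (lit 1 ∔ lit 2 ∗ (lit 1 ∔ (lit 1 ∔ (lit 1 ∔ (lit 1 ∔ n# 0)))))))
      (# 5 :* nat (lit 1 ∔ lit 2 ∗ (lit 1 ∔ (lit 1 ∔ (lit 1 ∔ (lit 1 ∔ n# 0))))) :+ # 2 :* # 0)
      (n1 :* nat (lit 1 ∔ lit 2 ∗ (lit 1 ∔ (lit 1 ∔ (lit 1 ∔ (lit 1 ∔ n# 0))))) :+ # 2 :* n0)
      (⊗-monoʳ (0≤ι (suc (2 * suc (suc (suc (suc m)))))) (ι-mono h) ⊞ 2 ⊙ 0≤ι m))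

-- Discriminators of quadratic sequences

-- The absolute value of α s + β for s ≥ 0; the sign records whether α and β agree in sign, so the
-- rest takes place in ℕ.
form : Sign → ℕ → ℕ → ℕ → ℕ
form Sign.+ a c s = a * s + c
form Sign.- a c s = ∣ a * s - c ∣

form-scale : ∀ σ g a c s → form σ (g * a) (g * c) s ≡ g * form σ a c s
form-scale Sign.+ g a c s = trans (cong (_+ g * c) (ℕ.*-assoc g a s)) (sym (ℕ.*-distribˡ-+ g (a * s) c))
form-scale Sign.- g a c s = trans (cong (λ t → ∣ t - g * c ∣) (ℕ.*-assoc g a s)) (sym (ℕ.*-distribˡ-∣-∣ g (a * s) c))

∣⊖∣ : ∀ m n → ∣ m ℤ.⊖ n ∣ ≡ ℕ.∣ m - n ∣
∣⊖∣ m n with ℕ.≤-total m n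
... | inj₁ m≤n = trans (ℤ.∣⊖∣-≤ m≤n) (sym (ℕ.m≤n⇒∣m-n∣≡n∸m m≤n))
... | inj₂ n≤m = trans (cong ∣_∣ (ℤ.⊖-≥ n≤m)) (sym (ℕ.m≤n⇒∣n-m∣≡n∸m n≤m))

∣linear∣⁺ : ∀ a β → Σ Sign λ σ → ∀ s → ∣ + a ℤ.* + s ℤ.+ β ∣ ≡ form σ a ∣ β ∣ s
∣linear∣⁺ a (+ c) = Sign.+ , λ s → cong (λ t → ∣ t ℤ.+ + c ∣) (sym (ℤ.pos-* a s))
∣linear∣⁺ a -[1+ c ] = Sign.- , λ s → trans (cong (λ t → ∣ t ℤ.+ -[1+ c ] ∣) (sym (ℤ.pos-* a s))) (∣⊖∣ (a * s) (suc c))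

∣linear∣ : ∀ α β → Σ Sign λ σ → ∀ s → ∣ α ℤ.* + s ℤ.+ β ∣ ≡ form σ ∣ α ∣ ∣ β ∣ s
∣linear∣ (+ a) β = ∣linear∣⁺ a β
∣linear∣ -[1+ a ] β with ∣linear∣⁺ (suc a) (ℤ.- β)
... | σ , e = σ , λ s → trans (sym (ℤ.∣-i∣≡∣i∣ (-[1+ a ] ℤ.* + s ℤ.+ β)))
      (trans (cong ∣_∣ (lem (+ suc a) (+ s) β)) (trans (e s) (cong (λ t → form σ (suc a) t s) (ℤ.∣-i∣≡∣i∣ β))))
  where
  lem : ∀ x y z → ℤ.- (ℤ.- x ℤ.* y ℤ.+ z) ≡ x ℤ.* y ℤ.+ ℤ.- z
  lem = ℤ-Ring.solve-∀

∣quad-diff∣ : ∀ α β γ i e → ∣ quadSeq α β γ i ℤ.- quadSeq α β γ (i + e) ∣ ≡ e * ∣ α ℤ.* + (i + (i + e)) ℤ.+ β ∣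
∣quad-diff∣ α β γ i e = trans (ℤ.∣i-j∣≡∣j-i∣ (quadSeq α β γ i) (quadSeq α β γ (i + e)))
  (trans (cong ∣_∣ (lem α β γ (+ i) (+ e))) (ℤ.abs-* (+ e) (α ℤ.* + (i + (i + e)) ℤ.+ β)))
  where
  lem : ∀ α β γ i e → (α ℤ.* (i ℤ.+ e) ℤ.* (i ℤ.+ e) ℤ.+ β ℤ.* (i ℤ.+ e) ℤ.+ γ) ℤ.- (α ℤ.* i ℤ.* i ℤ.+ β ℤ.* i ℤ.+ γ)
    ≡ e ℤ.* (α ℤ.* (i ℤ.+ (i ℤ.+ e)) ℤ.+ β)
  lem = ℤ-Ring.solve-∀

-- The failure of `PairwiseIncongruent` as a bounded existential, hence decidable.
Collision : (ℕ → ℤ) → ℕ → ℕ → Set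
Collision s n m = Σ ℕ λ j → j < n × (Σ ℕ λ i → i < j × m ∣ ∣ s i ℤ.- s j ∣)

collision? : ∀ s n m → Dec (Collision s n m)
collision? s n m = ℕ.anyUpTo? (λ j → ℕ.anyUpTo? (λ i → m ∣? ∣ s i ℤ.- s j ∣) j) n

collision⇒¬incongruent : ∀ {s n m} → Collision s n m → ¬ PairwiseIncongruent s n m
collision⇒¬incongruent (j , j<n , i , i<j , d) h = h i j (ℕ.<-trans i<j j<n) j<n i<j d

¬collision⇒incongruent : ∀ {s n m} → ¬ Collision s n m → PairwiseIncongruent s n m
¬collision⇒incongruent h i j _ j<n i<j d = h (j , j<n , i , i<j , d)

module _ (n : ℕ) {{nz : NonZero n}} where
  open Residues n

  -- The residue of -c, without subtraction of c.
  opposite : ℕ → ℕ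
  opposite c = (n ∸ 1) * c

  opposite-+ : ∀ c → opposite c + c ≡ c * n
  opposite-+ c = trans (ℕ.+-comm (opposite c) c) (trans (cong (_* c) (ℕ.suc-pred n)) (ℕ.*-comm n c))

  root-of : Sign → ℕ → ℕ
  root-of Sign.+ c = opposite c
  root-of Sign.- c = c

  ∣-difference : ∀ x c → x ≈ c → n ∣ ∣ x - c ∣
  ∣-difference x c e = divides ∣ x / n - c / n ∣ (begin
    ∣ x - c ∣                                     ≡⟨ cong₂ ∣_-_∣ (m≡m%n+[m/n]*n x n) (trans (m≡m%n+[m/n]*n c n) (cong (_+ c / n * n) (sym e))) ⟩
    ∣ x % n + x / n * n - x % n + c / n * n ∣     ≡⟨ ℕ.∣m+n-m+o∣≡∣n-o∣ (x % n) (x / n * n) (c / n * n) ⟩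
    ∣ x / n * n - c / n * n ∣                     ≡⟨ sym (ℕ.*-distribʳ-∣-∣ n (x / n) (c / n)) ⟩
    ∣ x / n - c / n ∣ * n                         ∎)
    where open ≡-Reasoning

  form-root : ∀ σ a c s → a * s ≈ root-of σ c → n ∣ form σ a c s
  form-root Sign.- a c s e = ∣-difference (a * s) c e
  form-root Sign.+ a c s e = m%n≡0⇒n∣m (a * s + c) n (begin
    (a * s + c) % n                    ≡⟨ %-distribˡ-+ (a * s) c n ⟩
    ((a * s) % n + c % n) % n          ≡⟨ cong (λ t → (t + c % n) % n) e ⟩
    (opposite c % n + c % n) % n       ≡⟨ sym (%-distribˡ-+ (opposite c) c n) ⟩
    (opposite c + c) % n               ≡⟨ cong (_% n) (opposite-+ c) ⟩
    (c * n) % n                        ≡⟨ m*n%n≡0 c n ⟩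
    0                                  ∎)
    where open ≡-Reasoning

  -- The class of the values n s ± c themselves, whereas `root-of` is the class of a s at a zero of
  -- a s ± c; hence the opposite signs.
  value-class : Sign → ℕ → ℕ
  value-class Sign.+ c = c
  value-class Sign.- c = opposite c

  value-class-coprime : ∀ σ c → Coprime c n → Coprime (value-class σ c) n
  value-class-coprime Sign.+ c h = h
  value-class-coprime Sign.- c h = coprime-* {n ∸ 1} {c} pred-coprime h
    where
    pred-coprime : Coprime (n ∸ 1) n
    pred-coprime (d , d′) = ∣1⇒≡1 (∣m+n∣m⇒∣n {m = n ∸ 1} (subst (_ ∣_) (sym (ℕ.m∸n+n≡m 1≤A)) d′) d)

  form-value : ∀ σ c s m e → c < m → form σ n c s ≡ e * m → e * m ≈ value-class σ c × e * m ≤ n * s + c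
  form-value Sign.+ c s m e _ eq = trans (cong (_% n) (trans (sym eq) (trans (ℕ.+-comm (n * s) c) (cong (λ t → c + t) (ℕ.*-comm n s))))) ([m+kn]%n≡m%n c s n)
    , ℕ.≤-reflexive (sym eq)
  form-value Sign.- c s m e c<m eq with c ℕ.≤? n * s
  ... | yes c≤ns = cls , ℕ.≤-trans (ℕ.m≤m+n (e * m) c) (ℕ.≤-trans (ℕ.≤-reflexive em+c) (ℕ.m≤m+n (n * s) c))
    where
    em+c : e * m + c ≡ n * s
    em+c = trans (cong (_+ c) (trans (sym eq) (ℕ.m≤n⇒∣n-m∣≡n∸m c≤ns))) (ℕ.m∸n+n≡m c≤ns)
    cls : e * m ≈ opposite c
    cls = begin
      (e * m) % n                     ≡⟨ sym ([m+kn]%n≡m%n (e * m) c n) ⟩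
      (e * m + c * n) % n             ≡⟨ cong (λ t → (e * m + t) % n) (trans (sym (opposite-+ c)) (ℕ.+-comm (opposite c) c)) ⟩
      (e * m + (c + opposite c)) % n  ≡⟨ cong (_% n) (sym (ℕ.+-assoc (e * m) c (opposite c))) ⟩
      (e * m + c + opposite c) % n    ≡⟨ cong (λ t → (t + opposite c) % n) em+c ⟩
      (n * s + opposite c) % n        ≡⟨ cong (_% n) (trans (ℕ.+-comm (n * s) (opposite c)) (cong (λ t → opposite c + t) (ℕ.*-comm n s))) ⟩
      (opposite c + s * n) % n        ≡⟨ [m+kn]%n≡m%n (opposite c) s n ⟩
      opposite c % n                  ∎
      where open ≡-Reasoning
  -- The value would be c - n s, a multiple of m between 1 and c < m.
  ... | no c≰ns = contradiction (∣⇒≤ {{ℕ.>-nonZero (ℕ.m<n⇒0<n∸m ns<c)}} (divides e gap)) (ℕ.<⇒≱ (ℕ.≤-<-trans (ℕ.m∸n≤m c (n * s)) c<m))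
    where
    ns<c = ℕ.≰⇒> c≰ns
    gap : c ∸ n * s ≡ e * m
    gap = trans (sym (ℕ.m≤n⇒∣m-n∣≡n∸m (ℕ.<⇒≤ ns<c))) eq

prime∤ : ∀ {p n} → 1 ≤ n → n < p → ¬ p ∣ n
prime∤ 1≤n n<p d = ℕ.<⇒≱ n<p (∣⇒≤ {{ℕ.>-nonZero 1≤n}} d)

prime-coprime : ∀ {p n} → Prime p → ¬ p ∣ n → Coprime n p
prime-coprime {p} {n} pp p∤n (d∣n , d∣p) = go d∣n (prime⇒irreducible pp d∣p)
  where
  go : ∀ {d} → d ∣ n → d ≡ 1 ⊎ d ≡ p → d ≡ 1
  go _   (inj₁ e)    = e
  go d∣n (inj₂ refl) = contradiction d∣n p∤n

cofactors-coprime : ∀ a c {a′ c′} → 1 ≤ a → a ≡ a′ * gcd a c → c ≡ c′ * gcd a c → Coprime c′ a′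
cofactors-coprime a c {a′} {c′} 1≤a a≡ c≡ {d} (d∣c′ , d∣a′) = ℕ.*-cancelʳ-≡ d 1 (gcd a c) {{g≢0}} (trans (ℕ.≤-antisym
    (∣⇒≤ {{g≢0}} (gcd-greatest (subst (d * gcd a c ∣_) (sym a≡) (*-monoˡ-∣ (gcd a c) d∣a′)) (subst (d * gcd a c ∣_) (sym c≡) (*-monoˡ-∣ (gcd a c) d∣c′))))
    (ℕ.m≤n*m (gcd a c) d {{ℕ.≢-nonZero λ { refl → contradiction (subst (1 ≤_) (trans a≡ (cong (_* gcd a c) (0∣⇒≡0 d∣a′))) 1≤a) (λ ()) }}}))
    (sym (ℕ.*-identityˡ _)))
  where
  g≢0 : NonZero (gcd a c)
  g≢0 = ℕ.≢-nonZero λ e → contradiction (subst (1 ≤_) (gcd[m,n]≡0⇒m≡0 {a} {c} e) 1≤a) (λ ())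

module Quadratic (q : ℕ → ℤ) (σ : Sign) (a c : ℕ) (1≤a : 1 ≤ a)
  (diff : ∀ i e → ∣ q i ℤ.- q (i + e) ∣ ≡ e * form σ a c (i + (i + e))) where

  collide : ∀ {n m} i e → 1 ≤ e → i + e < n → m ∣ form σ a c (i + (i + e)) → Collision q n m
  collide i e 1≤e lt d = i + e , lt , i , ℕ.m<m+n i 1≤e , subst (_ ∣_) (sym (diff i e)) (∣n⇒∣m*n e d)

  module _ (p : ℕ) (pp : Prime p) (5≤p : 5 ≤ p) (free : ¬ Collision q p p) where
    instance
      p≢0 : NonZero p
      p≢0 = ℕ.>-nonZero (ℕ.≤-trans (s≤s z≤n) 5≤p)

    p∣a : p ∣ a
    p∣a = decidable-stable (p ∣? a) λ p∤a → go (Residues.solve p a (root-of p σ c) (prime-coprime pp p∤a))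
      where
      5≤ : ∀ {k} → 5 ≤ k → Σ ℕ λ k′ → k ≡ 5 + k′
      5≤ {k} h = k ∸ 5 , sym (ℕ.m+[n∸m]≡n h)
      go : (Σ ℕ λ s → 1 ≤ s × s ≤ p × Residues._≈_ p (a * s) (root-of p σ c)) → ⊥
      go (s , 1≤s , s≤p , e) with s ℕ.<? p
      -- A root s below p is the index sum 0 + s, and s = p is 1 + (p - 1); both are pairs of
      -- distinct indices below p.
      ... | yes s<p = free (collide 0 s 1≤s s<p (form-root p σ a c s e))
      ... | no s≮p with ℕ.≤-antisym s≤p (ℕ.≮⇒≥ s≮p) | 5≤ 5≤p
      ...   | refl | k , refl = free (collide 1 (3 + k) (s≤s z≤n) ℕ.≤-refl (form-root p σ a c s e))

    p∤c : ¬ p ∣ c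
    p∤c (divides y ey) with p∣a
    ... | divides x ex = free (collide 0 1 ℕ.≤-refl (ℕ.≤-trans (s≤s (s≤s z≤n)) 5≤p)
          (subst (p ∣_) (sym (trans (cong₂ (λ u v → form σ u v 1) (trans ex (ℕ.*-comm x p)) (trans ey (ℕ.*-comm y p))) (form-scale σ p x y 1))) (m∣m*n _)))

    module _ (g A c′ : ℕ) (a≡ : a ≡ g * A) (c≡ : c ≡ g * c′) (cop : Coprime c′ A) where

      1≤A : 1 ≤ A
      1≤A = ℕ.n≢0⇒n>0 λ { refl → contradiction (subst (1 ≤_) (trans a≡ (ℕ.*-zeroʳ g)) 1≤a) (λ ()) }

      1≤g : 1 ≤ g
      1≤g = ℕ.n≢0⇒n>0 λ { refl → contradiction (subst (1 ≤_) a≡ 1≤a) (λ ()) }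

      instance
        A≢0 : NonZero A
        A≢0 = ℕ.>-nonZero 1≤A

      open Residues A hiding (1≤A)

      p∣A : p ∣ A
      p∣A with euclidsLemma g A pp (subst (p ∣_) a≡ p∣a)
      ... | inj₂ h = h
      ... | inj₁ h = contradiction (subst (p ∣_) (sym c≡) (∣-trans h (m∣m*n c′))) p∤c

      5≤A : 5 ≤ A
      5≤A = ℕ.≤-trans 5≤p (∣⇒≤ p∣A)

      b : ℕ
      b = value-class A σ c′ % A

      b≈ : b ≈ value-class A σ c′
      b≈ = m%n%n≡m%n (value-class A σ c′) A

      b-coprime : Coprime b A
      b-coprime = ≈-coprime {value-class A σ c′} {b} (sym b≈) (value-class-coprime A σ c′ cop)

      -- The prime m divides (j - i) g times the form at i + j, and it is too large to divide j - i
      -- ≤ p^k or g.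
      prime-value : ∀ k m → Prime m → g + c′ < m → p ^ k < m → Collision q (suc (p ^ k)) m →
        Σ ℕ λ e → e * m ≈ b × e * m ≤ 2 * A * p ^ k + c′
      prime-value k m pm G<m pk<m (j , s≤s j≤ , i , i<j , d) = e , trans (proj₁ val) (sym b≈)
          , ℕ.≤-trans (proj₂ val) (ℕ.+-monoˡ-≤ c′ (ℕ.≤-trans (ℕ.*-monoʳ-≤ A (ℕ.+-mono-≤ (ℕ.≤-trans (ℕ.<⇒≤ i<j) j≤) i+h≤)) (ℕ.≤-reflexive (lem A (p ^ k)))))
        where
        lem : ∀ A x → A * (x + x) ≡ 2 * A * x
        lem = solve-∀
        h = j ∸ i
        i+h≡j = ℕ.m+[n∸m]≡n (ℕ.<⇒≤ i<j)
        i+h≤ : i + h ≤ p ^ k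
        i+h≤ = ℕ.≤-trans (ℕ.≤-reflexive i+h≡j) j≤
        s = i + (i + h)
        d′ : m ∣ h * (g * form σ A c′ s)
        d′ = subst (m ∣_) (trans (cong (λ t → ∣ q i ℤ.- q t ∣) (sym i+h≡j)) (trans (diff i h)
          (cong (h *_) (trans (cong₂ (λ u v → form σ u v s) a≡ c≡) (form-scale σ g A c′ s))))) d
        d″ : m ∣ form σ A c′ s
        d″ with euclidsLemma h (g * form σ A c′ s) pm d′
        ... | inj₁ x = contradiction x (prime∤ (ℕ.m<n⇒0<n∸m i<j) (ℕ.≤-<-trans (ℕ.≤-trans (ℕ.m∸n≤m j i) j≤) pk<m))
        ... | inj₂ x with euclidsLemma g (form σ A c′ s) pm x
        ...   | inj₁ y = contradiction y (prime∤ 1≤g (ℕ.≤-<-trans (ℕ.m≤m+n g c′) G<m))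
        ...   | inj₂ y = y
        e = _∣_.quotient d″
        val = form-value A σ c′ s m e (ℕ.≤-<-trans (ℕ.m≤n+m c′ g) G<m) (_∣_.equality d″)

      window : ∀ Kmax → (∀ k m → k ≤ Kmax → 1 ≤ m → m < p ^ suc k → Collision q (suc (p ^ k)) m) → Window p A b c′ (g + c′) Kmax
      window Kmax col = record
        { p-prime = pp ; 5≤p = 5≤p ; 5≤A = 5≤A ; b-unit = b-coprime ; win = win }
        where
        win : ∀ k m d → k ≤ Kmax → Prime m → g + c′ < m → p ^ k < m → m < p ^ suc k → 1 ≤ d → d < A → d * m ≈ b → d * m ≤ 2 * A * p ^ k + c′
        win k m d k≤ pm G<m lo hi 1≤d d<A e≈ with prime-value k m pm G<m lo (col k m k≤ (ℕ.≤-trans (s≤s z≤n) G<m) hi)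
        ... | e , em≈b , em≤ = ℕ.≤-trans (ℕ.*-monoˡ-≤ m d≤e) em≤
          where
          m-unit : Coprime m A
          m-unit = proj₂ (class-coprime {d} {b} {m} b-coprime e≈)
          e≈d : e ≈ d
          e≈d = ≈-cancel m {e} {d} m-unit (trans (cong (_% A) (ℕ.*-comm m e)) (trans (trans em≈b (sym e≈)) (cong (_% A) (ℕ.*-comm d m))))
          -- d < A is the remainder of e modulo A.
          d≤e : d ≤ e
          d≤e = subst (_≤ e) (trans e≈d (m<n⇒m%n≡m d<A)) (m%n≤m e A)

      Improvement : ℕ → ℕ → Set
      Improvement k m = 1 ≤ m × ¬ Collision q (suc (p ^ k)) m

      -- A bounded search over k ≤ Kmax; if every smaller modulus collided, the window would hold up
      -- to Kmax.
      improvement : Σ ℕ λ k → Σ ℕ λ m → m < p ^ suc k × Improvement k m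
      improvement = search (window-impossible p A b c′ (g + c′) d* d′ unit* 1≤d* 2d*<A 1≤d′ d′<A large square)
        where
        open Pair (pair p A b pp 5≤p p∣A 5≤A (m%n<n (value-class A σ c′) A) b-coprime)
        search : (Σ ℕ λ Kmax → ¬ Window p A b c′ (g + c′) Kmax) → Σ ℕ λ k → Σ ℕ λ m → m < p ^ suc k × Improvement k m
        search (Kmax , impossible) with ℕ.anyUpTo? (λ k → ℕ.anyUpTo? (λ m → (1 ℕ.≤? m) ×-dec ¬? (collision? q (suc (p ^ k)) m)) (p ^ suc k)) (suc Kmax)
        ... | yes (k , _ , m , m< , im) = k , m , m< , im
        ... | no none = contradiction (window Kmax λ k m k≤ 1≤m m< → decidable-stable (collision? q (suc (p ^ k)) m) λ nc → none (k , s≤s k≤ , m , m< , 1≤m , nc)) impossible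

  not-power : ∀ p → Prime p → 5 ≤ p → Σ ℕ λ n → 1 ≤ n × ((k : ℕ) → IsCeilLog p n k → ¬ IsDiscriminator q n (p ^ k))
  not-power p pp 5≤p with collision? q p p
  -- The ceiling logarithm of n = p is 1, so the modulus in question is p itself, where there is a
  -- collision.
  ... | yes col = p , ℕ.≤-trans (s≤s z≤n) 5≤p , λ { k cl (_ , inc , _) →
          collision⇒¬incongruent {q} {p} {p} col (subst (PairwiseIncongruent q p) (trans (cong (p ^_) (one k cl)) (ℕ.^-identityʳ p)) inc) }
    where
    one : ∀ k → IsCeilLog p p k → k ≡ 1
    one 0 (h , _) = contradiction (ℕ.≤-trans 5≤p h) (λ { (s≤s ()) })
    one 1 _ = refl
    one (suc (suc k)) (_ , h) = contradiction (subst (_< p) (ℕ.^-identityʳ p) (h 1 (s≤s (s≤s z≤n)))) (ℕ.<-irrefl refl)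
  ... | no free = fromImprovement (improvement p pp 5≤p free (gcd a c) (_∣_.quotient g∣a) (_∣_.quotient g∣c)
        (trans (_∣_.equality g∣a) (ℕ.*-comm (_∣_.quotient g∣a) _)) (trans (_∣_.equality g∣c) (ℕ.*-comm (_∣_.quotient g∣c) _))
        (cofactors-coprime a c 1≤a (_∣_.equality g∣a) (_∣_.equality g∣c)))
    where
    g∣a = gcd[m,n]∣m a c
    g∣c = gcd[m,n]∣n a c
    p≢0′ = ℕ.>-nonZero (ℕ.≤-trans (s≤s z≤n) 5≤p)
    fromImprovement : (Σ ℕ λ k → Σ ℕ λ m → m < p ^ suc k × 1 ≤ m × ¬ Collision q (suc (p ^ k)) m) →
      Σ ℕ λ n → 1 ≤ n × ((k : ℕ) → IsCeilLog p n k → ¬ IsDiscriminator q n (p ^ k))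
    -- With n = p^i + 1 every admissible k exceeds i, so m < p^(i + 1) ≤ p^k contradicts minimality.
    fromImprovement (i , m , m< , 1≤m , nc) = suc (p ^ i) , s≤s z≤n , λ { k (le , _) (_ , _ , least) →
      least m 1≤m (ℕ.<-≤-trans m< (ℕ.^-monoʳ-≤ p {{p≢0′}} {suc i} {k} (ℕ.≰⇒> λ k≤i → ℕ.<⇒≱ le (ℕ.^-monoʳ-≤ p {{p≢0′}} {k} {i} k≤i))))
        (¬collision⇒incongruent {q} {suc (p ^ i)} {m} nc) }

theorem16 : (p : ℕ) → Prime p → 5 ≤ p →
    (α β γ : ℤ) → α ≢ + 0 →
    Σ ℕ (λ n → 1 ≤ n ×
    ((k : ℕ) → IsCeilLog p n k → ¬ IsDiscriminator (quadSeq α β γ) n (p ^ k)))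
theorem16 p pp 5≤p α β γ α≢0 with ∣linear∣ α β
... | σ , e = Quadratic.not-power (quadSeq α β γ) σ ∣ α ∣ ∣ β ∣ (ℕ.n≢0⇒n>0 (λ z → α≢0 (ℤ.∣i∣≡0⇒i≡0 z)))
        (λ i h → trans (∣quad-diff∣ α β γ i h) (cong (h *_) (e (i + (i + h))))) p pp 5≤p
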